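{- For every $w\in W=S_r$, $$\mathcal{B}_\infty(w)=\{v\in\mathcal{B}_\infty\mid \omega^\dagger(v)\,w_0\le w\}=\{v\in\mathcal{B}_\infty\mid w_0\,\omega(v)\le w\},$$ and for every $v\in\mathcal{B}_\infty$, $$w_0\,\omega(v)\,w_0=\omega^\dagger(v)=\omega(v^\star)^{ -1}.$$
   Context: Type $A_{r-1}$, $r\ge2$; $W=S_r$ with $s_i=(i,i+1)$, Bruhat order $\le$, longest element $w_0$. $\mathcal{B}_\infty$ is Kashiwara's crystal (crystal base of the negative part of the quantum group) with highest weight element $u_0$, Kashiwara operators $e_i,f_i$, and $v\mapsto v^\star$ is Kashiwara's $\star$-involution. Demazure crystals: $\mathcal{B}_\infty(1)=\{u_0\}$, and if $s_iw>w$ then $\mathcal{B}_\infty(s_iw)=\{v\mid e_i^kv\in\mathcal{B}_\infty(w)\text{ for some }k\ge0\}$. Realization: let $J$ be the reduced word for $w_0$ obtained by concatenating blocks $(r-m,\dots,r-1)$, $m=1,\dots,r-1$. With $\mathcal{B}_j=\{u_j(a):a\in\mathbb{Z}\}$ Kashiwara's elementary crystals, $\mathcal{B}_\infty$ is identified with the subcrystal of $\mathcal{B}_{J_1}\otimes\cdots\otimes\mathcal{B}_{J_M}$ (tensor convention of Bump–Schilling) generated from $u_{J_1}(0)\otimes\cdots\otimes u_{J_M}(0)$ by the $f_i$. Thus each $v$ is $v=D_1\otimes\cdots\otimes D_{r-1}$, $D_i=u_{r-i}(-d_{i,r-i})\otimes\cdots\otimes u_{r-1}(-d_{i,r-1})$,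 with $d_{i,r-i}\ge\cdots\ge d_{i,r-1}\ge0$. Set $d_{i,r}=0$ and $c_{i,j}=d_{i,j}-d_{i,j+1}$. Degenerate Hecke algebra $\mathcal{H}$: generators $S_1,\dots,S_{r-1}$ with braid relations and $S_i^2=S_i$; it has basis $S_w$ ($w\in W$, $S_w=S_{j_1}\cdots S_{j_\ell}$ for a reduced word), and $\{S_w\}=w$. Let $\Omega_i(D_i)=\prod_{j=1}^{i}X_j$ (product in increasing $j$) with $X_j=S_j$ if $c_{i,r-1+j-i}=0$ and $X_j=1$ otherwise, and $\omega^\dagger(v)=\{\Omega_{r-1}(D_{r-1})\cdots\Omega_1(D_1)\}$. $\omega:\mathcal{B}_\infty\to W$: for $v$ let $b_1$ be maximal with $e_{J_1}^{b_1}v\ne0$, $b_2$ maximal with $e_{J_2}^{b_2}e_{J_1}^{b_1}v\ne0$, etc. Put $\beta_{m,p}=b_{m(m-1)/2+p}$; $\beta_{m,p}$ is circled if $p=m$ and $\beta_{m,m}=0$, or $p<m$ and $\beta_{m,p}=\beta_{m,p+1}$. List, for $m=1,\dots,r-1$ and within each $m$ for $p=m,\dots,1$, the $s_p$ with $\beta_{m,p}$ circled, as $(s_{j_1},\dots,s_{j_k})$; $\omega(v)=\{S_{j_1}\cdots S_{j_k}\}$ (equivalently the nondescending product: $\Pi_{\mathrm{nd}}(s_{i_1},\dots,s_{i_k})=s_{i_1}\pi$ if $s_{i_1}\pi>\pi$, else $\pi$, with $\pi=\Pi_{\mathrm{nd}}(s_{i_2},\dots)$ and empty product $1$). -}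

module Defs where

open import Data.Bool using (Bool; true; false; if_then_else_; _∧_; _∨_; not)
open import Data.Nat as ℕ using (ℕ; zero; suc; _∸_; _≡ᵇ_; _<ᵇ_)
import Data.Nat.Properties as ℕP
open import Data.Integer as ℤ using (ℤ; +_; 0ℤ; 1ℤ; -1ℤ; -_)
import Data.Integer.Properties as ℤP
open import Data.List using (List; []; _∷_; _++_; map; concat; concatMap; reverse; take; drop; upTo; foldr; sum; length; filterᵇ)
open import Data.Maybe using (Maybe; just; nothing)
open import Data.Product using (Σ; _×_; _,_)
open import Relation.Nullary using (¬_; does)
open import Relation.Binary.PropositionalEquality using (_≡_)

-- The Weyl group W = S_r, permutations in one-line notation.
-- A permutation w of {1,…,r} is stored 0-based as the list
-- [w(1)-1, …, w(r)-1].  Group law = composition of functions.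

Perm : Set
Perm = List ℕ

-- i-th entry (0-based), default 0 (only used on valid permutations)
nth : List ℕ → ℕ → ℕ
nth []       _       = 0
nth (x ∷ xs) zero    = x
nth (x ∷ xs) (suc k) = nth xs k

idP : ℕ → Perm
idP r = upTo r

_·_ : Perm → Perm → Perm
u · w = map (nth u) w

w0 : ℕ → Perm
w0 r = reverse (upTo r)

-- left multiplication by s_i = (i,i+1), 1 ≤ i ≤ r-1 : swaps the values i, i+1
swapVal : ℕ → ℕ → ℕ
swapVal i x = if x ≡ᵇ (i ∸ 1) then i else (if x ≡ᵇ i then i ∸ 1 else x)

sL : ℕ → Perm → Perm
sL i w = map (swapVal i) w

swapPos : ℕ → ℕ → Perm → Perm
swapPos a b w =
  map (λ k → nth w (if k ≡ᵇ a then b else (if k ≡ᵇ b then a else k))) (upTo (length w))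

countᵇ : List Bool → ℕ
countᵇ []           = 0
countᵇ (true ∷ bs)  = suc (countᵇ bs)
countᵇ (false ∷ bs) = countᵇ bs

len : Perm → ℕ
len w = countᵇ (concatMap (λ a → map (λ b → (a <ᵇ b) ∧ (nth w b <ᵇ nth w a)) (upTo n)) (upTo n))
  where n = length w

IsPerm : ℕ → Perm → Set
IsPerm r w = w ↭ upTo r
  where open import Data.List.Relation.Binary.Permutation.Propositional using (_↭_)

data _≤B_ : Perm → Perm → Set where
  ≤B-refl : ∀ {u} → u ≤B u
  ≤B-step : ∀ {u w} a b → a ℕ.< b → b ℕ.< length w →
            u ≤B w → len w ℕ.< len (swapPos a b w) → u ≤B swapPos a b w

-- Demazure ("nondescending") product = image {S_{j1}⋯S_{jk}} in W of a
-- product of generators of the degenerate Hecke algebra: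
-- Π(s_{i1},…) = s_{i1} π if s_{i1} π > π, else π.
demazure : ℕ → List ℕ → Perm
demazure r = foldr (λ j π → if len π <ᵇ len (sL j π) then sL j π else π) (idP r)

-- Crystals.  Elementary crystal B_j = {u_j(a)}; an element of
-- B_{J_1} ⊗ ⋯ ⊗ B_{J_M} is a list of factors (J_k , a_k) meaning u_{J_k}(a_k).
-- −∞ is represented by nothing.

State : Set
State = List (ℕ × ℤ)

-- the reduced word J : blocks (r-m, …, r-1), m = 1, …, r-1
Jword : ℕ → List ℕ
Jword r = concatMap (λ m → map (λ t → (r ∸ m) ℕ.+ t) (upTo m)) (map suc (upTo (r ∸ 1)))

u0 : ℕ → State
u0 r = map (λ j → (j , 0ℤ)) (Jword r)

cartan : ℕ → ℕ → ℤ
cartan i j = if i ≡ᵇ j then + 2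
             else (if (suc i ≡ᵇ j) ∨ (suc j ≡ᵇ i) then -1ℤ else 0ℤ)

hw : ℕ → State → ℤ
hw i []            = 0ℤ
hw i ((j , a) ∷ xs) = a ℤ.* cartan i j ℤ.+ hw i xs

wtc : ℕ → State → ℤ
wtc j []             = 0ℤ
wtc j ((k , a) ∷ xs) = (if j ≡ᵇ k then a else 0ℤ) ℤ.+ wtc j xs

ℤ∞ : Set
ℤ∞ = Maybe ℤ

max∞ : ℤ∞ → ℤ∞ → ℤ∞
max∞ nothing  y        = y
max∞ (just x) nothing  = just x
max∞ (just x) (just y) = just (x ℤ.⊔ y)

add∞ : ℤ∞ → ℤ → ℤ∞
add∞ nothing  n = nothing
add∞ (just x) n = just (x ℤ.+ n)

le∞ : ℤ∞ → ℤ∞ → Bool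
le∞ nothing  _        = true
le∞ (just x) nothing  = false
le∞ (just x) (just y) = x ℤ.≤ᵇ y

lt∞ : ℤ∞ → ℤ∞ → Bool
lt∞ nothing  nothing  = false
lt∞ nothing  (just y) = true
lt∞ (just x) nothing  = false
lt∞ (just x) (just y) = not (y ℤ.≤ᵇ x)

phi1 : ℕ → ℕ × ℤ → ℤ∞
phi1 i (j , a) = if i ≡ᵇ j then just a else nothing

eps1 : ℕ → ℕ × ℤ → ℤ∞
eps1 i (j , a) = if i ≡ᵇ j then just (- a) else nothing

-- tensor product, Bump–Schilling convention:
-- φ_i(x⊗y) = max(φ_i x, φ_i y + ⟨h_i,wt x⟩), ε_i(x⊗y) = max(ε_i y, ε_i x − ⟨h_i,wt y⟩),
-- f_i(x⊗y) = f_i x ⊗ y if φ_i y ≤ ε_i x, else x ⊗ f_i y,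
-- e_i(x⊗y) = e_i x ⊗ y if φ_i y < ε_i x, else x ⊗ e_i y.
phiT : ℕ → State → ℤ∞
phiT i []       = nothing
phiT i (x ∷ y) = max∞ (phi1 i x) (add∞ (phiT i y) (hw i (x ∷ [])))

epsT : ℕ → State → ℤ∞
epsT i []       = nothing
epsT i (x ∷ y) = max∞ (epsT i y) (add∞ (eps1 i x) (- hw i y))

consM : ℕ × ℤ → Maybe State → Maybe State
consM x nothing  = nothing
consM x (just y) = just (x ∷ y)

fT : ℕ → State → Maybe State
fT i []             = nothing
fT i ((j , a) ∷ y) =
  if le∞ (phiT i y) (eps1 i (j , a))
  then (if i ≡ᵇ j then just ((j , a ℤ.- 1ℤ) ∷ y) else nothing)
  else consM (j , a) (fT i y)

eT : ℕ → State → Maybe State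
eT i []             = nothing
eT i ((j , a) ∷ y) =
  if lt∞ (phiT i y) (eps1 i (j , a))
  then (if i ≡ᵇ j then just ((j , a ℤ.+ 1ℤ) ∷ y) else nothing)
  else consM (j , a) (eT i y)

eIter : ℕ → ℕ → State → Maybe State
eIter i zero    v = just v
eIter i (suc k) v with eT i v
... | nothing = nothing
... | just u  = eIter i k u

data InB (r : ℕ) : State → Set where
  base : InB r (u0 r)
  step : ∀ {v v'} i → 1 ℕ.≤ i → i ℕ.≤ r ∸ 1 → InB r v → fT i v ≡ just v' → InB r v'

-- "e_i^k v ≠ 0" in B_∞ (the crystal operators of B_∞ are those of the
-- tensor product, set to 0 when the result leaves B_∞)
NzE : ℕ → ℕ → ℕ → State → Set
NzE r i k v = Σ State (λ u → (eIter i k v ≡ just u) × InB r u)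

Eps : ℕ → ℕ → State → ℕ → Set
Eps r i v b = NzE r i b v × ¬ NzE r i (suc b) v

data Str (r : ℕ) : List ℕ → State → List ℕ → Set where
  []  : ∀ {v} → Str r [] v []
  cons : ∀ {j js v v' b bs} → Eps r j v b → eIter j b v ≡ just v' →
         Str r js v' bs → Str r (j ∷ js) v (b ∷ bs)

StringJ : ℕ → State → List ℕ → Set
StringJ r v bs = Str r (Jword r) v bs

blocksFrom : {A : Set} → ℕ → ℕ → List A → List (List A)
blocksFrom zero    m xs = []
blocksFrom (suc n) m xs = take m xs ∷ blocksFrom n (suc m) (drop m xs)

blocks : {A : Set} → ℕ → List A → List (List A)
blocks r xs = blocksFrom (r ∸ 1) 1 xs

-- positions p (1-based, increasing) with x_p = x_{p+1}, where x_{m+1} := 0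
eqPosFrom : ℕ → List ℤ → List ℕ
eqPosFrom p []           = []
eqPosFrom p (x ∷ [])     = if does (x ℤP.≟ 0ℤ) then p ∷ [] else []
eqPosFrom p (x ∷ y ∷ xs) =
  if does (x ℤP.≟ y) then p ∷ eqPosFrom (suc p) (y ∷ xs) else eqPosFrom (suc p) (y ∷ xs)

eqPos : List ℤ → List ℕ
eqPos = eqPosFrom 1

-- ω(v) from the string β: for m = 1..r-1, and p = m, …, 1, the s_p with β_{m,p} circled
omegaOfString : ℕ → List ℕ → Perm
omegaOfString r bs = demazure r (concatMap (λ blk → reverse (eqPos (map +_ blk))) (blocks r bs))

-- ω†(v) = {Ω_{r-1}(D_{r-1}) ⋯ Ω_1(D_1)},  Ω_i(D_i) = ∏_{j=1..i} X_j (increasing j),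
-- X_j = S_j iff c_{i,r-1+j-i} = 0, i.e. d_{i,r-1+j-i} = d_{i,r+j-i} (d_{i,r} = 0).
-- The d's of D_i are minus the entries of the i-th block.
omegaDag : ℕ → State → Perm
omegaDag r v = demazure r (concat (reverse (map (λ blk → eqPos (map (λ x → - (Data.Product.proj₂ x)) blk)) (blocks r v))))
  where import Data.Product

data Dem (r : ℕ) : Perm → State → Set where
  dem1 : Dem r (idP r) (u0 r)
  demS : ∀ {w u v} i k → 1 ℕ.≤ i → i ℕ.≤ r ∸ 1 → len w ℕ.< len (sL i w) →
         Dem r w u → InB r v → eIter i k v ≡ just u → Dem r (sL i w) v

-- Kashiwara's ⋆-involution, characterised through the Kashiwara–Saito
-- criterion: f_i^⋆ := ⋆ ∘ f_i ∘ ⋆, ε_i^⋆ := ε_i ∘ ⋆.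

mapM : (State → State) → Maybe State → Maybe State
mapM g nothing  = nothing
mapM g (just x) = just (g x)

bindM : Maybe State → (State → Maybe State) → Maybe State
bindM nothing  g = nothing
bindM (just x) g = g x

fStar : (State → State) → ℕ → State → Maybe State
fStar star i b = mapM star (fT i (star b))

record IsStar (r : ℕ) (star : State → State) : Set where
  field
    star-B     : ∀ b → InB r b → InB r (star b)
    star-invol : ∀ b → InB r b → star (star b) ≡ b
    star-u0    : star (u0 r) ≡ u0 r
    star-wt    : ∀ b → InB r b → ∀ j → wtc j (star b) ≡ wtc j b
    ks-comm    : ∀ i j → 1 ℕ.≤ i → i ℕ.≤ r ∸ 1 → 1 ℕ.≤ j → j ℕ.≤ r ∸ 1 → ¬ i ≡ j →
                 ∀ b → InB r b →
                 bindM (fT j b) (fStar star i) ≡ bindM (fStar star i b) (fT j)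
    ks-nonneg  : ∀ i → 1 ℕ.≤ i → i ℕ.≤ r ∸ 1 → ∀ b → InB r b → ∀ n m →
                 Eps r i b n → Eps r i (star b) m →
                 0ℤ ℤ.≤ (+ n) ℤ.+ (+ m) ℤ.+ hw i b
    ks-zero    : ∀ i → 1 ℕ.≤ i → i ℕ.≤ r ∸ 1 → ∀ b → InB r b → ∀ n m →
                 Eps r i b n → Eps r i (star b) m →
                 (+ n) ℤ.+ (+ m) ℤ.+ hw i b ≡ 0ℤ → fT i b ≡ fStar star i b
    ks-pos     : ∀ i → 1 ℕ.≤ i → i ℕ.≤ r ∸ 1 → ∀ b → InB r b → ∀ n m →
                 Eps r i b n → Eps r i (star b) m →
                 1ℤ ℤ.≤ (+ n) ℤ.+ (+ m) ℤ.+ hw i b →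
                 (∀ b' m' → fT i b ≡ just b' → Eps r i (star b') m' → m' ≡ m) ×
                 (∀ b' n' → fStar star i b ≡ just b' → Eps r i b' n' → n' ≡ n)

module Submission where

-- Grouping the factors of v by blocks turns v into a multisegment: c_{i,j} counts the
-- segments [r - i , j].  The operator f_i lengthens a segment ending at i - 1 according to a
-- bracketing rule; the mirror rule on the starting points of segments gives operators f_i′.
-- The two families commute for different indices and interact for equal indices as f_i and
-- f_i^⋆ do, so both string embeddings hold: the f′-string of v along J is its tensor
-- coordinate vector, and the f-string of v along J is the coordinate vector of τ v, where
-- τ is the involution exchanging the two families.
--
-- ω†(v) is the Hecke word with a letter for every absent segment.  Braid moves along the
-- bracketing show S_i · ω†(v) = ω†(e_i^max v), so μ(v) = ω†(v) w₀ satisfies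
-- μ(e_i^max v) = min (μ(v) , s_i μ(v)), and monotonicity of these Demazure operators for the
-- Bruhat order makes μ(v) the least w with v ∈ B(w).  Reading the triangle of segments by
-- columns instead of rows identifies ω(v) with ω† of the mirror image of τ v, so w₀ ω(v) is
-- another such least element; antisymmetry gives w₀ ω(v) w₀ = ω†(v).
--
-- Finally ⋆ = τ by induction on the height: commutation of f_l^⋆ with f_k (k ≠ l) determines
-- ⋆ on everything except the elements killed by all operators but those of one index, on
-- both sides, and in type A these are determined by their weights.

open import Data.Empty
open import Data.Product hiding (map; swap)
open import Data.Sum using (_⊎_; inj₁; inj₂)
open import Function using (_∘_; id)
open import Relation.Binary.Definitions using (tri<; tri≈; tri>)
open import Relation.Binary.PropositionalEquality
open import Relation.Nullary

-- In tensor coordinates the operators twisted by ⋆, and with them the strings that define ω, are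
-- opaque. In the triangle of multiplicities the second family is the first one read after
-- transposition, so a statement about one family yields the other. All interplay is then between a
-- column word and a row word. For distinct indices they share a square of at most four cells or
-- nothing; for equal indices they share one cell, the multiplicity of the simple segment, and the
-- unmatched brackets in excess of that cell make up the Kashiwara-Saito number κ = ε + ε' + ⟨h ,
-- wt⟩.
--
-- The words for ω†(v) and ω(v) are read off two arrays, `n` and `τ n`, with no visible cell-by-cell
-- relation. They are compared only through the Demazure crystals that both describe, which is why
-- `Key` lists just what that comparison requires.
--
-- Subtraction of naturals truncates, so a change of one cell is recorded as an equation with the
-- moved units added on both sides (`Step`), and `≈` compares arrays on the triangle only. Cells
-- beyond its edge stand for the empty segment, of which there is an endless supply: the +^∞ at the
-- end of each bracket word.

-- Bracket words: cancellation, surviving letters, and their positions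

module Brackets where
  open import Data.Nat
  open import Data.Nat.Properties

  ind : ℕ → ℕ → ℕ
  ind zero    zero    = 1
  ind zero    (suc _) = 0
  ind (suc _) zero    = 0
  ind (suc a) (suc b) = ind a b

  ind-refl : ∀ a → ind a a ≡ 1
  ind-refl zero    = refl
  ind-refl (suc a) = ind-refl a

  ind-≢ : ∀ {a b} → a ≢ b → ind a b ≡ 0
  ind-≢ {zero}  {zero}  ne = ⊥-elim (ne refl)
  ind-≢ {zero}  {suc b} ne = refl
  ind-≢ {suc a} {zero}  ne = refl
  ind-≢ {suc a} {suc b} ne = ind-≢ (ne ∘ cong suc)

  sh : (ℕ → ℕ) → ℕ → ℕ
  sh q x = q (suc x)

  -- The word −^{q 0} +^{p 0} −^{q 1} +^{p 1} ⋯ −^{q L} +^∞ after cancelling all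
  -- pairs "+−": eps counts the surviving −, and f turns the first surviving + into −.
  eps : ℕ → (ℕ → ℕ) → (ℕ → ℕ) → ℕ
  eps zero    q p = q 0
  eps (suc L) q p = q 0 + (eps L (sh q) (sh p) ∸ p 0)

  -- The value of `eps` on the suffix of the word that starts at block `x`.
  tl : ℕ → (ℕ → ℕ) → (ℕ → ℕ) → ℕ → ℕ
  tl L       q p zero    = eps L q p
  tl zero    q p (suc x) = 0
  tl (suc L) q p (suc x) = tl L (sh q) (sh p) x

  -- The block of the first surviving +: its + outnumber the - that arrive from the right. Block `L`
  -- carries +^∞, so a position always exists and `f` is total.
  data Pos : ℕ → (ℕ → ℕ) → (ℕ → ℕ) → ℕ → Set where
    stop  : ∀ {q p} → Pos zero q p 0
    here  : ∀ {L q p} → eps L (sh q) (sh p) < p 0 → Pos (suc L) q p 0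
    there : ∀ {L q p X} → p 0 ≤ eps L (sh q) (sh p) → Pos L (sh q) (sh p) X → Pos (suc L) q p (suc X)

  -- The block of the last surviving -, where `e` acts. If no - survives, the index has no meaning.
  data DPos : ℕ → (ℕ → ℕ) → (ℕ → ℕ) → ℕ → Set where
    stop  : ∀ {q p} → DPos zero q p 0
    here  : ∀ {L q p} → eps L (sh q) (sh p) ≤ p 0 → DPos (suc L) q p 0
    there : ∀ {L q p X} → p 0 < eps L (sh q) (sh p) → DPos L (sh q) (sh p) X → DPos (suc L) q p (suc X)

  pos : ∀ L q p → Σ ℕ (Pos L q p)
  pos zero    q p = 0 , stop
  pos (suc L) q p with p 0 ≤? eps L (sh q) (sh p)
  ... | yes h = let X , P = pos L (sh q) (sh p) in suc X , there h P
  ... | no  h = 0 , here (≰⇒> h)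

  dpos : ∀ L q p → Σ ℕ (DPos L q p)
  dpos zero    q p = 0 , stop
  dpos (suc L) q p with p 0 <? eps L (sh q) (sh p)
  ... | yes h = let X , P = dpos L (sh q) (sh p) in suc X , there h P
  ... | no  h = 0 , here (≮⇒≥ h)

  Pos-unique : ∀ {L q p X Y} → Pos L q p X → Pos L q p Y → X ≡ Y
  Pos-unique stop        stop        = refl
  Pos-unique (here h)    (here h')   = refl
  Pos-unique (here h)    (there h' _) = ⊥-elim (<⇒≱ h h')
  Pos-unique (there h _) (here h')   = ⊥-elim (<⇒≱ h' h)
  Pos-unique (there h P) (there _ Q) = cong suc (Pos-unique P Q)

  DPos-unique : ∀ {L q p X Y} → DPos L q p X → DPos L q p Y → X ≡ Y
  DPos-unique stop        stop        = refl
  DPos-unique (here h)    (here h')   = refl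
  DPos-unique (here h)    (there h' _) = ⊥-elim (<⇒≱ h' h)
  DPos-unique (there h _) (here h')   = ⊥-elim (<⇒≱ h h')
  DPos-unique (there h P) (there _ Q) = cong suc (DPos-unique P Q)

  Agree : ℕ → (q p q' p' : ℕ → ℕ) → Set
  Agree L q p q' p' = (∀ x → x ≤ L → q x ≡ q' x) × (∀ x → x < L → p x ≡ p' x)

  shA : ∀ {L q p q' p'} → Agree (suc L) q p q' p' → Agree L (sh q) (sh p) (sh q') (sh p')
  shA (a , b) = (λ x h → a (suc x) (s≤s h)) , (λ x h → b (suc x) (s≤s h))

  eps-cong : ∀ L {q p q' p'} → Agree L q p q' p' → eps L q p ≡ eps L q' p'
  eps-cong zero    (a , b) = a 0 z≤n
  eps-cong (suc L) A@(a , b) = cong₂ _+_ (a 0 z≤n) (cong₂ _∸_ (eps-cong L (shA A)) (b 0 (s≤s z≤n)))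

  Pos-cong : ∀ {L q p q' p' X} → Agree L q p q' p' → Pos L q p X → Pos L q' p' X
  Pos-cong A stop = stop
  Pos-cong {suc L} A@(a , b) (here h) = here (subst₂ _<_ (eps-cong L (shA A)) (b 0 (s≤s z≤n)) h)
  Pos-cong {suc L} A@(a , b) (there h P) =
    there (subst₂ _≤_ (b 0 (s≤s z≤n)) (eps-cong L (shA A)) h) (Pos-cong (shA A) P)

  DPos-cong : ∀ {L q p q' p' X} → Agree L q p q' p' → DPos L q p X → DPos L q' p' X
  DPos-cong A stop = stop
  DPos-cong {suc L} A@(a , b) (here h) = here (subst₂ _≤_ (eps-cong L (shA A)) (b 0 (s≤s z≤n)) h)
  DPos-cong {suc L} A@(a , b) (there h P) =
    there (subst₂ _<_ (b 0 (s≤s z≤n)) (eps-cong L (shA A)) h) (DPos-cong (shA A) P)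

  -- (q' , p') arises from (q , p) by turning one + of block X into a −.
  Bump : ℕ → ℕ → (q p q' p' : ℕ → ℕ) → Set
  Bump L X q p q' p' = (∀ x → x ≤ L → q' x ≡ q x + ind X x) × (∀ x → x < L → p' x + ind X x ≡ p x)

  Bump-sh : ∀ {L X q p q' p'} → Bump (suc L) (suc X) q p q' p' → Bump L X (sh q) (sh p) (sh q') (sh p')
  Bump-sh (a , b) = (λ x h → a (suc x) (s≤s h)) , (λ x h → b (suc x) (s≤s h))

  Bump-tail : ∀ {L q p q' p'} → Bump (suc L) 0 q p q' p' → Agree L (sh q) (sh p) (sh q') (sh p')
  Bump-tail (a , b) = (λ x h → sym (trans (a (suc x) (s≤s h)) (+-identityʳ _)))
                    , (λ x h → sym (trans (sym (+-identityʳ _)) (b (suc x) (s≤s h))))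

  -- Left of the first surviving + every letter is matched or a surviving -. Turning that + into -
  -- therefore creates no new pair, and the new - is the last survivor.
  up : ∀ {L X q p q' p'} → Pos L q p X → Bump L X q p q' p' →
       eps L q' p' ≡ suc (eps L q p) × DPos L q' p' X
  up stop (a , b) = trans (a 0 z≤n) (+-comm _ 1) , stop
  up {suc L} {q = q} {p} {q'} {p'} (here h) B@(a , b) = e1 , here (subst (_≤ p' 0) ec h1)
    where
    ec = eps-cong L (Bump-tail B)
    h1 : eps L (sh q) (sh p) ≤ p' 0
    h1 = s≤s⁻¹ (subst (suc (eps L (sh q) (sh p)) ≤_) (trans (sym (b 0 (s≤s z≤n))) (+-comm (p' 0) 1)) h)
    open ≡-Reasoning
    e1 : q' 0 + (eps L (sh q') (sh p') ∸ p' 0) ≡ suc (q 0 + (eps L (sh q) (sh p) ∸ p 0))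
    e1 = begin
      q' 0 + (eps L (sh q') (sh p') ∸ p' 0) ≡⟨ cong₂ _+_ (trans (a 0 z≤n) (+-comm (q 0) 1)) (m≤n⇒m∸n≡0 (subst (_≤ p' 0) ec h1)) ⟩
      suc (q 0) + 0 ≡⟨ cong (suc (q 0) +_) (sym (m≤n⇒m∸n≡0 (<⇒≤ h))) ⟩
      suc (q 0 + (eps L (sh q) (sh p) ∸ p 0)) ∎
  up {suc L} {suc X} {q} {p} {q'} {p'} (there h P) B@(a , b) with up P (Bump-sh B)
  ... | ie , D = e1 , there (subst₂ (λ u v → u < v) (sym pe) (sym ie) (s≤s h)) D
    where
    pe : p' 0 ≡ p 0
    pe = trans (sym (+-identityʳ _)) (b 0 (s≤s z≤n))
    open ≡-Reasoning
    e1 : q' 0 + (eps L (sh q') (sh p') ∸ p' 0) ≡ suc (q 0 + (eps L (sh q) (sh p) ∸ p 0))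
    e1 = begin
      q' 0 + (eps L (sh q') (sh p') ∸ p' 0) ≡⟨ cong₂ _+_ (trans (a 0 z≤n) (+-identityʳ (q 0))) (cong₂ _∸_ ie pe) ⟩
      q 0 + (suc (eps L (sh q) (sh p)) ∸ p 0) ≡⟨ cong (q 0 +_) (+-∸-assoc 1 h) ⟩
      q 0 + suc (eps L (sh q) (sh p) ∸ p 0) ≡⟨ +-suc (q 0) _ ⟩
      suc (q 0 + (eps L (sh q) (sh p) ∸ p 0)) ∎

  q≤eps : ∀ L q p → q 0 ≤ eps L q p
  q≤eps zero    q p = ≤-refl
  q≤eps (suc L) q p = m≤m+n _ _

  DPos-q : ∀ {L q p X} → DPos L q p X → 0 < eps L q p → 0 < q X
  DPos-q stop h = h
  DPos-q {q = q} (here e) h = subst (0 <_) (trans (cong (q 0 +_) (m≤n⇒m∸n≡0 e)) (+-identityʳ _)) h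
  DPos-q (there e P) h = DPos-q P (≤-<-trans z≤n e)

  Pos-p : ∀ {L q p X} → Pos L q p X → X < L → 0 < p X
  Pos-p (here e) h = ≤-<-trans z≤n e
  Pos-p (there e P) (s≤s h) = Pos-p P h

  Pos-≤ : ∀ {L q p X} → Pos L q p X → X ≤ L
  Pos-≤ stop = z≤n
  Pos-≤ (here _) = z≤n
  Pos-≤ (there _ P) = s≤s (Pos-≤ P)

  down : ∀ {L X q p q' p'} → DPos L q' p' X → Bump L X q p q' p' → 0 < eps L q' p' → Pos L q p X
  down stop _ _ = stop
  down {suc L} {q = q} {p} {q'} {p'} (here h) B@(a , b) _ =
    here (subst₂ _≤_ (cong suc (sym (eps-cong L (Bump-tail B)))) (trans (+-comm 1 (p' 0)) (b 0 (s≤s z≤n))) (s≤s h))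
  down {suc L} {suc X} {q} {p} {q'} {p'} (there h D) B@(a , b) _ = there (s≤s⁻¹ (subst₂ _<_ pe ie h)) P
    where
    P = down D (Bump-sh B) (≤-<-trans z≤n h)
    ie = proj₁ (up P (Bump-sh B))
    pe : p' 0 ≡ p 0
    pe = trans (sym (+-identityʳ _)) (b 0 (s≤s z≤n))

  tl-step : ∀ L q p x → x < L → tl L q p x ≡ q x + (tl L q p (suc x) ∸ p x)
  tl-step (suc L) q p zero    h = refl
  tl-step (suc L) q p (suc x) (s≤s h) = tl-step L (sh q) (sh p) x h

  tl-last : ∀ L q p → tl L q p L ≡ q L
  tl-last zero    q p = refl
  tl-last (suc L) q p = tl-last L (sh q) (sh p)

  q≤tl : ∀ L q p x → x ≤ L → q x ≤ tl L q p x
  q≤tl L       q p zero    h = q≤eps L q p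
  q≤tl (suc L) q p (suc x) (s≤s h) = q≤tl L (sh q) (sh p) x h

  tl-cong : ∀ L {q p q' p'} x → (∀ z → x ≤ z → z ≤ L → q z ≡ q' z) → (∀ z → x ≤ z → z < L → p z ≡ p' z) →
            tl L q p x ≡ tl L q' p' x
  tl-cong L       zero    a b = eps-cong L ((λ x h → a x z≤n h) , (λ x h → b x z≤n h))
  tl-cong zero    (suc x) a b = refl
  tl-cong (suc L) (suc x) a b = tl-cong L x (λ z h k → a (suc z) (s≤s h) (s≤s k)) (λ z h k → b (suc z) (s≤s h) (s≤s k))

  -- What lies at or beyond block `d` affects earlier suffixes only through the number of - that it
  -- sends to the left.
  tl-below : ∀ L {q p q' p'} d x → d ≤ L → x ≤ d → (∀ z → z < d → q z ≡ q' z) → (∀ z → z < d → p z ≡ p' z) →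
             tl L q p d ≡ tl L q' p' d → tl L q p x ≡ tl L q' p' x
  tl-below (suc L) (suc d) (suc x) (s≤s k) (s≤s h) a b e =
    tl-below L d x k h (λ z h → a (suc z) (s≤s h)) (λ z h → b (suc z) (s≤s h)) e
  tl-below L       zero    zero    k z≤n a b e = e
  tl-below (suc L) {q} {p} {q'} {p'} (suc d) zero (s≤s k) z≤n a b e =
    cong₂ _+_ (a 0 (s≤s z≤n)) (cong₂ _∸_ ih (b 0 (s≤s z≤n)))
    where
    ih : eps L (sh q) (sh p) ≡ eps L (sh q') (sh p')
    ih = tl-below L d zero k z≤n (λ z h → a (suc z) (s≤s h)) (λ z h → b (suc z) (s≤s h)) e

  -- `Pos` without recursion. Comparing two words that differ in two inner blocks needs conditions
  -- addressed by block number.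
  record Spec (L : ℕ) (q p : ℕ → ℕ) (X : ℕ) : Set where
    constructor spec
    field
      bound  : X ≤ L
      before : ∀ x → x < X → p x ≤ tl L q p (suc x)
      at     : X < L → tl L q p (suc X) < p X
  open Spec public

  Pos⇒Spec : ∀ {L q p X} → Pos L q p X → Spec L q p X
  Pos⇒Spec stop = spec z≤n (λ _ ()) (λ ())
  Pos⇒Spec (here h) = spec z≤n (λ _ ()) (λ _ → h)
  Pos⇒Spec {suc L} {q} {p} {suc X} (there h P) = spec (s≤s (bound S)) bf λ { (s≤s k) → at S k }
    where
    S = Pos⇒Spec P
    bf : ∀ x → x < suc X → p x ≤ tl (suc L) q p (suc x)
    bf zero    _ = h
    bf (suc x) (s≤s k) = before S x k

  Spec⇒Pos : ∀ {L q p X} → Spec L q p X → Pos L q p X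
  Spec⇒Pos {zero} {X = zero} S = stop
  Spec⇒Pos {zero} {X = suc X} S with () ← bound S
  Spec⇒Pos {suc L} {X = zero} S = here (at S (s≤s z≤n))
  Spec⇒Pos {suc L} {X = suc X} S =
    there (before S 0 (s≤s z≤n))
          (Spec⇒Pos (spec (s≤s⁻¹ (bound S)) (λ x h → before S (suc x) (s≤s h)) (λ h → at S (s≤s h))))

-- Effect on one bracket word of moving a letter to the neighbouring block

module OverlappingBrackets where
  open import Data.Nat
  open import Data.Nat.Properties
  open Brackets

  -- One - moves from block `d + 1` to block `d`, across the `p d` + between them. By `small` these
  -- + can all be matched in block `d + 1` with a - to spare, so the spare one may cross.
  record Vertical (L d : ℕ) (q p q' p' : ℕ → ℕ) : Set where
    field
      d<L   : d < L
      q-at  : q' d ≡ suc (q d)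
      q-nxt : suc (q' (suc d)) ≡ q (suc d)
      q-off : ∀ x → x ≤ L → x ≢ d → x ≢ suc d → q x ≡ q' x
      p-all : ∀ x → x < L → p x ≡ p' x
      small : p d < q (suc d)

  -- One + moves from block `d + 1` to block `d`, across the - of block `d + 1`, which the + of
  -- block `d` can already match. If `d + 1 = L`, the source is +^∞ and nothing decreases, hence the
  -- bound in `p-nxt`.
  record Vertical⁺ (L d : ℕ) (q p q' p' : ℕ → ℕ) : Set where
    field
      d<L   : d < L
      p-at  : p' d ≡ suc (p d)
      p-nxt : suc d < L → suc (p' (suc d)) ≡ p (suc d)
      p-off : ∀ x → x < L → x ≢ d → x ≢ suc d → p x ≡ p' x
      q-all : ∀ x → x ≤ L → q x ≡ q' x
      small : q (suc d) ≤ p d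

  offset : ∀ {d x} → suc d < x → x ≢ d × x ≢ suc d
  offset h = (λ { refl → <-irrefl refl (<-trans (n<1+n _) h) }) , (λ { refl → <-irrefl refl h })

  below : ∀ {d x} → x < d → x ≢ d × x ≢ suc d
  below h = (λ { refl → <-irrefl refl h }) , (λ { refl → <-irrefl refl (<-trans (n<1+n _) h) })

  module _ {L d q p q' p'} (V : Vertical L d q p q' p') where
    open Vertical V

    private
      far : ∀ x → suc d < x → tl L q p x ≡ tl L q' p' x
      far x h = tl-cong L x (λ z k l → let a , b = offset (<-≤-trans h k) in q-off z l a b) (λ z k l → p-all z l)

      nxt : suc (tl L q' p' (suc d)) ≡ tl L q p (suc d)
      nxt with suc d ≟ L
      ... | yes refl = trans (cong suc (tl-last L q' p')) (trans q-nxt (sym (tl-last L q p)))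
      ... | no  ne   = trans (cong suc (tl-step L q' p' (suc d) lt))
                         (trans (cong₂ _+_ q-nxt (cong₂ _∸_ (sym (far _ ≤-refl)) (sym (p-all _ lt))))
                                (sym (tl-step L q p (suc d) lt)))
        where lt = ≤∧≢⇒< d<L ne

      big : p d ≤ tl L q' p' (suc d)
      big = ≤-trans (s≤s⁻¹ (subst (suc (p d) ≤_) (sym q-nxt) small)) (q≤tl L q' p' (suc d) d<L)

      at-d : tl L q p d ≡ tl L q' p' d
      at-d = begin
        tl L q p d                                      ≡⟨ tl-step L q p d d<L ⟩
        q d + (tl L q p (suc d) ∸ p d)                  ≡⟨ cong (λ t → q d + (t ∸ p d)) (sym nxt) ⟩
        q d + (suc (tl L q' p' (suc d)) ∸ p d)          ≡⟨ cong (q d +_) (+-∸-assoc 1 big) ⟩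
        q d + suc (tl L q' p' (suc d) ∸ p d)            ≡⟨ +-suc (q d) _ ⟩
        suc (q d) + (tl L q' p' (suc d) ∸ p d)          ≡⟨ cong₂ (λ a b → a + (tl L q' p' (suc d) ∸ b)) (sym q-at) (p-all d d<L) ⟩
        q' d + (tl L q' p' (suc d) ∸ p' d)              ≡⟨ sym (tl-step L q' p' d d<L) ⟩
        tl L q' p' d ∎
        where open ≡-Reasoning

      teq : ∀ x → x ≢ suc d → tl L q p x ≡ tl L q' p' x
      teq x ne with <-cmp x (suc d)
      ... | tri< a _ _ = tl-below L d x (<⇒≤ d<L) (s≤s⁻¹ a)
                           (λ z h → let u , v = below h in q-off z (<⇒≤ (<-trans h d<L)) u v)
                           (λ z h → p-all z (<-trans h d<L)) at-d
      ... | tri≈ _ b _ = ⊥-elim (ne b)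
      ... | tri> _ _ c = far x c

    vertical-eps : eps L q p ≡ eps L q' p'
    vertical-eps = teq 0 λ ()

    vertical-pos : ∀ {X} → Pos L q p X → Pos L q' p' X
    vertical-pos {X} P = Spec⇒Pos (spec (bound S) bf a')
      where
      S = Pos⇒Spec P
      bf : ∀ x → x < X → p' x ≤ tl L q' p' (suc x)
      bf x h with x ≟ d
      ... | yes refl = subst (_≤ _) (p-all d d<L) big
      ... | no  ne   = subst₂ _≤_ (p-all x (<-≤-trans h (bound S))) (teq (suc x) (ne ∘ suc-injective)) (before S x h)
      a' : X < L → tl L q' p' (suc X) < p' X
      a' h with X ≟ d
      ... | yes refl = ⊥-elim (<-asym (at S h) (<-≤-trans small (q≤tl L q p (suc d) d<L)))
      ... | no  ne   = subst₂ _<_ (teq (suc X) (ne ∘ suc-injective)) (p-all X h) (at S h)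

  module _ {L d q p q' p'} (V : Vertical⁺ L d q p q' p') where
    open Vertical⁺ V

    private
      far : ∀ x → suc d < x → tl L q p x ≡ tl L q' p' x
      far x h = tl-cong L x (λ z k l → q-all z l) (λ z k l → let a , b = offset (<-≤-trans h k) in p-off z l a b)

      F = tl L q p (suc (suc d))

      fits : suc d < L → p (suc d) ≤ F → tl L q' p' (suc d) ≡ suc (tl L q p (suc d))
      fits lt h = begin
        tl L q' p' (suc d)                         ≡⟨ tl-step L q' p' (suc d) lt ⟩
        q' (suc d) + (tl L q' p' (suc (suc d)) ∸ p' (suc d))   ≡⟨ cong₂ (λ a b → a + (b ∸ p' (suc d))) (sym (q-all (suc d) d<L)) (sym (far (suc (suc d)) ≤-refl)) ⟩
        q (suc d) + (suc F ∸ suc (p' (suc d)))     ≡⟨ cong (λ t → q (suc d) + (suc F ∸ t)) (p-nxt lt) ⟩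
        q (suc d) + (suc F ∸ p (suc d))            ≡⟨ cong (q (suc d) +_) (+-∸-assoc 1 h) ⟩
        q (suc d) + suc (F ∸ p (suc d))            ≡⟨ +-suc _ _ ⟩
        suc (q (suc d) + (F ∸ p (suc d)))          ≡⟨ cong suc (sym (tl-step L q p (suc d) lt)) ⟩
        suc (tl L q p (suc d)) ∎
        where open ≡-Reasoning

      loose : suc d < L → F < p (suc d) → tl L q p (suc d) ≡ q (suc d) × tl L q' p' (suc d) ≡ q (suc d)
      loose lt h = trans (tl-step L q p (suc d) lt) (trans (cong (q (suc d) +_) (m≤n⇒m∸n≡0 (<⇒≤ h))) (+-identityʳ _))
                 , trans (tl-step L q' p' (suc d) lt)
                     (trans (cong₂ _+_ (sym (q-all (suc d) d<L))
                       (m≤n⇒m∸n≡0 (subst (_≤ p' (suc d)) (far (suc (suc d)) ≤-refl) (s≤s⁻¹ (subst (F <_) (sym (p-nxt lt)) h))))) (+-identityʳ _))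

      final : suc d ≡ L → tl L q p (suc d) ≡ q (suc d) × tl L q' p' (suc d) ≡ q (suc d)
      final refl = tl-last L q p , trans (tl-last L q' p') (sym (q-all (suc d) d<L))

      -- Either all + of block `d + 1` are used up by - from further right, and the departing +
      -- releases one such -; or an unmatched + remains there, and in both words block `d + 1` sends
      -- only its own - to the left.
      Cases : Set
      Cases = (suc d < L × p (suc d) ≤ F × tl L q' p' (suc d) ≡ suc (tl L q p (suc d)))
            ⊎ ((suc d < L → F < p (suc d)) × tl L q p (suc d) ≡ q (suc d) × tl L q' p' (suc d) ≡ q (suc d))

      cases : Cases
      cases with suc d ≟ L
      ... | yes e = inj₂ ((λ h → ⊥-elim (<-irrefl e h)) , final e)
      ... | no  ne with p (suc d) ≤? F
      ... | yes h = inj₁ (≤∧≢⇒< d<L ne , h , fits (≤∧≢⇒< d<L ne) h)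
      ... | no  h = inj₂ ((λ _ → ≰⇒> h) , loose (≤∧≢⇒< d<L ne) (≰⇒> h))

      same : tl L q p (suc d) ∸ p d ≡ tl L q' p' (suc d) ∸ p' d
      same with cases
      ... | inj₁ (_ , _ , e) = sym (cong₂ _∸_ e p-at)
      ... | inj₂ (_ , e , e') = trans (m≤n⇒m∸n≡0 (subst (_≤ p d) (sym e) small))
             (sym (m≤n⇒m∸n≡0 (subst₂ _≤_ (sym e') (sym p-at) (≤-trans small (n≤1+n _)))))

      at-d : tl L q p d ≡ tl L q' p' d
      at-d = trans (tl-step L q p d d<L) (trans (cong₂ _+_ (q-all d (<⇒≤ d<L)) same) (sym (tl-step L q' p' d d<L)))

      teq : ∀ x → x ≢ suc d → tl L q p x ≡ tl L q' p' x
      teq x ne with <-cmp x (suc d)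
      ... | tri< a _ _ = tl-below L d x (<⇒≤ d<L) (s≤s⁻¹ a)
                           (λ z h → q-all z (<⇒≤ (<-trans h d<L)))
                           (λ z h → let u , v = below h in p-off z (<-trans h d<L) u v) at-d
      ... | tri≈ _ b _ = ⊥-elim (ne b)
      ... | tri> _ _ c = far x c

      regular : ∀ {X} → Spec L q p X → ∀ x → x < X → x ≢ d → x ≢ suc d → p' x ≤ tl L q' p' (suc x)
      regular S x h a b = subst₂ _≤_ (p-off x (<-≤-trans h (bound S)) a b) (teq (suc x) (a ∘ suc-injective)) (before S x h)

      at-d-small : ∀ {X} → Spec L q p X → X ≡ d ⊎ X ≡ suc d → tl L q' p' (suc d) < p' d
      at-d-small S _ with cases
      at-d-small S _            | inj₂ (_ , _ , e) = subst₂ _<_ (sym e) (sym p-at) (s≤s small)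
      at-d-small S (inj₁ refl)  | inj₁ (_ , _ , e) = subst₂ _<_ (sym e) (sym p-at) (s≤s (at S d<L))
      at-d-small S (inj₂ refl)  | inj₁ (lt , h , _) = ⊥-elim (<⇒≱ (at S lt) h)

    vertical⁺-eps : eps L q p ≡ eps L q' p'
    vertical⁺-eps = teq 0 λ ()

    -- Here the + of block `d` are all used up, so the newcomer is the surplus that makes block `d`
    -- hold the first survivor.
    vertical⁺-swap : Pos L q p (suc d) → Pos L q' p' d
    vertical⁺-swap P = Spec⇒Pos (spec (<⇒≤ d<L) (λ x h → let a , b = below h in regular S x (<-trans h (n<1+n d)) a b)
                                   (λ _ → at-d-small S (inj₂ refl)))
      where S = Pos⇒Spec P

    vertical⁺-pos : ∀ {X} → X ≢ suc d → Pos L q p X → Pos L q' p' X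
    vertical⁺-pos {X} ne P = Spec⇒Pos (spec (bound S) bf a')
      where
      S = Pos⇒Spec P
      bf : ∀ x → x < X → p' x ≤ tl L q' p' (suc x)
      bf x h with x ≟ d | x ≟ suc d
      ... | no a     | no b     = regular S x h a b
      ... | no _     | yes refl =
        ≤-trans (n≤1+n _) (subst₂ _≤_ (sym (p-nxt (<-≤-trans h (bound S)))) (far _ ≤-refl) (before S (suc d) h))
      ... | yes refl | _ with cases
      ... | inj₁ (_ , _ , e) = subst₂ _≤_ (sym p-at) (sym e) (s≤s (before S d h))
      ... | inj₂ (g , _) = ⊥-elim (<⇒≱ (g lt) (before S (suc d) h'))
        where
        h' = ≤∧≢⇒< h (ne ∘ sym)
        lt = <-≤-trans h' (bound S)
      a' : X < L → tl L q' p' (suc X) < p' X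
      a' h with X ≟ d
      ... | yes refl = at-d-small S (inj₁ refl)
      ... | no  a    = subst₂ _<_ (teq (suc X) (a ∘ suc-injective)) (p-off X h a ne) (at S h)

-- Dependence of a bracket word on its last block

module BracketCorners where
  open import Data.Nat
  open import Data.Nat.Properties
  open import Data.Nat.Tactic.RingSolver using (solve-∀)
  open Brackets

  Σ< : ℕ → (ℕ → ℕ) → ℕ
  Σ< zero    g = 0
  Σ< (suc k) g = Σ< k g + g k

  Σ<-cong : ∀ k {g h} → (∀ x → x < k → g x ≡ h x) → Σ< k g ≡ Σ< k h
  Σ<-cong zero    e = refl
  Σ<-cong (suc k) e = cong₂ _+_ (Σ<-cong k λ x h → e x (m<n⇒m<1+n h)) (e k ≤-refl)

  Σ<-cons : ∀ k g → Σ< (suc k) g ≡ g 0 + Σ< k (sh g)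
  Σ<-cons zero    g = +-comm 0 (g 0)
  Σ<-cons (suc k) g = trans (cong (_+ g (suc k)) (Σ<-cons k g)) (+-assoc (g 0) _ _)

  interchange : ∀ a b c d → (a + b) + (c + d) ≡ (a + c) + (b + d)
  interchange = solve-∀

  Σ<-+ : ∀ k g h → Σ< k (λ x → g x + h x) ≡ Σ< k g + Σ< k h
  Σ<-+ zero    g h = refl
  Σ<-+ (suc k) g h = trans (cong (_+ (g k + h k)) (Σ<-+ k g h)) (interchange (Σ< k g) (Σ< k h) (g k) (h k))

  Σ<-*ʳ : ∀ k g a → Σ< k (λ x → g x * a) ≡ Σ< k g * a
  Σ<-*ʳ zero    g a = refl
  Σ<-*ʳ (suc k) g a = trans (cong (_+ g k * a) (Σ<-*ʳ k g a)) (sym (*-distribʳ-+ a (Σ< k g) (g k)))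

  Σ<-*ˡ : ∀ k g a → Σ< k (λ x → a * g x) ≡ a * Σ< k g
  Σ<-*ˡ zero    g a = sym (*-zeroʳ a)
  Σ<-*ˡ (suc k) g a = trans (cong (_+ a * g k) (Σ<-*ˡ k g a)) (sym (*-distribˡ-+ a (Σ< k g) (g k)))

  Σ<-ind-≥ : ∀ k X → k ≤ X → Σ< k (ind X) ≡ 0
  Σ<-ind-≥ zero    X h = refl
  Σ<-ind-≥ (suc k) X h = cong₂ _+_ (Σ<-ind-≥ k X (<⇒≤ h)) (ind-≢ {X} {k} λ { refl → <-irrefl refl h })

  Σ<-ind-< : ∀ k X → X < k → Σ< k (ind X) ≡ 1
  Σ<-ind-< (suc k) X h with X ≟ k
  ... | yes refl = cong₂ _+_ (Σ<-ind-≥ k k ≤-refl) (ind-refl k)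
  ... | no  ne   = cong₂ _+_ (Σ<-ind-< k X (≤∧≢⇒< (s≤s⁻¹ h) ne)) (ind-≢ {X} {k} ne)

  -- The word of the blocks 0, …, L - 1 cancels to −^surv +^pend.
  surv pend : ℕ → (ℕ → ℕ) → (ℕ → ℕ) → ℕ
  surv zero    q p = 0
  surv (suc L) q p = q 0 + (surv L (sh q) (sh p) ∸ p 0)
  pend zero    q p = 0
  pend (suc L) q p = pend L (sh q) (sh p) + (p 0 ∸ surv L (sh q) (sh p))

  Inner : ℕ → (q p q' p' : ℕ → ℕ) → Set
  Inner L q p q' p' = (∀ x → x < L → q x ≡ q' x) × (∀ x → x < L → p x ≡ p' x)

  shI : ∀ {L q p q' p'} → Inner (suc L) q p q' p' → Inner L (sh q) (sh p) (sh q') (sh p')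
  shI (a , b) = (λ x h → a (suc x) (s≤s h)) , (λ x h → b (suc x) (s≤s h))

  surv-cong : ∀ L {q p q' p'} → Inner L q p q' p' → surv L q p ≡ surv L q' p'
  surv-cong zero    I = refl
  surv-cong (suc L) I@(a , b) = cong₂ _+_ (a 0 (s≤s z≤n)) (cong₂ _∸_ (surv-cong L (shI I)) (b 0 (s≤s z≤n)))

  pend-cong : ∀ L {q p q' p'} → Inner L q p q' p' → pend L q p ≡ pend L q' p'
  pend-cong zero    I = refl
  pend-cong (suc L) I@(a , b) = cong₂ _+_ (pend-cong L (shI I)) (cong₂ _∸_ (b 0 (s≤s z≤n)) (surv-cong L (shI I)))

  -- Put +^p in front of -^k +^l -^y: the new + first cancel the leading -^k, and only the excess
  -- `p ∸ k` joins +^l against -^y.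
  ∸-split : ∀ k y p l → (k + (y ∸ l)) ∸ p ≡ (k ∸ p) + (y ∸ (l + (p ∸ k)))
  ∸-split k y p l with p ≤? k
  ... | yes h = begin
    (k + (y ∸ l)) ∸ p           ≡⟨ cong (_∸ p) (+-comm k (y ∸ l)) ⟩
    ((y ∸ l) + k) ∸ p           ≡⟨ +-∸-assoc (y ∸ l) h ⟩
    (y ∸ l) + (k ∸ p)           ≡⟨ +-comm (y ∸ l) (k ∸ p) ⟩
    (k ∸ p) + (y ∸ l)           ≡⟨ cong (λ t → (k ∸ p) + (y ∸ t)) (sym (trans (cong (l +_) (m≤n⇒m∸n≡0 h)) (+-identityʳ l))) ⟩
    (k ∸ p) + (y ∸ (l + (p ∸ k))) ∎
    where open ≡-Reasoning
  ... | no h = begin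
    (k + (y ∸ l)) ∸ p           ≡⟨ cong ((k + (y ∸ l)) ∸_) (sym (m+[n∸m]≡n k≤p)) ⟩
    (k + (y ∸ l)) ∸ (k + (p ∸ k)) ≡⟨ [m+n]∸[m+o]≡n∸o k _ _ ⟩
    (y ∸ l) ∸ (p ∸ k)           ≡⟨ ∸-+-assoc y l (p ∸ k) ⟩
    y ∸ (l + (p ∸ k))           ≡⟨ cong (_+ (y ∸ (l + (p ∸ k)))) (sym (m≤n⇒m∸n≡0 k≤p)) ⟩
    (k ∸ p) + (y ∸ (l + (p ∸ k))) ∎
    where
    open ≡-Reasoning
    k≤p = <⇒≤ (≰⇒> h)

  -- The final -^{q L} meets only the + left pending by the first `L` blocks.
  eps-corner : ∀ L q p → eps L q p ≡ surv L q p + (q L ∸ pend L q p)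
  eps-corner zero    q p = refl
  eps-corner (suc L) q p = begin
    q 0 + (eps L (sh q) (sh p) ∸ p 0)
      ≡⟨ cong (λ t → q 0 + (t ∸ p 0)) (eps-corner L (sh q) (sh p)) ⟩
    q 0 + ((surv L (sh q) (sh p) + (q (suc L) ∸ pend L (sh q) (sh p))) ∸ p 0)
      ≡⟨ cong (q 0 +_) (∸-split (surv L (sh q) (sh p)) (q (suc L)) (p 0) (pend L (sh q) (sh p))) ⟩
    q 0 + ((surv L (sh q) (sh p) ∸ p 0) + (q (suc L) ∸ pend (suc L) q p))
      ≡⟨ sym (+-assoc (q 0) _ _) ⟩
    surv (suc L) q p + (q (suc L) ∸ pend (suc L) q p) ∎
    where open ≡-Reasoning

  m+[n∸m]-comm : ∀ m n → m + (n ∸ m) ≡ n + (m ∸ n)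
  m+[n∸m]-comm zero    zero    = refl
  m+[n∸m]-comm zero    (suc n) = sym (+-identityʳ (suc n))
  m+[n∸m]-comm (suc m) zero    = +-identityʳ (suc m)
  m+[n∸m]-comm (suc m) (suc n) = cong suc (m+[n∸m]-comm m n)

  -- Each cancellation removes one + and one -.
  balance : ∀ L q p → surv L q p + Σ< L p ≡ pend L q p + Σ< L q
  balance zero    q p = refl
  balance (suc L) q p = begin
    (q 0 + (k ∸ p 0)) + Σ< (suc L) p      ≡⟨ cong ((q 0 + (k ∸ p 0)) +_) (Σ<-cons L p) ⟩
    (q 0 + (k ∸ p 0)) + (p 0 + P)         ≡⟨ r1 (q 0) (k ∸ p 0) (p 0) P ⟩
    q 0 + ((p 0 + (k ∸ p 0)) + P)         ≡⟨ cong (λ t → q 0 + (t + P)) (m+[n∸m]-comm (p 0) k) ⟩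
    q 0 + ((k + (p 0 ∸ k)) + P)           ≡⟨ r2 (q 0) k (p 0 ∸ k) P ⟩
    q 0 + ((k + P) + (p 0 ∸ k))           ≡⟨ cong (λ t → q 0 + (t + (p 0 ∸ k))) (balance L (sh q) (sh p)) ⟩
    q 0 + ((l + Q) + (p 0 ∸ k))           ≡⟨ r3 (q 0) l Q (p 0 ∸ k) ⟩
    (l + (p 0 ∸ k)) + (q 0 + Q)           ≡⟨ cong ((l + (p 0 ∸ k)) +_) (sym (Σ<-cons L q)) ⟩
    (l + (p 0 ∸ k)) + Σ< (suc L) q ∎
    where
    open ≡-Reasoning
    k = surv L (sh q) (sh p)
    l = pend L (sh q) (sh p)
    P = Σ< L (sh p)
    Q = Σ< L (sh q)
    r1 : ∀ a b c d → (a + b) + (c + d) ≡ a + ((c + b) + d)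
    r1 = solve-∀
    r2 : ∀ a b c d → a + ((b + c) + d) ≡ a + ((b + d) + c)
    r2 = solve-∀
    r3 : ∀ a b c d → a + ((b + c) + d) ≡ (b + d) + (a + c)
    r3 = solve-∀

  -- The last - absorb every pending +, so the first survivor belongs to +^∞.
  Pos-corner : ∀ L q p → pend L q p ≤ q L → Pos L q p L
  Pos-corner zero    q p h = stop
  Pos-corner (suc L) q p h = there
    (subst (p 0 ≤_) (sym (eps-corner L (sh q) (sh p)))
      (≤-trans (m≤n+m∸n (p 0) k) (+-monoʳ-≤ k (m+n≤o⇒m≤o∸n _ (subst (_≤ q (suc L)) (+-comm l _) h)))))
    (Pos-corner L (sh q) (sh p) (≤-trans (m≤m+n l _) h))
    where
    k = surv L (sh q) (sh p)
    l = pend L (sh q) (sh p)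

  -- A pending + outlives the last block and stands before it. The last - consume pending + from the
  -- right, so the first survivor stays in place for every size of the last block below `pend`.
  Pos-inner : ∀ {L q p q' p' X} → Inner L q p q' p' → q L < pend L q p → q' L < pend L q p →
              Pos L q p X → Pos L q' p' X × X < L
  Pos-inner {suc L} {q} {p} {q'} {p'} I@(a , b) h h' P with p 0 ≤? surv L (sh q) (sh p)
  ... | yes g = go P
    where
    k = surv L (sh q) (sh p)
    le : pend (suc L) q p ≡ pend L (sh q) (sh p)
    le = trans (cong (pend L (sh q) (sh p) +_) (m≤n⇒m∸n≡0 g)) (+-identityʳ _)
    go : ∀ {X} → Pos (suc L) q p X → Pos (suc L) q' p' X × X < suc L
    go (here e) = ⊥-elim (<⇒≱ e (≤-trans g (subst (k ≤_) (sym (eps-corner L (sh q) (sh p))) (m≤m+n k _))))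
    go (there e P) with Pos-inner (shI I) (subst (q (suc L) <_) le h) (subst (q' (suc L) <_) le h') P
    ... | P' , lt = there (subst₂ _≤_ (b 0 (s≤s z≤n)) (sym (eps-corner L (sh q') (sh p')))
                      (≤-trans (subst (p 0 ≤_) (surv-cong L (shI I)) g) (m≤m+n _ _))) P' , s≤s lt
  ... | no g = go P
    where
    k = surv L (sh q) (sh p)
    l = pend L (sh q) (sh p)
    small : ∀ y → y < pend (suc L) q p → k + (y ∸ l) < p 0
    small y u = subst (k + (y ∸ l) <_) (m+[n∸m]≡n (<⇒≤ (≰⇒> g)))
      (+-monoʳ-< k (lemma y l (p 0 ∸ k) u (m<n⇒0<n∸m (≰⇒> g))))
      where
      lemma : ∀ y l d → y < l + d → 0 < d → y ∸ l < d
      lemma y       zero    d u v = u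
      lemma zero    (suc l) d u v = v
      lemma (suc y) (suc l) d u v = lemma y l d (s≤s⁻¹ u) v
    go : ∀ {X} → Pos (suc L) q p X → Pos (suc L) q' p' X × X < suc L
    go (there e P) = ⊥-elim (<⇒≱ (subst (_< p 0) (sym (eps-corner L (sh q) (sh p))) (small (q (suc L)) h)) e)
    go (here e) = here (subst₂ _<_ (sym (trans (eps-corner L (sh q') (sh p'))
                          (cong₂ (λ s t → s + (q' (suc L) ∸ t)) (sym (surv-cong L (shI I))) (sym (pend-cong L (shI I))))))
                        (b 0 (s≤s z≤n)) (small (q' (suc L)) h')) , s≤s z≤n

-- Multisegments as triangular arrays; lengthening segments at either side

module Triangles where
  open import Data.Nat
  open import Data.Nat.Properties
  open import Data.Nat.Tactic.RingSolver using (solve-∀)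
  open Brackets
  open OverlappingBrackets
  open BracketCorners

  -- n x y is the multiplicity of the segment [x + 1, R + 1 - y]; only x + y ≤ R matters.
  Mat : Set
  Mat = ℕ → ℕ → ℕ

  -- The mirror image: for r = R + 2 a segment [a , b] becomes [r - b , r - a], so starts and ends
  -- of segments are exchanged.
  T : Mat → Mat
  T n x y = n y x

  -- The letters - are the segments ending at R + 1 - c and the letters + those ending at R - c,
  -- ordered by starting point.
  Q P : Mat → ℕ → ℕ → ℕ
  Q n c x = n x c
  P n c x = n x (suc c)

  ind² : ℕ → ℕ → Mat
  ind² X c x y = ind X x * ind c y

  ind²-1 : ∀ X c → ind² X c X c ≡ 1
  ind²-1 X c = cong₂ _*_ (ind-refl X) (ind-refl c)

  ind²-0ˡ : ∀ {X c x y} → X ≢ x → ind² X c x y ≡ 0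
  ind²-0ˡ {X} {c} {x} {y} h = cong (_* ind c y) (ind-≢ {X} {x} h)

  ind²-0ʳ : ∀ {X c x y} → c ≢ y → ind² X c x y ≡ 0
  ind²-0ʳ {X} {c} {x} {y} h = trans (cong (ind X x *_) (ind-≢ {c} {y} h)) (*-zeroʳ (ind X x))

  ind²-≤ : ∀ X c (n : Mat) x y → (X ≡ x → c ≡ y → 0 < n x y) → ind² X c x y ≤ n x y
  ind²-≤ X c n x y h with X ≟ x | c ≟ y
  ... | yes refl | yes refl = subst (_≤ n X c) (sym (ind²-1 X c)) (h refl refl)
  ... | no ne    | _        = subst (_≤ n x y) (sym (ind²-0ˡ {X} {c} {x} {y} ne)) z≤n
  ... | yes _    | no ne    = subst (_≤ n x y) (sym (ind²-0ʳ {X} {c} {x} {y} ne)) z≤n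

  add sub : ℕ → ℕ → Mat → Mat
  add X c n x y = (n x y + ind² X c x y) ∸ ind² X (suc c) x y
  sub X c n x y = (n x y + ind² X (suc c) x y) ∸ ind² X c x y

  module Triangle (R : ℕ) where

    infix 4 _≈_
    record _≈_ (n m : Mat) : Set where
      constructor pw
      field on : ∀ x y → x + y ≤ R → n x y ≡ m x y
    open _≈_ public

    ≈-refl : ∀ {n} → n ≈ n
    ≈-refl = pw λ x y h → refl

    ≈-sym : ∀ {n m} → n ≈ m → m ≈ n
    ≈-sym e = pw λ x y h → sym (on e x y h)

    ≈-trans : ∀ {n m k} → n ≈ m → m ≈ k → n ≈ k
    ≈-trans e f = pw λ x y h → trans (on e x y h) (on f x y h)

    T-cong : ∀ {n m} → n ≈ m → T n ≈ T m
    T-cong e = pw λ x y h → on e y x (subst (_≤ R) (+-comm x y) h)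

    T-inv : ∀ {n m} → T n ≈ T m → n ≈ m
    T-inv e = pw λ x y h → on e y x (subst (_≤ R) (+-comm x y) h)

    -- A segment moves from cell (X , c + 1) to (X , c), so its end grows by one. If (X , c + 1)
    -- lies beyond the triangle while (X , c) lies in it, the equation says that a new simple
    -- segment appears.
    record Step (X c : ℕ) (n m : Mat) : Set where
      constructor st
      field eqn : ∀ x y → x + y ≤ R → m x y + ind² X (suc c) x y ≡ n x y + ind² X c x y
    open Step public

    Step-resp : ∀ {X c n n' m m'} → n ≈ n' → m ≈ m' → Step X c n m → Step X c n' m'
    Step-resp {X} {c} e f S = st λ x y h →
      subst₂ (λ a b → b + ind² X (suc c) x y ≡ a + ind² X c x y) (on e x y h) (on f x y h) (eqn S x y h)

    Step-fun : ∀ {X c n m m'} → Step X c n m → Step X c n m' → m ≈ m'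
    Step-fun {X} {c} S S' = pw λ x y h → +-cancelʳ-≡ (ind² X (suc c) x y) _ _ (trans (eqn S x y h) (sym (eqn S' x y h)))

    Step-inj : ∀ {X c n n' m} → Step X c n m → Step X c n' m → n ≈ n'
    Step-inj {X} {c} S S' = pw λ x y h → +-cancelʳ-≡ (ind² X c x y) _ _ (trans (sym (eqn S x y h)) (eqn S' x y h))

    add-step : ∀ {X c n} → (X + suc c ≤ R → 0 < n X (suc c)) → Step X c n (add X c n)
    add-step {X} {c} {n} pos = st λ x y h → m∸n+n≡m (≤-trans (ind²-≤ X (suc c) n x y λ { refl refl → pos h }) (m≤m+n _ _))

    sub-step : ∀ {X c n} → 0 < n X c → Step X c (sub X c n) n
    sub-step {X} {c} {n} pos = st λ x y h → sym (m∸n+n≡m (≤-trans (ind²-≤ X c n x y λ { refl refl → pos }) (m≤m+n _ _)))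

    step-off : ∀ {X c n m x y} → Step X c n m → x + y ≤ R → x ≢ X ⊎ (y ≢ c × y ≢ suc c) → n x y ≡ m x y
    step-off {X} {c} {n} {m} {x} {y} S h o = +-cancelʳ-≡ 0 _ _
      (trans (cong (n x y +_) (sym (z c proj₁ o)))
        (trans (sym (eqn S x y h)) (cong (m x y +_) (z (suc c) proj₂ o))))
      where
      z : ∀ c' → (y ≢ c × y ≢ suc c → y ≢ c') → x ≢ X ⊎ (y ≢ c × y ≢ suc c) → ind² X c' x y ≡ 0
      z c' g (inj₁ ne) = ind²-0ˡ {X} {c'} {x} {y} (ne ∘ sym)
      z c' g (inj₂ ne) = ind²-0ʳ {X} {c'} {x} {y} (g ne ∘ sym)

    step-inc : ∀ {X c n m} → Step X c n m → X + c ≤ R → m X c ≡ suc (n X c)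
    step-inc {X} {c} {n} {m} S h = begin
      m X c                       ≡⟨ sym (+-identityʳ _) ⟩
      m X c + 0                   ≡⟨ cong (m X c +_) (sym (ind²-0ʳ {X} {suc c} {X} {c} λ ())) ⟩
      m X c + ind² X (suc c) X c  ≡⟨ eqn S X c h ⟩
      n X c + ind² X c X c        ≡⟨ cong (n X c +_) (ind²-1 X c) ⟩
      n X c + 1                   ≡⟨ +-comm _ 1 ⟩
      suc (n X c) ∎
      where open ≡-Reasoning

    step-dec : ∀ {X c n m} → Step X c n m → X + suc c ≤ R → suc (m X (suc c)) ≡ n X (suc c)
    step-dec {X} {c} {n} {m} S h = begin
      suc (m X (suc c))                       ≡⟨ +-comm 1 _ ⟩
      m X (suc c) + 1                         ≡⟨ cong (m X (suc c) +_) (sym (ind²-1 X (suc c))) ⟩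
      m X (suc c) + ind² X (suc c) X (suc c)  ≡⟨ eqn S X (suc c) h ⟩
      n X (suc c) + ind² X c X (suc c)        ≡⟨ cong (n X (suc c) +_) (ind²-0ʳ {X} {c} {X} {suc c} λ ()) ⟩
      n X (suc c) + 0                         ≡⟨ +-identityʳ _ ⟩
      n X (suc c) ∎
      where open ≡-Reasoning

    record PosC (c : ℕ) (n : Mat) (X : ℕ) : Set where
      constructor mk
      field raw : Pos (R ∸ c) (Q n c) (P n c) X
    open PosC public

    record DPosC (c : ℕ) (n : Mat) (X : ℕ) : Set where
      constructor mk
      field draw : DPos (R ∸ c) (Q n c) (P n c) X
    open DPosC public

    opaque
      epsC : ℕ → Mat → ℕ
      epsC c n = eps (R ∸ c) (Q n c) (P n c)

      epsC-def : ∀ c n → epsC c n ≡ eps (R ∸ c) (Q n c) (P n c)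
      epsC-def c n = refl

      position dposition : ℕ → Mat → ℕ
      position  c n = proj₁ (pos  (R ∸ c) (Q n c) (P n c))
      dposition c n = proj₁ (dpos (R ∸ c) (Q n c) (P n c))

      posC : ∀ c n → PosC c n (position c n)
      posC c n = mk (proj₂ (pos (R ∸ c) (Q n c) (P n c)))

      dposC : ∀ c n → DPosC c n (dposition c n)
      dposC c n = mk (proj₂ (dpos (R ∸ c) (Q n c) (P n c)))

      F G : ℕ → Mat → Mat
      F c n = add (position c n) c n
      G c n = sub (dposition c n) c n

      F-def : ∀ c n → F c n ≡ add (position c n) c n
      F-def c n = refl

      G-def : ∀ c n → G c n ≡ sub (dposition c n) c n
      G-def c n = refl

    in-col : ∀ {x c} → c ≤ R → x ≤ R ∸ c → x + c ≤ R
    in-col {x} h k = m≤o∸n⇒m+n≤o x h k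

    in-col⁺ : ∀ {x c} → x < R ∸ c → x + suc c ≤ R
    in-col⁺ {x} {c} k with c ≤? R
    ... | yes h = subst (_≤ R) (sym (+-suc x c)) (m≤o∸n⇒m+n≤o (suc x) h k)
    ... | no  h with () ← subst (x <_) (m≤n⇒m∸n≡0 (<⇒≤ (≰⇒> h))) k

    col-in : ∀ {x} c → x + suc c ≤ R → x < R ∸ c
    col-in {x} c h = m+n≤o⇒m≤o∸n (suc x) (subst (_≤ R) (+-suc x c) h)

    F-step : ∀ {c n X} → PosC c n X → Step X c n (F c n)
    F-step {c} {n} {X} p rewrite F-def c n | Pos-unique (raw p) (raw (posC c n)) =
      add-step (λ h → Pos-p (raw (posC c n)) (col-in c h))

    G-step : ∀ {c n X} → DPosC c n X → 0 < epsC c n → Step X c (G c n) n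
    G-step {c} {n} p h rewrite G-def c n | DPos-unique (draw p) (draw (dposC c n)) =
      sub-step (DPos-q (draw (dposC c n)) (subst (0 <_) (epsC-def c n) h))

    agree : ∀ {c n m} → c ≤ R → n ≈ m → Agree (R ∸ c) (Q n c) (P n c) (Q m c) (P m c)
    agree h e = (λ x k → on e x _ (in-col h k)) , (λ x k → on e x _ (in-col⁺ k))

    bump : ∀ {c n m X} → c ≤ R → Step X c n m → Bump (R ∸ c) X (Q n c) (P n c) (Q m c) (P m c)
    bump {c} {n} {m} {X} h S = a , b
      where
      a : ∀ x → x ≤ R ∸ c → m x c ≡ n x c + ind X x
      a x k = trans (sym (+-identityʳ _)) (trans (cong (m x c +_) (sym (ind²-0ʳ {X} {suc c} {x} {c} λ ())))
                (trans (eqn S x c (in-col h k)) (cong (n x c +_) (trans (cong (ind X x *_) (ind-refl c)) (*-identityʳ _)))))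
      b : ∀ x → x < R ∸ c → m x (suc c) + ind X x ≡ n x (suc c)
      b x k = trans (cong (m x (suc c) +_) (sym (trans (cong (ind X x *_) (ind-refl c)) (*-identityʳ _))))
                (trans (eqn S x (suc c) (in-col⁺ k))
                  (trans (cong (n x (suc c) +_) (ind²-0ʳ {X} {c} {x} {suc c} λ ())) (+-identityʳ _)))

    PosC-cong : ∀ {c n m X} → c ≤ R → n ≈ m → PosC c n X → PosC c m X
    PosC-cong h e p = mk (Pos-cong (agree h e) (raw p))

    DPosC-cong : ∀ {c n m X} → c ≤ R → n ≈ m → DPosC c n X → DPosC c m X
    DPosC-cong h e p = mk (DPos-cong (agree h e) (draw p))

    epsC-agree : ∀ {c n m} → Agree (R ∸ c) (Q n c) (P n c) (Q m c) (P m c) → epsC c n ≡ epsC c m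
    epsC-agree {c} {n} {m} A = trans (epsC-def c n) (trans (eps-cong (R ∸ c) A) (sym (epsC-def c m)))

    epsC-cong : ∀ {c n m} → c ≤ R → n ≈ m → epsC c n ≡ epsC c m
    epsC-cong h e = epsC-agree (agree h e)

    F-cong : ∀ {c n m} → c ≤ R → n ≈ m → F c n ≈ F c m
    F-cong {c} {n} h e =
      Step-fun (Step-resp e ≈-refl (F-step (posC c n))) (F-step (PosC-cong h e (posC c n)))

    private
      up-F : ∀ c n → c ≤ R → eps (R ∸ c) (Q (F c n) c) (P (F c n) c) ≡ suc (eps (R ∸ c) (Q n c) (P n c))
             × DPos (R ∸ c) (Q (F c n) c) (P (F c n) c) (position c n)
      up-F c n h = up (raw (posC c n)) (bump h (F-step (posC c n)))

    epsC-F : ∀ {c n} → c ≤ R → epsC c (F c n) ≡ suc (epsC c n)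
    epsC-F {c} {n} h = trans (epsC-def c (F c n)) (trans (proj₁ (up-F c n h)) (cong suc (sym (epsC-def c n))))

    epsC-F-pos : ∀ {c n} → c ≤ R → 0 < epsC c (F c n)
    epsC-F-pos h = subst (0 <_) (sym (epsC-F h)) z<s

    G-F : ∀ {c n} → c ≤ R → G c (F c n) ≈ n
    G-F {c} {n} h = Step-inj (G-step (mk (proj₂ (up-F c n h))) (epsC-F-pos h)) (F-step (posC c n))

    F-G : ∀ {c n} → c ≤ R → 0 < epsC c n → F c (G c n) ≈ n
    F-G {c} {n} h k = Step-fun (F-step (mk (down (draw (dposC c n)) (bump h S) (subst (0 <_) (epsC-def c n) k)))) S
      where S = G-step (dposC c n) k

    G-cong : ∀ {c n m} → c ≤ R → 0 < epsC c n → n ≈ m → G c n ≈ G c m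
    G-cong {c} {n} {m} h k e =
      Step-inj (Step-resp ≈-refl e (G-step D k)) (G-step (DPosC-cong h e D) (subst (0 <_) (epsC-cong h e) k))
      where D = dposC c n

    PosR : ℕ → Mat → ℕ → Set
    PosR d n = PosC d (T n)

    StepR : ℕ → ℕ → Mat → Mat → Set
    StepR Y d n m = Step Y d (T n) (T m)

    +-flip : ∀ {x y} → x + y ≤ R → y + x ≤ R
    +-flip {x} {y} = subst (_≤ R) (+-comm x y)

    -- How a row step at (d , Y) affects the column word of `c`. The only conflict is that both
    -- operators want a segment in cell (d + 1 , c + 1); by `swap` the column position then follows
    -- that segment to row `d`.
    record Interaction (c d Y : ℕ) (n m : Mat) : Set where
      field
        same-eps : epsC c n ≡ epsC c m
        keep     : ∀ {X} → PosC c n X → ¬ (X ≡ suc d × Y ≡ suc c) → PosC c m X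
        swap     : Y ≡ suc c → PosC c n (suc d) → PosC c m d
    open Interaction public

    untouched : ∀ {c d Y n m} → c ≤ R → Y ≢ c → Y ≢ suc c → StepR Y d n m → Agree (R ∸ c) (Q n c) (P n c) (Q m c) (P m c)
    untouched {n = n} {m} h a b S = (λ x k → step-off {n = T n} {T m} S (+-flip {x} (in-col h k)) (inj₁ (a ∘ sym)))
                                , (λ x k → step-off {n = T n} {T m} S (+-flip {x} (in-col⁺ k)) (inj₁ (b ∘ sym)))

    eps-def : ∀ {c n m} → eps (R ∸ c) (Q n c) (P n c) ≡ eps (R ∸ c) (Q m c) (P m c) → epsC c n ≡ epsC c m
    eps-def {c} {n} {m} e = trans (epsC-def c n) (trans e (sym (epsC-def c m)))

    -- The row step touches (d , Y) and (d + 1 , Y). These cells carry letters of the column word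
    -- only for Y = c, as -, and for Y = c + 1, as +. The inequality `small` comes from Y being the
    -- first surviving + of the row word.
    interaction : ∀ {c d Y n m} → c + d < R → PosR d n Y → StepR Y d n m → Interaction c d Y n m
    interaction {c} {d} {Y} {n} {m} cd pY S with Y ≟ c | Y ≟ suc c
    ... | no a | no b = record
      { same-eps = epsC-agree A ; keep = λ p _ → mk (Pos-cong A (raw p)) ; swap = λ e _ → ⊥-elim (b e) }
      where A = untouched {n = n} {m} (≤-trans (m≤m+n c d) (<⇒≤ cd)) a b S
    ... | yes refl | _ = record
      { same-eps = eps-def (vertical-eps V) ; keep = λ p _ → mk (vertical-pos V (raw p)) ; swap = λ e _ → ⊥-elim (1+n≢n (sym e)) }
      where
      c≤R = ≤-trans (m≤m+n c d) (<⇒≤ cd)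
      dc : d + suc c ≤ R
      dc = subst (_≤ R) (trans (cong suc (+-comm c d)) (sym (+-suc d c))) cd
      V : Vertical (R ∸ c) d (Q n c) (P n c) (Q m c) (P m c)
      V = record
        { d<L = col-in c dc
        ; q-at = step-inc {n = T n} {T m} S (<⇒≤ cd)
        ; q-nxt = step-dec {n = T n} {T m} S (subst (_≤ R) (sym (+-suc c d)) cd)
        ; q-off = λ x k a b → step-off {n = T n} {T m} S (+-flip {x} (in-col c≤R k)) (inj₂ (a , b))
        ; p-all = λ x k → step-off {n = T n} {T m} S (+-flip {x} (in-col⁺ k)) (inj₁ 1+n≢n)
        ; small = ≤-<-trans (q≤tl (R ∸ d) (Q (T n) d) (P (T n) d) (suc c) k) (at (Pos⇒Spec (raw pY)) k) }
        where k = col-in d (subst (_≤ R) (sym (+-suc c d)) cd)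
    ... | no _ | yes refl = record
      { same-eps = eps-def (vertical⁺-eps V) ; keep = λ {X} p ne → mk (vertical⁺-pos V (λ e → ne (e , refl)) (raw p)) ; swap = λ _ p → mk (vertical⁺-swap V (raw p)) }
      where
      c≤R = ≤-trans (m≤m+n c d) (<⇒≤ cd)
      dc : d + suc c ≤ R
      dc = subst (_≤ R) (trans (cong suc (+-comm c d)) (sym (+-suc d c))) cd
      Sp = Pos⇒Spec (raw pY)
      k : suc c ≤ R ∸ d
      k = col-in d (subst (_≤ R) (sym (+-suc c d)) cd)
      -- The + of the block at the position outnumber the - arriving from its right, so this block
      -- sends only its own - to the left.
      tail : tl (R ∸ d) (Q (T n) d) (P (T n) d) (suc c) ≡ n d (suc c)
      tail with suc c ≟ R ∸ d
      ... | yes e = trans (cong (λ L → tl L (Q (T n) d) (P (T n) d) (suc c)) (sym e))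
                      (tl-last (suc c) (Q (T n) d) (P (T n) d))
      ... | no ne = trans (tl-step (R ∸ d) (Q (T n) d) (P (T n) d) (suc c) lt)
                      (trans (cong (n d (suc c) +_) (m≤n⇒m∸n≡0 (<⇒≤ (at Sp lt)))) (+-identityʳ _))
        where lt = ≤∧≢⇒< k ne
      V : Vertical⁺ (R ∸ c) d (Q n c) (P n c) (Q m c) (P m c)
      V = record
        { d<L = col-in c dc
        ; p-at = step-inc {n = T n} {T m} S (+-flip {d} dc)
        ; p-nxt = λ lt → step-dec {n = T n} {T m} S (+-flip {suc d} (in-col⁺ lt))
        ; p-off = λ x k a b → step-off {n = T n} {T m} S (+-flip {x} (in-col⁺ k)) (inj₂ (a , b))
        ; q-all = λ x k → step-off {n = T n} {T m} S (+-flip {x} (in-col c≤R k)) (inj₁ (1+n≢n ∘ sym))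
        ; small = subst (n (suc d) c ≤_) tail (before Sp c ≤-refl) }

    F' : ℕ → Mat → Mat
    F' d n = T (F d (T n))

    F'-step : ∀ {d n Y} → PosR d n Y → StepR Y d n (F' d n)
    F'-step {d} {n} p = F-step {d} {T n} p

    four : ∀ {A A₁ N a b a' b'} → A₁ + a ≡ N + b → A + a' ≡ A₁ + b' → A + (a + a') ≡ N + (b + b')
    four {A} {A₁} {N} {a} {b} {a'} {b'} e f = begin
      A + (a + a')   ≡⟨ l1 A a a' ⟩
      (A + a') + a   ≡⟨ cong (_+ a) f ⟩
      (A₁ + b') + a  ≡⟨ l2 A₁ b' a ⟩
      (A₁ + a) + b'  ≡⟨ cong (_+ b') e ⟩
      (N + b) + b'   ≡⟨ +-assoc N b b' ⟩
      N + (b + b') ∎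
      where
      open ≡-Reasoning
      l1 : ∀ x y z → x + (y + z) ≡ (x + z) + y
      l1 = solve-∀
      l2 : ∀ x y z → (x + y) + z ≡ (x + z) + y
      l2 = solve-∀

    commute-keep : ∀ {c d X Y n} → PosC c n X → PosC c (F' d n) X → PosR d n Y → PosR d (F c n) Y →
                   F c (F' d n) ≈ F' d (F c n)
    commute-keep {c} {d} {X} {Y} {n} p p' r r' = pw λ x y h → +-cancelʳ-≡ (ind² X (suc c) x y + ind² Y (suc d) y x) _ _
      (trans (trans (cong (F c (F' d n) x y +_) (+-comm (ind² X (suc c) x y) (ind² Y (suc d) y x))) (one x y h))
        (trans (cong (n x y +_) (+-comm (ind² Y d y x) (ind² X c x y))) (sym (two x y h))))
      where
      module _ (x y : ℕ) (h : x + y ≤ R) where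
        one : F c (F' d n) x y + (ind² Y (suc d) y x + ind² X (suc c) x y) ≡ n x y + (ind² Y d y x + ind² X c x y)
        one = four {F c (F' d n) x y} {F' d n x y} {n x y} (eqn (F'-step r) y x (+-flip {x} h)) (eqn (F-step p') x y h)
        two : F' d (F c n) x y + (ind² X (suc c) x y + ind² Y (suc d) y x) ≡ n x y + (ind² X c x y + ind² Y d y x)
        two = four {F' d (F c n) x y} {F c n x y} {n x y} (eqn (F-step p) x y h) (eqn (F'-step r') y x (+-flip {x} h))

    -- Both operators want the same segment. In either order it is lengthened at both ends and goes
    -- from cell (d + 1 , c + 1) to (d , c).
    commute-swap : ∀ {c d n} → PosC c n (suc d) → PosC c (F' d n) d → PosR d n (suc c) → PosR d (F c n) c →
                   F c (F' d n) ≈ F' d (F c n)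
    commute-swap {c} {d} {n} p p' r r' = pw λ x y h → entry x y h
     where
     entry : ∀ x y → x + y ≤ R → F c (F' d n) x y ≡ F' d (F c n) x y
     entry x y h = +-cancelʳ-≡ (w + (v + z)) _ _ (begin
      A + (w + (v + z))  ≡⟨ l3 A w v z ⟩
      (A + (w + v)) + z  ≡⟨ cong (_+ z) one' ⟩
      (N + (v + u)) + z  ≡⟨ l4 N v u z ⟩
      (N + (z + u)) + v  ≡⟨ cong (_+ v) (sym two') ⟩
      (B + (w + z)) + v  ≡⟨ l5 B w z v ⟩
      B + (w + (v + z)) ∎)
      where
      open ≡-Reasoning
      A = F c (F' d n) x y
      B = F' d (F c n) x y
      N = n x y
      u = ind² d c x y
      v = ind² d (suc c) x y
      w = ind² (suc d) (suc c) x y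
      z = ind² (suc d) c x y
      one : A + (ind² (suc c) (suc d) y x + ind² d (suc c) x y) ≡ N + (ind² (suc c) d y x + ind² d c x y)
      one = four {A} {F' d n x y} {N} (eqn (F'-step r) y x (+-flip {x} h)) (eqn (F-step p') x y h)
      two : B + (ind² (suc d) (suc c) x y + ind² c (suc d) y x) ≡ N + (ind² (suc d) c x y + ind² c d y x)
      two = four {B} {F c n x y} {N} (eqn (F-step p) x y h) (eqn (F'-step r') y x (+-flip {x} h))
      fl : ∀ a b → ind² a b y x ≡ ind² b a x y
      fl a b = *-comm (ind a y) (ind b x)
      one' : A + (w + v) ≡ N + (v + u)
      one' = subst₂ (λ s t → A + (s + v) ≡ N + (t + u)) (fl (suc c) (suc d)) (fl (suc c) d) one
      two' : B + (w + z) ≡ N + (z + u)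
      two' = subst₂ (λ s t → B + (w + s) ≡ N + (z + t)) (fl c (suc d)) (fl c d) two
      l3 : ∀ a b c d → a + (b + (c + d)) ≡ (a + (b + c)) + d
      l3 = solve-∀
      l4 : ∀ a b c d → (a + (b + c)) + d ≡ (a + (d + c)) + b
      l4 = solve-∀
      l5 : ∀ a b c d → (a + (b + c)) + d ≡ a + (b + (d + c))
      l5 = solve-∀

-- Weights, equal indices, and the Kashiwara-Saito number

module Weights where
  open import Data.Nat
  open import Data.Nat.Properties
  open import Data.Nat.Tactic.RingSolver using (solve-∀)
  open Brackets
  open OverlappingBrackets
  open BracketCorners
  open Triangles

  cnt : ℕ → ℕ → Mat → ℕ
  cnt a b n = Σ< a (λ x → Σ< b (n x))

  lt : ℕ → ℕ → ℕ
  lt X a = Σ< a (ind X)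

  cnt-ind : ∀ a b X c → cnt a b (ind² X c) ≡ lt X a * lt c b
  cnt-ind a b X c = trans (Σ<-cong a λ x _ → Σ<-*ˡ b (ind c) (ind X x)) (Σ<-*ʳ a (ind X) (lt c b))

  cnt-ind-T : ∀ a b Y d → cnt a b (T (ind² Y d)) ≡ lt d a * lt Y b
  cnt-ind-T a b Y d = trans (Σ<-cong a λ x _ → Σ<-*ʳ b (ind Y) (ind d x))
    (trans (Σ<-*ˡ a (ind d) (lt Y b)) (*-comm (lt Y b) (lt d a)))

  cnt-eq : ∀ a b {m n e e' : Mat} → (∀ x y → x < a → y < b → m x y + e x y ≡ n x y + e' x y) →
           cnt a b m + cnt a b e ≡ cnt a b n + cnt a b e'
  cnt-eq a b {m} {n} {e} {e'} h = trans (sym (pt m e)) (trans (Σ<-cong a λ x u → Σ<-cong b λ y v → h x y u v) (pt n e'))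
    where
    pt : ∀ (m e : Mat) → Σ< a (λ x → Σ< b (λ y → m x y + e x y)) ≡ cnt a b m + cnt a b e
    pt m e = trans (Σ<-cong a λ x _ → Σ<-+ b (m x) (e x)) (Σ<-+ a (λ x → Σ< b (m x)) (λ x → Σ< b (e x)))

  module Triangle2 (R : ℕ) where
    open Triangle R public

    position-≤ : ∀ c n → position c n ≤ R ∸ c
    position-≤ c n = Pos-≤ (raw (posC c n))

    epsC' : ℕ → Mat → ℕ
    epsC' d n = epsC d (T n)

    module Near {c d : ℕ} (cd : c + d < R) (n : Mat) where
      private
        X = position c n
        Y = position d (T n)
        I₁ = interaction {n = n} {F' d n} cd (posC d (T n)) (F'-step (posC d (T n)))
        I₂ = interaction {d} {c} {n = T n} {T (F c n)} (subst (_< R) (+-comm c d) cd) (posC c n) (F-step (posC c n))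

      near-eps : epsC c (F' d n) ≡ epsC c n
      near-eps = sym (same-eps I₁)

      near-eps' : epsC' d (F c n) ≡ epsC' d n
      near-eps' = sym (same-eps I₂)

      near-comm : F c (F' d n) ≈ F' d (F c n)
      near-comm with X ≟ suc d | Y ≟ suc c
      ... | yes eX | yes eY = commute-swap pX (swap I₁ eY pX) pY (swap I₂ eX pY)
        where
        pX = subst (PosC c n) eX (posC c n)
        pY = subst (PosC d (T n)) eY (posC d (T n))
      ... | no ne | _ = commute-keep (posC c n) (keep I₁ (posC c n) (ne ∘ proj₁)) (posC d (T n)) (keep I₂ (posC d (T n)) (ne ∘ proj₂))
      ... | yes _ | no ne = commute-keep (posC c n) (keep I₁ (posC c n) (ne ∘ proj₂)) (posC d (T n)) (keep I₂ (posC d (T n)) (ne ∘ proj₁))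

    module Far {c d : ℕ} (c≤R : c ≤ R) (d≤R : d ≤ R) (cd : R < c + d) (n : Mat) where
      private
        Y<c : position d (T n) < c
        Y<c = ≤-<-trans (position-≤ d (T n)) (+-cancelʳ-< d _ _ (subst (_< c + d) (sym (m∸n+n≡m d≤R)) cd))
        X<d : position c n < d
        X<d = ≤-<-trans (position-≤ c n) (+-cancelʳ-< c _ _ (subst₂ _<_ (sym (m∸n+n≡m c≤R)) (+-comm c d) cd))
        A₁ = untouched {n = n} {F' d n} c≤R (<⇒≢ Y<c) (<⇒≢ (m<n⇒m<1+n Y<c)) (F'-step (posC d (T n)))
        A₂ = untouched {d} {c} {n = T n} {T (F c n)} d≤R (<⇒≢ X<d) (<⇒≢ (m<n⇒m<1+n X<d)) (F-step (posC c n))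

      far-eps : epsC c (F' d n) ≡ epsC c n
      far-eps = sym (epsC-agree A₁)

      far-eps' : epsC' d (F c n) ≡ epsC' d n
      far-eps' = sym (epsC-agree A₂)

      far-comm : F c (F' d n) ≈ F' d (F c n)
      far-comm = commute-keep (posC c n) (mk (Pos-cong A₁ (raw (posC c n)))) (posC d (T n)) (mk (Pos-cong A₂ (raw (posC d (T n)))))

    pl : ℕ → Mat → ℕ
    pl c n = pend (R ∸ c) (Q n c) (P n c)

    -- The case of equal indices, d + c = R. The cell (d , c) counts the simple segments; it is the
    -- last block -^{q L} of both words and the only cell they share.
    module Corner {c d : ℕ} (c≤R : c ≤ R) (ec : R ∸ c ≡ d) (ed : R ∸ d ≡ c) (n : Mat) where
      private
        y = n d c
        dc : d + c ≡ R
        dc = trans (cong (_+ c) (sym ec)) (m∸n+n≡m c≤R)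
        d≤R = ≤-trans (m≤m+n d c) (≤-reflexive dc)

      corner-pos : pl c n ≤ y → PosC c n d
      corner-pos h = mk (subst (Pos (R ∸ c) (Q n c) (P n c)) ec
        (Pos-corner (R ∸ c) (Q n c) (P n c) (subst (λ z → pl c n ≤ n z c) (sym ec) h)))

      corner-pos' : pl d (T n) ≤ y → PosR d n c
      corner-pos' h = mk (subst (Pos (R ∸ d) (Q (T n) d) (P (T n) d)) ed
        (Pos-corner (R ∸ d) (Q (T n) d) (P (T n) d) (subst (λ z → pl d (T n) ≤ n d z) (sym ed) h)))

      private
        inner' : ∀ {Y} → y < pl d (T n) → PosR d n Y → Y < c
        inner' {Y} h p = subst (Y <_) ed (proj₂ (Pos-inner ((λ _ _ → refl) , (λ _ _ → refl)) h' h' (raw p)))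
          where h' = subst (λ z → n d z < pl d (T n)) (sym ed) h

        calm : ∀ {Y m} → Y < c → StepR Y d n m → Agree (R ∸ c) (Q n c) (P n c) (Q m c) (P m c)
        calm {m = m} h S = untouched {n = n} {m} c≤R (<⇒≢ h) (<⇒≢ (m<n⇒m<1+n h)) S

      -- In both words the first surviving + belongs to +^∞, so both operators create the same
      -- simple segment.
      kappa-zero : pl c n ≤ y → pl d (T n) ≤ y → F c n ≈ F' d n
      kappa-zero h h' = pw λ x z k → begin
        F c n x z                                ≡⟨ sym (+-identityʳ _) ⟩
        F c n x z + 0                            ≡⟨ cong (F c n x z +_) (sym (out d c x z k (≤-reflexive (sym dc)))) ⟩
        F c n x z + ind² d (suc c) x z           ≡⟨ eqn (F-step (corner-pos h)) x z k ⟩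
        n x z + ind² d c x z                     ≡⟨ cong (n x z +_) (*-comm (ind d x) (ind c z)) ⟩
        n x z + ind² c d z x                     ≡⟨ sym (eqn (F'-step (corner-pos' h')) z x (+-flip {x} k)) ⟩
        F' d n x z + ind² c (suc d) z x          ≡⟨ cong (F' d n x z +_) (out c d z x (+-flip {x} k) (≤-reflexive (sym (trans (+-comm c d) dc)))) ⟩
        F' d n x z + 0                           ≡⟨ +-identityʳ _ ⟩
        F' d n x z ∎
        where
        open ≡-Reasoning
        out : ∀ d c x z → x + z ≤ R → R ≤ d + c → ind² d (suc c) x z ≡ 0
        out d c x z k g with d ≟ x | suc c ≟ z
        ... | no ne    | _        = ind²-0ˡ {d} {suc c} {x} {z} ne
        ... | yes _    | no ne    = ind²-0ʳ {d} {suc c} {x} {z} ne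
        ... | yes refl | yes refl = ⊥-elim (<⇒≱ (s≤s g) (subst (_≤ R) (+-suc d c) k))

      module AtCorner (h : pl d (T n) ≤ y) where
        private
          S = F'-step (corner-pos' h)
          m = F' d n
          in-L : ∀ {x} → x < R ∸ c → x ≢ d × x ≢ suc d
          in-L {x} k = <⇒≢ (subst (x <_) ec k) , <⇒≢ (m<n⇒m<1+n (subst (x <_) ec k))

        corner-inner : Inner (R ∸ c) (Q n c) (P n c) (Q m c) (P m c)
        corner-inner = (λ x k → step-off {n = T n} {T m} S (+-flip {x} (in-col c≤R (<⇒≤ k))) (inj₂ (in-L k)))
                     , (λ x k → step-off {n = T n} {T m} S (+-flip {x} (in-col⁺ k)) (inj₂ (in-L k)))

        corner-inc : m d c ≡ suc y
        corner-inc = step-inc {n = T n} {T m} S (≤-reflexive (trans (+-comm c d) dc))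

      -- If the row operator acts away from the corner, the column word does not change. If it acts
      -- there, the additional - cancels one of the + that are pending in the column word.
      kappa-eps : y < pl c n ⊎ y < pl d (T n) → epsC c (F' d n) ≡ epsC c n
      kappa-eps k with pl d (T n) ≤? y
      ... | no h = sym (epsC-agree (calm (inner' (≰⇒> h) (posC d (T n))) (F'-step (posC d (T n)))))
      kappa-eps (inj₂ k) | yes h = ⊥-elim (<⇒≱ k h)
      kappa-eps (inj₁ k) | yes h = eps-def (begin
        eps L (Q m c) (P m c)                    ≡⟨ eps-corner L (Q m c) (P m c) ⟩
        surv L (Q m c) (P m c) + (m L c ∸ pl c m) ≡⟨ cong₂ (λ s t → s + (m L c ∸ t)) (sym (surv-cong L corner-inner)) (sym (pend-cong L corner-inner)) ⟩
        surv L (Q n c) (P n c) + (m L c ∸ pl c n) ≡⟨ cong (surv L (Q n c) (P n c) +_) (trans (m≤n⇒m∸n≡0 a) (sym (m≤n⇒m∸n≡0 b))) ⟩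
        surv L (Q n c) (P n c) + (n L c ∸ pl c n) ≡⟨ sym (eps-corner L (Q n c) (P n c)) ⟩
        eps L (Q n c) (P n c) ∎)
        where
        open ≡-Reasoning
        open AtCorner h
        L = R ∸ c
        m = F' d n
        a : m L c ≤ pl c n
        a = subst (λ z → m z c ≤ pl c n) (sym ec) (subst (_≤ pl c n) (sym corner-inc) k)
        b : n L c ≤ pl c n
        b = subst (λ z → n z c ≤ pl c n) (sym ec) (<⇒≤ k)

      -- One pending + more than in `kappa-eps`: the additional - uses up one of them, and another
      -- has to remain for the position to stay inside.
      kappa-pos : suc y < pl c n ⊎ y < pl d (T n) → PosC c (F' d n) (position c n)
      kappa-pos k with pl d (T n) ≤? y
      ... | no h = mk (Pos-cong (calm (inner' (≰⇒> h) (posC d (T n))) (F'-step (posC d (T n)))) (raw (posC c n)))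
      kappa-pos (inj₂ k) | yes h = ⊥-elim (<⇒≱ k h)
      kappa-pos (inj₁ k) | yes h = mk (proj₁ (Pos-inner corner-inner
          (subst (λ z → n z c < pl c n) (sym ec) (<⇒≤ k))
          (subst (λ z → F' d n z c < pl c n) (sym ec) (subst (_< pl c n) (sym corner-inc) k)) (raw (posC c n))))
        where open AtCorner h

    -- The coefficient of α_k in - wt.
    W : ℕ → Mat → ℕ
    W k n = cnt k (suc (suc R) ∸ k) n

    private
      fits : ∀ {k x z} → x < k → z < suc (suc R) ∸ k → x + z ≤ R
      fits {k} {x} {z} h h' = s≤s⁻¹ (s≤s⁻¹ (begin
        suc (suc (x + z)) ≡⟨ cong suc (sym (+-suc x z)) ⟩
        suc x + suc z     ≤⟨ +-mono-≤ h h' ⟩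
        k + (suc (suc R) ∸ k) ≡⟨ m+[n∸m]≡n {k} (<⇒≤ (m∸n≢0⇒n<m {suc (suc R)} {k} λ e → <⇒≱ h' (subst (_≤ z) (sym e) z≤n))) ⟩
        suc (suc R) ∎))
        where open ≤-Reasoning

      -- A step changes the count of `W k` only if a side of the rectangle separates c from c + 1
      -- or, for row steps, d from d + 1. Both happen exactly at k = d + 1.
      rect : ∀ {c d k} → d + c ≡ R → k ≢ suc d → (k ≤ d × suc c < suc (suc R) ∸ k) ⊎ (suc d < k × suc (suc R) ∸ k ≤ c)
      rect {c} {d} {k} e ne with <-cmp k (suc d)
      ... | tri≈ _ q _ = ⊥-elim (ne q)
      ... | tri< q _ _ = inj₁ (s≤s⁻¹ q , m+n≤o⇒m≤o∸n (suc (suc c))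
                            (subst (suc (suc c) + k ≤_) (cong (λ z → suc (suc z)) (trans (+-comm c d) e)) (+-monoʳ-≤ (suc (suc c)) (s≤s⁻¹ q))))
      ... | tri> _ _ q = inj₂ (q , subst (suc (suc R) ∸ k ≤_) (trans (cong (_∸ d) (trans (sym e) (+-comm d c))) (m+n∸n≡m c d))
                            (∸-monoʳ-≤ (suc (suc R)) q))

      side : ∀ {c d} → d + c ≡ R → suc (suc R) ∸ suc d ≡ suc c
      side {c} {d} e = trans (cong (λ z → suc z ∸ d) (trans (sym e) (+-comm d c))) (trans (cong (_∸ d) refl) (m+n∸n≡m (suc c) d))

    W-F : ∀ {c d n} k → c ≤ R → d + c ≡ R → W k (F c n) ≡ W k n + ind (suc d) k
    W-F {c} {d} {n} k c≤R e = final (k ≟ suc d)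
      where
      X = position c n
      S = F-step (posC c n)
      b = suc (suc R) ∸ k
      X≤d : X ≤ d
      X≤d = subst (X ≤_) (trans (cong (_∸ c) (sym e)) (m+n∸n≡m d c)) (position-≤ c n)
      main : W k (F c n) + lt X k * lt (suc c) b ≡ W k n + lt X k * lt c b
      main = subst₂ (λ s t → W k (F c n) + s ≡ W k n + t) (cnt-ind k b X (suc c)) (cnt-ind k b X c)
               (cnt-eq k b (λ x z u v → eqn S x z (fits u v)))
      final : Dec (k ≡ suc d) → W k (F c n) ≡ W k n + ind (suc d) k
      final (yes refl) = trans (sym (+-identityʳ _)) (trans (cong (W k (F c n) +_) (sym z0)) (trans main (cong (W k n +_) (trans z1 (sym (ind-refl d))))))
        where
        z0 : lt X k * lt (suc c) b ≡ 0
        z0 = trans (cong (lt X k *_) (Σ<-ind-≥ b (suc c) (≤-reflexive (side e)))) (*-zeroʳ (lt X k))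
        z1 : lt X k * lt c b ≡ 1
        z1 = cong₂ _*_ (Σ<-ind-< k X (s≤s X≤d)) (Σ<-ind-< b c (subst (c <_) (sym (side e)) ≤-refl))
      final (no ne) = trans (+-cancelʳ-≡ (lt X k * lt c b) _ _ (trans (cong (λ t → W k (F c n) + lt X k * t) (sym eq)) main))
                        (trans (sym (+-identityʳ _)) (cong (W k n +_) (sym (ind-≢ (ne ∘ sym)))))
        where
        eq : lt (suc c) b ≡ lt c b
        eq with rect e ne
        ... | inj₁ (_ , h) = trans (Σ<-ind-< b (suc c) h) (sym (Σ<-ind-< b c (<⇒≤ h)))
        ... | inj₂ (_ , h) = trans (Σ<-ind-≥ b (suc c) (≤-trans h (n≤1+n c))) (sym (Σ<-ind-≥ b c h))

    W-F' : ∀ {c d n} k → d ≤ R → d + c ≡ R → W k (F' d n) ≡ W k n + ind (suc d) k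
    W-F' {c} {d} {n} k d≤R e = final (k ≟ suc d)
      where
      Y = position d (T n)
      S = F'-step (posC d (T n))
      b = suc (suc R) ∸ k
      Y≤c : Y ≤ c
      Y≤c = subst (Y ≤_) (trans (cong (_∸ d) (trans (sym e) (+-comm d c))) (m+n∸n≡m c d)) (position-≤ d (T n))
      main : W k (F' d n) + lt (suc d) k * lt Y b ≡ W k n + lt d k * lt Y b
      main = subst₂ (λ s t → W k (F' d n) + s ≡ W k n + t) (cnt-ind-T k b Y (suc d)) (cnt-ind-T k b Y d)
               (cnt-eq k b (λ x z u v → eqn S z x (+-flip {x} (fits u v))))
      final : Dec (k ≡ suc d) → W k (F' d n) ≡ W k n + ind (suc d) k
      final (yes refl) = trans (sym (+-identityʳ _)) (trans (cong (W k (F' d n) +_) (sym z0)) (trans main (cong (W k n +_) (trans z1 (sym (ind-refl d))))))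
        where
        z0 : lt (suc d) k * lt Y b ≡ 0
        z0 = cong (_* lt Y b) (Σ<-ind-≥ k (suc d) ≤-refl)
        z1 : lt d k * lt Y b ≡ 1
        z1 = cong₂ _*_ (Σ<-ind-< k d ≤-refl) (Σ<-ind-< b Y (subst (Y <_) (sym (side e)) (s≤s Y≤c)))
      final (no ne) = trans (+-cancelʳ-≡ (lt d k * lt Y b) _ _ (trans (cong (λ t → W k (F' d n) + t * lt Y b) (sym eq)) main))
                        (trans (sym (+-identityʳ _)) (cong (W k n +_) (sym (ind-≢ (ne ∘ sym)))))
        where
        eq : lt (suc d) k ≡ lt d k
        eq with rect e ne
        ... | inj₁ (h , _) = trans (Σ<-ind-≥ k (suc d) (≤-trans h (n≤1+n d))) (sym (Σ<-ind-≥ k d h))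
        ... | inj₂ (h , _) = trans (Σ<-ind-< k (suc d) h) (sym (Σ<-ind-< k d (<⇒≤ h)))

    W-cong : ∀ k {n m} → n ≈ m → W k n ≡ W k m
    W-cong k e = Σ<-cong k λ x h → Σ<-cong _ λ y h' → on e x y (fits h h')

    -- κ = ε + ε' + ⟨h , wt⟩ with negative terms moved across. The rectangles of `W d`, `W (d + 1)`
    -- and `W (d + 2)` exceed their common part `U` by partial row and column sums, and `balance`
    -- trades these for surviving and pending letters.
    kappa-eq : ∀ {c d} n → d + c ≡ R →
               ((pl c n ∸ n d c) + (pl d (T n) ∸ n d c)) + (W (suc d) n + W (suc d) n) ≡
               (epsC c n + epsC' d n) + (W d n + W (suc (suc d)) n)
    kappa-eq {c} {d} n e = begin
      ((l ∸ y) + (l' ∸ y)) + (W (suc d) n + W (suc d) n)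
        ≡⟨ cong (λ t → ((l ∸ y) + (l' ∸ y)) + (t + t)) W1 ⟩
      ((l ∸ y) + (l' ∸ y)) + ((U + q + (q' + y)) + (U + q + (q' + y)))
        ≡⟨ r1 (l ∸ y) (l' ∸ y) U q q' y ⟩
      (y + (l ∸ y)) + (y + (l' ∸ y)) + ((U + U) + (q + q + (q' + q')))
        ≡⟨ cong₂ (λ s t → s + t + ((U + U) + (q + q + (q' + q')))) (m+[n∸m]-comm y l) (m+[n∸m]-comm y l') ⟩
      (l + (y ∸ l)) + (l' + (y ∸ l')) + ((U + U) + (q + q + (q' + q')))
        ≡⟨ r2 l (y ∸ l) l' (y ∸ l') (U + U) q q' ⟩
      ((l + q) + (l' + q')) + (((y ∸ l) + (y ∸ l')) + ((U + U) + (q + q')))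
        ≡⟨ cong₂ (λ s t → (s + t) + (((y ∸ l) + (y ∸ l')) + ((U + U) + (q + q')))) (sym b1) (sym b2) ⟩
      ((a + p) + (a' + p')) + (((y ∸ l) + (y ∸ l')) + ((U + U) + (q + q')))
        ≡⟨ r3 a p a' p' (y ∸ l) (y ∸ l') U q q' ⟩
      ((a + (y ∸ l)) + (a' + (y ∸ l'))) + ((U + q + p) + (U + q' + p'))
        ≡⟨ cong₂ _+_ (cong₂ _+_ (sym E1) (sym E2)) (cong₂ _+_ (sym W0) (sym W2)) ⟩
      (epsC c n + epsC' d n) + (W d n + W (suc (suc d)) n) ∎
      where
      open ≡-Reasoning
      ec : R ∸ c ≡ d
      ec = trans (cong (_∸ c) (sym e)) (m+n∸n≡m d c)
      ed : R ∸ d ≡ c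
      ed = trans (cong (_∸ d) (trans (sym e) (+-comm d c))) (m+n∸n≡m c d)
      y = n d c
      l = pl c n
      l' = pl d (T n)
      U = cnt d c n
      q = Σ< d (Q n c)
      p = Σ< d (P n c)
      q' = Σ< c (n d)
      p' = Σ< c (n (suc d))
      a = surv (R ∸ c) (Q n c) (P n c)
      a' = surv (R ∸ d) (Q (T n) d) (P (T n) d)
      b1 : a + p ≡ l + q
      b1 = subst (λ z → a + Σ< z (P n c) ≡ l + Σ< z (Q n c)) ec (balance (R ∸ c) (Q n c) (P n c))
      b2 : a' + p' ≡ l' + q'
      b2 = subst (λ z → a' + Σ< z (P (T n) d) ≡ l' + Σ< z (Q (T n) d)) ed (balance (R ∸ d) (Q (T n) d) (P (T n) d))
      E1 : epsC c n ≡ a + (y ∸ l)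
      E1 = trans (epsC-def c n) (trans (eps-corner (R ∸ c) (Q n c) (P n c)) (cong (λ z → a + (n z c ∸ l)) ec))
      E2 : epsC' d n ≡ a' + (y ∸ l')
      E2 = trans (epsC-def d (T n)) (trans (eps-corner (R ∸ d) (Q (T n) d) (P (T n) d)) (cong (λ z → a' + (n d z ∸ l')) ed))
      split1 : cnt d (suc c) n ≡ U + q
      split1 = Σ<-+ d (λ x → Σ< c (n x)) (Q n c)
      W1 : W (suc d) n ≡ U + q + (q' + y)
      W1 = trans (cong (λ z → cnt (suc d) z n) (side e)) (cong (_+ (q' + y)) split1)
      W0 : W d n ≡ U + q + p
      W0 = trans (cong (λ z → cnt d z n) (trans (+-∸-assoc 2 (subst (d ≤_) e (m≤m+n d c))) (cong (λ z → suc (suc z)) ed)))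
             (trans (Σ<-+ d (λ x → Σ< (suc c) (n x)) (P n c)) (cong (_+ p) split1))
      W2 : W (suc (suc d)) n ≡ U + q' + p'
      W2 = cong (λ z → cnt (suc (suc d)) z n) ed
      r1 : ∀ s t U q q' y → (s + t) + ((U + q + (q' + y)) + (U + q + (q' + y))) ≡ (y + s) + (y + t) + ((U + U) + (q + q + (q' + q')))
      r1 = solve-∀
      r2 : ∀ l s l' t V q q' → (l + s) + (l' + t) + (V + (q + q + (q' + q'))) ≡ ((l + q) + (l' + q')) + ((s + t) + (V + (q + q')))
      r2 = solve-∀
      r3 : ∀ a p a' p' s t U q q' → ((a + p) + (a' + p')) + ((s + t) + ((U + U) + (q + q'))) ≡ ((a + s) + (a' + t)) + ((U + q + p) + (U + q' + p'))
      r3 = solve-∀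

  -- The first block bounds `eps` from below, so row 0 is empty. Then it matches nothing, and the
  -- remaining rows again have no surviving -.
  extremal-zero : ∀ R n → (∀ c → c ≤ R → eps (R ∸ c) (Q n c) (P n c) ≡ 0) → ∀ x y → x + y ≤ R → n x y ≡ 0
  extremal-zero R n h zero y k = n≤0⇒n≡0 (subst (n 0 y ≤_) (h y k) (q≤eps (R ∸ y) (Q n y) (P n y)))
  extremal-zero (suc R) n h (suc x) y (s≤s k) = extremal-zero R (λ x → n (suc x)) h' x y k
    where
    h' : ∀ c → c ≤ R → eps (R ∸ c) (Q (λ x → n (suc x)) c) (P (λ x → n (suc x)) c) ≡ 0
    h' c le with h c (≤-trans le (n≤1+n R))
    ... | z rewrite +-∸-assoc 1 le | extremal-zero (suc R) n h 0 (suc c) (s≤s le) = m+n≡0⇒n≡0 (n 0 c) z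

-- Abstract crystals and the Kashiwara-Saito axioms for a pair of them

module DoubleCrystal where
  open import Data.Nat
  open import Data.Nat.Properties
  open Brackets
  open BracketCorners
  open Triangles
  open Weights

  𝟎 : Mat
  𝟎 x y = 0

  module Bicrystals (R : ℕ) where
    open Triangle2 R public

    -- The index i stands for the simple root α_{i+1}.
    record Crystal : Set where
      field
        ε   : ℕ → Mat → ℕ
        f e : ℕ → Mat → Mat
        ε-cong : ∀ {i n m} → i ≤ R → n ≈ m → ε i n ≡ ε i m
        f-cong : ∀ {i n m} → i ≤ R → n ≈ m → f i n ≈ f i m
        e-cong : ∀ {i n m} → i ≤ R → 0 < ε i n → n ≈ m → e i n ≈ e i m
        ε-f : ∀ {i n} → i ≤ R → ε i (f i n) ≡ suc (ε i n)
        e-f : ∀ {i n} → i ≤ R → e i (f i n) ≈ n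
        f-e : ∀ {i n} → i ≤ R → 0 < ε i n → f i (e i n) ≈ n
        W-f : ∀ {i n} k → i ≤ R → W k (f i n) ≡ W k n + ind (suc i) k
        ε-𝟎 : ∀ {i} → i ≤ R → ε i 𝟎 ≡ 0
        extremal : ∀ {n} → (∀ i → i ≤ R → ε i n ≡ 0) → n ≈ 𝟎

    -- The Kashiwara-Saito criterion for `f` and `f'` in the roles of f and f^⋆, with `κ` for ε +
    -- ε^⋆ + ⟨h , wt⟩. Since `W` measures - wt, `κ-eq` has 2W on the side of κ.
    record Compatible (C C' : Crystal) : Set where
      open Crystal C
      open Crystal C' using () renaming (ε to ε'; f to f')
      field
        comm    : ∀ {i j n} → i ≤ R → j ≤ R → i ≢ j → f i (f' j n) ≈ f' j (f i n)
        ε-comm  : ∀ {i j n} → i ≤ R → j ≤ R → i ≢ j → ε i (f' j n) ≡ ε i n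
        ε'-comm : ∀ {i j n} → i ≤ R → j ≤ R → i ≢ j → ε' i (f j n) ≡ ε' i n
        κ       : ℕ → Mat → ℕ
        κ-eq    : ∀ {i n} → i ≤ R → κ i n + (W (suc i) n + W (suc i) n) ≡ (ε i n + ε' i n) + (W i n + W (suc (suc i)) n)
        κ-zero  : ∀ {i n} → i ≤ R → κ i n ≡ 0 → f i n ≈ f' i n
        κ-one   : ∀ {i n} → i ≤ R → 0 < κ i n → ε i (f' i n) ≡ ε i n
        κ-one'  : ∀ {i n} → i ≤ R → 0 < κ i n → ε' i (f i n) ≡ ε' i n
        κ-two   : ∀ {i n} → i ≤ R → 1 < κ i n → f i (f' i n) ≈ f' i (f i n)

    flipC : ∀ {C C'} → Compatible C C' → Compatible C' C
    flipC {C} {C'} K = record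
      { comm = λ h k ne → ≈-sym (comm k h (ne ∘ sym)) ; ε-comm = ε'-comm ; ε'-comm = ε-comm
      ; κ = κ
      ; κ-eq = λ {i} {n} h → trans (κ-eq h) (cong (_+ (W i n + W (suc (suc i)) n)) (+-comm (Crystal.ε C i n) (Crystal.ε C' i n)))
      ; κ-zero = λ h z → ≈-sym (κ-zero h z)
      ; κ-one = κ-one' ; κ-one' = κ-one ; κ-two = λ h z → ≈-sym (κ-two h z) }
      where open Compatible K

    eps-𝟎 : ∀ L {q p} → (∀ x → q x ≡ 0) → eps L q p ≡ 0
    eps-𝟎 zero    h = h 0
    eps-𝟎 (suc L) {q} {p} h = cong₂ _+_ (h 0) (trans (cong (_∸ p 0) (eps-𝟎 L (λ x → h (suc x)))) (0∸n≡0 (p 0)))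

    epsC-𝟎 : ∀ c → epsC c 𝟎 ≡ 0
    epsC-𝟎 c = trans (epsC-def c 𝟎) (eps-𝟎 (R ∸ c) (λ _ → refl))

    epsC-extremal : ∀ {n} → (∀ c → c ≤ R → epsC c n ≡ 0) → n ≈ 𝟎
    epsC-extremal {n} h = pw (extremal-zero R n (λ c k → trans (sym (epsC-def c n)) (h c k)))

    -- Column c belongs to the root α_{R+1-c} and row d to α_{d+1}; hence the index `R ∸ i` for the
    -- former and `i` for the latter.
    ends starts : Crystal
    ends = record
      { ε = λ i → epsC (R ∸ i) ; f = λ i → F (R ∸ i) ; e = λ i → G (R ∸ i)
      ; ε-cong = λ {i} _ → epsC-cong (m∸n≤m R i) ; f-cong = λ {i} _ → F-cong (m∸n≤m R i)
      ; e-cong = λ {i} _ → G-cong (m∸n≤m R i) ; ε-f = λ {i} _ → epsC-F (m∸n≤m R i)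
      ; e-f = λ {i} _ → G-F (m∸n≤m R i) ; f-e = λ {i} _ → F-G (m∸n≤m R i)
      ; W-f = λ {i} {n} k h → W-F {R ∸ i} {i} {n} k (m∸n≤m R i) (m+[n∸m]≡n h)
      ; ε-𝟎 = λ {i} _ → epsC-𝟎 (R ∸ i)
      ; extremal = λ {n} h → epsC-extremal (λ c k → subst (λ z → epsC z n ≡ 0) (m∸[m∸n]≡n k) (h (R ∸ c) (m∸n≤m R c))) }
    starts = record
      { ε = λ i n → epsC i (T n) ; f = F' ; e = λ i n → T (G i (T n))
      ; ε-cong = λ h e → epsC-cong h (T-cong e) ; f-cong = λ h e → T-cong (F-cong h (T-cong e))
      ; e-cong = λ h k e → T-cong (G-cong h k (T-cong e)) ; ε-f = λ h → epsC-F h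
      ; e-f = λ {i} {n} h → T-cong (G-F {i} {T n} h) ; f-e = λ {i} {n} h k → T-cong (F-G {i} {T n} h k)
      ; W-f = λ {i} {n} k h → W-F' {R ∸ i} {i} {n} k h (m+[n∸m]≡n h)
      ; ε-𝟎 = λ {i} _ → epsC-𝟎 i
      ; extremal = λ h → T-cong (epsC-extremal h) }

    private
      module E = Crystal ends
      module S = Crystal starts

      near? : ∀ {i j} → i ≤ R → j ≤ R → i ≢ j → ((R ∸ i) + j < R) ⊎ (R < (R ∸ i) + j)
      near? {i} {j} h k ne with <-cmp i j
      ... | tri< a _ _ = inj₂ (subst (_< (R ∸ i) + j) (m∸n+n≡m h) (+-monoʳ-< (R ∸ i) a))
      ... | tri≈ _ b _ = ⊥-elim (ne b)
      ... | tri> _ _ a = inj₁ (subst ((R ∸ i) + j <_) (m∸n+n≡m h) (+-monoʳ-< (R ∸ i) a))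

      both : ∀ {i j} n → i ≤ R → j ≤ R → i ≢ j →
             E.f i (S.f j n) ≈ S.f j (E.f i n) × E.ε i (S.f j n) ≡ E.ε i n × S.ε j (E.f i n) ≡ S.ε j n
      both {i} {j} n h k ne with near? h k ne
      ... | inj₁ a = near-comm , near-eps , near-eps'
        where open Near {R ∸ i} {j} a n
      ... | inj₂ a = far-comm , far-eps , far-eps'
        where open Far {R ∸ i} {j} (m∸n≤m R i) k a n

      κ' : ℕ → Mat → ℕ
      κ' i n = (pl (R ∸ i) n ∸ n i (R ∸ i)) + (pl i (T n) ∸ n i (R ∸ i))

      pos-sum : ∀ a b c → 0 < (a ∸ c) + (b ∸ c) → c < a ⊎ c < b
      pos-sum a b c h with c <? a
      ... | yes k = inj₁ k
      ... | no  k = inj₂ (m∸n≢0⇒n<m λ e → <-irrefl refl (subst (0 <_) (cong₂ _+_ (m≤n⇒m∸n≡0 (≮⇒≥ k)) e) h))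

      two-sum : ∀ a b c → 1 < (a ∸ c) + (b ∸ c) → (suc c < a ⊎ c < b) × (suc c < b ⊎ c < a)
      two-sum a b c h = one a b h , one b a (subst (1 <_) (+-comm (a ∸ c) (b ∸ c)) h)
        where
        one : ∀ a b → 1 < (a ∸ c) + (b ∸ c) → suc c < a ⊎ c < b
        one a b h with c <? b
        ... | yes k = inj₂ k
        ... | no  k = inj₁ (m<n∸o⇒m+o<n' a (subst (1 <_) (trans (cong ((a ∸ c) +_) (m≤n⇒m∸n≡0 (≮⇒≥ k))) (+-identityʳ _)) h))
          where
          m<n∸o⇒m+o<n' : ∀ a → 1 < a ∸ c → suc c < a
          m<n∸o⇒m+o<n' a u = m≤o∸n⇒m+n≤o 2 (<⇒≤ (m∸n≢0⇒n<m {a} {c} λ e → <-irrefl refl (<-trans z<s (subst (1 <_) e u)))) u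

    compatible : Compatible ends starts
    compatible = record
      { comm = λ {i} {j} {n} h k ne → proj₁ (both n h k ne)
      ; ε-comm = λ {i} {j} {n} h k ne → proj₁ (proj₂ (both n h k ne))
      ; ε'-comm = λ {i} {j} {n} h k ne → proj₂ (proj₂ (both n k h (ne ∘ sym)))
      ; κ = κ'
      ; κ-eq = λ {i} {n} h → kappa-eq n (m+[n∸m]≡n h)
      ; κ-zero = λ {i} {n} h z → Corner.kappa-zero (m∸n≤m R i) (m∸[m∸n]≡n h) refl n
                   (m∸n≡0⇒m≤n (m+n≡0⇒m≡0 _ z)) (m∸n≡0⇒m≤n (m+n≡0⇒n≡0 (pl (R ∸ i) n ∸ n i (R ∸ i)) z))
      ; κ-one = λ {i} {n} h z → Corner.kappa-eps (m∸n≤m R i) (m∸[m∸n]≡n h) refl n (pos-sum _ _ _ z)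
      ; κ-one' = λ {i} {n} h z → Corner.kappa-eps h refl (m∸[m∸n]≡n h) (T n)
                   (pos-sum _ _ _ (subst (0 <_) (+-comm (pl (R ∸ i) n ∸ n i (R ∸ i)) _) z))
      ; κ-two = λ {i} {n} h z → let u , v = two-sum _ _ _ z in
          commute-keep (posC (R ∸ i) n) (Corner.kappa-pos (m∸n≤m R i) (m∸[m∸n]≡n h) refl n u)
                       (posC i (T n)) (Corner.kappa-pos h refl (m∸[m∸n]≡n h) (T n) v) }

    module Powers (C : Crystal) where
      open Crystal C

      pow : ℕ → ℕ → Mat → Mat
      pow zero    i n = n
      pow (suc m) i n = f i (pow m i n)

      lower : ℕ → ℕ → Mat → Mat
      lower zero    i n = n
      lower (suc m) i n = lower m i (e i n)

      top : ℕ → Mat → Mat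
      top i n = lower (ε i n) i n

      pow-cong : ∀ m {i n n'} → i ≤ R → n ≈ n' → pow m i n ≈ pow m i n'
      pow-cong zero    h q = q
      pow-cong (suc m) h q = f-cong h (pow-cong m h q)

      ε-pow : ∀ m {i n} → i ≤ R → ε i (pow m i n) ≡ m + ε i n
      ε-pow zero    h = refl
      ε-pow (suc m) h = trans (ε-f h) (cong suc (ε-pow m h))

      ε-e : ∀ {i n} → i ≤ R → 0 < ε i n → ε i n ≡ suc (ε i (e i n))
      ε-e h k = trans (ε-cong h (≈-sym (f-e h k))) (ε-f h)

      lower-spec : ∀ m {i n} → i ≤ R → m ≤ ε i n → pow m i (lower m i n) ≈ n × ε i n ≡ m + ε i (lower m i n)
      lower-spec zero    h k = ≈-refl , refl
      lower-spec (suc m) {i} {n} h k with lower-spec m {i} {e i n} h (s≤s⁻¹ (subst (suc m ≤_) (ε-e h (≤-trans z<s k)) k))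
      ... | a , b = ≈-trans (f-cong h a) (f-e h (≤-trans z<s k)) , trans (ε-e h (≤-trans z<s k)) (cong suc b)

      lower-pow : ∀ m {i n} → i ≤ R → lower m i (pow m i n) ≈ n
      lower-cong : ∀ m {i n n'} → i ≤ R → m ≤ ε i n → n ≈ n' → lower m i n ≈ lower m i n'
      lower-cong zero    h k q = q
      lower-cong (suc m) {i} {n} h k q =
        lower-cong m h (s≤s⁻¹ (subst (suc m ≤_) (ε-e h (≤-trans z<s k)) k)) (e-cong h (≤-trans z<s k) q)
      lower-pow zero    h = ≈-refl
      lower-pow (suc m) {i} {n} h = ≈-trans
        (lower-cong m h (subst (m ≤_) (sym (trans (ε-cong h (e-f h)) (ε-pow m h))) (m≤m+n m _)) (e-f h)) (lower-pow m h)

      pow-top : ∀ {i n} → i ≤ R → pow (ε i n) i (top i n) ≈ n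
      pow-top h = proj₁ (lower-spec _ h ≤-refl)

      ε-top : ∀ {i n} → i ≤ R → ε i (top i n) ≡ 0
      ε-top {i} {n} h = +-cancelˡ-≡ (ε i n) _ _ (trans (sym (proj₂ (lower-spec (ε i n) h ≤-refl))) (sym (+-identityʳ _)))

      -- A factorisation f^m n₀ with ε n₀ = 0 determines the i-string. The computations of `ε` and
      -- `top` below exhibit such a factorisation.
      top-unique : ∀ {i n n₀} m → i ≤ R → n ≈ pow m i n₀ → ε i n₀ ≡ 0 → ε i n ≡ m × top i n ≈ n₀
      top-unique {i} {n} {n₀} m h q z = em , subst (λ k → lower k i n ≈ n₀) (sym em)
          (≈-trans (lower-cong m h (≤-reflexive (sym em)) q) (lower-pow m h))
        where
        em : ε i n ≡ m
        em = trans (ε-cong h q) (trans (ε-pow m h) (trans (cong (m +_) z) (+-identityʳ m)))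

      top-cong : ∀ {i n n'} → i ≤ R → n ≈ n' → top i n ≈ top i n'
      top-cong {i} {n} {n'} h q = proj₂ (top-unique (ε i n') h (≈-trans q (≈-sym (pow-top h))) (ε-top h))

      top-f : ∀ {i n} → i ≤ R → top i (f i n) ≈ top i n
      top-f {i} {n} h = proj₂ (top-unique (suc (ε i n)) h (f-cong h (≈-sym (pow-top h))) (ε-top h))

      W-pow : ∀ m {i n} k → i ≤ R → W k (pow m i n) ≡ W k n + m * ind (suc i) k
      W-pow zero    k h = sym (+-identityʳ _)
      W-pow (suc m) {i} {n} k h = trans (W-f k h) (trans (cong (_+ ind (suc i) k) (W-pow m k h))
        (trans (+-assoc (W k n) _ _) (cong (W k n +_) (+-comm (m * ind (suc i) k) _))))

      size : Mat → ℕ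
      size n = Σ< (suc (suc R)) (λ k → W k n)

      size-f : ∀ {i n} → i ≤ R → size (f i n) ≡ suc (size n)
      size-f {i} {n} h = trans (Σ<-cong (suc (suc R)) λ k _ → W-f k h)
        (trans (Σ<-+ (suc (suc R)) (λ k → W k n) (ind (suc i))) (trans (cong (size n +_) (Σ<-ind-< (suc (suc R)) (suc i) (s≤s (s≤s h)))) (+-comm _ 1)))

      find : ∀ n → (∃ λ i → i ≤ R × 0 < ε i n) ⊎ n ≈ 𝟎
      find n with search (suc R)
        where
        search : ∀ k → (∃ λ i → i < k × 0 < ε i n) ⊎ (∀ i → i < k → ε i n ≡ 0)
        search zero = inj₂ λ _ ()
        search (suc k) with search k | 0 <? ε k n
        ... | inj₁ (i , a , b) | _ = inj₁ (i , m<n⇒m<1+n a , b)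
        ... | inj₂ _ | yes b = inj₁ (k , ≤-refl , b)
        ... | inj₂ g | no  b = inj₂ λ i a → case-eq i a
          where
          case-eq : ∀ i → i < suc k → ε i n ≡ 0
          case-eq i a with i ≟ k
          ... | yes refl = n≤0⇒n≡0 (≮⇒≥ b)
          ... | no  ne   = g i (≤∧≢⇒< (s≤s⁻¹ a) ne)
      ... | inj₁ (i , a , b) = inj₁ (i , s≤s⁻¹ a , b)
      ... | inj₂ g = inj₂ (extremal λ i a → g i (s≤s a))

      -- Induction on the height: an element other than `𝟎` has some positive ε and so comes from a
      -- lower one.
      generated : (Pr : Mat → Set) → (∀ {n m} → n ≈ m → Pr n → Pr m) → Pr 𝟎 → (∀ {i n} → i ≤ R → Pr n → Pr (f i n)) → ∀ n → Pr n
      generated Pr resp z s n = go (size n) n refl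
        where
        go : ∀ k n → size n ≡ k → Pr n
        go k n q with find n
        ... | inj₂ n≈𝟎 = resp (≈-sym n≈𝟎) z
        go k n q | inj₁ (i , h , p) = step k (trans (sym (size-f h)) (trans (Σ<-cong (suc (suc R)) λ k _ → W-cong k (f-e h p)) q))
          where
          step : ∀ k → suc (size (e i n)) ≡ k → Pr n
          step (suc k) q = resp (f-e h p) (s h (go k (e i n) (suc-injective q)))

-- The tensor product rule as an inductive relation

module TensorProducts where
  open import Defs
  open import Data.Bool using (true; false; T)
  open import Data.Nat as ℕ using (ℕ; zero; suc; _≡ᵇ_)
  import Data.Nat.Properties as ℕP
  open import Data.Integer using (+_; 0ℤ; 1ℤ; -1ℤ; -_; _+_; _-_; _*_; _⊔_; _≤_; _<_; _≤ᵇ_)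
  open import Data.Integer.Properties
  open import Data.Integer.Tactic.RingSolver using (solve-∀)
  open import Data.List using ([]; _∷_)
  open import Data.Maybe using (just; nothing)
  open import Data.Maybe.Properties using (just-injective)
  open import Data.Unit using (tt)

  ≤ᵇ-yes : ∀ {x y} → x ≤ y → (x ≤ᵇ y) ≡ true
  ≤ᵇ-yes {x} {y} h with x ≤ᵇ y | ≤⇒≤ᵇ h
  ... | true | _ = refl

  ≤ᵇ-no : ∀ {x y} → y < x → (x ≤ᵇ y) ≡ false
  ≤ᵇ-no {x} {y} h with x ≤ᵇ y in q
  ... | false = refl
  ... | true  = ⊥-elim (<⇒≱ h (≤ᵇ⇒≤ (subst T (sym q) tt)))

  ≡ᵇ-yes : ∀ i → (i ≡ᵇ i) ≡ true
  ≡ᵇ-yes zero    = refl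
  ≡ᵇ-yes (suc i) = ≡ᵇ-yes i

  ≡ᵇ-no : ∀ {i j} → i ≢ j → (i ≡ᵇ j) ≡ false
  ≡ᵇ-no {i} {j} ne with i ≡ᵇ j in q
  ... | false = refl
  ... | true  = ⊥-elim (ne (ℕP.≡ᵇ⇒≡ i j (subst T (sym q) tt)))

  module _ {i : ℕ} where

    phi1-same : ∀ a → phi1 i (i , a) ≡ just a
    phi1-same a rewrite ≡ᵇ-yes i = refl

    eps1-same : ∀ a → eps1 i (i , a) ≡ just (- a)
    eps1-same a rewrite ≡ᵇ-yes i = refl

    phi1-diff : ∀ {j a} → i ≢ j → phi1 i (j , a) ≡ nothing
    phi1-diff ne rewrite ≡ᵇ-no ne = refl

    eps1-diff : ∀ {j a} → i ≢ j → eps1 i (j , a) ≡ nothing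
    eps1-diff ne rewrite ≡ᵇ-no ne = refl

    hw1-same : ∀ a → hw i ((i , a) ∷ []) ≡ a + a
    hw1-same a rewrite ≡ᵇ-yes i = lem a
      where
      lem : ∀ a → a * + 2 + 0ℤ ≡ a + a
      lem = solve-∀

  hw-cons : ∀ i x y → hw i (x ∷ y) ≡ hw i (x ∷ []) + hw i y
  hw-cons i (j , a) y = cong (_+ hw i y) (sym (+-identityʳ (a * cartan i j)))

  shiftˡ : ∀ {x y} z → x ≤ y → x + z ≤ y + z
  shiftˡ z h = +-monoˡ-≤ z h

  private
    ⊔-doubleˡ : ∀ {a p} → p ≤ - a → a ⊔ (p + (a + a)) ≡ a
    ⊔-doubleˡ {a} {p} h = i≥j⇒i⊔j≡i (subst (p + (a + a) ≤_) (l a) (shiftˡ (a + a) h))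
      where
      l : ∀ a → - a + (a + a) ≡ a
      l = solve-∀

    ⊔-doubleʳ : ∀ {a p} → - a ≤ p → a ⊔ (p + (a + a)) ≡ p + (a + a)
    ⊔-doubleʳ {a} {p} h = i≤j⇒i⊔j≡j (subst (_≤ p + (a + a)) (l a) (shiftˡ (a + a) h))
      where
      l : ∀ a → - a + (a + a) ≡ a
      l = solve-∀

  phi-same : ∀ i a y {p} → phiT i y ≡ just p → phiT i ((i , a) ∷ y) ≡ just (a ⊔ (p + (a + a)))
  phi-same i a y q rewrite q | phi1-same {i} a | hw1-same {i} a = refl

  phi-same∅ : ∀ i a y → phiT i y ≡ nothing → phiT i ((i , a) ∷ y) ≡ just a
  phi-same∅ i a y q rewrite q | phi1-same {i} a = refl

  phi-diff : ∀ {i j} a y {p} → i ≢ j → phiT i y ≡ just p → phiT i ((j , a) ∷ y) ≡ just (p + hw i ((j , a) ∷ []))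
  phi-diff {i} {j} a y ne q rewrite phi1-diff {i} {j} {a} ne | q = refl

  -- The ways in which `fT` can succeed, with the comparison that decides each of them; `first∅` is
  -- the case φ_i = -∞ of the right factor. The same relation, read backwards, describes `eT`.
  data FView (i : ℕ) : State → State → Set where
    first∅ : ∀ a {y} → phiT i y ≡ nothing → FView i ((i , a) ∷ y) ((i , a - 1ℤ) ∷ y)
    first  : ∀ a {y p} → phiT i y ≡ just p → p ≤ - a → FView i ((i , a) ∷ y) ((i , a - 1ℤ) ∷ y)
    later  : ∀ a {y y' p} → phiT i y ≡ just p → - a < p → FView i y y' → FView i ((i , a) ∷ y) ((i , a) ∷ y')
    other  : ∀ {j a y y'} → i ≢ j → FView i y y' → FView i ((j , a) ∷ y) ((j , a) ∷ y')

  view-phi : ∀ {i u v} → FView i u v → ∃ λ p → phiT i u ≡ just p × phiT i v ≡ just (p - 1ℤ)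
  view-phi {i} (first∅ a {y} q) = a , phi-same∅ i a y q , phi-same∅ i (a - 1ℤ) y q
  view-phi {i} (first a {y} {p} q h) =
    a , trans (phi-same i a y q) (cong just (⊔-doubleˡ h))
      , trans (phi-same i (a - 1ℤ) y q) (cong just (⊔-doubleˡ {a - 1ℤ} {p} (≤-trans h (subst (_≤ - (a - 1ℤ)) (+-identityʳ (- a)) (subst (- a + 0ℤ ≤_) (l a) (+-monoʳ-≤ (- a) (_≤_.+≤+ ℕ.z≤n)))))))
    where
    l : ∀ a → - a + 1ℤ ≡ - (a - 1ℤ)
    l = solve-∀
  view-phi {i} (later a {y} {y'} {p} q h V) with view-phi V
  ... | p' , q' , r with just-injective (trans (sym q) q')
  ... | refl = p + (a + a)
             , trans (phi-same i a y q) (cong just (⊔-doubleʳ (<⇒≤ h)))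
             , trans (phi-same i a y' r) (cong just (trans (⊔-doubleʳ {a} {p - 1ℤ} (i<j⇒i≤pred[j]' h)) (l p a)))
    where
    l : ∀ p a → p - 1ℤ + (a + a) ≡ p + (a + a) - 1ℤ
    l = solve-∀
    i<j⇒i≤pred[j]' : ∀ {x y} → x < y → x ≤ y - 1ℤ
    i<j⇒i≤pred[j]' {x} {y} k = subst₂ _≤_ (l2 x) refl (shiftˡ -1ℤ (i<j⇒suc[i]≤j k))
      where
      l2 : ∀ x → 1ℤ + x + -1ℤ ≡ x
      l2 = solve-∀
  view-phi {i} (other {j} {a} {y} {y'} ne V) with view-phi V
  ... | p , q , r = p + hw i ((j , a) ∷ []) , phi-diff a y ne q , trans (phi-diff a y' ne r) (cong just (l p _))
    where
    l : ∀ p h → p - 1ℤ + h ≡ p + h - 1ℤ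
    l = solve-∀

  view-f : ∀ {i u v} → FView i u v → fT i u ≡ just v
  view-f {i} (first∅ a q) rewrite q | ≡ᵇ-yes i = refl
  view-f {i} (first a {p = p} q h) rewrite q | ≡ᵇ-yes i | ≤ᵇ-yes h = refl
  view-f {i} (later a q h V) rewrite q | ≡ᵇ-yes i | ≤ᵇ-no h | view-f V = refl
  view-f {i} (other ne V) with view-phi V
  ... | p , q , _ rewrite q | ≡ᵇ-no ne | view-f V = refl

  f-view : ∀ i u {v} → fT i u ≡ just v → FView i u v
  f-view i ((j , a) ∷ y) q with i ℕ.≟ j
  f-view i ((j , a) ∷ y) q | yes refl with phiT i y in e
  f-view i ((j , a) ∷ y) q | yes refl | nothing rewrite ≡ᵇ-yes i with q
  ... | refl = first∅ a e
  f-view i ((j , a) ∷ y) q | yes refl | just p rewrite ≡ᵇ-yes i with p ≤? - a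
  ... | yes h rewrite ≤ᵇ-yes h with q
  ...   | refl = first a e h
  f-view i ((j , a) ∷ y) q | yes refl | just p | no h rewrite ≤ᵇ-no (≰⇒> h) with fT i y in e'
  f-view i ((j , a) ∷ y) refl | yes refl | just p | no h | just y' = later a e (≰⇒> h) (f-view i y e')
  f-view i ((j , a) ∷ y) q | no ne with phiT i y in e
  f-view i ((j , a) ∷ y) q | no ne | nothing rewrite ≡ᵇ-no ne with () ← q
  f-view i ((j , a) ∷ y) q | no ne | just p rewrite ≡ᵇ-no ne with fT i y in e'
  f-view i ((j , a) ∷ y) refl | no ne | just p | just y' = other ne (f-view i y e')

  private
    sub-add : ∀ a → a - 1ℤ + 1ℤ ≡ a
    sub-add = solve-∀
    add-sub : ∀ a → a + 1ℤ - 1ℤ ≡ a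
    add-sub = solve-∀
    neg-predʳ : ∀ a → 1ℤ + - a ≡ - (a - 1ℤ)
    neg-predʳ = solve-∀
    neg-sucʳ : ∀ a → - a + -1ℤ ≡ - (a + 1ℤ)
    neg-sucʳ = solve-∀
    suc-predʳ : ∀ x → 1ℤ + x + -1ℤ ≡ x
    suc-predʳ = solve-∀
    pred-sucʳ : ∀ x → 1ℤ + (x - 1ℤ) ≡ x
    pred-sucʳ = solve-∀
    i<suc[i]' : ∀ x → x < 1ℤ + x
    i<suc[i]' x = suc[i]≤j⇒i<j ≤-refl

  -- A step raises ε of the factor it changes, or lowers φ of the right-hand part it changes, by
  -- one. So the test φ ≤ ε of f becomes the test φ < ε of e with the same outcome.
  view-e : ∀ {i u v} → FView i u v → eT i v ≡ just u
  view-e {i} (first∅ a q) rewrite q | ≡ᵇ-yes i = cong (λ z → just ((i , z) ∷ _)) (sub-add a)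
  view-e {i} (first a {y} {p} q h) rewrite q | ≡ᵇ-yes i | ≤ᵇ-no {x = - (a - 1ℤ)} {p} (≤-<-trans h (subst (- a <_) (neg-predʳ a) (i<suc[i]' (- a)))) =
    cong (λ z → just ((i , z) ∷ y)) (sub-add a)
  view-e {i} (later a {y} {y'} {p} q h V) with view-phi V
  ... | p' , q' , r with just-injective (trans (sym q) q')
  ... | refl rewrite r | ≡ᵇ-yes i | ≤ᵇ-yes {x = - a} {p - 1ℤ} (subst₂ _≤_ (suc-predʳ (- a)) refl (shiftˡ -1ℤ (i<j⇒suc[i]≤j h))) | view-e V = refl
  view-e {i} (other ne V) with view-phi V
  ... | p , _ , r rewrite r | ≡ᵇ-no ne | view-e V = refl

  e-view : ∀ i v {u} → eT i v ≡ just u → FView i u v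
  e-view i ((j , a) ∷ y) q with i ℕ.≟ j
  e-view i ((j , a) ∷ y) q | yes refl with phiT i y in e
  e-view i ((j , a) ∷ y) q | yes refl | nothing rewrite ≡ᵇ-yes i with q
  ... | refl = subst (λ z → FView i ((i , a + 1ℤ) ∷ y) ((i , z) ∷ y)) (add-sub a) (first∅ (a + 1ℤ) e)
  e-view i ((j , a) ∷ y) q | yes refl | just p rewrite ≡ᵇ-yes i with - a ≤? p
  ... | no h rewrite ≤ᵇ-no (≰⇒> h) with q
  ...   | refl = subst (λ z → FView i ((i , a + 1ℤ) ∷ y) ((i , z) ∷ y)) (add-sub a)
                   (first (a + 1ℤ) e (subst₂ _≤_ (suc-predʳ p) (neg-sucʳ a) (shiftˡ -1ℤ (i<j⇒suc[i]≤j (≰⇒> h)))))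
  e-view i ((j , a) ∷ y) q | yes refl | just p | yes h rewrite ≤ᵇ-yes h with eT i y in e'
  e-view i ((j , a) ∷ y) refl | yes refl | just p | yes h | just y' with e-view i y e'
  ... | V with view-phi V
  ... | p' , q' , r with just-injective (trans (sym e) r)
  ... | refl = later a q' (≤-<-trans h (suc[i]≤j⇒i<j (≤-reflexive (pred-sucʳ p')))) V
  e-view i ((j , a) ∷ y) q | no ne with phiT i y in e
  e-view i ((j , a) ∷ y) q | no ne | nothing rewrite ≡ᵇ-no ne with eT i y in e'
  e-view i ((j , a) ∷ y) refl | no ne | nothing | just y' = other ne (e-view i y e')
  e-view i ((j , a) ∷ y) q | no ne | just p rewrite ≡ᵇ-no ne with eT i y in e'
  e-view i ((j , a) ∷ y) refl | no ne | just p | just y' = other ne (e-view i y e')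

  fT⇒eT : ∀ i u {v} → fT i u ≡ just v → eT i v ≡ just u
  fT⇒eT i u q = view-e (f-view i u q)

  eT⇒fT : ∀ i v {u} → eT i v ≡ just u → fT i u ≡ just v
  eT⇒fT i v q = view-f (e-view i v q)

-- Kashiwara's embedding by strings, for a compatible pair

module StringEmbedding where
  open import Defs
  open import Data.Bool using (true; false; if_then_else_)
  open import Data.Nat as ℕ using (ℕ; zero; suc; _≡ᵇ_; _∸_)
  import Data.Nat.Properties as ℕP
  open import Data.Integer using (ℤ; +_; 0ℤ; 1ℤ; -1ℤ; -_; _+_; _-_; _*_; _⊔_; _≤_; _<_; +≤+)
  open import Data.Integer.Properties
  open import Data.Integer.Tactic.RingSolver using (solve-∀)
  open import Data.List using (List; []; _∷_)
  open import Data.List.Relation.Unary.All using (All; []; _∷_)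
  open import Data.Maybe using (just; nothing)
  open import Data.Maybe.Properties using (just-injective)
  open Brackets using (ind; ind-refl; ind-≢)
  open BracketCorners using (Σ<; Σ<-cong)
  open Triangles using (Mat)
  open Weights
  open DoubleCrystal
  open TensorProducts

  +-distribʳ-⊔ : ∀ h x y → (x ⊔ y) + h ≡ (x + h) ⊔ (y + h)
  +-distribʳ-⊔ h = mono-≤-distrib-⊔ {f = _+ h} (+-monoˡ-≤ h)

  phi-eps : ∀ i s → phiT i s ≡ add∞ (epsT i s) (hw i s)
  phi-eps i [] = refl
  phi-eps i ((j , a) ∷ y) with i ℕ.≟ j
  ... | no ne with epsT i y | phiT i y | phi-eps i y
  ...   | nothing | _ | refl rewrite phi1-diff {i} {j} {a} ne | eps1-diff {i} {j} {a} ne = refl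
  ...   | just E  | _ | refl rewrite phi1-diff {i} {j} {a} ne | eps1-diff {i} {j} {a} ne =
          cong just (trans (l E (hw i y) _) (cong (_+_ E) (sym (hw-cons i (j , a) y))))
    where
    l : ∀ e h x → e + h + x ≡ e + (x + h)
    l = solve-∀
  phi-eps i ((j , a) ∷ y) | yes refl with epsT i y | phiT i y | phi-eps i y
  ...   | nothing | _ | refl rewrite phi1-same {i} a | eps1-same {i} a =
          cong just (trans (l a (hw i y)) (cong (_+_ (- a + - hw i y)) (sym (trans (hw-cons i (i , a) y) (cong (_+ hw i y) (hw1-same {i} a))))))
    where
    l : ∀ a h → a ≡ - a + - h + (a + a + h)
    l = solve-∀
  ...   | just E  | _ | refl rewrite phi1-same {i} a | eps1-same {i} a = cong just (begin
          a ⊔ (E + hw i y + hw i ((i , a) ∷ []))         ≡⟨ cong (λ z → a ⊔ (E + hw i y + z)) (hw1-same {i} a) ⟩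
          a ⊔ (E + hw i y + (a + a))                     ≡⟨ ⊔-comm a _ ⟩
          (E + hw i y + (a + a)) ⊔ a                     ≡⟨ cong₂ _⊔_ (l1 E (hw i y) a) (l2 a (hw i y)) ⟩
          (E + (a + a + hw i y)) ⊔ (- a + - hw i y + (a + a + hw i y)) ≡⟨ sym (+-distribʳ-⊔ (a + a + hw i y) E (- a + - hw i y)) ⟩
          (E ⊔ (- a + - hw i y)) + (a + a + hw i y)      ≡⟨ cong (_+_ (E ⊔ (- a + - hw i y))) (sym (trans (hw-cons i (i , a) y) (cong (_+ hw i y) (hw1-same {i} a)))) ⟩
          (E ⊔ (- a + - hw i y)) + hw i ((i , a) ∷ y) ∎)
    where
    open ≡-Reasoning
    l1 : ∀ e h a → e + h + (a + a) ≡ e + (a + a + h)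
    l1 = solve-∀
    l2 : ∀ a h → a ≡ - a + - h + (a + a + h)
    l2 = solve-∀

  wtc-view : ∀ {i u v} k → FView i u v → wtc k v ≡ wtc k u + (if k ≡ᵇ i then -1ℤ else 0ℤ)
  wtc-view {i} k (first∅ a {y} _) with k ≡ᵇ i
  ... | true  = l a (wtc k y)
    where
    l : ∀ a h → a - 1ℤ + h ≡ a + h + -1ℤ
    l = solve-∀
  ... | false = sym (+-identityʳ _)
  wtc-view {i} k (first a {y} _ _) with k ≡ᵇ i
  ... | true  = l a (wtc k y)
    where
    l : ∀ a h → a - 1ℤ + h ≡ a + h + -1ℤ
    l = solve-∀
  ... | false = sym (+-identityʳ _)
  wtc-view {i} k (later a _ _ V) = trans (cong (_+_ (if k ≡ᵇ i then a else 0ℤ)) (wtc-view k V)) (sym (+-assoc (if k ≡ᵇ i then a else 0ℤ) _ _))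
  wtc-view {i} k (other {j} {a} _ V) = trans (cong (_+_ (if k ≡ᵇ j then a else 0ℤ)) (wtc-view k V)) (sym (+-assoc (if k ≡ᵇ j then a else 0ℤ) _ _))

  -- φ_i of s ⊗ b, where φ_i b = φ₀.
  phiX : ℕ → State → ℤ → ℤ
  phiX i []            φ₀ = φ₀
  phiX i ((j , a) ∷ y) φ₀ = if i ≡ᵇ j then a ⊔ (phiX i y φ₀ + hw i ((j , a) ∷ [])) else phiX i y φ₀ + hw i ((j , a) ∷ [])

  data XView (i : ℕ) (φ₀ : ℤ) : State → State → Set where
    first : ∀ {a y} → phiX i y φ₀ ≤ - a → XView i φ₀ ((i , a) ∷ y) ((i , a - 1ℤ) ∷ y)
    later : ∀ {a y y'} → - a < phiX i y φ₀ → XView i φ₀ y y' → XView i φ₀ ((i , a) ∷ y) ((i , a) ∷ y')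
    other : ∀ {j a y y'} → i ≢ j → XView i φ₀ y y' → XView i φ₀ ((j , a) ∷ y) ((j , a) ∷ y')

  phiX-same : ∀ i a y φ₀ → phiX i ((i , a) ∷ y) φ₀ ≡ a ⊔ (phiX i y φ₀ + (a + a))
  phiX-same i a y φ₀ with hw1-same {i} a
  ... | q rewrite ≡ᵇ-yes i | q = refl

  phiX-diff : ∀ {i j} a y φ₀ → i ≢ j → phiX i ((j , a) ∷ y) φ₀ ≡ phiX i y φ₀ + hw i ((j , a) ∷ [])
  phiX-diff a y φ₀ ne rewrite ≡ᵇ-no ne = refl

  add-nothing : ∀ {m} {h : ℤ} → add∞ m h ≡ nothing → m ≡ nothing
  add-nothing {nothing} _ = refl

  add-just : ∀ {m} {h p : ℤ} → add∞ m h ≡ just p → ∃ λ e → m ≡ just e × p ≡ e + h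
  add-just {just e} refl = e , refl , refl

  phiX-nothing : ∀ i s φ₀ → epsT i s ≡ nothing → phiX i s φ₀ ≡ φ₀ + hw i s
  phiX-nothing i [] φ₀ q = sym (+-identityʳ φ₀)
  phiX-nothing i ((j , a) ∷ y) φ₀ q with i ℕ.≟ j
  ... | yes refl with epsT i y
  ...   | nothing rewrite eps1-same {i} a with () ← q
  ...   | just _ rewrite eps1-same {i} a with () ← q
  phiX-nothing i ((j , a) ∷ y) φ₀ q | no ne with epsT i y in e
  ...   | nothing = trans (phiX-diff a y φ₀ ne) (trans (cong (_+ hw i ((j , a) ∷ [])) (phiX-nothing i y φ₀ e))
                      (trans (l φ₀ (hw i y) _) (cong (_+_ φ₀) (sym (hw-cons i (j , a) y)))))
    where
    l : ∀ e h x → e + h + x ≡ e + (x + h)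
    l = solve-∀
  ...   | just E rewrite eps1-diff {i} {j} {a} ne with () ← q

  phiX-just : ∀ i s φ₀ {p} → phiT i s ≡ just p → phiX i s φ₀ ≡ p ⊔ (φ₀ + hw i s)
  phiX-just i ((j , a) ∷ y) φ₀ {p} q with i ℕ.≟ j
  ... | yes refl with phiT i y in e
  ...   | nothing rewrite phi1-same {i} a with just-injective q
  ...     | refl = trans (phiX-same i a y φ₀) (cong (a ⊔_) (trans (cong (_+ (a + a)) (phiX-nothing i y φ₀ (add-nothing (trans (sym (phi-eps i y)) e))))
                     (trans (l φ₀ (hw i y) (a + a)) (cong (_+_ φ₀) (sym (trans (hw-cons i (i , a) y) (cong (_+ hw i y) (hw1-same {i} a))))))))
    where
    l : ∀ e h x → e + h + x ≡ e + (x + h)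
    l = solve-∀
  phiX-just i ((j , a) ∷ y) φ₀ {p} q | yes refl | just p' with hw1-same {i} a
  ...     | h1 rewrite phi1-same {i} a with just-injective q
  ...       | refl = trans (phiX-same i a y φ₀) (trans (cong (λ z → a ⊔ (z + (a + a))) (phiX-just i y φ₀ e))
                       (trans (cong (a ⊔_) (+-distribʳ-⊔ (a + a) p' (φ₀ + hw i y)))
                         (trans (sym (⊔-assoc a _ _)) (cong₂ (λ s t → (a ⊔ (p' + s)) ⊔ t) (sym h1)
                           (trans (l φ₀ (hw i y) (a + a)) (cong (_+_ φ₀) (sym (trans (hw-cons i (i , a) y) (cong (_+ hw i y) h1)))))))))
    where
    l : ∀ e h x → e + h + x ≡ e + (x + h)
    l = solve-∀
  phiX-just i ((j , a) ∷ y) φ₀ {p} q | no ne with phiT i y in e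
  ...   | nothing rewrite phi1-diff {i} {j} {a} ne with () ← q
  ...   | just p' rewrite phi1-diff {i} {j} {a} ne with just-injective q
  ...     | refl = trans (phiX-diff a y φ₀ ne) (trans (cong (_+ hw i ((j , a) ∷ [])) (phiX-just i y φ₀ e))
                     (trans (+-distribʳ-⊔ _ p' (φ₀ + hw i y)) (cong (_ ⊔_) (trans (l φ₀ (hw i y) _) (cong (_+_ φ₀) (sym (hw-cons i (j , a) y)))))))
    where
    l : ∀ e h x → e + h + x ≡ e + (x + h)
    l = solve-∀

  private
    to-right : ∀ {x y} h → x ≤ y + - h → x + h ≤ y
    to-right {x} {y} h k = subst (x + h ≤_) (l y h) (shiftˡ h k)
      where
      l : ∀ y h → y + - h + h ≡ y
      l = solve-∀

    to-left : ∀ {x y} h → x + h ≤ y → x ≤ y + - h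
    to-left {x} {y} h k = subst (_≤ y + - h) (l x h) (shiftˡ (- h) k)
      where
      l : ∀ y h → y + h + - h ≡ y
      l = solve-∀

  eps-cons-same : ∀ i a y {e} → epsT i y ≡ just e → epsT i ((i , a) ∷ y) ≡ just (e ⊔ (- a + - hw i y))
  eps-cons-same i a y q rewrite q | eps1-same {i} a = refl

  eps-cons-same∅ : ∀ i a y → epsT i y ≡ nothing → epsT i ((i , a) ∷ y) ≡ just (- a + - hw i y)
  eps-cons-same∅ i a y q rewrite q | eps1-same {i} a = refl

  eps-cons-diff : ∀ {i j} a y → i ≢ j → epsT i ((j , a) ∷ y) ≡ epsT i y
  eps-cons-diff {i} {j} a y ne with epsT i y
  ... | nothing rewrite eps1-diff {i} {j} {a} ne = refl
  ... | just _  rewrite eps1-diff {i} {j} {a} ne = refl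

  -- If φ₀ ≤ ε_i(s) then f_i acts on the left factor of s ⊗ b.
  absorb : ∀ {i φ₀ u v e} → FView i u v → epsT i u ≡ just e → φ₀ ≤ e → XView i φ₀ u v
  absorb {i} {φ₀} (first∅ a {y} q) q' h with add-nothing (trans (sym (phi-eps i y)) q)
  ... | n with just-injective (trans (sym (eps-cons-same∅ i a y n)) q')
  ... | refl = first (subst (_≤ - a) (sym (phiX-nothing i y φ₀ n)) (to-right (hw i y) h))
  absorb {i} {φ₀} (first a {y} {p} q k) q' h with add-just (trans (sym (phi-eps i y)) q)
  ... | e' , r , refl with just-injective (trans (sym (eps-cons-same i a y r)) q')
  ... | refl = first (subst (_≤ - a) (sym (phiX-just i y φ₀ q)) (⊔-lub k (to-right (hw i y) (≤-trans h (⊔-lub (to-left (hw i y) k) ≤-refl)))))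
  absorb {i} {φ₀} (later a {y} {y'} {p} q k V) q' h with add-just (trans (sym (phi-eps i y)) q)
  ... | e' , r , refl with just-injective (trans (sym (eps-cons-same i a y r)) q')
  ... | refl = later (subst (- a <_) (sym (phiX-just i y φ₀ q)) (<-≤-trans k (i≤i⊔j (e' + hw i y) _)))
                     (absorb V r (≤-trans h (⊔-lub ≤-refl lem)))
    where
    lem : - a + - hw i y ≤ e'
    lem = subst (- a + - hw i y ≤_) (l e' (hw i y)) (shiftˡ (- hw i y) (<⇒≤ k))
      where
      l : ∀ y h → y + h + - h ≡ y
      l = solve-∀
  absorb {i} (other {j} {a} {y} ne V) q' h = other ne (absorb V (trans (sym (eps-cons-diff a y ne)) q') h)

  can-act : ∀ i u {e} → epsT i u ≡ just e → ∃ λ v → FView i u v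
  can-act i ((j , a) ∷ y) q with i ℕ.≟ j
  ... | no ne = let v , V = can-act i y (trans (sym (eps-cons-diff a y ne)) q) in _ , other ne V
  ... | yes refl with phiT i y in e
  ...   | nothing = _ , first∅ a e
  ...   | just p with p ≤? - a
  ...     | yes h = _ , first a e h
  ...     | no  h with add-just (trans (sym (phi-eps i y)) e)
  ...       | e' , r , _ = let v , V = can-act i y r in _ , later a e (≰⇒> h) V

  module Embedding (R : ℕ) where
    open Bicrystals R public

    -- Kashiwara's embedding n ↦ u_j(-ε_j n) ⊗ e_j^max n, iterated along `js`. The strings are taken
    -- in `C`; the operators of `C'` are the ones that act by the tensor rule.
    module Strings (C C' : Crystal) (K : Compatible C C') where
      open Crystal C
      open Crystal C' using () renaming (ε to ε'; f to f'; ε-f to ε'-f; f-cong to f'-cong; ε-cong to ε'-cong; ε-𝟎 to ε'-𝟎)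
      open Compatible K
      open Powers C

      St : List ℕ → Mat → State
      St []       n = []
      St (j ∷ js) n = (suc j , - (+ ε j n)) ∷ St js (top j n)

      Res : List ℕ → Mat → Mat
      Res []       n = n
      Res (j ∷ js) n = Res js (top j n)

      St-cong : ∀ {js n m} → All (ℕ._≤ R) js → n ≈ m → St js n ≡ St js m
      St-cong []       e = refl
      St-cong (h ∷ hs) e = cong₂ (λ k s → (_ , - (+ k)) ∷ s) (ε-cong h e) (St-cong hs (top-cong h e))

      Res-cong : ∀ {js n m} → All (ℕ._≤ R) js → n ≈ m → Res js n ≈ Res js m
      Res-cong []       e = e
      Res-cong (h ∷ hs) e = Res-cong hs (top-cong h e)

      private
        W-self : ∀ {i n} → i ℕ.≤ R → W (suc i) (f i n) ≡ suc (W (suc i) n)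
        W-self {i} {n} h = trans (W-f (suc i) h) (trans (cong (W (suc i) n ℕ.+_) (ind-refl i)) (ℕP.+-comm _ 1))

        W-other : ∀ {i k n} → i ℕ.≤ R → suc i ≢ k → W k (f i n) ≡ W k n
        W-other {i} {k} {n} h ne = trans (W-f k h) (trans (cong (W k n ℕ.+_) (ind-≢ ne)) (ℕP.+-identityʳ _))

        κ-eq-f : ∀ {i n} → i ℕ.≤ R → suc (suc (κ i (f i n) ℕ.+ (W (suc i) n ℕ.+ W (suc i) n))) ≡
                                suc (ε i n ℕ.+ ε' i (f i n) ℕ.+ (W i n ℕ.+ W (suc (suc i)) n))
        κ-eq-f {i} {n} h = begin
          suc (suc (κ i (f i n) ℕ.+ (w ℕ.+ w)))      ≡⟨ l (κ i (f i n)) w ⟩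
          κ i (f i n) ℕ.+ (suc w ℕ.+ suc w)          ≡⟨ cong (λ z → κ i (f i n) ℕ.+ (z ℕ.+ z)) (sym (W-self h)) ⟩
          _                                         ≡⟨ κ-eq h ⟩
          (ε i (f i n) ℕ.+ ε' i (f i n)) ℕ.+ (W i (f i n) ℕ.+ W (suc (suc i)) (f i n))
            ≡⟨ cong₂ (λ a b → (a ℕ.+ ε' i (f i n)) ℕ.+ b) (ε-f h) (cong₂ ℕ._+_ (W-other h ℕP.1+n≢n) (W-other h (ℕP.1+n≢n ∘ sym))) ⟩
          suc (ε i n ℕ.+ ε' i (f i n) ℕ.+ (W i n ℕ.+ W (suc (suc i)) n)) ∎
          where
          open ≡-Reasoning
          w = W (suc i) n
          l : ∀ k w → suc (suc (k ℕ.+ (w ℕ.+ w))) ≡ k ℕ.+ (suc w ℕ.+ suc w)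
          l k w = sym (trans (cong (k ℕ.+_) (cong suc (ℕP.+-suc w w))) (trans (ℕP.+-suc k _) (cong suc (ℕP.+-suc k _))))

      -- In `κ-eq`, f raises ε by one and 2W by two, and ε' rises only at κ = 0, where f = f'. So κ
      -- falls by one per step until it is zero and then stays there.
      κ-f : ∀ {i n} → i ℕ.≤ R → κ i (f i n) ≡ κ i n ∸ 1
      κ-f {i} {n} h with κ i n in q
      ... | zero = ℕP.+-cancelʳ-≡ (w ℕ.+ w) _ _ (ℕP.suc-injective (ℕP.suc-injective (begin
            suc (suc (κ i (f i n) ℕ.+ (w ℕ.+ w)))   ≡⟨ κ-eq-f h ⟩
            suc (ε i n ℕ.+ ε' i (f i n) ℕ.+ V)       ≡⟨ cong (λ z → suc (ε i n ℕ.+ z ℕ.+ V)) (trans (ε'-cong h (κ-zero h q)) (ε'-f h)) ⟩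
            suc (ε i n ℕ.+ suc (ε' i n) ℕ.+ V)       ≡⟨ cong (λ z → suc (z ℕ.+ V)) (ℕP.+-suc (ε i n) (ε' i n)) ⟩
            suc (suc (ε i n ℕ.+ ε' i n ℕ.+ V))       ≡⟨ cong (λ z → suc (suc z)) (sym (trans (cong (ℕ._+ (w ℕ.+ w)) (sym q)) (κ-eq h))) ⟩
            suc (suc (w ℕ.+ w)) ∎)))
        where
        open ≡-Reasoning
        w = W (suc i) n
        V = W i n ℕ.+ W (suc (suc i)) n
      ... | suc k = ℕP.+-cancelʳ-≡ (w ℕ.+ w) _ _ (ℕP.suc-injective (ℕP.suc-injective (begin
            suc (suc (κ i (f i n) ℕ.+ (w ℕ.+ w)))   ≡⟨ κ-eq-f h ⟩
            suc (ε i n ℕ.+ ε' i (f i n) ℕ.+ V)       ≡⟨ cong (λ z → suc (ε i n ℕ.+ z ℕ.+ V)) (κ-one' h (subst (0 ℕ.<_) (sym q) ℕ.z<s)) ⟩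
            suc (ε i n ℕ.+ ε' i n ℕ.+ V)             ≡⟨ cong suc (sym (trans (cong (ℕ._+ (w ℕ.+ w)) (sym q)) (κ-eq h))) ⟩
            suc (suc (k ℕ.+ (w ℕ.+ w))) ∎)))
        where
        open ≡-Reasoning
        w = W (suc i) n
        V = W i n ℕ.+ W (suc (suc i)) n

      κ-cong : ∀ {i n m} → i ℕ.≤ R → n ≈ m → κ i n ≡ κ i m
      κ-cong {i} {n} {m} h e = ℕP.+-cancelʳ-≡ (W (suc i) n ℕ.+ W (suc i) n) _ _ (trans (κ-eq h)
        (trans (cong₂ ℕ._+_ (cong₂ ℕ._+_ (ε-cong h e) (ε'-cong h e)) (cong₂ ℕ._+_ (W-cong i e) (W-cong (suc (suc i)) e)))
          (trans (sym (κ-eq h)) (cong (λ z → κ i m ℕ.+ (z ℕ.+ z)) (sym (W-cong (suc i) e))))))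

      κ-pow : ∀ m {i n} → i ℕ.≤ R → κ i (pow m i n) ≡ κ i n ∸ m
      κ-pow zero    h = refl
      κ-pow (suc m) {i} {n} h = trans (κ-f h) (trans (cong (_∸ 1) (κ-pow m h)) (trans (ℕP.∸-+-assoc (κ i n) m 1) (cong (κ i n ∸_) (ℕP.+-comm m 1))))

      -- The weight φ_i of the primed crystal, up to the relation φ = ε + ⟨h_i , wt⟩.
      φ' : ℕ → Mat → ℤ
      φ' i n = + κ i n - + ε i n

      φ'-wt : ∀ {i n} → i ℕ.≤ R → φ' i n ≡ + ε' i n + (+ W i n + + W (suc (suc i)) n - (+ W (suc i) n + + W (suc i) n))
      φ'-wt {i} {n} h = l (+ κ i n) (+ ε i n) (+ ε' i n) (+ W i n + + W (suc (suc i)) n) (+ W (suc i) n + + W (suc i) n)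
          (cong (λ z → + z) (κ-eq h))
        where
        l : ∀ k e e' v w → k + w ≡ (e + e') + v → k - e ≡ e' + (v - w)
        l k e e' v w q = begin
          k - e             ≡⟨ l1 k e w ⟩
          (k + w) - e - w   ≡⟨ cong (λ z → z - e - w) q ⟩
          (e + e') + v - e - w ≡⟨ l2 e e' v w ⟩
          e' + (v - w) ∎
          where
          open ≡-Reasoning
          l1 : ∀ k e w → k - e ≡ (k + w) - e - w
          l1 = solve-∀
          l2 : ∀ e e' v w → (e + e') + v - e - w ≡ e' + (v - w)
          l2 = solve-∀

      ε'-pow : ∀ m {i j n} → i ℕ.≤ R → j ℕ.≤ R → i ≢ j → ε' i (pow m j n) ≡ ε' i n
      ε'-pow zero    h k ne = refl
      ε'-pow (suc m) h k ne = trans (ε'-comm h k ne) (ε'-pow m h k ne)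

      cartan-ind : ∀ {i j} → i ≢ j → cartan (suc i) (suc j) ≡ - (+ (ind (suc j) i ℕ.+ ind j (suc i)))
      cartan-ind {i} {j} ne rewrite ≡ᵇ-no ne with suc i ℕ.≟ j | suc j ℕ.≟ i
      ... | yes refl | yes q = ⊥-elim (ℕP.<-irrefl (sym q) (ℕP.<-trans (ℕP.n<1+n i) (ℕP.n<1+n (suc i))))
      ... | yes refl | no ne' rewrite ≡ᵇ-yes i | ind-refl i | ind-≢ ne' = refl
      ... | no ne' | yes refl rewrite ≡ᵇ-no ne' | ≡ᵇ-yes j | ind-refl j | ind-≢ (ne' ∘ sym) = refl
      ... | no a | no b rewrite ≡ᵇ-no a | ≡ᵇ-no b | ind-≢ b | ind-≢ (a ∘ sym) = refl

      φ'-other : ∀ {i j n} → i ℕ.≤ R → j ℕ.≤ R → i ≢ j →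
                 φ' i n ≡ φ' i (top j n) + hw (suc i) ((suc j , - (+ ε j n)) ∷ [])
      φ'-other {i} {j} {n} h k ne = begin
        φ' i n                                          ≡⟨ φ'-wt h ⟩
        + ε' i n + (+ W i n + + W (suc (suc i)) n - (+ W (suc i) n + + W (suc i) n))
          ≡⟨ cong₂ (λ a b → + a + b) e1 (cong₂ (λ a b → a - b) (cong₂ (λ a b → + a + + b) (w i) (w (suc (suc i)))) (cong (λ a → + a + + a) w1)) ⟩
        + ε' i n₀ + (+ (W i n₀ ℕ.+ m ℕ.* ind (suc j) i) + + (W (suc (suc i)) n₀ ℕ.+ m ℕ.* ind (suc j) (suc (suc i))) - (+ W (suc i) n₀ + + W (suc i) n₀))
          ≡⟨ cong₂ (λ a b → + ε' i n₀ + (+ W i n₀ + a + (+ W (suc (suc i)) n₀ + b) - (+ W (suc i) n₀ + + W (suc i) n₀))) (pos-* m _) (pos-* m _) ⟩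
        + ε' i n₀ + (+ W i n₀ + + m * + ind (suc j) i + (+ W (suc (suc i)) n₀ + + m * + ind j (suc i)) - (+ W (suc i) n₀ + + W (suc i) n₀))
          ≡⟨ l (+ ε' i n₀) (+ W i n₀) (+ W (suc (suc i)) n₀) (+ W (suc i) n₀ + + W (suc i) n₀) (+ m) (+ ind (suc j) i) (+ ind j (suc i)) ⟩
        (+ ε' i n₀ + (+ W i n₀ + + W (suc (suc i)) n₀ - (+ W (suc i) n₀ + + W (suc i) n₀))) + (- (+ m) * - (+ ind (suc j) i + + ind j (suc i)) + 0ℤ)
          ≡⟨ cong₂ (λ a b → a + (- (+ m) * b + 0ℤ)) (sym (φ'-wt h)) (sym (cartan-ind ne)) ⟩
        φ' i n₀ + hw (suc i) ((suc j , - (+ ε j n)) ∷ []) ∎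
        where
        open ≡-Reasoning
        n₀ = top j n
        m = ε j n
        back = ≈-sym (pow-top {j} {n} k)
        e1 : ε' i n ≡ ε' i n₀
        e1 = trans (ε'-cong h back) (ε'-pow m h k ne)
        w : ∀ z → W z n ≡ W z n₀ ℕ.+ m ℕ.* ind (suc j) z
        w z = trans (W-cong z back) (W-pow m z k)
        w1 : W (suc i) n ≡ W (suc i) n₀
        w1 = trans (w (suc i)) (trans (cong (λ z → W (suc i) n₀ ℕ.+ m ℕ.* z) (ind-≢ {suc j} {suc i} (ne ∘ sym ∘ ℕP.suc-injective)))
               (trans (cong (W (suc i) n₀ ℕ.+_) (ℕP.*-zeroʳ m)) (ℕP.+-identityʳ _)))
        l : ∀ e a b c m x y → e + (a + m * x + (b + m * y) - c) ≡ (e + (a + b - c)) + (- m * - (x + y) + 0ℤ)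
        l = solve-∀

      κ-of : ∀ {i n} → i ℕ.≤ R → κ i n ≡ κ i (top i n) ∸ ε i n
      κ-of {i} {n} h = trans (κ-cong h (≈-sym (pow-top h))) (κ-pow (ε i n) h)

      φ'-top : ∀ {i n} → i ℕ.≤ R → φ' i (top i n) ≡ + κ i (top i n)
      φ'-top {i} {n} h = trans (cong (λ z → + κ i (top i n) - + z) (ε-top h)) (+-identityʳ _)

      -- This is φ of u_i(-m) ⊗ b with b the top of the string. The maximum in the tensor rule is
      -- the truncated subtraction in `κ-of`.
      φ'-same : ∀ {i n} → i ℕ.≤ R → φ' i n ≡ (- (+ ε i n)) ⊔ (φ' i (top i n) + (- (+ ε i n) + - (+ ε i n)))
      φ'-same {i} {n} h = trans (cong (λ z → + z - + m) (κ-of h)) (trans (go (ℕP.≤-total N m)) (cong (λ z → - (+ m) ⊔ (z + (- (+ m) + - (+ m)))) (sym (φ'-top h))))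
        where
        N = κ i (top i n)
        m = ε i n
        l1 : ∀ m → m + (- m + - m) ≡ - m
        l1 = solve-∀
        l2 : ∀ N m → N - m - m ≡ N + (- m + - m)
        l2 = solve-∀
        go : N ℕ.≤ m ⊎ m ℕ.≤ N → + (N ∸ m) - + m ≡ - (+ m) ⊔ (+ N + (- (+ m) + - (+ m)))
        go (inj₁ k) = trans (cong (λ z → + z - + m) (ℕP.m≤n⇒m∸n≡0 k)) (trans (+-identityˡ _)
          (sym (i≥j⇒i⊔j≡i (subst (+ N + (- (+ m) + - (+ m)) ≤_) (l1 (+ m)) (shiftˡ (- (+ m) + - (+ m)) (+≤+ k))))))
        go (inj₂ k) = trans (cong (_- + m) (trans (sym (⊖-≥ k)) (sym (m-n≡m⊖n N m)))) (trans (l2 (+ N) (+ m))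
          (sym (i≤j⇒i⊔j≡j (subst (_≤ + N + (- (+ m) + - (+ m))) (l1 (+ m)) (shiftˡ (- (+ m) + - (+ m)) (+≤+ k))))))

      φ'-phiX : ∀ {i js} → i ℕ.≤ R → All (ℕ._≤ R) js → ∀ n → φ' i n ≡ phiX (suc i) (St js n) (φ' i (Res js n))
      φ'-phiX h [] n = refl
      φ'-phiX {i} {j ∷ js} h (k ∷ ks) n with i ℕ.≟ j
      ... | yes refl = trans (φ'-same h) (trans (cong (λ z → - (+ ε i n) ⊔ (z + (- (+ ε i n) + - (+ ε i n)))) (φ'-phiX h ks (top i n)))
                         (sym (phiX-same (suc i) (- (+ ε i n)) (St js (top i n)) _)))
      ... | no ne = trans (φ'-other h k ne) (trans (cong (_+ hw (suc i) ((suc j , - (+ ε j n)) ∷ [])) (φ'-phiX h ks (top j n)))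
                      (sym (phiX-diff {suc i} {suc j} (- (+ ε j n)) (St js (top j n)) _ (ne ∘ ℕP.suc-injective))))

      f'-pow : ∀ m {i j n} → i ℕ.≤ R → j ℕ.≤ R → i ≢ j → f' i (pow m j n) ≈ pow m j (f' i n)
      f'-pow zero    h k ne = ≈-refl
      f'-pow (suc m) h k ne = ≈-trans (≈-sym (comm k h (ne ∘ sym))) (f-cong k (f'-pow m h k ne))

      -- Each exchange of f' with one more f needs κ > 1 at that stage, and κ has by then dropped
      -- once for every f already exchanged; this gives the bound m < κ.
      f'-pow-self : ∀ m {i n} → i ℕ.≤ R → m ℕ.< κ i n → f' i (pow m i n) ≈ pow m i (f' i n)
      f'-pow-self zero    h k = ≈-refl
      f'-pow-self (suc m) {i} {n} h k = ≈-trans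
        (≈-sym (κ-two h (subst (1 ℕ.<_) (sym (κ-pow m h)) (ℕP.m+n≤o⇒m≤o∸n 2 k))))
        (f-cong h (f'-pow-self m h (ℕP.<⇒≤ k)))

      string-other : ∀ {i j n} → i ℕ.≤ R → j ℕ.≤ R → i ≢ j → ε j (f' i n) ≡ ε j n × top j (f' i n) ≈ f' i (top j n)
      string-other {i} {j} {n} h k ne = top-unique (ε j n) k
        (≈-trans (f'-cong h (≈-sym (pow-top k))) (f'-pow (ε j n) h k ne)) (trans (ε-comm k h (ne ∘ sym)) (ε-top k))

      string-later : ∀ {i n} → i ℕ.≤ R → ε i n ℕ.< κ i (top i n) → ε i (f' i n) ≡ ε i n × top i (f' i n) ≈ f' i (top i n)
      string-later {i} {n} h k = top-unique (ε i n) h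
        (≈-trans (f'-cong h (≈-sym (pow-top h))) (f'-pow-self (ε i n) h k))
        (trans (κ-one h (ℕP.≤-<-trans ℕ.z≤n k)) (ε-top h))

      string-first : ∀ {i n} → i ℕ.≤ R → κ i (top i n) ℕ.≤ ε i n → ε i (f' i n) ≡ suc (ε i n) × top i (f' i n) ≈ top i n
      string-first {i} {n} h k = trans (ε-cong h same) (ε-f h) , ≈-trans (top-cong h same) (top-f h)
        where
        same : f' i n ≈ f i n
        same = ≈-sym (κ-zero h (trans (κ-of h) (ℕP.m≤n⇒m∸n≡0 k)))

      -- The test φ ≤ ε of the tensor rule reads `κ i (top i n)` ≤ `ε i n`. If it holds, f' agrees
      -- with f and lengthens the string; if not, f' commutes past the whole string and acts on its
      -- top.
      string-step : ∀ {i js} → i ℕ.≤ R → All (ℕ._≤ R) js → ∀ n {v} →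
                    XView (suc i) (φ' i (Res js n)) (St js n) v → v ≡ St js (f' i n) × Res js (f' i n) ≈ Res js n
      string-step {i} {.i ∷ js} h (k ∷ ks) n (first q) with string-first h
        (drop‿+≤+ (subst₂ _≤_ (trans (sym (φ'-phiX h ks (top i n))) (φ'-top h)) (neg-involutive (+ ε i n)) q))
      ... | a , b = cong₂ (λ z y → (suc i , z) ∷ y) (trans (l (+ ε i n)) (cong (λ z → - (+ z)) (sym a))) (St-cong ks (≈-sym b))
                  , Res-cong ks b
        where
        l : ∀ z → - z - 1ℤ ≡ - (1ℤ + z)
        l = solve-∀
      string-step {i} {.i ∷ js} h (k ∷ ks) n (later q V) with string-later h
        (drop‿+<+ (subst₂ _<_ (neg-involutive (+ ε i n)) (trans (sym (φ'-phiX h ks (top i n))) (φ'-top h)) q)) | string-step h ks (top i n) V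
      ... | a , b | e , r = cong₂ (λ z y → (suc i , - (+ z)) ∷ y) (sym a) (trans e (St-cong ks (≈-sym b)))
                          , ≈-trans (Res-cong ks b) r
      string-step {i} {j ∷ js} h (k ∷ ks) n (other ne V) with string-other h k (ne ∘ cong suc) | string-step h ks (top j n) V
      ... | a , b | e , r = cong₂ (λ z y → (suc j , - (+ z)) ∷ y) (sym a) (trans e (St-cong ks (≈-sym b)))
                          , ≈-trans (Res-cong ks b) r

      W-𝟎 : ∀ k → W k 𝟎 ≡ 0
      W-𝟎 k = zz k
        where
        z : ∀ b → Σ< b (λ _ → 0) ≡ 0
        z zero    = refl
        z (suc b) = trans (ℕP.+-identityʳ _) (z b)
        zz : ∀ a → Σ< a (λ x → Σ< (suc (suc R) ∸ k) (𝟎 x)) ≡ 0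
        zz a = trans (Σ<-cong a λ _ _ → z (suc (suc R) ∸ k)) (z a)

      φ'-𝟎 : ∀ {i n} → i ℕ.≤ R → n ≈ 𝟎 → φ' i n ≡ 0ℤ
      φ'-𝟎 {i} {n} h e = trans (φ'-wt h) (cong₂ (λ a b → + a + b) (trans (ε'-cong h e) (ε'-𝟎 h))
         (cong₂ (λ a b → a - b) (cong₂ (λ a b → + a + + b) (w i) (w (suc (suc i)))) (cong (λ a → + a + + a) (w (suc i)))))
        where
        w : ∀ k → W k n ≡ 0
        w k = trans (W-cong k e) (W-𝟎 k)

      -- The residue `𝟎` has φ = 0, which a nonnegative ε of the preceding factors absorbs. So f'
      -- never reaches the residue, and the finite list of factors alone carries the action.
      embed : ∀ {i js n e} → i ℕ.≤ R → All (ℕ._≤ R) js → Res js n ≈ 𝟎 → epsT (suc i) (St js n) ≡ just e → 0ℤ ≤ e →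
              FView (suc i) (St js n) (St js (f' i n)) × Res js (f' i n) ≈ 𝟎
      embed {i} {js} {n} {e} h ks r q k with can-act (suc i) (St js n) q
      ... | v , V with string-step h ks n (absorb V q (subst (_≤ e) (sym (φ'-𝟎 h r)) k))
      ... | refl , r' = V , ≈-trans r' r

      St-𝟎 : ∀ {js n} → All (ℕ._≤ R) js → n ≈ 𝟎 → St js n ≡ Data.List.map (λ j → (suc j , 0ℤ)) js × Res js n ≈ 𝟎
      St-𝟎 []       e = refl , e
      St-𝟎 {j ∷ js} {n} (h ∷ hs) e with St-𝟎 hs (proj₂ (top-unique {j} {n} 0 h e (ε-𝟎 h)))
      ... | s , r = cong₂ (λ z y → (suc j , - (+ z)) ∷ y) (trans (ε-cong h e) (ε-𝟎 h)) s , r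

      St-inj : ∀ {js n m} → All (ℕ._≤ R) js → St js n ≡ St js m → Res js n ≈ Res js m → n ≈ m
      St-inj []       e r = r
      St-inj {j ∷ js} {n} {m} (h ∷ hs) e r = ≈-trans (≈-sym (pow-top h))
        (≈-trans (pow-cong (ε j n) h (St-inj hs (∷-injectiveʳ e) r))
          (subst (λ k → pow k j (top j m) ≈ m) (sym (+-injective (neg-injective (,-injectiveʳ (∷-injectiveˡ e))))) (pow-top h)))
        where
        open import Data.List.Properties using (∷-injectiveˡ; ∷-injectiveʳ)
        open import Data.Product.Properties using (,-injectiveʳ)

      rebuild : List ℕ → State → Mat
      rebuild []       _             = 𝟎
      rebuild (j ∷ js) []            = 𝟎
      rebuild (j ∷ js) ((_ , a) ∷ s) = pow (Data.Integer.∣ a ∣) j (rebuild js s)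

      rebuild-St : ∀ {js n} → All (ℕ._≤ R) js → Res js n ≈ 𝟎 → n ≈ rebuild js (St js n)
      rebuild-St []       r = r
      rebuild-St {j ∷ js} {n} (h ∷ hs) r = ≈-trans (≈-sym (pow-top h))
        (subst (λ k → pow (ε j n) j (top j n) ≈ pow k j (rebuild js (St js (top j n)))) (sym (∣-i∣≡∣i∣ (+ ε j n))) (pow-cong (ε j n) h (rebuild-St hs r)))

-- Multisegments as tensors along `J`

module PatternEncoding where
  open import Defs
  open import Data.Nat
  open import Data.Nat.Properties
  import Data.Integer as ℤ
  open ℤ using (ℤ; 0ℤ)
  import Data.Integer.Properties as ℤP
  open import Data.Integer.Tactic.RingSolver using (solve-∀)
  open import Data.List using (List; []; _∷_; _++_; map; concatMap; upTo)
  open import Data.List.Properties using (concatMap-++; map-++; map-cong; ++-identityʳ)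
  open import Data.List.Relation.Unary.All using (All; []; _∷_)
  open import Data.List.Relation.Unary.All.Properties using (++⁺)
  open import Data.Maybe using (just; nothing)
  open Brackets
  open BracketCorners
  open Triangles
  open DoubleCrystal
  open TensorProducts
  open StringEmbedding

  -- No + precedes a −, so nothing cancels, and applying e as often as possible turns every −
  -- into a +.
  Sorted : ℕ → (ℕ → ℕ) → (ℕ → ℕ) → Set
  Sorted L q p = ∀ x y → x < y → y ≤ L → p x ≡ 0 ⊎ q y ≡ 0

  Sorted-sh : ∀ {L q p} → Sorted (suc L) q p → Sorted L (sh q) (sh p)
  Sorted-sh S x y h k = S (suc x) (suc y) (s≤s h) (s≤s k)

  sorted-eps : ∀ L q p → Sorted L q p → eps L q p ≡ Σ< (suc L) q
  sorted-eps zero    q p S = refl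
  sorted-eps (suc L) q p S = trans (cong (q 0 +_) (trans (cong (_∸ p 0) (sorted-eps L (sh q) (sh p) (Sorted-sh S))) (lem (p 0) refl)))
                               (sym (Σ<-cons (suc L) q))
    where
    z : ∀ k → (∀ y → y < k → sh q y ≡ 0) → Σ< k (sh q) ≡ 0
    z zero    h = refl
    z (suc k) h = cong₂ _+_ (z k λ y u → h y (m<n⇒m<1+n u)) (h k ≤-refl)
    lem : ∀ a → p 0 ≡ a → Σ< (suc L) (sh q) ∸ p 0 ≡ Σ< (suc L) (sh q)
    lem zero    e = cong (Σ< (suc L) (sh q) ∸_) e
    lem (suc a) e = trans (cong (_∸ p 0) zz) (trans (0∸n≡0 (p 0)) (sym zz))
      where
      zz : Σ< (suc L) (sh q) ≡ 0
      zz = z (suc L) λ y u → [ (λ w → ⊥-elim (0≢1+n (trans (sym w) e))) , (λ w → w) ]′ (S 0 (suc y) (s≤s z≤n) u)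
        where open Data.Sum using ([_,_]′)

  Σ<-zero : ∀ k {g} → Σ< k g ≡ 0 → ∀ x → x < k → g x ≡ 0
  Σ<-zero (suc k) {g} e x h with x ≟ k
  ... | yes refl = m+n≡0⇒n≡0 (Σ< k g) e
  ... | no  ne   = Σ<-zero k (m+n≡0⇒m≡0 _ e) x (≤∧≢⇒< (s≤s⁻¹ h) ne)

  sorted-above : ∀ {L q p X} → Sorted L q p → DPos L q p X → ∀ y → X < y → y ≤ L → q y ≡ 0
  sorted-above {suc L} {q} {p} S (here h) (suc y) _ (s≤s k) with p 0 in e
  ... | zero  = Σ<-zero (suc L) (trans (sym (sorted-eps L (sh q) (sh p) (Sorted-sh S))) (n≤0⇒n≡0 h)) y (s≤s k)
  ... | suc a with S 0 (suc y) (s≤s z≤n) (s≤s k)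
  ...   | inj₁ w = ⊥-elim (0≢1+n (trans (sym w) e))
  ...   | inj₂ w = w
  sorted-above {suc L} S (there h D) (suc y) (s≤s u) (s≤s k) = sorted-above (Sorted-sh S) D y u k

  sorted-down : ∀ {L q p q₁ p₁ X} → Sorted L q p → DPos L q p X → Bump L X q₁ p₁ q p → Sorted L q₁ p₁
  sorted-down {L} {q} {p} {q₁} {p₁} {X} S D (a , b) x y h k with X ≟ x
  ... | yes refl = inj₂ (m+n≡0⇒m≡0 _ (trans (sym (a y k)) (sorted-above S D y h k)))
  ... | no ne with S x y h k
  ...   | inj₁ w = inj₁ (trans (sym (b x (<-≤-trans h k))) (trans (cong (p x +_) (ind-≢ ne)) (trans (+-identityʳ _) w)))
  ...   | inj₂ w = inj₂ (m+n≡0⇒m≡0 _ (trans (sym (a y k)) w))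

  run : ℕ → ℕ → List ℕ
  run x zero    = []
  run x (suc k) = x ∷ run (suc x) k

  -- For k = R + 1 - x and `g` the row x of an array, the entry at j is minus the number of segments
  -- that start at x + 1 and reach j. Thus the d_{i,j} are partial sums of `g` and the c_{i,j} are
  -- its values.
  blk : ℕ → ℕ → (ℕ → ℕ) → State
  blk x zero    g = []
  blk x (suc k) g = (suc x , ℤ.- (ℤ.+ Σ< (suc k) g)) ∷ blk (suc x) k g

  blk-cong : ∀ x k {g h} → (∀ y → y < k → g y ≡ h y) → blk x k g ≡ blk x k h
  blk-cong x zero    e = refl
  blk-cong x (suc k) e = cong₂ (λ a b → (suc x , ℤ.- (ℤ.+ a)) ∷ b) (Σ<-cong (suc k) e) (blk-cong (suc x) k λ y h → e y (m<n⇒m<1+n h))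

  record Nonneg (i : ℕ) (s : State) : Set where
    constructor nn
    field
      value  : ℤ
      is     : epsT i s ≡ just value
      value≥ : 0ℤ ℤ.≤ value

  nonneg-cons : ∀ {i s} x → Nonneg i s → Nonneg i (x ∷ s)
  nonneg-cons {i} {s} x (nn e q h) = go (eps1 i x) refl
    where
    go : ∀ m → eps1 i x ≡ m → Nonneg i (x ∷ s)
    go nothing  q' = nn e (cong₂ (λ a b → max∞ a (add∞ b (ℤ.- hw i s))) q q') h
    go (just d) q' = nn (e ℤ.⊔ (d ℤ.+ ℤ.- hw i s)) (cong₂ (λ a b → max∞ a (add∞ b (ℤ.- hw i s))) q q') (ℤP.≤-trans h (ℤP.i≤i⊔j e _))

  nonneg-++ : ∀ {i s} t → Nonneg i s → Nonneg i (t ++ s)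
  nonneg-++ []      h = h
  nonneg-++ (x ∷ t) h = nonneg-cons x (nonneg-++ t h)

  cartan-far : ∀ {i x} → suc i < x → cartan (suc i) (suc x) ≡ 0ℤ
  cartan-far {i} {x} h
    rewrite ≡ᵇ-no {i} {x} (<⇒≢ (<-trans (n<1+n i) h)) | ≡ᵇ-no {suc i} {x} (<⇒≢ h)
          | ≡ᵇ-no {suc x} {i} (λ e → <-asym h (subst (x <_) (cong suc e) (<-trans (n<1+n x) (n<1+n (suc x))))) = refl

  hw-blk-far : ∀ i x k g → suc i < x → hw (suc i) (blk x k g) ≡ 0ℤ
  hw-blk-far i x zero    g h = refl
  hw-blk-far i x (suc k) g h = cong₂ ℤ._+_
    (trans (cong ((ℤ.- (ℤ.+ Σ< (suc k) g)) ℤ.*_) (cartan-far h)) (ℤP.*-zeroʳ (ℤ.- (ℤ.+ Σ< (suc k) g))))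
    (hw-blk-far i (suc x) k g (m<n⇒m<1+n h))

  hw-blk-next : ∀ i k g → hw (suc i) (blk (suc i) k g) ≡ ℤ.+ Σ< k g
  hw-blk-next i zero    g = refl
  hw-blk-next i (suc k) g rewrite ≡ᵇ-no {i} {suc i} (1+n≢n ∘ sym) | ≡ᵇ-yes i =
    trans (cong (ℤ._+_ (ℤ.- S ℤ.* ℤ.-1ℤ)) (hw-blk-far i (suc (suc i)) k g ≤-refl)) (l S)
    where
    S = ℤ.+ Σ< (suc k) g
    l : ∀ z → ℤ.- z ℤ.* ℤ.-1ℤ ℤ.+ 0ℤ ≡ z
    l = solve-∀

  nonneg-head : ∀ i a s → 0ℤ ℤ.≤ ℤ.- a ℤ.+ ℤ.- hw i s → Nonneg i ((i , a) ∷ s)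
  nonneg-head i a s h = go (epsT i s) refl
    where
    go : ∀ m → epsT i s ≡ m → Nonneg i ((i , a) ∷ s)
    go nothing  q = nn _ (eps-cons-same∅ i a s q) h
    go (just e) q = nn _ (eps-cons-same i a s q) (ℤP.≤-trans h (ℤP.i≤j⊔i e (ℤ.- a ℤ.+ ℤ.- hw i s)))

  -- At root i + 1 the factor contributes its d, and the rest of the block takes away the next d;
  -- their difference is a multiplicity. One such candidate is enough, because ε of a tensor product
  -- is a maximum.
  nonneg-blk : ∀ i x k g → x ≤ i → i < x + k → Nonneg (suc i) (blk x k g)
  nonneg-blk i x zero    g h h' = ⊥-elim (<⇒≱ h' (subst (_≤ i) (sym (+-identityʳ x)) h))
  nonneg-blk i x (suc k) g h h' with x ≟ i
  ... | no ne = nonneg-cons _ (nonneg-blk i (suc x) k g (≤∧≢⇒< h ne) (subst (i <_) (+-suc x k) h'))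
  ... | yes refl = nonneg-head (suc i) _ (blk (suc i) k g)
      (subst (0ℤ ℤ.≤_) (sym (trans (cong₂ (λ u v → ℤ.- (ℤ.- u) ℤ.+ ℤ.- v) (ℤP.pos-+ (Σ< k g) (g k)) (hw-blk-next i k g)) (l (ℤ.+ Σ< k g) (ℤ.+ g k))))
        (ℤ.+≤+ z≤n))
    where
    l : ∀ s t → ℤ.- (ℤ.- (s ℤ.+ t)) ℤ.+ ℤ.- s ≡ t
    l = solve-∀

  -- `J` with every letter lowered by one, as i stands for α_{i+1}: the block added at `suc m`
  -- starts at r - (m + 1) - 1 = R - m.
  Js : ℕ → ℕ → List ℕ
  Js R zero    = []
  Js R (suc m) = Js R m ++ run (R ∸ m) (suc m)

  run-upTo : ∀ x k → map suc (run x k) ≡ map (λ t → suc (x + t)) (upTo k)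
  run-upTo x zero    = refl
  run-upTo x (suc k) = cong₂ _∷_ (cong suc (sym (+-identityʳ x))) (trans (run-upTo (suc x) k)
    (trans (map-cong (λ t → cong suc (sym (+-suc x t))) (upTo k)) (lem (λ t → suc (x + t)) k)))
    where
    open import Data.List using (applyUpTo)
    open import Data.List.Properties using (map-applyUpTo)
    lem : ∀ (g : ℕ → ℕ) k → map (λ t → g (suc t)) (upTo k) ≡ map g (applyUpTo suc k)
    lem g k = trans (map-applyUpTo (λ z → z) (λ t → g (suc t)) k) (sym (map-applyUpTo suc g k))

  Jword-Js : ∀ R → Jword (suc (suc R)) ≡ map suc (Js R (suc R))
  Jword-Js R = go (suc R) ≤-refl
    where
    open import Data.List.Properties using (upTo-∷ʳ)
    r = suc (suc R)
    b : ℕ → List ℕ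
    b m = map (λ t → (r ∸ m) + t) (upTo m)
    go : ∀ k → k ≤ suc R → concatMap b (map suc (upTo k)) ≡ map suc (Js R k)
    go zero    h = refl
    go (suc k) h = begin
      concatMap b (map suc (upTo (suc k)))               ≡⟨ cong (λ z → concatMap b (map suc z)) (sym (upTo-∷ʳ k)) ⟩
      concatMap b (map suc (upTo k ++ k ∷ []))           ≡⟨ cong (concatMap b) (map-++ suc (upTo k) (k ∷ [])) ⟩
      concatMap b (map suc (upTo k) ++ suc k ∷ [])       ≡⟨ concatMap-++ b (map suc (upTo k)) (suc k ∷ []) ⟩
      concatMap b (map suc (upTo k)) ++ (b (suc k) ++ []) ≡⟨ cong₂ _++_ (go k (≤-trans (n≤1+n k) h)) (++-identityʳ (b (suc k))) ⟩
      map suc (Js R k) ++ b (suc k)                      ≡⟨ cong (map suc (Js R k) ++_) (trans (map-cong (λ t → cong (_+ t) (+-∸-assoc 1 (s≤s⁻¹ h))) (upTo (suc k))) (sym (run-upTo (R ∸ k) (suc k)))) ⟩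
      map suc (Js R k) ++ map suc (run (R ∸ k) (suc k))  ≡⟨ sym (map-++ suc (Js R k) (run (R ∸ k) (suc k))) ⟩
      map suc (Js R k ++ run (R ∸ k) (suc k)) ∎
      where open ≡-Reasoning

  run-≤ : ∀ R x k → x + k ≤ suc R → All (_≤ R) (run x k)
  run-≤ R x zero    h = []
  run-≤ R x (suc k) h = s≤s⁻¹ (≤-trans (s≤s (m≤m+n x k)) (subst (_≤ suc R) (+-suc x k) h)) ∷ run-≤ R (suc x) k (subst (_≤ suc R) (+-suc x k) h)

  Js-≤ : ∀ R m → m ≤ suc R → All (_≤ R) (Js R m)
  Js-≤ R zero    h = []
  Js-≤ R (suc m) h = ++⁺ (Js-≤ R m (≤-trans (n≤1+n m) h)) (run-≤ R (R ∸ m) (suc m) (≤-reflexive (trans (+-suc (R ∸ m) m) (cong suc (m∸n+n≡m (s≤s⁻¹ h))))))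

  encs : (R m : ℕ) → Mat → State
  encs R zero    n = []
  encs R (suc m) n = encs R m n ++ blk (R ∸ m) (suc m) (n (R ∸ m))

  module Encoding (R : ℕ) where
    open Embedding R public

    module EndStrings   = Strings ends starts compatible
    module StartStrings = Strings starts ends (flipC compatible)
    module EP = Powers ends
    module SP = Powers starts

    -- In a sorted word the maximal lowering turns every - into +, so column c is emptied into
    -- column c + 1. The cell with x + c = R has no successor in the triangle: its simple segments
    -- disappear.
    lower-sorted : ∀ m {c n} → c ≤ R → Sorted (R ∸ c) (Q n c) (P n c) → epsC c n ≡ m →
      ∃ λ t → SP.lower m c (T n) ≡ T t × (∀ x → x ≤ R ∸ c → t x c ≡ 0) ×
              (∀ x → x < R ∸ c → t x (suc c) ≡ n x (suc c) + n x c) ×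
              (∀ x y → x + y ≤ R → y ≢ c → y ≢ suc c → t x y ≡ n x y)
    lower-sorted zero {c} {n} h S e = n , refl , z , (λ x k → sym (trans (cong (n x (suc c) +_) (z x (<⇒≤ k))) (+-identityʳ _))) , λ _ _ _ _ _ → refl
      where
      z : ∀ x → x ≤ R ∸ c → n x c ≡ 0
      z x k = Σ<-zero (suc (R ∸ c)) (trans (sym (sorted-eps (R ∸ c) (Q n c) (P n c) S)) (trans (sym (epsC-def c n)) e)) x (s≤s k)
    lower-sorted (suc m) {c} {n} h S e with lower-sorted m {c} {G c n} h (sorted-down S (draw D) B) e₁
      where
      pos' : 0 < epsC c n
      pos' = subst (0 <_) (sym e) z<s
      D = dposC c n
      B = bump h (G-step D pos')
      e₁ : epsC c (G c n) ≡ m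
      e₁ = suc-injective (trans (sym (epsC-F h)) (trans (epsC-cong h (F-G h pos')) e))
    ... | t , a , z , p , o = t , a , z
        , (λ x k → trans (p x k) (+-cancelʳ-≡ (ind (dposition c n) x) _ _ (tot x k)))
        , (λ x y k u v → trans (o x y k u v) (step-off S' k (inj₂ (u , v))))
      where
      S' = G-step (dposC c n) (subst (0 <_) (sym e) z<s)
      B = bump h S'
      tot : ∀ x → x < R ∸ c → G c n x (suc c) + G c n x c + ind (dposition c n) x ≡ n x (suc c) + n x c + ind (dposition c n) x
      tot x k = begin
        G c n x (suc c) + G c n x c + i                   ≡⟨ +-assoc (G c n x (suc c)) _ _ ⟩
        G c n x (suc c) + (G c n x c + i)                 ≡⟨ cong₂ _+_ (sym (proj₂ B x k)) (sym (proj₁ B x (<⇒≤ k))) ⟩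
        (n x (suc c) + i) + n x c                         ≡⟨ +-assoc (n x (suc c)) i _ ⟩
        n x (suc c) + (i + n x c)                         ≡⟨ cong (n x (suc c) +_) (+-comm i (n x c)) ⟩
        n x (suc c) + (n x c + i)                         ≡⟨ sym (+-assoc (n x (suc c)) _ _) ⟩
        n x (suc c) + n x c + i ∎
        where
        open ≡-Reasoning
        i = ind (dposition c n) x

    ZeroFrom : ℕ → Mat → Set
    ZeroFrom x n = ∀ a b → x ≤ a → a + b ≤ R → n a b ≡ 0

    -- With the later rows empty, the row word contains no + before +^∞ and is sorted. Its maximal
    -- string cuts the first root off every segment that starts at x + 1.
    row-top : ∀ {x} n → x ≤ R → ZeroFrom (suc x) n → Crystal.ε starts x n ≡ Σ< (suc (R ∸ x)) (n x) ×
              (∀ b → b ≤ R ∸ x → SP.top x n x b ≡ 0) × (∀ b → b < R ∸ x → SP.top x n (suc x) b ≡ n x b) ×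
              (∀ a b → a + b ≤ R → a ≢ x → a ≢ suc x → SP.top x n a b ≡ n a b)
    row-top {x} n h Z with lower-sorted (epsC x (T n)) {x} {T n} h S refl
      where
      S : Sorted (R ∸ x) (Q (T n) x) (P (T n) x)
      S a b u v = inj₁ (Z (suc x) a ≤-refl (+-flip {a} (in-col⁺ (<-≤-trans u v))))
    ... | t , e , z , p , o rewrite e = trans (epsC-def x (T n)) (sorted-eps (R ∸ x) (Q (T n) x) (P (T n) x) S)
        , z , (λ b k → trans (p b k) (cong (_+ n x b) (Z (suc x) b ≤-refl (+-flip {b} (in-col⁺ k)))))
        , λ a b k u v → o b a (+-flip {a} k) u v
      where
      S : Sorted (R ∸ x) (Q (T n) x) (P (T n) x)
      S a b u v = inj₁ (Z (suc x) a ≤-refl (+-flip {a} (in-col⁺ (<-≤-trans u v))))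

    open StartStrings using () renaming (St to St'; Res to Res'; St-cong to St'-cong; Res-cong to Res'-cong)

    -- Along x, x + 1, ..., R the segments of row x are consumed from the left. Each exponent is the
    -- number of segments that still reach that root.
    St-run : ∀ k x n → x + k ≡ suc R → ZeroFrom (suc x) n → St' (run x k) n ≡ blk x k (n x) ×
             ZeroFrom x (Res' (run x k) n) × (∀ a b → a < x → a + b ≤ R → Res' (run x k) n a b ≡ n a b)
    St-run zero x n e Z = refl , (λ a b u v → ⊥-elim (<⇒≱ (≤-trans (≤-reflexive (sym (trans (sym (+-identityʳ x)) e))) u) (≤-trans (m≤m+n a b) v))) , λ _ _ _ _ → refl
    St-run (suc k) x n e Z with row-top n x≤R Z | St-run k (suc x) (SP.top x n) (trans (sym (+-suc x k)) e) Z'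
      where
      x≤R : x ≤ R
      x≤R = s≤s⁻¹ (subst (suc x ≤_) (trans (sym (+-suc x k)) e) (s≤s (m≤m+n x k)))
      Z' : ZeroFrom (suc (suc x)) (SP.top x n)
      Z' a b u v = trans (proj₂ (proj₂ (proj₂ (row-top n x≤R Z))) a b v (λ { refl → <-irrefl refl (≤-trans (n≤1+n _) u) }) (λ { refl → <-irrefl refl u }))
                     (Z a b (≤-trans (n≤1+n _) u) v)
    ... | ε= , z , sft , off | s , zr , un = cong₂ (λ m y → (suc x , ℤ.- (ℤ.+ m)) ∷ y) (trans ε= (cong (λ L → Σ< (suc L) (n x)) L≡k))
            (trans s (blk-cong (suc x) k (λ b u → sft b (subst (b <_) (sym L≡k) u))))
        , zf , λ a b u v → trans (un a b (m<n⇒m<1+n u) v) (off a b v (<⇒≢ u) (<⇒≢ (m<n⇒m<1+n u)))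
      where
      L≡k : R ∸ x ≡ k
      L≡k = trans (cong (_∸ x) (suc-injective (trans (sym e) (trans (+-suc x k) (cong suc (+-comm x k)))))) (m+n∸n≡m k x)
      zf : ZeroFrom x (Res' (run x (suc k)) n)
      zf a b u v with x ≟ a
      ... | yes refl = trans (un x b ≤-refl v) (z b (m+n≤o⇒m≤o∸n b (+-flip {x} v)))
      ... | no  ne   = zr a b (≤∧≢⇒< u ne) v

    St-++ : ∀ as {bs n} → St' (as ++ bs) n ≡ St' as n ++ St' bs (Res' as n)
    St-++ []       = refl
    St-++ (a ∷ as) = cong (_ ∷_) (St-++ as)

    Res-++ : ∀ as {bs n} → Res' (as ++ bs) n ≡ Res' bs (Res' as n)
    Res-++ []       = refl
    Res-++ (a ∷ as) = Res-++ as

    -- The block order of `J` treats the rows from R down to 0, so all later rows are already empty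
    -- when a row is consumed, as `row-top` demands.
    St-rows : ∀ m n → m ≤ suc R → St' (Js R m) n ≡ encs R m n × ZeroFrom (suc R ∸ m) (Res' (Js R m) n) ×
              (∀ a b → a < suc R ∸ m → a + b ≤ R → Res' (Js R m) n a b ≡ n a b)
    St-rows zero    n h = refl , (λ a b u v → ⊥-elim (<⇒≱ u (≤-trans (m≤m+n a b) v))) , λ _ _ _ _ → refl
    St-rows (suc m) n h with St-rows m n (≤-trans (n≤1+n m) h)
    ... | s , z , un with St-run (suc m) (R ∸ m) (Res' (Js R m) n) (trans (+-suc (R ∸ m) m) (cong suc (m∸n+n≡m (s≤s⁻¹ h))))
                       (subst (λ t → ZeroFrom t (Res' (Js R m) n)) (+-∸-assoc 1 (s≤s⁻¹ h)) z)
    ... | s' , z' , un' = trans (St-++ (Js R m)) (cong₂ _++_ s (trans s' (blk-cong (R ∸ m) (suc m) λ b u → un (R ∸ m) b lt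
              (≤-trans (+-monoʳ-≤ (R ∸ m) (s≤s⁻¹ u)) (≤-reflexive (m∸n+n≡m (s≤s⁻¹ h)))))))
        , (λ a b u v → trans (cong (λ g → g a b) (Res-++ (Js R m))) (z' a b u v))
        , λ a b u v → trans (cong (λ g → g a b) (Res-++ (Js R m))) (trans (un' a b u v) (un a b (<-≤-trans u (<⇒≤ lt)) v))
      where
      lt : R ∸ m < suc R ∸ m
      lt = subst (R ∸ m <_) (sym (+-∸-assoc 1 (s≤s⁻¹ h))) ≤-refl

    Jr : List ℕ
    Jr = Js R (suc R)

    J-≤ : All (_≤ R) Jr
    J-≤ = Js-≤ R (suc R) ≤-refl

    enc : Mat → State
    enc = encs R (suc R)

    enc-St : ∀ n → St' Jr n ≡ enc n
    enc-St n = proj₁ (St-rows (suc R) n ≤-refl)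

    enc-Res : ∀ n → Res' Jr n ≈ 𝟎
    enc-Res n = pw λ a b h → proj₁ (proj₂ (St-rows (suc R) n ≤-refl)) a b (subst (_≤ a) (sym (n∸n≡0 R)) z≤n) h

    enc-cong : ∀ {n m} → n ≈ m → enc n ≡ enc m
    enc-cong {n} {m} e = trans (sym (enc-St n)) (trans (St'-cong J-≤ e) (enc-St m))

    enc-nonneg : ∀ {i} n → i ≤ R → Nonneg (suc i) (enc n)
    enc-nonneg {i} n h = nonneg-++ (encs R R n) (nonneg-blk i (R ∸ R) (suc R) (n (R ∸ R)) (subst (_≤ i) (sym (n∸n≡0 R)) z≤n) (≤-trans (s≤s h) (m≤n+m (suc R) (R ∸ R))))

    -- The coordinates of `n` are its string for `starts`, on which `embed` lets the operators of
    -- `ends` act by the tensor rule. This identifies the given crystal with multisegments.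
    fT-enc : ∀ {i} n → i ≤ R → FView (suc i) (enc n) (enc (Crystal.f ends i n))
    fT-enc {i} n h with enc-nonneg n h
    ... | nn e q k = subst₂ (FView (suc i)) (enc-St n) (enc-St (Crystal.f ends i n))
      (proj₁ (StartStrings.embed h J-≤ (enc-Res n) (trans (cong (epsT (suc i)) (enc-St n)) q) k))

-- The degenerate Hecke algebra acting on one-line notation

module HeckeAction where
  open import Defs
  open import Data.Bool using (true; false; if_then_else_)
  open import Data.Nat
  open import Data.Nat.Properties
  open import Data.List using (List; []; _∷_)
  open import Data.List.Properties using (map-∘; map-cong; map-id)
  open import Data.List.Relation.Unary.All using ([]; _∷_)
  open import Data.Unit using (tt)
  open import Data.Bool using (T)
  open TensorProducts using (≡ᵇ-yes; ≡ᵇ-no)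

  <ᵇ-yes : ∀ {x y} → x < y → (x <ᵇ y) ≡ true
  <ᵇ-yes {x} {y} h with x <ᵇ y | <⇒<ᵇ h
  ... | true | _ = refl

  <ᵇ-no : ∀ {x y} → ¬ x < y → (x <ᵇ y) ≡ false
  <ᵇ-no {x} {y} h with x <ᵇ y in q
  ... | false = refl
  ... | true  = ⊥-elim (h (<ᵇ⇒< x y (subst T (sym q) tt)))

  sw : ℕ → ℕ → ℕ
  sw k = swapVal (suc k)

  sw-k : ∀ k → sw k k ≡ suc k
  sw-k k rewrite ≡ᵇ-yes k = refl

  sw-suc : ∀ k → sw k (suc k) ≡ k
  sw-suc k rewrite ≡ᵇ-no {suc k} {k} 1+n≢n | ≡ᵇ-yes k = refl

  sw-off : ∀ {k x} → x ≢ k → x ≢ suc k → sw k x ≡ x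
  sw-off a b rewrite ≡ᵇ-no a | ≡ᵇ-no b = refl

  data SwView (k x : ℕ) : Set where
    lo  : x ≡ k → SwView k x
    hi  : x ≡ suc k → SwView k x
    off : x ≢ k → x ≢ suc k → SwView k x

  swView : ∀ k x → SwView k x
  swView k x with x ≟ k | x ≟ suc k
  ... | yes a | _     = lo a
  ... | no _  | yes b = hi b
  ... | no a  | no b  = off a b

  sw-inv : ∀ k x → sw k (sw k x) ≡ x
  sw-inv k x with swView k x
  ... | lo refl  = trans (cong (sw k) (sw-k k)) (sw-suc k)
  ... | hi refl  = trans (cong (sw k) (sw-suc k)) (sw-k k)
  ... | off a b  = trans (cong (sw k) (sw-off a b)) (sw-off a b)

  sL-inv : ∀ k w → sL (suc k) (sL (suc k) w) ≡ w
  sL-inv k w = trans (sym (map-∘ w)) (trans (map-cong (sw-inv k) w) (map-id w))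

  -- The inverse permutation, w⁻¹(x). With values counted from 0, s_{k+1} w > w means w⁻¹(k) < w⁻¹(k
  -- + 1), so lengths can be avoided.
  idx : ℕ → List ℕ → ℕ
  idx x []       = 0
  idx x (y ∷ ys) = if x ≡ᵇ y then 0 else suc (idx x ys)

  idx-sL : ∀ k x w → idx x (sL (suc k) w) ≡ idx (sw k x) w
  idx-sL k x []       = refl
  idx-sL k x (y ∷ ys) with x ≟ sw k y
  ... | yes refl rewrite ≡ᵇ-yes (sw k y) | sw-inv k y | ≡ᵇ-yes y = refl
  ... | no ne rewrite ≡ᵇ-no ne | ≡ᵇ-no {sw k x} {y} (λ e → ne (trans (sym (sw-inv k x)) (cong (sw k) e))) = cong suc (idx-sL k x ys)

  -- Tx k and Td k act on one-line notation as the Demazure operators for s_{k+1},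
  -- going up and down respectively.
  Tx Td : ℕ → Perm → Perm
  Tx k w = if idx k w <ᵇ idx (suc k) w then sL (suc k) w else w
  Td k w = if idx (suc k) w <ᵇ idx k w then sL (suc k) w else w

  Tx-yes : ∀ {k w a b} → idx k w ≡ a → idx (suc k) w ≡ b → a < b → Tx k w ≡ sL (suc k) w
  Tx-yes refl refl h rewrite <ᵇ-yes h = refl

  Tx-no : ∀ {k w a b} → idx k w ≡ a → idx (suc k) w ≡ b → ¬ a < b → Tx k w ≡ w
  Tx-no refl refl h rewrite <ᵇ-no h = refl

  Td-yes : ∀ {k w a b} → idx k w ≡ a → idx (suc k) w ≡ b → b < a → Td k w ≡ sL (suc k) w
  Td-yes refl refl h rewrite <ᵇ-yes h = refl

  Td-no : ∀ {k w a b} → idx k w ≡ a → idx (suc k) w ≡ b → ¬ b < a → Td k w ≡ w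
  Td-no refl refl h rewrite <ᵇ-no h = refl

  idx-lo : ∀ k w → idx k (sL (suc k) w) ≡ idx (suc k) w
  idx-lo k w = trans (idx-sL k k w) (cong (λ x → idx x w) (sw-k k))

  idx-hi : ∀ k w → idx (suc k) (sL (suc k) w) ≡ idx k w
  idx-hi k w = trans (idx-sL k (suc k) w) (cong (λ x → idx x w) (sw-suc k))

  idx-off : ∀ {k x} w → x ≢ k → x ≢ suc k → idx x (sL (suc k) w) ≡ idx x w
  idx-off {k} {x} w a b = trans (idx-sL k x w) (cong (λ x → idx x w) (sw-off a b))

  Tx-idem : ∀ k w → Tx k (Tx k w) ≡ Tx k w
  Tx-idem k w with idx k w <? idx (suc k) w
  ... | no h  = cong (Tx k) (Tx-no {k} {w} refl refl h)
  ... | yes h = trans (cong (Tx k) e) (trans (Tx-no (idx-lo k w) (idx-hi k w) (<-asym h)) (sym e))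
    where e = Tx-yes {k} {w} refl refl h

  module _ {k l : ℕ} (h : suc k < l) where
    private
      l≢k : l ≢ k
      l≢k refl = <-asym h (n<1+n k)
      l≢k' : l ≢ suc k
      l≢k' refl = <-irrefl refl h
      sl≢k : suc l ≢ k
      sl≢k refl = <-asym h (<-trans (n<1+n l) (n<1+n (suc l)))
      sl≢k' : suc l ≢ suc k
      sl≢k' = l≢k ∘ suc-injective

    sw-comm : ∀ x → sw k (sw l x) ≡ sw l (sw k x)
    sw-comm x with swView k x | swView l x
    ... | lo refl | lo e = ⊥-elim (l≢k (sym e))
    ... | lo refl | hi e = ⊥-elim (sl≢k (sym e))
    ... | lo refl | off a b = trans (cong (sw k) (sw-off a b)) (trans (sw-k k) (sym (trans (cong (sw l) (sw-k k)) (sw-off (l≢k' ∘ sym) (sl≢k' ∘ sym)))))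
    ... | hi refl | lo e = ⊥-elim (l≢k' (sym e))
    ... | hi refl | hi e = ⊥-elim (sl≢k' (sym e))
    ... | hi refl | off a b = trans (cong (sw k) (sw-off a b)) (trans (sw-suc k) (sym (trans (cong (sw l) (sw-suc k)) (sw-off (l≢k ∘ sym) (sl≢k ∘ sym)))))
    ... | off a b | lo refl = trans (cong (sw k) (sw-k l)) (trans (sw-off sl≢k sl≢k') (sym (trans (cong (sw l) (sw-off a b)) (sw-k l))))
    ... | off a b | hi refl = trans (cong (sw k) (sw-suc l)) (trans (sw-off l≢k l≢k') (sym (trans (cong (sw l) (sw-off a b)) (sw-suc l))))
    ... | off a b | off c d = trans (cong (sw k) (sw-off c d)) (trans (sw-off a b) (sym (trans (cong (sw l) (sw-off a b)) (sw-off c d))))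

    sL-comm : ∀ w → sL (suc k) (sL (suc l) w) ≡ sL (suc l) (sL (suc k) w)
    sL-comm w = trans (sym (map-∘ w)) (trans (map-cong sw-comm w) (map-∘ w))

    Tx-comm : ∀ w → Tx k (Tx l w) ≡ Tx l (Tx k w)
    Tx-comm w with idx k w <? idx (suc k) w | idx l w <? idx (suc l) w
    ... | yes a | yes b = trans (cong (Tx k) (Tx-yes {l} {w} refl refl b)) (trans (Tx-yes ik ik' a)
          (trans (sL-comm w) (sym (trans (cong (Tx l) (Tx-yes {k} {w} refl refl a)) (Tx-yes il il' b)))))
      where
      ik = idx-off {l} {k} w (l≢k ∘ sym) (sl≢k ∘ sym)
      ik' = idx-off {l} {suc k} w (l≢k' ∘ sym) (sl≢k' ∘ sym)
      il = idx-off {k} {l} w l≢k l≢k'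
      il' = idx-off {k} {suc l} w sl≢k sl≢k'
    ... | yes a | no b = trans (cong (Tx k) (Tx-no {l} {w} refl refl b)) (trans (Tx-yes {k} {w} refl refl a)
          (sym (trans (cong (Tx l) (Tx-yes {k} {w} refl refl a)) (Tx-no (idx-off {k} {l} w l≢k l≢k') (idx-off {k} {suc l} w sl≢k sl≢k') b))))
    ... | no a | yes b = trans (cong (Tx k) (Tx-yes {l} {w} refl refl b)) (trans (Tx-no (idx-off {l} {k} w (l≢k ∘ sym) (sl≢k ∘ sym)) (idx-off {l} {suc k} w (l≢k' ∘ sym) (sl≢k' ∘ sym)) a)
          (sym (trans (cong (Tx l) (Tx-no {k} {w} refl refl a)) (Tx-yes {l} {w} refl refl b))))
    ... | no a | no b = trans (cong (Tx k) (Tx-no {l} {w} refl refl b)) (trans (Tx-no {k} {w} refl refl a)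
          (sym (trans (cong (Tx l) (Tx-no {k} {w} refl refl a)) (Tx-no {l} {w} refl refl b))))

  module _ (k : ℕ) where
    private
      s₁ = sL (suc k)
      s₂ = sL (suc (suc k))
      T₁ = Tx k
      T₂ = Tx (suc k)

      record Loc (w : Perm) (a b c : ℕ) : Set where
        constructor loc
        field
          i₀ : idx k w ≡ a
          i₁ : idx (suc k) w ≡ b
          i₂ : idx (suc (suc k)) w ≡ c

      L₁ : ∀ {w a b c} → Loc w a b c → Loc (s₁ w) b a c
      L₁ {w} (loc a b c) = loc (trans (idx-lo k w) b) (trans (idx-hi k w) a)
        (trans (idx-off {k} w (λ e → <-irrefl (sym e) (<-trans (n<1+n k) (n<1+n (suc k)))) 1+n≢n) c)

      L₂ : ∀ {w a b c} → Loc w a b c → Loc (s₂ w) a c b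
      L₂ {w} (loc a b c) = loc
        (trans (idx-off {suc k} w (1+n≢n ∘ sym) (λ e → <-irrefl e (<-trans (n<1+n k) (n<1+n (suc k))))) a)
        (trans (idx-lo (suc k) w) c) (trans (idx-hi (suc k) w) b)

      y₁ : ∀ {w a b c} → Loc w a b c → a < b → T₁ w ≡ s₁ w
      y₁ (loc a b c) h = Tx-yes a b h
      n₁ : ∀ {w a b c} → Loc w a b c → ¬ a < b → T₁ w ≡ w
      n₁ (loc a b c) h = Tx-no a b h
      y₂ : ∀ {w a b c} → Loc w a b c → b < c → T₂ w ≡ s₂ w
      y₂ (loc a b c) h = Tx-yes b c h
      n₂ : ∀ {w a b c} → Loc w a b c → ¬ b < c → T₂ w ≡ w
      n₂ (loc a b c) h = Tx-no b c h

      sw-braid : ∀ x → sw k (sw (suc k) (sw k x)) ≡ sw (suc k) (sw k (sw (suc k) x))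
      sw-braid x with swView k x | x ≟ suc (suc k)
      ... | lo refl | _ = trans (cong (sw k) (trans (cong (sw (suc k)) (sw-k k)) (sw-k (suc k))))
            (trans (sw-off e₂ 1+n≢n) (sym (trans (cong (λ z → sw (suc k) (sw k z)) (sw-off (1+n≢n ∘ sym) (e₂ ∘ sym)))
               (trans (cong (sw (suc k)) (sw-k k)) (sw-k (suc k))))))
        where
        e₂ : suc (suc k) ≢ k
        e₂ e = <-irrefl (sym e) (<-trans (n<1+n k) (n<1+n (suc k)))
      ... | hi refl | _ = trans (cong (sw k) (trans (cong (sw (suc k)) (sw-suc k)) (sw-off (1+n≢n ∘ sym) (e₂ ∘ sym))))
            (trans (sw-k k) (sym (trans (cong (λ z → sw (suc k) (sw k z)) (sw-k (suc k)))
               (trans (cong (sw (suc k)) (sw-off e₂ 1+n≢n)) (sw-suc (suc k))))))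
        where
        e₂ : suc (suc k) ≢ k
        e₂ e = <-irrefl (sym e) (<-trans (n<1+n k) (n<1+n (suc k)))
      ... | off a b | yes refl = trans (cong (λ z → sw k (sw (suc k) z)) (sw-off a b)) (trans (cong (sw k) (sw-suc (suc k)))
            (trans (sw-suc k) (sym (trans (cong (λ z → sw (suc k) (sw k z)) (sw-suc (suc k))) (trans (cong (sw (suc k)) (sw-suc k)) (sw-off (1+n≢n ∘ sym) (a ∘ sym)))))))
      ... | off a b | no c = trans (cong (λ z → sw k (sw (suc k) z)) (sw-off a b)) (trans (cong (sw k) (sw-off b c))
            (trans (sw-off a b) (sym (trans (cong (λ z → sw (suc k) (sw k z)) (sw-off b c)) (trans (cong (sw (suc k)) (sw-off a b)) (sw-off b c))))))

      sL-braid : ∀ w → s₁ (s₂ (s₁ w)) ≡ s₂ (s₁ (s₂ w))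
      sL-braid w = trans (cong s₁ (sym (map-∘ w))) (trans (sym (map-∘ w)) (trans (map-cong sw-braid w) (trans (map-∘ w) (cong s₂ (map-∘ w)))))

      _then_ : ∀ {A : Set} {x y z : A} → x ≡ y → y ≡ z → x ≡ z
      _then_ = trans
      infixr 5 _then_

    -- Only the positions of the values k, k + 1, k + 2 matter, and both sides rearrange these
    -- values so that the largest comes first and the smallest last.
    Tx-braid : ∀ w → T₁ (T₂ (T₁ w)) ≡ T₂ (T₁ (T₂ w))
    Tx-braid w = go (loc refl refl refl) (a <? b) (b <? c) (a <? c)
      where
      a = idx k w
      b = idx (suc k) w
      c = idx (suc (suc k)) w
      go : Loc w a b c → Dec (a < b) → Dec (b < c) → Dec (a < c) → T₁ (T₂ (T₁ w)) ≡ T₂ (T₁ (T₂ w))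
      go L (yes ab) (yes bc) (no ac) = ⊥-elim (ac (<-trans ab bc))
      go L (yes ab) (yes bc) (yes ac) =
        cong (T₁ ∘ T₂) (y₁ L ab) then cong T₁ (y₂ (L₁ L) ac) then y₁ (L₂ (L₁ L)) bc then sL-braid w then
        sym (cong (T₂ ∘ T₁) (y₂ L bc) then cong T₂ (y₁ (L₂ L) ac) then y₂ (L₁ (L₂ L)) ab)
      go L (yes ab) (no bc) (yes ac) =
        cong (T₁ ∘ T₂) (y₁ L ab) then cong T₁ (y₂ (L₁ L) ac) then n₁ (L₂ (L₁ L)) bc then
        sym (cong (T₂ ∘ T₁) (n₂ L bc) then cong T₂ (y₁ L ab) then y₂ (L₁ L) ac)
      go L (yes ab) (no bc) (no ac) =
        cong (T₁ ∘ T₂) (y₁ L ab) then cong T₁ (n₂ (L₁ L) ac) then n₁ (L₁ L) (<-asym ab) then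
        sym (cong (T₂ ∘ T₁) (n₂ L bc) then cong T₂ (y₁ L ab) then n₂ (L₁ L) ac)
      go L (no ab) (yes bc) (yes ac) =
        cong (T₁ ∘ T₂) (n₁ L ab) then cong T₁ (y₂ L bc) then y₁ (L₂ L) ac then
        sym (cong (T₂ ∘ T₁) (y₂ L bc) then cong T₂ (y₁ (L₂ L) ac) then n₂ (L₁ (L₂ L)) ab)
      go L (no ab) (yes bc) (no ac) =
        cong (T₁ ∘ T₂) (n₁ L ab) then cong T₁ (y₂ L bc) then n₁ (L₂ L) ac then
        sym (cong (T₂ ∘ T₁) (y₂ L bc) then cong T₂ (n₁ (L₂ L) ac) then n₂ (L₂ L) (<-asym bc))
      go L (no ab) (no bc) (yes ac) = ⊥-elim (<⇒≱ ac (≤-trans (≮⇒≥ bc) (≮⇒≥ ab)))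
      go L (no ab) (no bc) (no ac) =
        cong (T₁ ∘ T₂) (n₁ L ab) then cong T₁ (n₂ L bc) then n₁ L ab then
        sym (cong (T₂ ∘ T₁) (n₂ L bc) then cong T₂ (n₁ L ab) then n₂ L bc)

-- The word of absent segments under the crystal operators

module BlockWords where
  open import Defs
  open import Data.Nat
  open import Data.Nat.Properties
  open import Data.List using (List; []; _∷_; _++_; map; foldr)
  open import Data.List.Properties using (foldr-++; ++-assoc)
  open import Data.List.Relation.Unary.All as All using (All; []; _∷_)
  open import Data.List.Relation.Unary.All.Properties using (++⁺)
  open Brackets
  open BracketCorners
  open Triangles
  open Weights hiding (lt)
  open DoubleCrystal
  open HeckeAction

  act : List ℕ → Perm → Perm
  act W π = foldr (λ j → Tx (pred j)) π W

  act-++ : ∀ U V π → act (U ++ V) π ≡ act U (act V π)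
  act-++ U V π = foldr-++ (λ j → Tx (pred j)) π U V

  opt : ℕ → ℕ → List ℕ
  opt zero    j = j ∷ []
  opt (suc _) j = []

  -- The letters S_p, S_{p+1}, … of a block, read from the entry g (k - 1) down to g 0.
  rowW : ℕ → ℕ → (ℕ → ℕ) → List ℕ
  rowW zero    p g = []
  rowW (suc k) p g = opt (g k) p ++ rowW k (suc p) g

  -- For N = R + 1, row x is the factor Ω_{r-1-x}, and its letter S_j belongs to the segment
  -- [x + 1 , x + j].
  Wd : ℕ → Mat → List ℕ
  Wd zero    n = []
  Wd (suc N) n = rowW (suc N) 1 (n 0) ++ Wd N (λ x → n (suc x))

  rowW-cong : ∀ k p {g h} → (∀ y → y < k → g y ≡ h y) → rowW k p g ≡ rowW k p h
  rowW-cong zero    p e = refl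
  rowW-cong (suc k) p e = cong₂ _++_ (cong (λ v → opt v p) (e k ≤-refl)) (rowW-cong k (suc p) λ y h → e y (m<n⇒m<1+n h))

  Wd-cong : ∀ N {n m : Mat} → (∀ x y → x + y < N → n x y ≡ m x y) → Wd N n ≡ Wd N m
  Wd-cong zero    e = refl
  Wd-cong (suc N) e = cong₂ _++_ (rowW-cong (suc N) 1 (e 0)) (Wd-cong N λ x y h → e (suc x) y (s≤s h))

  rowW-split : ∀ a k p g → rowW (a + k) p g ≡ rowW a p (λ y → g (y + k)) ++ rowW k (a + p) g
  rowW-split zero    k p g = refl
  rowW-split (suc a) k p g = trans (cong (opt (g (a + k)) p ++_) (trans (rowW-split a k (suc p) g)
      (cong (λ z → rowW a (suc p) (λ y → g (y + k)) ++ rowW k z g) (+-suc a p))))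
    (sym (++-assoc (opt (g (a + k)) p) _ _))

  Between : ℕ → ℕ → ℕ → Set
  Between a b j = a ≤ j × j < b

  opt-between : ∀ {a b j} v → Between a b j → All (Between a b) (opt v j)
  opt-between zero    h = h ∷ []
  opt-between (suc _) h = []

  rowW-between : ∀ k p g → All (Between p (k + p)) (rowW k p g)
  rowW-between zero    p g = []
  rowW-between (suc k) p g = ++⁺ (opt-between (g k) (≤-refl , s≤s (m≤n+m p k)))
    (All.map (λ { {j} (a , b) → <⇒≤ a , subst (j <_) (+-suc k p) b }) (rowW-between k (suc p) g))

  Wd-between : ∀ N n → All (Between 1 (suc N)) (Wd N n)
  Wd-between zero    n = []
  Wd-between (suc N) n = ++⁺ (All.map (λ { {j} (a , b) → a , subst (j <_) (+-comm (suc N) 1) b }) (rowW-between (suc N) 1 (n 0)))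
    (All.map (λ { (a , b) → a , m<n⇒m<1+n b }) (Wd-between N (λ x → n (suc x))))

  Far : ℕ → ℕ → Set
  Far k j = suc k < pred j ⊎ suc (pred j) < k

  far-Tx : ∀ {k j} → Far k j → ∀ w → Tx k (Tx (pred j) w) ≡ Tx (pred j) (Tx k w)
  far-Tx (inj₁ h) w = Tx-comm h w
  far-Tx (inj₂ h) w = sym (Tx-comm h w)

  far-act : ∀ {k W} → All (Far k) W → ∀ w → Tx k (act W w) ≡ act W (Tx k w)
  far-act []       w = refl
  far-act {k} {j ∷ W} (h ∷ hs) w = trans (far-Tx {k} {j} h (act W w)) (cong (Tx (pred j)) (far-act hs w))

  row-split : ∀ L c g V π → act (rowW (L + suc (suc c)) 1 g ++ V) π ≡
              act (rowW L 1 (λ y → g (y + suc (suc c)))) (act (opt (g (suc c)) (suc L)) (act (opt (g c) (suc (suc L))) (act (rowW c (suc (suc (suc L))) g) (act V π))))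
  row-split L c g V π = begin
    act (rowW (L + suc (suc c)) 1 g ++ V) π           ≡⟨ act-++ (rowW (L + suc (suc c)) 1 g) V π ⟩
    act (rowW (L + suc (suc c)) 1 g) v                ≡⟨ cong (λ W → act W v) (trans (rowW-split L (suc (suc c)) 1 g) (cong (λ z → rowW L 1 (λ y → g (y + suc (suc c))) ++ rowW (suc (suc c)) z g) (+-comm L 1))) ⟩
    act (A ++ (opt (g (suc c)) (suc L) ++ (opt (g c) (suc (suc L)) ++ B))) v ≡⟨ act-++ A _ v ⟩
    act A (act (opt (g (suc c)) (suc L) ++ (opt (g c) (suc (suc L)) ++ B)) v) ≡⟨ cong (act A) (trans (act-++ (opt (g (suc c)) (suc L)) _ v) (cong (act (opt (g (suc c)) (suc L))) (act-++ (opt (g c) (suc (suc L))) B v))) ⟩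
    act A (act (opt (g (suc c)) (suc L)) (act (opt (g c) (suc (suc L))) (act B v))) ∎
    where
    open ≡-Reasoning
    v = act V π
    A = rowW L 1 (λ y → g (y + suc (suc c)))
    B = rowW c (suc (suc (suc L))) g

  -- One block A·S_m^{[p=0]}·S_{m+1}^{[q=0]}·B of the word; t = S_m and s = S_{m+1}.
  module Block (L c : ℕ) (g : ℕ → ℕ) where
    A B : Perm → Perm
    A = act (rowW L 1 (λ y → g (y + suc (suc c))))
    B = act (rowW c (suc (suc (suc L))) g)
    t s : Perm → Perm
    t = Tx L
    s = Tx (suc L)

    sA : ∀ w → s (A w) ≡ A (s w)
    sA = far-act (All.map (λ { {suc j} (_ , b) → inj₂ (subst (suc j <_) (+-comm L 1) b) ; {zero} (() , _) }) (rowW-between L 1 _))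

    tB : ∀ w → t (B w) ≡ B (t w)
    tB = far-act (All.map (λ { {suc j} (a , _) → inj₁ (s≤s⁻¹ a) ; {zero} (() , _) }) (rowW-between c (suc (suc (suc L))) g))

    sAs : ∀ w → s (A (s w)) ≡ A (s w)
    sAs w = trans (sA (s w)) (cong A (Tx-idem (suc L) w))

    sAts : ∀ w → s (A (t (s (B w)))) ≡ A (t (s (B (t w))))
    sAts w = trans (sA _) (cong A (trans (sym (Tx-braid L (B w))) (cong (t ∘ s) (tB w))))

  act-opt : ∀ {v} j → v ≡ 0 → ∀ w → act (opt v j) w ≡ Tx (pred j) w
  act-opt j refl w = refl

  act-opt⁺ : ∀ {v} j → 0 < v → ∀ w → act (opt v j) w ≡ w
  act-opt⁺ {suc v} j h w = refl

  shM : Mat → Mat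
  shM n x = n (suc x)

  row-Block : ∀ L c n π → act (Wd (suc (L + suc c)) n) π ≡
    Block.A L c (n 0) (act (opt (n 0 (suc c)) (suc L)) (act (opt (n 0 c) (suc (suc L))) (Block.B L c (n 0) (act (Wd (L + suc c) (shM n)) π))))
  row-Block L c n π = trans (cong (λ z → act (rowW z 1 (n 0) ++ Wd (L + suc c) (shM n)) π) (sym (+-suc L (suc c)))) (row-split L c (n 0) _ π)

  -- The generator passes `A` and meets its own letter s, which is present as q = 0. If t is absent,
  -- idempotency finishes. If t is present, sts = tst sends a t through `B` into the remaining rows,
  -- which absorb it by induction: p = 0 leaves no - surviving there.
  word-fix : ∀ L c n π → eps L (Q n c) (P n c) ≡ 0 → Tx L (act (Wd (suc (L + c)) n) π) ≡ act (Wd (suc (L + c)) n) π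
  word-fix zero    c n π h rewrite h = Tx-idem 0 (act (rowW c 2 (n 0) ++ Wd c (shM n)) π)
  word-fix (suc L) c n π h = subst (λ N → s (act (Wd (suc N) n) π) ≡ act (Wd (suc N) n) π) (+-suc L c) (begin
    s (act (Wd (suc (L + suc c)) n) π)                             ≡⟨ cong s (row-Block L c n π) ⟩
    s (A (act (opt p (suc L)) (act (opt q (suc (suc L))) (B V)))) ≡⟨ cong (λ z → s (A (act (opt p (suc L)) z))) (act-opt (suc (suc L)) q0 (B V)) ⟩
    s (A (act (opt p (suc L)) (s (B V))))                          ≡⟨ go p refl ⟩
    A (act (opt p (suc L)) (s (B V)))                              ≡⟨ cong (λ z → A (act (opt p (suc L)) z)) (sym (act-opt (suc (suc L)) q0 (B V))) ⟩
    A (act (opt p (suc L)) (act (opt q (suc (suc L))) (B V)))      ≡⟨ sym (row-Block L c n π) ⟩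
    act (Wd (suc (L + suc c)) n) π ∎)
    where
    open Block L c (n 0)
    open ≡-Reasoning
    p = n 0 (suc c)
    q = n 0 c
    V = act (Wd (L + suc c) (shM n)) π
    q0 : q ≡ 0
    q0 = m+n≡0⇒m≡0 q h
    e1 : eps L (Q (shM n) c) (P (shM n) c) ≤ p
    e1 = m∸n≡0⇒m≤n (m+n≡0⇒n≡0 q h)
    tV : p ≡ 0 → t V ≡ V
    tV e = subst (λ N → t (act (Wd N (shM n)) π) ≡ act (Wd N (shM n)) π) (sym (+-suc L c)) (word-fix L c (shM n) π (n≤0⇒n≡0 (subst (eps L (Q (shM n) c) (P (shM n) c) ≤_) e e1)))
    go : ∀ v → p ≡ v → s (A (act (opt v (suc L)) (s (B V)))) ≡ A (act (opt v (suc L)) (s (B V)))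
    go zero    e = trans (sAts V) (cong (λ z → A (t (s (B z)))) (tV e))
    go (suc v) e = sAs (B V)

  module _ where
    open Triangle

    Step-sh : ∀ {R X c n m} → Step (suc R) (suc X) c n m → Step R X c (shM n) (shM m)
    Step-sh S = st λ x y h → eqn S (suc x) y (s≤s h)

    step-row : ∀ {R X c n m} → Step R (suc X) c n m → ∀ y → y ≤ R → n 0 y ≡ m 0 y
    step-row {R} {n = n} {m} S y h = step-off R {n = n} {m} S h (inj₁ λ ())

    step-rest : ∀ {R c n m} → Step R 0 c n m → ∀ x y → suc x + y ≤ R → shM n x y ≡ shM m x y
    step-rest {R} {n = n} {m} S x y h = step-off R {n = n} {m} S h (inj₁ λ ())

    -- The step makes cell (X , c) positive, which deletes its letter s if present, and may make (X
    -- , c + 1) zero, which inserts a t. The new t is absorbed by `word-fix`, and a lost s is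
    -- supplied by the generator on the left. For positive ε the product itself does not change.
    word-step : ∀ L c {n m π X} → Pos L (Q n c) (P n c) X → Step (L + c) X c n m →
      Tx L (act (Wd (suc (L + c)) m) π) ≡ Tx L (act (Wd (suc (L + c)) n) π) ×
      (0 < eps L (Q n c) (P n c) → act (Wd (suc (L + c)) m) π ≡ act (Wd (suc (L + c)) n) π)
    word-step zero c {n} {m} {π} stop S = a , b
      where
      rest : rowW c 2 (m 0) ++ Wd c (shM m) ≡ rowW c 2 (n 0) ++ Wd c (shM n)
      rest = cong₂ _++_ (rowW-cong c 2 λ y h → sym (step-off c {n = n} {m} S (<⇒≤ h) (inj₂ (<⇒≢ h , <⇒≢ (m<n⇒m<1+n h)))))
                        (Wd-cong c λ x y h → sym (step-rest {n = n} {m} S x y h))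
      w = act (rowW c 2 (n 0) ++ Wd c (shM n)) π
      inc : m 0 c ≡ suc (n 0 c)
      inc = step-inc c {n = n} {m} S ≤-refl
      em : act (Wd (suc c) m) π ≡ w
      em rewrite inc = cong (λ W → act W π) rest
      en : ∀ v → n 0 c ≡ v → Tx 0 w ≡ Tx 0 (act (Wd (suc c) n) π)
      en zero    e rewrite e = sym (Tx-idem 0 w)
      en (suc v) e rewrite e = refl
      a = trans (cong (Tx 0) em) (en (n 0 c) refl)
      b : 0 < n 0 c → act (Wd (suc c) m) π ≡ act (Wd (suc c) n) π
      b h = trans em (lem (n 0 c) refl h)
        where
        lem : ∀ v → n 0 c ≡ v → 0 < v → w ≡ act (Wd (suc c) n) π
        lem (suc v) e h rewrite e = refl
    word-step (suc L) c {n} {m} {π} {X} Ps S =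
      subst (λ N → s (act (Wd (suc N) m) π) ≡ s (act (Wd (suc N) n) π) ×
                   (0 < q + (e₁ ∸ p) → act (Wd (suc N) m) π ≡ act (Wd (suc N) n) π)) (+-suc L c)
        (go Ps (subst (λ z → Step z X c n m) (sym (+-suc L c)) S))
      where
      module N = Block L c (n 0)
      module M = Block L c (m 0)
      open N using (t; s; sA; tB; sAs; sAts)
      R' = L + suc c
      p = n 0 (suc c)
      q = n 0 c
      Vn = act (Wd R' (shM n)) π
      Vm = act (Wd R' (shM m)) π
      e₁ = eps L (Q (shM n) c) (P (shM n) c)
      lhs rhs : Perm
      lhs = act (Wd (suc R') m) π
      rhs = act (Wd (suc R') n) π

      IN : ∀ {z} → z < L → z + suc (suc c) ≤ suc (L + c)
      IN {z} h = subst (_≤ suc (L + c)) (trans (cong suc (sym (+-suc z c))) (sym (+-suc z (suc c)))) (s≤s (+-monoˡ-≤ c h))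

      rows : suc (L + c) ≡ L + suc c
      rows = sym (+-suc L c)

      Goal : Set
      Goal = s lhs ≡ s rhs × (0 < q + (e₁ ∸ p) → lhs ≡ rhs)

      A-eq : (∀ y → suc (suc c) ≤ y → y ≤ L + suc c → n 0 y ≡ m 0 y) → ∀ w → M.A w ≡ N.A w
      A-eq h w = cong (λ W → act W w) (rowW-cong L 1 λ y k → sym (h (y + suc (suc c)) (m≤n+m _ y) (subst (y + suc (suc c) ≤_) rows (IN k))))

      B-eq : (∀ y → y < c → n 0 y ≡ m 0 y) → ∀ w → M.B w ≡ N.B w
      B-eq h w = cong (λ W → act W w) (rowW-cong c _ λ y k → sym (h y k))

      expand-n : ∀ {P' Q' : Perm → Perm} → (∀ w → act (opt p (suc L)) w ≡ P' w) → (∀ w → act (opt q (suc (suc L))) w ≡ Q' w) →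
                 rhs ≡ N.A (P' (Q' (N.B Vn)))
      expand-n {P'} {Q'} hp hq = trans (row-Block L c n π) (cong N.A (trans (cong (act (opt p (suc L))) (hq _)) (hp _)))

      go : Pos (suc L) (Q n c) (P n c) X → Step R' X c n m → Goal
      go (here h) S = go-q q refl
        where
        lt : c < L + suc c
        lt = ≤-trans (≤-reflexive refl) (m≤n+m (suc c) L)
        offr : ∀ y → y ≤ L + suc c → y ≢ c → y ≢ suc c → n 0 y ≡ m 0 y
        offr y k a b = step-off R' {n = n} {m} S k (inj₂ (a , b))
        V= : Vm ≡ Vn
        V= = cong (λ W → act W π) (Wd-cong R' λ x y k → sym (step-rest {n = n} {m} S x y k))
        inc : m 0 c ≡ suc q
        inc = step-inc R' {n = n} {m} S (<⇒≤ lt)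
        dec : suc (m 0 (suc c)) ≡ p
        dec = step-dec R' {n = n} {m} S (m≤n+m (suc c) L)
        tB-fix : m 0 (suc c) ≡ 0 → t (N.B Vn) ≡ N.B Vn
        tB-fix e = trans (tB Vn) (cong N.B (subst (λ N → t (act (Wd N (shM n)) π) ≡ act (Wd N (shM n)) π) (sym (+-suc L c))
          (word-fix L c (shM n) π (n≤0⇒n≡0 (s≤s⁻¹ (subst (e₁ <_) (trans (sym dec) (cong suc e)) h))))))
        optm : ∀ v → m 0 (suc c) ≡ v → act (opt v (suc L)) (N.B Vn) ≡ N.B Vn
        optm zero    e = tB-fix e
        optm (suc v) e = refl
        lhs= : lhs ≡ N.A (N.B Vn)
        lhs= = begin
          lhs ≡⟨ row-Block L c m π ⟩
          M.A (act (opt (m 0 (suc c)) (suc L)) (act (opt (m 0 c) (suc (suc L))) (M.B Vm)))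
            ≡⟨ A-eq (λ y a b → offr y b (>⇒≢ (<-trans (n<1+n c) a)) (>⇒≢ a)) _ ⟩
          N.A (act (opt (m 0 (suc c)) (suc L)) (act (opt (m 0 c) (suc (suc L))) (M.B Vm)))
            ≡⟨ cong (λ z → N.A (act (opt (m 0 (suc c)) (suc L)) z)) (act-opt⁺ (suc (suc L)) (subst (0 <_) (sym inc) z<s) _) ⟩
          N.A (act (opt (m 0 (suc c)) (suc L)) (M.B Vm))
            ≡⟨ cong (λ z → N.A (act (opt (m 0 (suc c)) (suc L)) z)) (trans (B-eq (λ y k → offr y (≤-trans (<⇒≤ k) (<⇒≤ lt)) (<⇒≢ k) (<⇒≢ (m<n⇒m<1+n k))) Vm) (cong N.B V=)) ⟩
          N.A (act (opt (m 0 (suc c)) (suc L)) (N.B Vn))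
            ≡⟨ cong N.A (optm _ refl) ⟩
          N.A (N.B Vn) ∎
          where open ≡-Reasoning
        ex : ∀ {Q'} → (∀ w → act (opt q (suc (suc L))) w ≡ Q' w) → rhs ≡ N.A (Q' (N.B Vn))
        ex hq = expand-n {λ w → w} (act-opt⁺ (suc L) (≤-<-trans z≤n h)) hq
        go-q : ∀ v → q ≡ v → Goal
        go-q zero e = trans (cong s lhs=) (trans (sA (N.B Vn)) (sym (trans (cong s (ex {s} (act-opt (suc (suc L)) e))) (sAs (N.B Vn)))))
                    , λ k → ⊥-elim (<-irrefl (sym (cong₂ _+_ e (m≤n⇒m∸n≡0 (<⇒≤ h)))) k)
        go-q (suc v) e = cong s same , λ _ → same
          where same = trans lhs= (sym (ex {λ w → w} (act-opt⁺ (suc (suc L)) (subst (0 <_) (sym e) z<s))))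
      go (there {X = X'} h Pt) S = go-e (0 <? e₁)
        where
        S' : Step (L + c) X' c (shM n) (shM m)
        S' = Step-sh (subst (λ z → Step z (suc X') c n m) (+-suc L c) S)
        ih = word-step L c {shM n} {shM m} {π} Pt S'
        ih-a : t Vm ≡ t Vn
        ih-a = subst (λ N → t (act (Wd N (shM m)) π) ≡ t (act (Wd N (shM n)) π)) (sym (+-suc L c)) (proj₁ ih)
        row : ∀ y → y ≤ L + suc c → n 0 y ≡ m 0 y
        row = step-row {n = n} {m} S
        lt : suc c ≤ L + suc c
        lt = m≤n+m (suc c) L
        lhs= : lhs ≡ N.A (act (opt p (suc L)) (act (opt q (suc (suc L))) (N.B Vm)))
        lhs= = trans (row-Block L c m π) (trans (A-eq (λ y _ k → row y k) _) (cong N.A (cong₂ (λ u v → act (opt u (suc L)) v) (sym (row (suc c) lt))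
                 (cong₂ (λ u v → act (opt u (suc (suc L))) v) (sym (row c (<⇒≤ lt))) (B-eq (λ y k → row y (≤-trans (<⇒≤ k) (<⇒≤ lt))) Vm)))))
        go-e : Dec (0 < e₁) → Goal
        go-e (yes k) = cong s same , λ _ → same
          where
          same : lhs ≡ rhs
          same = trans lhs= (trans (cong (λ z → N.A (act (opt p (suc L)) (act (opt q (suc (suc L))) (N.B z))))
                   (subst (λ N → act (Wd N (shM m)) π ≡ act (Wd N (shM n)) π) (sym (+-suc L c)) (proj₂ ih k))) (sym (row-Block L c n π)))
        go-e (no k) = go-q q refl
          where
          e₁0 : e₁ ≡ 0
          e₁0 = n≤0⇒n≡0 (≮⇒≥ k)
          p0 : p ≡ 0
          p0 = n≤0⇒n≡0 (subst (p ≤_) e₁0 h)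
          ex : ∀ {Q'} V → (∀ w → act (opt q (suc (suc L))) w ≡ Q' w) →
               N.A (act (opt p (suc L)) (act (opt q (suc (suc L))) (N.B V))) ≡ N.A (t (Q' (N.B V)))
          ex V hq = cong N.A (trans (act-opt (suc L) p0 _) (cong t (hq _)))
          go-q : ∀ v → q ≡ v → Goal
          -- Both letters are present, so sts = tst carries a t down to the remaining rows; the
          -- products of these rows agree only after multiplication by t.
          go-q zero e = trans (cong s (trans lhs= (ex {s} Vm hq))) (trans (sAts Vm) (trans (cong (λ z → N.A (t (s (N.B z)))) ih-a)
                          (sym (trans (cong s (trans (row-Block L c n π) (ex {s} Vn hq))) (sAts Vn)))))
                      , λ u → ⊥-elim (<-irrefl (sym (cong₂ _+_ e (trans (cong (_∸ p) e₁0) (0∸n≡0 p)))) u)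
            where hq = act-opt (suc (suc L)) e
          go-q (suc v) e = cong s same , λ _ → same
            where
            hq = act-opt⁺ (suc (suc L)) (subst (0 <_) (sym e) z<s)
            same : lhs ≡ rhs
            same = trans lhs= (trans (ex {λ w → w} Vm hq) (trans (cong N.A (trans (tB Vm) (trans (cong N.B ih-a) (sym (tB Vn)))))
                     (sym (trans (row-Block L c n π) (ex {λ w → w} Vn hq)))))

-- Rows against columns: transposition reverses the word

module WordSymmetry where
  open import Defs
  open import Data.Bool using (if_then_else_)
  open import Data.Nat
  open import Data.Nat.Properties
  import Data.Integer as ℤ
  open ℤ using (ℤ; 0ℤ)
  import Data.Integer.Properties as ℤP
  open import Data.List using (List; []; _∷_; _++_; map; reverse; length; concat; concatMap; take; drop)
  open import Data.List.Properties using (reverse-++; ++-identityʳ; length-++; map-++; concat-++; map-∘)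
  open import Data.List.Relation.Unary.All as All using (All; []; _∷_)
  open import Data.List.Relation.Unary.All.Properties using (++⁺)
  open Brackets
  open BracketCorners
  open Triangles
  open DoubleCrystal
  open PatternEncoding
  open HeckeAction
  open BlockWords

  -- Wr reads the triangle column by column; cells that change order carry commuting letters.
  Wr : ℕ → Mat → List ℕ
  Wr zero    n = []
  Wr (suc N) n = Wr N (λ x y → n x (suc y)) ++ reverse (rowW (suc N) 1 (λ x → n x 0))

  Wr-reverse : ∀ N n → Wr N n ≡ reverse (Wd N (T n))
  Wr-reverse zero    n = refl
  Wr-reverse (suc N) n = trans (cong (_++ reverse (rowW (suc N) 1 (λ x → n x 0))) (Wr-reverse N (λ x y → n x (suc y))))
    (sym (reverse-++ (rowW (suc N) 1 (λ x → n x 0)) (Wd N (λ x y → n y (suc x)))))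

  All-reverse : ∀ {P : ℕ → Set} xs → All P xs → All P (reverse xs)
  All-reverse []       [] = []
  All-reverse {P} (x ∷ xs) (h ∷ hs) = subst (All P) (sym (reverse-++ (x ∷ []) xs)) (++⁺ (All-reverse xs hs) (h ∷ []))

  reverse-opt : ∀ v j → reverse (opt v j ++ []) ≡ opt v j
  reverse-opt zero    j = refl
  reverse-opt (suc v) j = refl

  row-last : ∀ N g → rowW (suc N) 1 g ≡ rowW N 1 (sh g) ++ (opt (g 0) (suc N) ++ [])
  row-last N g = trans (cong (λ z → rowW z 1 g) (+-comm 1 N)) (trans (rowW-split N 1 1 g)
    (cong₂ _++_ (rowW-cong N 1 λ y _ → cong g (+-comm y 1)) (cong (λ z → opt (g 0) z ++ []) (+-comm N 1))))

  col-last : ∀ N g → reverse (rowW (suc N) 1 g) ≡ opt (g 0) (suc N) ++ reverse (rowW N 1 (sh g))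
  col-last N g = trans (cong reverse (row-last N g)) (trans (reverse-++ (rowW N 1 (sh g)) (opt (g 0) (suc N) ++ []))
    (cong (_++ reverse (rowW N 1 (sh g))) (reverse-opt (g 0) (suc N))))

  opt-commute : ∀ v N {W} → All (Between 1 (suc N)) W → ∀ w → act (opt v (suc (suc N))) (act W w) ≡ act W (act (opt v (suc (suc N))) w)
  opt-commute zero    N h w = far-act (All.map (λ { {suc j} (_ , b) → inj₂ b ; {zero} (() , _) }) h) w
  opt-commute (suc v) N h w = refl

  -- The letter of cell (0 , 0) closes row 0 and opens the reversed column 0. It exceeds by at least
  -- two every letter of the triangle left without that row and column, so it commutes past it, and
  -- the induction treats row and column together.
  Wd-Wr : ∀ N n π → act (Wd N n) π ≡ act (Wr N n) π
  Wd-Wr zero          n π = refl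
  Wd-Wr (suc zero)    n π with n 0 0
  ... | zero  = refl
  ... | suc _ = refl
  Wd-Wr (suc N₁@(suc N)) n π = begin
    act (rowW (suc N₁) 1 (n 0) ++ Wd N₁ (shM n)) π              ≡⟨ act-++ (rowW (suc N₁) 1 (n 0)) _ π ⟩
    act (rowW (suc N₁) 1 (n 0)) (act (Wd N₁ (shM n)) π)          ≡⟨ cong₂ act (trans (row-last N₁ (n 0)) (cong (row ++_) (++-identityʳ h))) (Wd-Wr N₁ (shM n) π) ⟩
    act (row ++ h) (act (U ++ C) π)                              ≡⟨ trans (act-++ row h _) (cong (λ z → act row (act h z)) (act-++ U C π)) ⟩
    act row (act h (act U (act C π)))                            ≡⟨ cong (act row) (opt-commute (n 0 0) N Ub (act C π)) ⟩
    act row (act U (act h (act C π)))                            ≡⟨ cong (λ z → act row (act U z)) (sym (act-++ h C π)) ⟩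
    act row (act U (act (h ++ C) π))                             ≡⟨ cong (act row) (sym (Wd-Wr N (λ x y → n (suc x) (suc y)) _)) ⟩
    act row (act (Wd N (λ x y → n (suc x) (suc y))) (act (h ++ C) π)) ≡⟨ sym (act-++ row _ _) ⟩
    act (Wd N₁ (λ x y → n x (suc y))) (act (h ++ C) π)           ≡⟨ Wd-Wr N₁ (λ x y → n x (suc y)) _ ⟩
    act (Wr N₁ (λ x y → n x (suc y))) (act (h ++ C) π)           ≡⟨ cong (λ z → act (Wr N₁ (λ x y → n x (suc y))) (act z π)) (sym (col-last N₁ (λ x → n x 0))) ⟩
    act (Wr N₁ (λ x y → n x (suc y))) (act (reverse (rowW (suc N₁) 1 (λ x → n x 0))) π) ≡⟨ sym (act-++ (Wr N₁ (λ x y → n x (suc y))) _ π) ⟩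
    act (Wr (suc N₁) n) π ∎
    where
    open ≡-Reasoning
    row = rowW N₁ 1 (sh (n 0))
    h = opt (n 0 0) (suc N₁)
    U = Wr N (λ x y → n (suc x) (suc y))
    C = reverse (rowW N₁ 1 (λ x → n (suc x) 0))
    Ub : All (Between 1 (suc N)) U
    Ub = subst (All (Between 1 (suc N))) (sym (Wr-reverse N (λ x y → n (suc x) (suc y)))) (All-reverse _ (Wd-between N _))

  -- The word for ω lists the blocks, and the letters within each block, in the order opposite to
  -- the one for ω†; this turns it into a word of the second kind.
  reverse-word : ∀ N n π → act (reverse (Wd N n)) π ≡ act (Wd N (T n)) π
  reverse-word N n π = sym (trans (Wd-Wr N (T n) π) (cong (λ W → act W π) (Wr-reverse N (T n))))

  tri : ℕ → ℕ
  tri zero    = 0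
  tri (suc N) = suc N + tri N

  rowW-length : ∀ k p g → length (rowW k p g) ≤ k
  rowW-length zero    p g = z≤n
  rowW-length (suc k) p g with g k
  ... | zero  = s≤s (rowW-length k (suc p) g)
  ... | suc _ = m≤n⇒m≤1+n (rowW-length k (suc p) g)

  rowW-full : ∀ k p g → k ≤ length (rowW k p g) → ∀ y → y < k → g y ≡ 0
  rowW-full (suc k) p g h y lt with g k in e
  ... | suc _ = ⊥-elim (<⇒≱ h (rowW-length k (suc p) g))
  ... | zero with y ≟ k
  ...   | yes refl = e
  ...   | no ne    = rowW-full k (suc p) g (s≤s⁻¹ h) y (≤∧≢⇒< (s≤s⁻¹ lt) ne)

  Wd-length : ∀ N n → length (Wd N n) ≤ tri N
  Wd-length zero    n = z≤n
  Wd-length (suc N) n = subst (_≤ tri (suc N)) (sym (length-++ (rowW (suc N) 1 (n 0)))) (+-mono-≤ (rowW-length (suc N) 1 (n 0)) (Wd-length N (shM n)))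

  Wd-full : ∀ N n → tri N ≤ length (Wd N n) → ∀ x y → x + y < N → n x y ≡ 0
  Wd-full (suc N) n h = go
    where
    a = length (rowW (suc N) 1 (n 0))
    b = length (Wd N (shM n))
    h' : suc N + tri N ≤ a + b
    h' = subst (tri (suc N) ≤_) (length-++ (rowW (suc N) 1 (n 0))) h
    go : ∀ x y → x + y < suc N → n x y ≡ 0
    go zero    y k = rowW-full (suc N) 1 (n 0) (+-cancelʳ-≤ (tri N) _ _ (≤-trans h' (+-monoʳ-≤ a (Wd-length N (shM n))))) y k
    go (suc x) y k = Wd-full N (shM n) (+-cancelˡ-≤ (suc N) _ _ (≤-trans h' (+-monoˡ-≤ b (rowW-length (suc N) 1 (n 0))))) x y (s≤s⁻¹ k)

  take-exact : ∀ {A : Set} (xs ys : List A) {s} → length xs ≡ s → take s (xs ++ ys) ≡ xs × drop s (xs ++ ys) ≡ ys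
  take-exact []       ys refl = refl , refl
  take-exact (x ∷ xs) ys refl = cong (x ∷_) (proj₁ (take-exact xs ys refl)) , proj₂ (take-exact xs ys refl)

  data Sized {A : Set} : ℕ → List (List A) → Set where
    []  : ∀ {s} → Sized s []
    _∷_ : ∀ {s b Bs} → length b ≡ s → Sized (suc s) Bs → Sized s (b ∷ Bs)

  blocks-sized : ∀ {A : Set} {s} {Bs : List (List A)} → Sized s Bs → blocksFrom (length Bs) s (concat Bs) ≡ Bs
  blocks-sized [] = refl
  blocks-sized {s = s} {b ∷ Bs} (e ∷ S) with take-exact b (concat Bs) e
  ... | p , q = cong₂ _∷_ p (trans (cong (blocksFrom (length Bs) (suc s)) q) (blocks-sized S))

  sized-snoc : ∀ {A : Set} {s b} {Bs : List (List A)} → Sized s Bs → length b ≡ length Bs + s → Sized s (Bs ++ b ∷ [])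
  sized-snoc []            h = h ∷ []
  sized-snoc {s = s} {Bs = _ ∷ Bs} (e ∷ S) h = e ∷ sized-snoc S (trans h (sym (+-suc (length Bs) s)))

  neg : ℕ × ℤ → ℤ
  neg x = ℤ.- proj₂ x

  rowBlocks : (R m : ℕ) → Mat → List State
  rowBlocks R zero    n = []
  rowBlocks R (suc m) n = rowBlocks R m n ++ blk (R ∸ m) (suc m) (n (R ∸ m)) ∷ []

  length-rowBlocks : ∀ R m n → length (rowBlocks R m n) ≡ m
  length-rowBlocks R zero    n = refl
  length-rowBlocks R (suc m) n = trans (length-++ (rowBlocks R m n)) (trans (cong (_+ 1) (length-rowBlocks R m n)) (+-comm m 1))

  length-blk : ∀ x k g → length (blk x k g) ≡ k
  length-blk x zero    g = refl
  length-blk x (suc k) g = cong suc (length-blk (suc x) k g)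

  concat-rowBlocks : ∀ R m n → concat (rowBlocks R m n) ≡ encs R m n
  concat-rowBlocks R zero    n = refl
  concat-rowBlocks R (suc m) n = trans (sym (concat-++ (rowBlocks R m n) _)) (cong₂ _++_ (concat-rowBlocks R m n) (++-identityʳ _))

  sized-rowBlocks : ∀ R m n → Sized 1 (rowBlocks R m n)
  sized-rowBlocks R zero    n = []
  sized-rowBlocks R (suc m) n = sized-snoc (sized-rowBlocks R m n)
    (trans (length-blk (R ∸ m) (suc m) _) (trans (+-comm 1 m) (cong (_+ 1) (sym (length-rowBlocks R m n)))))

  blocks-enc : ∀ R n → blocks (suc (suc R)) (encs R (suc R) n) ≡ rowBlocks R (suc R) n
  blocks-enc R n = subst₂ (λ k v → blocksFrom k 1 v ≡ rowBlocks R (suc R) n) (length-rowBlocks R (suc R) n) (concat-rowBlocks R (suc R) n)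
    (blocks-sized (sized-rowBlocks R (suc R) n))

  eqPos-blk : ∀ x k p g → eqPosFrom p (map neg (blk x k g)) ≡ rowW k p g
  eqPos-blk x zero p g = refl
  eqPos-blk x (suc zero) p g with g 0
  ... | zero  = refl
  ... | suc _ = refl
  eqPos-blk x (suc (suc k)) p g = trans (go (g (suc k)) refl) (cong (opt (g (suc k)) p ++_) (eqPos-blk (suc x) (suc k) (suc p) g))
    where
    S = Σ< (suc k) g
    rest = eqPosFrom (suc p) (map neg (blk (suc x) (suc k) g))
    a b : ℤ
    a = ℤ.- (ℤ.- (ℤ.+ (S + g (suc k))))
    b = ℤ.- (ℤ.- (ℤ.+ S))
    go : ∀ v → g (suc k) ≡ v → (if does (a ℤP.≟ b) then p ∷ rest else rest) ≡ opt (g (suc k)) p ++ rest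
    go v e with a ℤP.≟ b
    go zero    e | yes _ rewrite e = refl
    go zero    e | no ne = ⊥-elim (ne (cong (λ z → ℤ.- (ℤ.- (ℤ.+ z))) (trans (cong (S +_) e) (+-identityʳ S))))
    go (suc v) e | yes q = ⊥-elim (1+n≢0 (trans (sym e) (+-cancelˡ-≡ S _ _ (trans (ℤP.+-injective (ℤP.neg-injective (ℤP.neg-injective q))) (sym (+-identityʳ S))))))
    go (suc v) e | no _ rewrite e = refl

  eqPos-rows : ∀ R m n → m ≤ suc R → concat (reverse (map (λ b → eqPos (map neg b)) (rowBlocks R m n))) ≡ Wd m (λ x → n (suc R ∸ m + x))
  eqPos-rows R zero    n h = refl
  eqPos-rows R (suc m) n h = begin
    concat (reverse (map φ (rowBlocks R m n ++ b ∷ [])))        ≡⟨ cong (λ z → concat (reverse z)) (map-++ φ (rowBlocks R m n) (b ∷ [])) ⟩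
    concat (reverse (map φ (rowBlocks R m n) ++ φ b ∷ []))      ≡⟨ cong concat (reverse-++ (map φ (rowBlocks R m n)) (φ b ∷ [])) ⟩
    φ b ++ concat (reverse (map φ (rowBlocks R m n)))           ≡⟨ cong₂ _++_ (trans (eqPos-blk (R ∸ m) (suc m) 1 _) (rowW-cong (suc m) 1 λ y _ → cong (λ z → n z y) (sym (+-identityʳ (R ∸ m)))))
                                                                     (trans (eqPos-rows R m n (≤-trans (n≤1+n m) h)) (Wd-cong m λ x y _ → cong (λ z → n z y) (trans (cong (_+ x) (+-∸-assoc 1 (s≤s⁻¹ h))) (sym (+-suc (R ∸ m) x))))) ⟩
    Wd (suc m) (λ x → n (R ∸ m + x)) ∎
    where
    open ≡-Reasoning
    φ : State → List ℕ
    φ b = eqPos (map neg b)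
    b = blk (R ∸ m) (suc m) (n (R ∸ m))

  dag-word : ∀ R n → omegaDag (suc (suc R)) (encs R (suc R) n) ≡ demazure (suc (suc R)) (Wd (suc R) n)
  dag-word R n = cong (demazure (suc (suc R))) (trans (cong (λ z → concat (reverse (map (λ b → eqPos (map neg b)) z))) (blocks-enc R n))
    (trans (eqPos-rows R (suc R) n ≤-refl) (Wd-cong (suc R) λ x y _ → cong (λ z → n (z + x) y) (n∸n≡0 R))))

  take-map : ∀ {A B : Set} (f : A → B) s xs → take s (map f xs) ≡ map f (take s xs)
  take-map f zero    xs       = refl
  take-map f (suc s) []       = refl
  take-map f (suc s) (x ∷ xs) = cong (f x ∷_) (take-map f s xs)

  drop-map : ∀ {A B : Set} (f : A → B) s xs → drop s (map f xs) ≡ map f (drop s xs)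
  drop-map f zero    xs       = refl
  drop-map f (suc s) []       = refl
  drop-map f (suc s) (x ∷ xs) = drop-map f s xs

  blocks-map : ∀ {A B : Set} (f : A → B) k s xs → blocksFrom k s (map f xs) ≡ map (map f) (blocksFrom k s xs)
  blocks-map f zero    s xs = refl
  blocks-map f (suc k) s xs = cong₂ _∷_ (take-map f s xs) (trans (cong (blocksFrom k (suc s)) (drop-map f s xs)) (blocks-map f k (suc s) (drop s xs)))

  concat-reverse : ∀ (Ws : List (List ℕ)) → concat (map reverse Ws) ≡ reverse (concat (reverse Ws))
  concat-reverse []       = refl
  concat-reverse (W ∷ Ws) = begin
    reverse W ++ concat (map reverse Ws)                       ≡⟨ cong (reverse W ++_) (concat-reverse Ws) ⟩
    reverse W ++ reverse (concat (reverse Ws))                 ≡⟨ sym (reverse-++ (concat (reverse Ws)) W) ⟩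
    reverse (concat (reverse Ws) ++ W)                         ≡⟨ cong (λ z → reverse (concat (reverse Ws) ++ z)) (sym (++-identityʳ W)) ⟩
    reverse (concat (reverse Ws) ++ concat (W ∷ []))           ≡⟨ cong reverse (concat-++ (reverse Ws) (W ∷ [])) ⟩
    reverse (concat (reverse Ws ++ W ∷ []))                    ≡⟨ cong (λ z → reverse (concat z)) (sym (reverse-++ (W ∷ []) Ws)) ⟩
    reverse (concat (reverse (W ∷ Ws))) ∎
    where open ≡-Reasoning

  posℤ : ℕ → ℤ
  posℤ k = ℤ.+ k

  string-word : ∀ R n bs → map posℤ bs ≡ map neg (encs R (suc R) n) →
                omegaOfString (suc (suc R)) bs ≡ demazure (suc (suc R)) (reverse (Wd (suc R) n))
  string-word R n bs e = cong (demazure r) (begin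
    concatMap (λ b → reverse (eqPos (map posℤ b))) (blocks r bs)       ≡⟨ cong concat (trans (map-∘ (blocks r bs)) (cong (map reverse) (map-∘ (blocks r bs)))) ⟩
    concat (map reverse (map eqPos (map (map posℤ) (blocks r bs))))    ≡⟨ cong (λ z → concat (map reverse (map eqPos z))) (trans (sym (blocks-map posℤ (suc R) 1 bs)) (trans (cong (blocks r) e) (blocks-map neg (suc R) 1 (encs R (suc R) n)))) ⟩
    concat (map reverse (map eqPos (map (map neg) (blocks r (encs R (suc R) n))))) ≡⟨ cong (λ z → concat (map reverse z)) (sym (map-∘ (blocks r (encs R (suc R) n)))) ⟩
    concat (map reverse (map (λ b → eqPos (map neg b)) (blocks r (encs R (suc R) n)))) ≡⟨ concat-reverse (map (λ b → eqPos (map neg b)) (blocks r (encs R (suc R) n))) ⟩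
    reverse (concat (reverse (map (λ b → eqPos (map neg b)) (blocks r (encs R (suc R) n))))) ≡⟨ cong reverse (trans (cong (λ z → concat (reverse (map (λ b → eqPos (map neg b)) z))) (blocks-enc R n))
                         (trans (eqPos-rows R (suc R) n ≤-refl) (Wd-cong (suc R) λ x y _ → cong (λ z → n (z + x) y) (n∸n≡0 R)))) ⟩
    reverse (Wd (suc R) n) ∎)
    where
    open ≡-Reasoning
    r = suc (suc R)

  module Words (R : ℕ) where
    open Encoding R public

    wd : Mat → Perm → Perm
    wd n π = act (Wd (suc R) n) π

    wd-cong : ∀ {n m} → n ≈ m → ∀ π → wd n π ≡ wd m π
    wd-cong e π = cong (λ W → act W π) (Wd-cong (suc R) λ x y h → on e x y (s≤s⁻¹ h))

    wd-f : ∀ {i} n π → i ≤ R → Tx i (wd (Crystal.f ends i n) π) ≡ Tx i (wd n π)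
    wd-f {i} n π h = subst (λ z → Tx i (act (Wd (suc z) (F c n)) π) ≡ Tx i (act (Wd (suc z) n) π)) e
        (proj₁ (word-step i c (subst (λ L → Pos L (Q n c) (P n c) (position c n)) (m∸[m∸n]≡n h) (raw (posC c n)))
          (subst (λ z → Triangle.Step z (position c n) c n (F c n)) (sym e) (F-step (posC c n)))))
      where
      c = R ∸ i
      e : i + c ≡ R
      e = m+[n∸m]≡n h

    wd-fix : ∀ {i} n π → i ≤ R → Crystal.ε ends i n ≡ 0 → Tx i (wd n π) ≡ wd n π
    wd-fix {i} n π h z = subst (λ z → Tx i (act (Wd (suc z) n) π) ≡ act (Wd (suc z) n) π) (m+[n∸m]≡n h)
      (word-fix i (R ∸ i) n π (subst (λ L → eps L (Q n (R ∸ i)) (P n (R ∸ i)) ≡ 0) (m∸[m∸n]≡n h) (trans (sym (epsC-def (R ∸ i) n)) z)))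

    wd-top : ∀ {i} n π → i ≤ R → Tx i (wd n π) ≡ wd (EP.top i n) π
    wd-top {i} n π h = trans (cong (Tx i) (wd-cong (≈-sym (EP.pow-top h)) π)) (trans (go (Crystal.ε ends i n)) (wd-fix (EP.top i n) π h (EP.ε-top h)))
      where
      go : ∀ m → Tx i (wd (EP.pow m i (EP.top i n)) π) ≡ Tx i (wd (EP.top i n) π)
      go zero    = refl
      go (suc m) = trans (wd-f (EP.pow m i (EP.top i n)) π h) (go m)

-- Lengths as inversion numbers; Bruhat steps as swaps of entries

module Inversions where
  open import Defs
  open import Data.Bool using (Bool; true; false; if_then_else_; _∧_)
  open import Data.Nat
  open import Data.Nat.Properties
  open import Data.Nat.Tactic.RingSolver using (solve-∀)
  open import Data.List using (List; []; _∷_; _++_; map; length; concat; upTo; applyUpTo)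
  open import Data.List.Properties using (length-++; ++-assoc; map-applyUpTo)
  open import Data.List.Relation.Unary.All as All using (All; []; _∷_)
  open import Data.List.Relation.Unary.AllPairs using ([]; _∷_)
  open import Data.List.Relation.Binary.Permutation.Propositional using (_↭_; ↭-refl; ↭-sym; ↭-trans; prep; swap)
  open import Data.List.Relation.Binary.Permutation.Propositional.Properties using (shift; ++⁺ˡ)
  open TensorProducts using (≡ᵇ-yes; ≡ᵇ-no)
  open HeckeAction

  bit : Bool → ℕ
  bit true  = 1
  bit false = 0

  numBelow numAbove : ℕ → List ℕ → ℕ
  numBelow x []       = 0
  numBelow x (y ∷ ys) = bit (y <ᵇ x) + numBelow x ys
  numAbove x []       = 0
  numAbove x (y ∷ ys) = bit (x <ᵇ y) + numAbove x ys

  inv : List ℕ → ℕ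
  inv []       = 0
  inv (x ∷ xs) = numBelow x xs + inv xs

  cross : List ℕ → List ℕ → ℕ
  cross []       ys = 0
  cross (x ∷ xs) ys = numBelow x ys + cross xs ys

  countᵇ-∷ : ∀ b bs → countᵇ (b ∷ bs) ≡ bit b + countᵇ bs
  countᵇ-∷ true  bs = refl
  countᵇ-∷ false bs = refl

  countᵇ-++ : ∀ bs cs → countᵇ (bs ++ cs) ≡ countᵇ bs + countᵇ cs
  countᵇ-++ []           cs = refl
  countᵇ-++ (true ∷ bs)  cs = cong suc (countᵇ-++ bs cs)
  countᵇ-++ (false ∷ bs) cs = countᵇ-++ bs cs

  map-upTo-suc : ∀ {A : Set} (f : ℕ → A) n → map f (applyUpTo suc n) ≡ map (f ∘ suc) (upTo n)
  map-upTo-suc f n = trans (map-applyUpTo suc f n) (sym (map-applyUpTo id (f ∘ suc) n))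

  count-below : ∀ x xs → countᵇ (map (λ b → nth xs b <ᵇ x) (upTo (length xs))) ≡ numBelow x xs
  count-below x []       = refl
  count-below x (y ∷ ys) = trans (countᵇ-∷ (y <ᵇ x) _) (cong (bit (y <ᵇ x) +_)
    (trans (cong countᵇ (map-upTo-suc (λ b → nth (y ∷ ys) b <ᵇ x) (length ys))) (count-below x ys)))

  len-inv : ∀ w → len w ≡ inv w
  len-inv []       = refl
  len-inv (x ∷ xs) = begin
    countᵇ (row 0 ++ concat (map row (applyUpTo suc m)))     ≡⟨ countᵇ-++ (row 0) _ ⟩
    countᵇ (row 0) + countᵇ (concat (map row (applyUpTo suc m))) ≡⟨ cong₂ _+_ first rest ⟩
    numBelow x xs + inv xs ∎
    where
    open ≡-Reasoning
    m = length xs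
    row : ℕ → List Bool
    row a = map (λ b → (a <ᵇ b) ∧ (nth (x ∷ xs) b <ᵇ nth (x ∷ xs) a)) (upTo (suc m))
    row' : ℕ → List Bool
    row' a = map (λ b → (a <ᵇ b) ∧ (nth xs b <ᵇ nth xs a)) (upTo m)
    first : countᵇ (row 0) ≡ numBelow x xs
    first = trans (cong countᵇ (map-upTo-suc (λ b → (0 <ᵇ b) ∧ (nth (x ∷ xs) b <ᵇ x)) m)) (count-below x xs)
    count-rows : ∀ (as : List ℕ) → countᵇ (concat (map (λ a → row (suc a)) as)) ≡ countᵇ (concat (map row' as))
    count-rows []       = refl
    count-rows (a ∷ as) = trans (countᵇ-++ (row (suc a)) _) (trans (cong₂ _+_
      (cong countᵇ (map-upTo-suc (λ b → (suc a <ᵇ b) ∧ (nth (x ∷ xs) b <ᵇ nth xs a)) m)) (count-rows as)) (sym (countᵇ-++ (row' a) _)))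
    rest : countᵇ (concat (map row (applyUpTo suc m))) ≡ inv xs
    rest = trans (cong (countᵇ ∘ concat) (map-upTo-suc row m)) (trans (count-rows (upTo m)) (len-inv xs))

  numBelow-++ : ∀ x A B → numBelow x (A ++ B) ≡ numBelow x A + numBelow x B
  numBelow-++ x []      B = refl
  numBelow-++ x (a ∷ A) B = trans (cong (bit (a <ᵇ x) +_) (numBelow-++ x A B)) (sym (+-assoc (bit (a <ᵇ x)) _ _))

  inv-++ : ∀ A Q → inv (A ++ Q) ≡ inv A + (cross A Q + inv Q)
  inv-++ []      Q = refl
  inv-++ (a ∷ A) Q = trans (cong₂ _+_ (numBelow-++ a A Q) (inv-++ A Q)) (l (numBelow a A) (numBelow a Q) (inv A) (cross A Q) (inv Q))
    where
    l : ∀ p q i c j → p + q + (i + (c + j)) ≡ p + i + (q + c + j)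
    l = solve-∀

  cross-∷ : ∀ B y C → cross B (y ∷ C) ≡ numAbove y B + cross B C
  cross-∷ []      y C = refl
  cross-∷ (b ∷ B) y C = trans (cong (numBelow b (y ∷ C) +_) (cross-∷ B y C)) (l (bit (y <ᵇ b)) (numBelow b C) (numAbove y B) (cross B C))
    where
    l : ∀ a b c d → a + b + (c + d) ≡ a + c + (b + d)
    l = solve-∀

  numBelow-swap : ∀ z x B y C → numBelow z (x ∷ B ++ y ∷ C) ≡ numBelow z (y ∷ B ++ x ∷ C)
  numBelow-swap z x B y C = trans (cong (bit (x <ᵇ z) +_) (numBelow-++ z B (y ∷ C))) (trans (l (bit (x <ᵇ z)) (numBelow z B) (bit (y <ᵇ z)) (numBelow z C))
    (cong (bit (y <ᵇ z) +_) (sym (numBelow-++ z B (x ∷ C)))))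
    where
    l : ∀ a b c d → a + (b + (c + d)) ≡ c + (b + (a + d))
    l = solve-∀

  cross-swap : ∀ A x B y C → cross A (x ∷ B ++ y ∷ C) ≡ cross A (y ∷ B ++ x ∷ C)
  cross-swap []      x B y C = refl
  cross-swap (a ∷ A) x B y C = cong₂ _+_ (numBelow-swap a x B y C) (cross-swap A x B y C)

  numBelow-mono : ∀ {x y} B → x ≤ y → numBelow x B ≤ numBelow y B
  numBelow-mono []      h = z≤n
  numBelow-mono {x} {y} (b ∷ B) h = +-mono-≤ (lem (b <? x)) (numBelow-mono B h)
    where
    lem : Dec (b < x) → bit (b <ᵇ x) ≤ bit (b <ᵇ y)
    lem (yes k) rewrite <ᵇ-yes k | <ᵇ-yes (<-≤-trans k h) = ≤-refl
    lem (no k)  rewrite <ᵇ-no k = z≤n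

  numAbove-anti : ∀ {x y} B → x ≤ y → numAbove y B ≤ numAbove x B
  numAbove-anti []      h = z≤n
  numAbove-anti {x} {y} (b ∷ B) h = +-mono-≤ (lem (y <? b)) (numAbove-anti B h)
    where
    lem : Dec (y < b) → bit (y <ᵇ b) ≤ bit (x <ᵇ b)
    lem (yes k) rewrite <ᵇ-yes k | <ᵇ-yes (≤-<-trans h k) = ≤-refl
    lem (no k)  rewrite <ᵇ-no k = z≤n

  inv-parts : ∀ A x B y C → inv (A ++ x ∷ B ++ y ∷ C) ≡
    inv A + (cross A (x ∷ B ++ y ∷ C) + ((numBelow x B + (bit (y <ᵇ x) + numBelow x C)) + (inv B + ((numAbove y B + cross B C) + (numBelow y C + inv C)))))
  inv-parts A x B y C = trans (inv-++ A _) (cong (λ z → inv A + (cross A (x ∷ B ++ y ∷ C) + z))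
    (cong₂ _+_ (numBelow-++ x B (y ∷ C)) (trans (inv-++ B (y ∷ C)) (cong (λ z → inv B + (z + (numBelow y C + inv C))) (cross-∷ B y C)))))

  -- The pair itself becomes an inversion, and each entry between the two forms at least as many
  -- inversions with them as before.
  inv-swap : ∀ A B C {x y} → x < y → inv (A ++ x ∷ B ++ y ∷ C) < inv (A ++ y ∷ B ++ x ∷ C)
  inv-swap A B C {x} {y} h = subst₂ _<_ (sym (inv-parts A x B y C)) (sym (inv-parts A y B x C))
    (+-monoʳ-< (inv A) (subst (λ z → cross A (x ∷ B ++ y ∷ C) + _ < z + _) (cross-swap A x B y C) (+-monoʳ-< (cross A (x ∷ B ++ y ∷ C)) core)))
    where
    core : (numBelow x B + (bit (y <ᵇ x) + numBelow x C)) + (inv B + ((numAbove y B + cross B C) + (numBelow y C + inv C))) <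
           (numBelow y B + (bit (x <ᵇ y) + numBelow y C)) + (inv B + ((numAbove x B + cross B C) + (numBelow x C + inv C)))
    core rewrite <ᵇ-no (<-asym h) | <ᵇ-yes h = subst₂ _<_
      (l (numBelow x B) (numBelow x C) (inv B) (numAbove y B) (cross B C) (numBelow y C) (inv C))
      (l' (numBelow y B) (numBelow y C) (inv B) (numAbove x B) (cross B C) (numBelow x C) (inv C))
      (s≤s (+-monoˡ-≤ (numBelow x C + numBelow y C + (inv B + cross B C + inv C)) (+-mono-≤ (numBelow-mono B (<⇒≤ h)) (numAbove-anti B (<⇒≤ h)))))
      where
      l : ∀ a b i g c d j → a + g + (b + d + (i + c + j)) ≡ (a + (0 + b)) + (i + ((g + c) + (d + j)))
      l = solve-∀
      l' : ∀ a b i g c d j → suc (a + g + (d + b + (i + c + j))) ≡ (a + (1 + b)) + (i + ((g + c) + (d + j)))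
      l' = solve-∀

  Off : ℕ → ℕ → ℕ → Set
  Off x y z = z ≢ x × z ≢ y

  numBelow-adj : ∀ x {B} → All (Off x (suc x)) B → numBelow x B ≡ numBelow (suc x) B
  numBelow-adj x []                 = refl
  numBelow-adj x {b ∷ B} ((p , q) ∷ hs) = cong₂ _+_ (lem (b <? x)) (numBelow-adj x hs)
    where
    lem : Dec (b < x) → bit (b <ᵇ x) ≡ bit (b <ᵇ suc x)
    lem (yes k) rewrite <ᵇ-yes k | <ᵇ-yes (m<n⇒m<1+n k) = refl
    lem (no k)  rewrite <ᵇ-no k | <ᵇ-no {b} {suc x} (λ u → k (≤∧≢⇒< (s≤s⁻¹ u) p)) = refl

  numAbove-adj : ∀ x {B} → All (Off x (suc x)) B → numAbove (suc x) B ≡ numAbove x B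
  numAbove-adj x []                 = refl
  numAbove-adj x {b ∷ B} ((p , q) ∷ hs) = cong₂ _+_ (lem (suc x <? b)) (numAbove-adj x hs)
    where
    lem : Dec (suc x < b) → bit (suc x <ᵇ b) ≡ bit (x <ᵇ b)
    lem (yes k) rewrite <ᵇ-yes k | <ᵇ-yes (<-trans (n<1+n x) k) = refl
    lem (no k)  rewrite <ᵇ-no k | <ᵇ-no {x} {b} (λ u → k (≤∧≢⇒< u (q ∘ sym))) = refl

  -- No value lies strictly between x and x + 1, so other entries compare alike with both and only
  -- the pair itself counts.
  inv-adj : ∀ A B C {x} → All (Off x (suc x)) B → inv (A ++ suc x ∷ B ++ x ∷ C) ≡ suc (inv (A ++ x ∷ B ++ suc x ∷ C))
  inv-adj A B C {x} h = trans (inv-parts A (suc x) B x C) (trans (lem (inv A) (cross A (suc x ∷ B ++ x ∷ C)))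
      (cong suc (trans (cong (λ z → inv A + (z + _)) (sym (cross-swap A x B (suc x) C))) (sym (inv-parts A x B (suc x) C)))))
    where
    lem : ∀ i c → i + (c + ((numBelow (suc x) B + (bit (x <ᵇ suc x) + numBelow (suc x) C)) + (inv B + ((numAbove x B + cross B C) + (numBelow x C + inv C))))) ≡
                  suc (i + (c + ((numBelow x B + (bit (suc x <ᵇ x) + numBelow x C)) + (inv B + ((numAbove (suc x) B + cross B C) + (numBelow (suc x) C + inv C))))))
    lem i c rewrite <ᵇ-yes (n<1+n x) | <ᵇ-no {suc x} {x} (<-asym (n<1+n x)) | sym (numBelow-adj x h) | sym (numAbove-adj x h) =
      l i c (numBelow x B) (numBelow (suc x) C) (inv B) (numAbove (suc x) B) (cross B C) (numBelow x C) (inv C)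
      where
      l : ∀ i c a b e g d f j → i + (c + ((a + (1 + b)) + (e + ((g + d) + (f + j))))) ≡ suc (i + (c + ((a + (0 + f)) + (e + ((g + d) + (b + j))))))
      l = solve-∀

  nth-mid : ∀ A x R → nth (A ++ x ∷ R) (length A) ≡ x
  nth-mid []      x R = refl
  nth-mid (a ∷ A) x R = nth-mid A x R

  nth-off : ∀ A {x y R} k → k ≢ length A → nth (A ++ x ∷ R) k ≡ nth (A ++ y ∷ R) k
  nth-off []      zero    h = ⊥-elim (h refl)
  nth-off []      (suc k) h = refl
  nth-off (a ∷ A) zero    h = refl
  nth-off (a ∷ A) (suc k) h = nth-off A k (h ∘ cong suc)

  tabulate-nth : ∀ n {g : ℕ → ℕ} ys → length ys ≡ n → (∀ k → k < n → g k ≡ nth ys k) → map g (upTo n) ≡ ys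
  tabulate-nth zero    []       e h = refl
  tabulate-nth (suc n) {g} (y ∷ ys) e h = cong₂ _∷_ (h 0 z<s) (trans (map-upTo-suc g n)
    (tabulate-nth n ys (suc-injective e) λ k u → h (suc k) (s≤s u)))

  swapPos-split : ∀ A x B y C → swapPos (length A) (length A + suc (length B)) (A ++ x ∷ B ++ y ∷ C) ≡ A ++ y ∷ B ++ x ∷ C
  swapPos-split A x B y C = tabulate-nth (length w) w' len-eq entry
    where
    w  = A ++ x ∷ B ++ y ∷ C
    w' = A ++ y ∷ B ++ x ∷ C
    a = length A
    b = a + suc (length B)
    len-eq : length w' ≡ length w
    len-eq = trans (length-++ A) (trans (cong (λ z → a + suc z) (trans (length-++ B) (sym (length-++ B)))) (sym (length-++ A)))
    assoc : ∀ u v → (A ++ u ∷ B) ++ v ∷ C ≡ A ++ u ∷ B ++ v ∷ C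
    assoc u v = ++-assoc A (u ∷ B) (v ∷ C)
    len-b : ∀ u → length (A ++ u ∷ B) ≡ b
    len-b u = length-++ A
    at-b : ∀ u v → nth (A ++ u ∷ B ++ v ∷ C) b ≡ v
    at-b u v = subst₂ (λ W k → nth W k ≡ v) (assoc u v) (len-b u) (nth-mid (A ++ u ∷ B) v C)
    entry : ∀ k → k < length w → nth w (if k ≡ᵇ a then b else (if k ≡ᵇ b then a else k)) ≡ nth w' k
    entry k _ with k ≟ a | k ≟ b
    ... | yes refl | _ rewrite ≡ᵇ-yes a = trans (at-b x y) (sym (nth-mid A y (B ++ x ∷ C)))
    ... | no p | yes refl rewrite ≡ᵇ-no p | ≡ᵇ-yes b = trans (nth-mid A x (B ++ y ∷ C)) (sym (at-b y x))
    ... | no p | no q rewrite ≡ᵇ-no p | ≡ᵇ-no q = trans (nth-off A k p) (trans (cong (λ W → nth W k) (sym (assoc y y)))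
          (trans (nth-off (A ++ y ∷ B) {y} {x} {C} k (q ∘ λ e → trans e (len-b y))) (cong (λ W → nth W k) (assoc y x))))

  record Split (w : List ℕ) (a b : ℕ) : Set where
    constructor split
    field
      {A B C} : List ℕ
      {x y}   : ℕ
      shape   : w ≡ A ++ x ∷ B ++ y ∷ C
      a-is    : a ≡ length A
      b-is    : b ≡ length A + suc (length B)

  cut : ∀ k (w : List ℕ) → k < length w → ∃ λ A → ∃ λ x → ∃ λ C → w ≡ A ++ x ∷ C × k ≡ length A
  cut zero    (x ∷ w) h = [] , x , w , refl , refl
  cut (suc k) (x ∷ w) h with cut k w (s≤s⁻¹ h)
  ... | A , y , C , e , l = x ∷ A , y , C , cong (x ∷_) e , cong suc l

  splitAt² : ∀ {a b} (w : List ℕ) → a < b → b < length w → Split w a b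
  splitAt² {zero}  {suc b} (x ∷ w) h k with cut b w (s≤s⁻¹ k)
  ... | B , y , C , e , l = split {A = []} {B} {C} {x} {y} (cong (x ∷_) e) refl (cong suc l)
  splitAt² {suc a} {suc b} (z ∷ w) h k with splitAt² {a} {b} w (s≤s⁻¹ h) (s≤s⁻¹ k)
  ... | split {A} {B} {C} {x} {y} e p q = split {A = z ∷ A} {B} {C} {x} {y} (cong (z ∷_) e) (cong suc p) (cong suc q)

  swap-↭ : ∀ (A : List ℕ) x B y C → A ++ x ∷ B ++ y ∷ C ↭ A ++ y ∷ B ++ x ∷ C
  swap-↭ A x B y C = ++⁺ˡ A (↭-trans (prep x (shift y B C)) (↭-trans (swap x y ↭-refl) (prep y (↭-sym (shift x B C)))))

  -- Bruhat steps are given by positions and lengths; the arguments below need them in this form, by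
  -- the shape of the list and the order of two values.
  ≤B-swap : ∀ A B C {x y} → x < y → (A ++ x ∷ B ++ y ∷ C) ≤B (A ++ y ∷ B ++ x ∷ C)
  ≤B-swap A B C {x} {y} h = subst (w ≤B_) e (≤B-step a b lt bl ≤B-refl (subst₂ _<_ (sym (len-inv w)) (sym (trans (cong len e) (len-inv w'))) (inv-swap A B C h)))
    where
    w  = A ++ x ∷ B ++ y ∷ C
    w' = A ++ y ∷ B ++ x ∷ C
    a = length A
    b = a + suc (length B)
    e = swapPos-split A x B y C
    lt : a < b
    lt = subst (_≤ b) (+-comm a 1) (+-monoʳ-≤ a (s≤s z≤n))
    bl : b < length w
    bl = subst₂ _≤_ (trans (+-suc a _) refl) (sym (length-++ A)) (+-monoʳ-≤ a (s≤s (subst (suc (length B) ≤_) (sym (trans (length-++ B) (+-suc (length B) (length C)))) (s≤s (m≤m+n _ _)))))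

  ≤B-trans : ∀ {u v w} → u ≤B v → v ≤B w → u ≤B w
  ≤B-trans p ≤B-refl = p
  ≤B-trans p (≤B-step a b h k q l) = ≤B-step a b h k (≤B-trans p q) l

  ≤B-len : ∀ {u w} → u ≤B w → len u ≤ len w
  ≤B-len ≤B-refl = ≤-refl
  ≤B-len (≤B-step a b h k q l) = ≤-trans (≤B-len q) (<⇒≤ l)

  ≤B-antisym : ∀ {u w} → u ≤B w → w ≤B u → u ≡ w
  ≤B-antisym ≤B-refl q = refl
  ≤B-antisym (≤B-step a b h k p l) q = ⊥-elim (<-irrefl refl (<-≤-trans l (≤-trans (≤B-len q) (≤B-len p))))

-- Demazure operators and their monotonicity for the Bruhat order

module BruhatOrder where
  open import Defs
  open import Data.Bool using (true; false; if_then_else_)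
  open import Data.Nat
  open import Data.Nat.Properties
  open import Data.List using (List; []; _∷_; _++_; map; length)
  open import Data.List.Properties using (map-++; length-++; ++-assoc; length-upTo; map-id-local)
  open import Data.List.Relation.Unary.All as All using (All; []; _∷_)
  import Data.List.Relation.Unary.All.Properties as AllP
  open import Data.List.Relation.Unary.AllPairs using ([]; _∷_)
  open import Data.List.Relation.Unary.Any using (here; there)
  open import Data.List.Membership.Propositional using (_∈_)
  open import Data.List.Membership.Propositional.Properties using (∈-upTo⁺; ∈-upTo⁻)
  open import Data.List.Relation.Unary.Unique.Propositional using (Unique)
  open import Data.List.Relation.Unary.Unique.Propositional.Properties using (upTo⁺)
  open import Data.List.Relation.Binary.Permutation.Propositional using (_↭_; ↭-refl; ↭-sym; ↭-trans; ↭-reflexive; ↭⇒↭ₛ)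
  open import Data.List.Relation.Binary.Permutation.Propositional.Properties using (↭-length; ∈-resp-↭)
  import Data.List.Relation.Binary.Permutation.Setoid.Properties as PermS
  open TensorProducts using (≡ᵇ-yes; ≡ᵇ-no)
  open HeckeAction
  open BlockWords using (act; Between)
  open Inversions

  perm-unique : ∀ {r w} → IsPerm r w → Unique w
  perm-unique {r} p = PermS.Unique-resp-↭ (setoid ℕ) (↭⇒↭ₛ (↭-sym p)) (upTo⁺ r)

  perm-length : ∀ {r w} → IsPerm r w → length w ≡ r
  perm-length {r} p = trans (↭-length p) (length-upTo r)

  perm-∈ : ∀ {r w x} → IsPerm r w → x < r → x ∈ w
  perm-∈ p h = ∈-resp-↭ (↭-sym p) (∈-upTo⁺ h)

  perm-< : ∀ {r w x} → IsPerm r w → x ∈ w → x < r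
  perm-< p h = ∈-upTo⁻ (∈-resp-↭ p h)

  idx-< : ∀ {x w} → x ∈ w → idx x w < length w
  idx-< {x} {y ∷ w} h with x ≟ y
  idx-< {x} {y ∷ w} h         | yes refl rewrite ≡ᵇ-yes x = z<s
  idx-< {x} {y ∷ w} (here e)  | no ne = ⊥-elim (ne e)
  idx-< {x} {y ∷ w} (there h) | no ne rewrite ≡ᵇ-no ne = s≤s (idx-< h)

  nth-idx : ∀ {x w} → x ∈ w → nth w (idx x w) ≡ x
  nth-idx {x} {y ∷ w} h with x ≟ y
  nth-idx {x} {y ∷ w} h         | yes refl rewrite ≡ᵇ-yes x = refl
  nth-idx {x} {y ∷ w} (here e)  | no ne = ⊥-elim (ne e)
  nth-idx {x} {y ∷ w} (there h) | no ne rewrite ≡ᵇ-no ne = nth-idx h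

  nth-∈ : ∀ w {k} → k < length w → nth w k ∈ w
  nth-∈ (x ∷ w) {zero}  h = here refl
  nth-∈ (x ∷ w) {suc k} h = there (nth-∈ w (s≤s⁻¹ h))

  idx-nth : ∀ {w} k → Unique w → k < length w → idx (nth w k) w ≡ k
  idx-nth {x ∷ w} zero    U h rewrite ≡ᵇ-yes x = refl
  idx-nth {x ∷ w} (suc k) (a ∷ U) h rewrite ≡ᵇ-no {nth w k} {x} (λ e → All.lookup a (nth-∈ w (s≤s⁻¹ h)) (sym e)) =
    cong suc (idx-nth k U (s≤s⁻¹ h))

  idx-inj : ∀ {x y w} → x ∈ w → y ∈ w → idx x w ≡ idx y w → x ≡ y
  idx-inj {w = w} h k e = trans (sym (nth-idx h)) (trans (cong (nth w) e) (nth-idx k))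

  idx-mid : ∀ {A x R} → All (_≢ x) A → idx x (A ++ x ∷ R) ≡ length A
  idx-mid {[]} {x} [] rewrite ≡ᵇ-yes x = refl
  idx-mid {a ∷ A} {x} (h ∷ hs) rewrite ≡ᵇ-no {x} {a} (h ∘ sym) = cong suc (idx-mid hs)

  record Separated (A : List ℕ) (x : ℕ) (B : List ℕ) (y : ℕ) (C : List ℕ) : Set where
    field
      offA : All (Off x y) A
      offB : All (Off x y) B
      offC : All (Off x y) C
      x≢y  : x ≢ y
  open Separated public

  unique-mid : ∀ (A : List ℕ) {y C} → Unique (A ++ y ∷ C) → All (_≢ y) A × Unique (y ∷ C)
  unique-mid []      U = [] , U
  unique-mid (a ∷ A) (h ∷ U) with unique-mid A U
  ... | p , q = All.head (AllP.++⁻ʳ A h) ∷ p , q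

  separated : ∀ A {x} B {y} C → Unique (A ++ x ∷ B ++ y ∷ C) → Separated A x B y C
  separated A {x} B {y} C U with unique-mid A U
  ... | a , (hx ∷ U') with unique-mid B U'
  ...   | b , (hy ∷ _) = record
    { offA = zipA A a (proj₁ (unique-mid (A ++ x ∷ B) (subst Unique (sym (++-assoc A (x ∷ B) (y ∷ C))) U)))
    ; offB = All.zipWith (λ { (p , q) → p ∘ sym , q }) (AllP.++⁻ˡ B hx , b)
    ; offC = All.zipWith (λ { (p , q) → p ∘ sym , q ∘ sym }) (All.tail (AllP.++⁻ʳ B hx) , hy)
    ; x≢y = All.head (AllP.++⁻ʳ B hx) }
    where
    zipA : ∀ A → All (_≢ x) A → All (_≢ y) (A ++ x ∷ B) → All (Off x y) A
    zipA A p q = All.zipWith (λ { (u , v) → u , v }) (p , AllP.++⁻ˡ A q)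

  sL-off : ∀ k {A} → All (Off k (suc k)) A → sL (suc k) A ≡ A
  sL-off k h = map-id-local (All.map (λ { (p , q) → sw-off p q }) h)

  sL-shape : ∀ k A x B y C → sL (suc k) (A ++ x ∷ B ++ y ∷ C) ≡ sL (suc k) A ++ sw k x ∷ sL (suc k) B ++ sw k y ∷ sL (suc k) C
  sL-shape k A x B y C = trans (map-++ (sw k) A _) (cong (λ z → map (sw k) A ++ sw k x ∷ z) (map-++ (sw k) B _))

  sL-split : ∀ k A B C → Separated A k B (suc k) C → sL (suc k) (A ++ k ∷ B ++ suc k ∷ C) ≡ A ++ suc k ∷ B ++ k ∷ C
  sL-split k A B C S = trans (sL-shape k A k B (suc k) C)
    (cong₂ _++_ (sL-off k (offA S)) (cong₂ _∷_ (sw-k k) (cong₂ _++_ (sL-off k (offB S)) (cong₂ _∷_ (sw-suc k) (sL-off k (offC S))))))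

  record Ordered (w : List ℕ) (x y : ℕ) : Set where
    constructor ordered
    field
      {A B C} : List ℕ
      shape   : w ≡ A ++ x ∷ B ++ y ∷ C
      sep     : Separated A x B y C

  order : ∀ {r w x y} → IsPerm r w → x < r → y < r → idx x w < idx y w → Ordered w x y
  order {r} {w} {x} {y} p hx hy h with splitAt² w h (idx-< (perm-∈ p hy))
  ... | split {A} {B} {C} {x'} {y'} e ea eb = subst₂ (Ordered w) x= y= (ordered e (separated A B C (subst Unique e (perm-unique p))))
    where
    x= : x' ≡ x
    x= = trans (sym (nth-mid A x' (B ++ y' ∷ C))) (trans (cong₂ nth (sym e) (sym ea)) (nth-idx (perm-∈ p hx)))
    y= : y' ≡ y
    y= = trans (sym (nth-mid (A ++ x' ∷ B) y' C)) (trans (cong₂ nth (trans (++-assoc A (x' ∷ B) (y' ∷ C)) (sym e)) (trans (length-++ A) (sym eb))) (nth-idx (perm-∈ p hy)))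

  record Asc (k : ℕ) (w : Perm) : Set where
    constructor asc
    field lt↑ : idx k w < idx (suc k) w
  open Asc public

  record Desc (k : ℕ) (w : Perm) : Set where
    constructor desc
    field lt↓ : idx (suc k) w < idx k w
  open Desc public

  desc-asc : ∀ {k w} → Desc k w → Asc k (sL (suc k) w)
  desc-asc {k} {w} (desc h) = asc (subst₂ _<_ (sym (idx-lo k w)) (sym (idx-hi k w)) h)

  asc-or-desc : ∀ {r w k} → IsPerm r w → suc k < r → Asc k w ⊎ Desc k w
  asc-or-desc {w = w} {k} p h with <-cmp (idx k w) (idx (suc k) w)
  ... | tri< a _ _ = inj₁ (asc a)
  ... | tri≈ _ e _ = ⊥-elim (1+n≢n (sym (idx-inj (perm-∈ p (<-trans (n<1+n k) h)) (perm-∈ p h) e)))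
  ... | tri> _ _ c = inj₂ (desc c)

  module Step {r k : ℕ} (kr : suc k < r) where
    k<r : k < r
    k<r = <-trans (n<1+n k) kr

    asc-perm : ∀ {w} → IsPerm r w → Asc k w → sL (suc k) w ↭ w
    asc-perm {w} p h with order p k<r kr (lt↑ h)
    ... | ordered {A} {B} {C} e S = ↭-trans (↭-reflexive (trans (cong (sL (suc k)) e) (sL-split k A B C S)))
          (↭-trans (↭-sym (swap-↭ A k B (suc k) C)) (↭-reflexive (sym e)))

    sL-perm : ∀ {w} → IsPerm r w → IsPerm r (sL (suc k) w)
    sL-perm {w} p with asc-or-desc p kr
    ... | inj₁ h = ↭-trans (asc-perm p h) p
    ... | inj₂ h = ↭-trans desc↭ p
      where
      desc↭ : sL (suc k) w ↭ w
      desc↭ with order p kr k<r (lt↓ h)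
      ... | ordered {A} {B} {C} e S = ↭-trans (↭-reflexive (trans (cong (sL (suc k)) e) eq))
            (↭-trans (swap-↭ A k B (suc k) C) (↭-reflexive (sym e)))
        where
        flip' : ∀ {L} → All (Off (suc k) k) L → All (Off k (suc k)) L
        flip' = All.map (λ { (a , b) → b , a })
        eq : sL (suc k) (A ++ suc k ∷ B ++ k ∷ C) ≡ A ++ k ∷ B ++ suc k ∷ C
        eq = trans (sL-shape k A (suc k) B k C) (cong₂ _++_ (sL-off k (flip' (offA S))) (cong₂ _∷_ (sw-suc k)
               (cong₂ _++_ (sL-off k (flip' (offB S))) (cong₂ _∷_ (sw-k k) (sL-off k (flip' (offC S)))))))

    asc-len : ∀ {w} → IsPerm r w → Asc k w → len (sL (suc k) w) ≡ suc (len w)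
    asc-len {w} p h with order p k<r kr (lt↑ h)
    ... | ordered {A} {B} {C} e S = trans (len-inv (sL (suc k) w)) (trans (cong inv (trans (cong (sL (suc k)) e) (sL-split k A B C S)))
          (trans (inv-adj A B C (offB S)) (cong suc (trans (cong inv (sym e)) (sym (len-inv w))))))

    desc-len : ∀ {w} → IsPerm r w → Desc k w → len w ≡ suc (len (sL (suc k) w))
    desc-len {w} p h = trans (cong len (sym (sL-inv k w))) (asc-len {sL (suc k) w} (sL-perm p) (desc-asc {k} {w} h))

    len-asc : ∀ {w} → IsPerm r w → len w < len (sL (suc k) w) → Asc k w
    len-asc {w} p h with asc-or-desc p kr
    ... | inj₁ a = a
    ... | inj₂ d = ⊥-elim (<-asym h (subst (len (sL (suc k) w) <_) (sym (desc-len p d)) ≤-refl))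

    Tx-asc : ∀ {w} → Asc k w → Tx k w ≡ sL (suc k) w
    Tx-asc {w} h = Tx-yes {k} {w} refl refl (lt↑ h)

    Tx-desc : ∀ {w} → Desc k w → Tx k w ≡ w
    Tx-desc {w} h = Tx-no {k} {w} refl refl (<-asym (lt↓ h))

    Td-desc : ∀ {w} → Desc k w → Td k w ≡ sL (suc k) w
    Td-desc {w} h = Td-yes {k} {w} refl refl (lt↓ h)

    Td-asc : ∀ {w} → Asc k w → Td k w ≡ w
    Td-asc {w} h = Td-no {k} {w} refl refl (<-asym (lt↑ h))

    demazure-step : ∀ {w} → IsPerm r w → (if len w <ᵇ len (sL (suc k) w) then sL (suc k) w else w) ≡ Tx k w
    demazure-step {w} p = go (asc-or-desc p kr)
      where
      cond : ∀ {b} {x y : Perm} c → b ≡ c → (if b then x else y) ≡ (if c then x else y)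
      cond c refl = refl
      go : Asc k w ⊎ Desc k w → (if len w <ᵇ len (sL (suc k) w) then sL (suc k) w else w) ≡ Tx k w
      go (inj₁ a) = trans (cond true (<ᵇ-yes (subst (len w <_) (sym (asc-len p a)) ≤-refl))) (sym (Tx-asc a))
      go (inj₂ d) = trans (cond false (<ᵇ-no {len w} {len (sL (suc k) w)} (λ h → <-asym (lt↑ (len-asc p h)) (lt↓ d)))) (sym (Tx-desc d))

    Tx-perm : ∀ {w} → IsPerm r w → IsPerm r (Tx k w)
    Tx-perm {w} p with asc-or-desc p kr
    ... | inj₁ a = subst (IsPerm r) (sym (Tx-asc a)) (sL-perm p)
    ... | inj₂ d = subst (IsPerm r) (sym (Tx-desc d)) p

    Tx-len : ∀ {w} → IsPerm r w → len (Tx k w) ≤ suc (len w)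
    Tx-len {w} p with asc-or-desc p kr
    ... | inj₁ a = ≤-reflexive (trans (cong len (Tx-asc a)) (asc-len p a))
    ... | inj₂ d = ≤-trans (≤-reflexive (cong len (Tx-desc d))) (n≤1+n (len w))

    asc-≤B : ∀ {w} → IsPerm r w → Asc k w → w ≤B sL (suc k) w
    asc-≤B {w} p h with order p k<r kr (lt↑ h)
    ... | ordered {A} {B} {C} e S = subst₂ _≤B_ (sym e) (sym (trans (cong (sL (suc k)) e) (sL-split k A B C S))) (≤B-swap A B C (n<1+n k))

    desc-≤B : ∀ {w} → IsPerm r w → Desc k w → sL (suc k) w ≤B w
    desc-≤B {w} p h = subst (sL (suc k) w ≤B_) (sL-inv k w) (asc-≤B (sL-perm p) (desc-asc {k} {w} h))

    ≤B-Tx : ∀ {w} → IsPerm r w → w ≤B Tx k w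
    ≤B-Tx {w} p with asc-or-desc p kr
    ... | inj₁ a = subst (w ≤B_) (sym (Tx-asc a)) (asc-≤B p a)
    ... | inj₂ d = subst (w ≤B_) (sym (Tx-desc d)) ≤B-refl

    Td-≤B : ∀ {w} → IsPerm r w → Td k w ≤B w
    Td-≤B {w} p with asc-or-desc p kr
    ... | inj₁ a = subst (_≤B w) (sym (Td-asc a)) ≤B-refl
    ... | inj₂ d = subst (_≤B w) (sym (Td-desc d)) (desc-≤B p d)

    sL-≤B-Tx : ∀ {w} → IsPerm r w → sL (suc k) w ≤B Tx k w
    sL-≤B-Tx {w} p with asc-or-desc p kr
    ... | inj₁ a = subst (sL (suc k) w ≤B_) (sym (Tx-asc a)) ≤B-refl
    ... | inj₂ d = subst (sL (suc k) w ≤B_) (sym (Tx-desc d)) (desc-≤B p d)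

    Td-≤B-sL : ∀ {w} → IsPerm r w → Td k w ≤B sL (suc k) w
    Td-≤B-sL {w} p with asc-or-desc p kr
    ... | inj₁ a = subst (_≤B sL (suc k) w) (sym (Td-asc a)) (asc-≤B p a)
    ... | inj₂ d = subst (_≤B sL (suc k) w) (sym (Td-desc d)) ≤B-refl

    sw-mono : ∀ {x y} → x < y → sw k x < sw k y ⊎ (x ≡ k × y ≡ suc k)
    sw-mono {x} {y} h with swView k x | swView k y
    ... | lo refl | lo refl = ⊥-elim (<-irrefl refl h)
    ... | lo refl | hi refl = inj₂ (refl , refl)
    ... | lo refl | off a b = inj₁ (subst₂ _<_ (sym (sw-k k)) (sym (sw-off a b)) (≤∧≢⇒< h (b ∘ sym)))
    ... | hi refl | lo refl = ⊥-elim (<-asym h (n<1+n k))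
    ... | hi refl | hi refl = ⊥-elim (<-irrefl refl h)
    ... | hi refl | off a b = inj₁ (subst₂ _<_ (sym (sw-suc k)) (sym (sw-off a b)) (<-trans (n<1+n k) h))
    ... | off a b | lo refl = inj₁ (subst₂ _<_ (sym (sw-off a b)) (sym (sw-k k)) (<-trans h (n<1+n k)))
    ... | off a b | hi refl = inj₁ (subst₂ _<_ (sym (sw-off a b)) (sym (sw-suc k)) (≤∧≢⇒< (s≤s⁻¹ h) a))
    ... | off a b | off c d = inj₁ (subst₂ _<_ (sym (sw-off a b)) (sym (sw-off c d)) h)

    -- The lifting property for one reflection. Left multiplication by s_{k+1} keeps the order of
    -- the exchanged values x < y unless they are k and k + 1, and in that case it carries one
    -- element to the other.
    module Cover {A B C : List ℕ} {x y : ℕ} (p : IsPerm r (A ++ x ∷ B ++ y ∷ C)) (h : x < y) where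
      w w' : Perm
      w  = A ++ x ∷ B ++ y ∷ C
      w' = A ++ y ∷ B ++ x ∷ C

      p' : IsPerm r w'
      p' = ↭-trans (↭-sym (swap-↭ A x B y C)) p

      cover : sL (suc k) w ≤B sL (suc k) w' ⊎ sL (suc k) w ≡ w'
      cover with sw-mono h
      ... | inj₁ lt = inj₁ (subst₂ _≤B_ (sym (sL-shape k A x B y C)) (sym (sL-shape k A y B x C)) (≤B-swap (sL (suc k) A) (sL (suc k) B) (sL (suc k) C) lt))
      ... | inj₂ (refl , refl) = inj₂ (sL-split k A B C (separated A B C (perm-unique p)))

      Tx-cover : Tx k w ≤B Tx k w'
      Tx-cover with asc-or-desc p kr
      ... | inj₂ d = subst (_≤B Tx k w') (sym (Tx-desc d)) (≤B-trans (≤B-swap A B C h) (≤B-Tx p'))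
      ... | inj₁ a with cover
      ...   | inj₁ c = subst (_≤B Tx k w') (sym (Tx-asc a)) (≤B-trans c (sL-≤B-Tx p'))
      ...   | inj₂ e = subst (_≤B Tx k w') (sym (trans (Tx-asc a) e)) (≤B-Tx p')

      Td-cover : Td k w ≤B Td k w'
      Td-cover with asc-or-desc p' kr
      ... | inj₁ a = subst (Td k w ≤B_) (sym (Td-asc a)) (≤B-trans (Td-≤B p) (≤B-swap A B C h))
      ... | inj₂ d with cover
      ...   | inj₁ c = subst (Td k w ≤B_) (sym (Td-desc d)) (≤B-trans (Td-≤B-sL p) c)
      ...   | inj₂ e = subst (Td k w ≤B_) (sym (trans (Td-desc d) (trans (cong (sL (suc k)) (sym e)) (sL-inv k w)))) (Td-≤B p)

    private
      mono : (O : Perm → Perm) → (∀ {A B C x y} → IsPerm r (A ++ x ∷ B ++ y ∷ C) → x < y → O (A ++ x ∷ B ++ y ∷ C) ≤B O (A ++ y ∷ B ++ x ∷ C)) →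
             ∀ {u w} → IsPerm r w → u ≤B w → O u ≤B O w
      mono O cov p ≤B-refl = ≤B-refl
      mono O cov p (≤B-step {u} {w} a b h l q lt) with splitAt² w h l
      ... | split {A} {B} {C} {x} {y} e ea eb = ≤B-trans (mono O cov pw q) (subst₂ (λ s t → O s ≤B O t) (sym e) (sym se) (cov (subst (IsPerm r) e pw) x<y))
        where
        se : swapPos a b w ≡ A ++ y ∷ B ++ x ∷ C
        se = trans (cong (λ z → swapPos a b z) e) (trans (cong₂ (λ i j → swapPos i j (A ++ x ∷ B ++ y ∷ C)) ea eb) (swapPos-split A x B y C))
        pw : IsPerm r w
        pw = ↭-trans (↭-reflexive e) (↭-trans (swap-↭ A x B y C) (↭-trans (↭-reflexive (sym se)) p))
        -- A swap that puts the larger value last would lower the inversion number, against the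
        -- length condition of the step.
        x<y : x < y
        x<y with <-cmp x y
        ... | tri< a _ _ = a
        ... | tri≈ _ refl _ = ⊥-elim (<-irrefl (cong len (trans e (sym se))) lt)
        ... | tri> _ _ c = ⊥-elim (<-asym (subst₂ _<_ (trans (len-inv w) (cong inv e)) (trans (len-inv (swapPos a b w)) (cong inv se)) lt) (inv-swap A B C c))

    Tx-mono : ∀ {u w} → IsPerm r w → u ≤B w → Tx k u ≤B Tx k w
    Tx-mono = mono (Tx k) (λ p h → Cover.Tx-cover p h)

    Td-mono : ∀ {u w} → IsPerm r w → u ≤B w → Td k u ≤B Td k w
    Td-mono = mono (Td k) (λ p h → Cover.Td-cover p h)

  -- The three claims are proved together because the comparison of lengths in `demazure` agrees
  -- with `Tx` on permutations only.
  letters-act : ∀ {r W} → All (Between 1 r) W → IsPerm r (act W (idP r)) × demazure r W ≡ act W (idP r) × len (act W (idP r)) ≤ length W + len (idP r)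
  letters-act [] = ↭-refl , refl , ≤-refl
  letters-act {r} {suc k ∷ W} ((_ , b) ∷ hs) with letters-act hs
  ... | p , e , l = Tx-perm p , trans (cong (λ π → if len π <ᵇ len (sL (suc k) π) then sL (suc k) π else π) e) (demazure-step p)
                  , ≤-trans (Tx-len p) (s≤s l)
    where open Step b

-- Multiplication by the longest element; inverses

module LongestElement where
  open import Defs
  open import Data.Bool using (if_then_else_)
  open import Data.Nat
  open import Data.Nat.Properties
  open import Data.List using ([]; _∷_; _++_; map; reverse; length; upTo; applyUpTo)
  open import Data.List.Properties using (map-∘; map-id; length-map; length-++; ++-assoc; length-upTo; reverse-++; length-reverse; map-id-local; reverse-map; upTo-∷ʳ; reverse-involutive; map-cong-local)
  open import Data.List.Relation.Unary.All as All using (All; []; _∷_)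
  import Data.List.Relation.Unary.All.Properties as AllP
  open import Data.List.Membership.Propositional.Properties using (∈-upTo⁻)
  open import Data.List.Relation.Binary.Permutation.Propositional using (↭-refl; ↭-sym; ↭-trans; ↭-reflexive)
  open import Data.List.Relation.Binary.Permutation.Propositional.Properties using (↭-reverse)
  open TensorProducts using (≡ᵇ-yes; ≡ᵇ-no)
  open HeckeAction
  open BlockWords using (act; act-++; Between)
  open WordSymmetry using (tri; All-reverse)
  open Inversions
  open BruhatOrder

  ext : ∀ {n} xs ys → length xs ≡ n → length ys ≡ n → (∀ k → k < n → nth xs k ≡ nth ys k) → xs ≡ ys
  ext {n} xs ys a b h = trans (sym (tabulate-nth n xs a λ _ _ → refl)) (tabulate-nth n ys b h)

  nth-tab : ∀ n (g : ℕ → ℕ) k → k < n → nth (map g (upTo n)) k ≡ g k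
  nth-tab (suc n) g zero    h = refl
  nth-tab (suc n) g (suc k) h = trans (cong (λ z → nth z k) (map-upTo-suc g n)) (nth-tab n (g ∘ suc) k (s≤s⁻¹ h))

  nth-upTo : ∀ n k → k < n → nth (upTo n) k ≡ k
  nth-upTo n k h = trans (cong (λ z → nth z k) (sym (map-id (upTo n)))) (nth-tab n id k h)

  nth-map : ∀ (f : ℕ → ℕ) w k → k < length w → nth (map f w) k ≡ f (nth w k)
  nth-map f (x ∷ w) zero    h = refl
  nth-map f (x ∷ w) (suc k) h = nth-map f w k (s≤s⁻¹ h)

  module _ {r : ℕ} where

    nth-perm : ∀ {w k} → IsPerm r w → k < r → nth w k < r
    nth-perm {w} p h = perm-< p (nth-∈ w (subst (_ <_) (sym (perm-length p)) h))

    idx-perm : ∀ {w x} → IsPerm r w → x < r → idx x w < r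
    idx-perm {w} {x} p h = subst (idx x w <_) (perm-length p) (idx-< (perm-∈ p h))

    idx-nth-perm : ∀ {w} k → IsPerm r w → k < r → idx (nth w k) w ≡ k
    idx-nth-perm k p h = idx-nth k (perm-unique p) (subst (k <_) (sym (perm-length p)) h)

    -- Without descents the positions grow by at least one from each value to the next. Counting
    -- from below and from above leaves a single choice.
    asc-id : ∀ {w} → IsPerm r w → (∀ k → suc k < r → Asc k w) → w ≡ idP r
    asc-id {w} p h = ext w (idP r) (perm-length p) (length-upTo r)
      λ k kr → trans (cong (nth w) (sym (fix k kr))) (trans (nth-idx (perm-∈ p kr)) (sym (nth-upTo r k kr)))
      where
      lower : ∀ k → k < r → k ≤ idx k w
      lower zero    kr = z≤n
      lower (suc k) kr = ≤-<-trans (lower k (<-trans (n<1+n k) kr)) (lt↑ (h k kr))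
      upper : ∀ d k → k + d < r → idx k w + d ≤ idx (k + d) w
      upper zero    k kr = ≤-reflexive (trans (+-identityʳ _) (cong (λ z → idx z w) (sym (+-identityʳ k))))
      upper (suc d) k kr = ≤-trans (subst (_≤ idx (suc k) w + d) (sym (+-suc (idx k w) d)) (+-monoˡ-≤ d (lt↑ (h k (≤-<-trans (m≤m+n (suc k) d) kr')))))
                             (subst (λ z → idx (suc k) w + d ≤ idx z w) (sym (+-suc k d)) (upper d (suc k) kr'))
        where kr' = subst (_< r) (+-suc k d) kr
      fix : ∀ k → k < r → idx k w ≡ k
      fix k kr = ≤-antisym (+-cancelʳ-≤ d (idx k w) k (≤-trans (upper d k (≤-reflexive e)) (s≤s⁻¹ (≤-trans (idx-perm p (≤-reflexive e)) (≤-reflexive (sym e)))))) (lower k kr)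
        where
        d = r ∸ suc k
        e : suc (k + d) ≡ r
        e = m+[n∸m]≡n kr

    rev-order : ∀ {w x y} → Ordered w x y → idx y (reverse w) < idx x (reverse w)
    rev-order {w} {x} {y} (ordered {A} {B} {C} e S) = subst₂ _<_ (sym iy) (sym ix) (subst (_≤ length (reverse C ++ y ∷ reverse B)) (+-comm (length (reverse C)) 1)
        (subst (length (reverse C) + 1 ≤_) (sym (length-++ (reverse C))) (+-monoʳ-≤ (length (reverse C)) (s≤s z≤n))))
      where
      shape1 : reverse w ≡ reverse C ++ y ∷ (reverse B ++ x ∷ reverse A)
      shape1 = begin
        reverse w                                          ≡⟨ cong reverse e ⟩
        reverse (A ++ (x ∷ []) ++ B ++ (y ∷ []) ++ C)      ≡⟨ reverse-++ A _ ⟩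
        reverse (x ∷ (B ++ y ∷ C)) ++ reverse A            ≡⟨ cong (_++ reverse A) (reverse-++ (x ∷ []) (B ++ y ∷ C)) ⟩
        (reverse (B ++ y ∷ C) ++ x ∷ []) ++ reverse A      ≡⟨ ++-assoc (reverse (B ++ y ∷ C)) (x ∷ []) (reverse A) ⟩
        reverse (B ++ y ∷ C) ++ x ∷ reverse A              ≡⟨ cong (_++ x ∷ reverse A) (trans (reverse-++ B (y ∷ C)) (trans (cong (_++ reverse B) (reverse-++ (y ∷ []) C)) (++-assoc (reverse C) (y ∷ []) (reverse B)))) ⟩
        (reverse C ++ y ∷ reverse B) ++ x ∷ reverse A      ≡⟨ ++-assoc (reverse C) (y ∷ reverse B) (x ∷ reverse A) ⟩
        reverse C ++ y ∷ (reverse B ++ x ∷ reverse A) ∎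
        where open ≡-Reasoning
      iy : idx y (reverse w) ≡ length (reverse C)
      iy = trans (cong (idx y) shape1) (idx-mid (All-reverse C (All.map proj₂ (offC S))))
      ix : idx x (reverse w) ≡ length (reverse C ++ y ∷ reverse B)
      ix = trans (cong (idx x) (trans shape1 (sym (++-assoc (reverse C) (y ∷ reverse B) (x ∷ reverse A)))))
             (idx-mid (AllP.++⁺ (All-reverse C (All.map proj₁ (offC S))) ((x≢y S ∘ sym) ∷ All-reverse B (All.map proj₁ (offB S)))))

    reverse-perm : ∀ {w} → IsPerm r w → IsPerm r (reverse w)
    reverse-perm {w} p = ↭-trans (↭-reverse w) p

    module _ {k : ℕ} (kr : suc k < r) where
      open Step kr

      rev-asc : ∀ {w} → IsPerm r w → Asc k w → Desc k (reverse w)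
      rev-asc p (asc h) = desc (rev-order (order p k<r kr h))

      rev-desc : ∀ {w} → IsPerm r w → Desc k w → Asc k (reverse w)
      rev-desc p (desc h) = asc (rev-order (order p kr k<r h))

      -- Right multiplication by w₀ reverses one-line notation, which exchanges ascents with
      -- descents and so upward with downward operators.
      rev-Tx : ∀ {w} → IsPerm r w → Td k (reverse w) ≡ reverse (Tx k w)
      rev-Tx {w} p with asc-or-desc p kr
      ... | inj₁ a = trans (Td-desc (rev-asc p a)) (trans (reverse-map (sw k) w) (cong reverse (sym (Tx-asc a))))
      ... | inj₂ d = trans (Td-asc (rev-desc p d)) (cong reverse (sym (Tx-desc d)))

    desc-w0 : ∀ {w} → IsPerm r w → (∀ k → suc k < r → Desc k w) → w ≡ w0 r
    desc-w0 {w} p h = trans (sym (reverse-involutive w)) (cong reverse (asc-id (reverse-perm p) λ k kr → rev-desc kr p (h k kr)))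

    w0-perm : IsPerm r (w0 r)
    w0-perm = ↭-reverse (upTo r)

    dot-w0 : ∀ {w} → IsPerm r w → w · w0 r ≡ reverse w
    dot-w0 {w} p = trans (reverse-map (nth w) (upTo r)) (cong reverse (tabulate-nth r w (perm-length p) λ _ _ → refl))

    reverse-upTo : ∀ n → reverse (upTo (suc n)) ≡ n ∷ reverse (upTo n)
    reverse-upTo n = trans (cong reverse (sym (upTo-∷ʳ n))) (reverse-++ (upTo n) (n ∷ []))

    nth-w0 : ∀ n k → k < n → nth (w0 n) k ≡ n ∸ suc k
    nth-w0 (suc n) zero    h rewrite reverse-upTo n = refl
    nth-w0 (suc n) (suc k) h rewrite reverse-upTo n = nth-w0 n k (s≤s⁻¹ h)

    numBelow-all : ∀ x ys → All (_< x) ys → numBelow x ys ≡ length ys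
    numBelow-all x []       []       = refl
    numBelow-all x (y ∷ ys) (h ∷ hs) rewrite <ᵇ-yes h = cong suc (numBelow-all x ys hs)

    upTo-< : ∀ n → All (_< n) (upTo n)
    upTo-< n = All.tabulate ∈-upTo⁻

    len-w0 : ∀ n → len (w0 (suc n)) ≡ tri n
    len-w0 n = trans (len-inv (w0 (suc n))) (go n)
      where
      go : ∀ n → inv (w0 (suc n)) ≡ tri n
      peel : ∀ n → inv (w0 (suc n)) ≡ n + inv (w0 n)
      peel n = trans (cong inv (reverse-upTo n)) (cong (_+ inv (w0 n)) (trans (numBelow-all n _ (All-reverse (upTo n) (upTo-< n)))
        (trans (length-reverse (upTo n)) (length-upTo n))))
      go zero    = refl
      go (suc n) = trans (peel (suc n)) (cong (suc n +_) (go n))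

    numBelow-none : ∀ x ys → All (x ≤_) ys → numBelow x ys ≡ 0
    numBelow-none x []       []       = refl
    numBelow-none x (y ∷ ys) (h ∷ hs) rewrite <ᵇ-no {y} {x} (≤⇒≯ h) = numBelow-none x ys hs

    len-id : ∀ n → len (idP n) ≡ 0
    len-id n = trans (len-inv (idP n)) (go n id (λ x≤y → x≤y))
      where
      go : ∀ n (f : ℕ → ℕ) → (∀ {x y} → x ≤ y → f x ≤ f y) → inv (applyUpTo f n) ≡ 0
      go zero    f m = refl
      go (suc n) f m = cong₂ _+_ (numBelow-none (f 0) _ (AllP.applyUpTo⁺₂ (f ∘ suc) n λ _ → m z≤n)) (go n (f ∘ suc) (m ∘ s≤s))

  module Complement (R : ℕ) where
    private r = suc (suc R)

    -- Left multiplication by w₀ replaces each value by its complement.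
    co : ℕ → ℕ
    co = nth (w0 r)

    co-eq : ∀ {x} → x < r → co x ≡ suc R ∸ x
    co-eq {x} h = nth-w0 {r} r x h

    co-< : ∀ {x} → x < r → co x < r
    co-< {x} h = subst (_< r) (sym (co-eq h)) (s≤s (m∸n≤m (suc R) x))

    co-inj : ∀ {x y} → x < r → y < r → co x ≡ co y → x ≡ y
    co-inj {x} {y} h k e = ∸-cancelˡ-≡ (s≤s⁻¹ h) (s≤s⁻¹ k) (trans (sym (co-eq h)) (trans e (co-eq k)))

    co-idx : ∀ {w x} → All (_< r) w → x < r → idx (co x) (map co w) ≡ idx x w
    co-idx {[]}    {x} []       h = refl
    co-idx {y ∷ w} {x} (k ∷ ks) h with x ≟ y
    ... | yes refl rewrite ≡ᵇ-yes (co x) | ≡ᵇ-yes x = refl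
    ... | no ne rewrite ≡ᵇ-no (ne ∘ co-inj h k) | ≡ᵇ-no ne = cong suc (co-idx ks h)

    perm-all : ∀ {w} → IsPerm r w → All (_< r) w
    perm-all p = All.tabulate (perm-< p)

    co-invol : ∀ {x} → x < r → co (co x) ≡ x
    co-invol {x} h = trans (co-eq (co-< h)) (trans (cong (suc R ∸_) (co-eq h)) (m∸[m∸n]≡n (s≤s⁻¹ h)))

    co-w0 : w0 r ≡ map co (idP r)
    co-w0 = sym (tabulate-nth r (w0 r) (trans (length-reverse (upTo r)) (length-upTo r)) λ _ _ → refl)

    co-co : ∀ {w} → IsPerm r w → map co (map co w) ≡ w
    co-co {w} p = trans (sym (map-∘ w)) (map-id-local (All.map co-invol (perm-all p)))

    module _ {k : ℕ} (k≤R : k ≤ R) where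
      private
        k' = R ∸ k
        kr : suc k < r
        kr = s≤s (s≤s k≤R)
        kr' : suc k' < r
        kr' = s≤s (s≤s (m∸n≤m R k))

      co-k : co k ≡ suc k'
      co-k = trans (co-eq (Step.k<r kr)) (+-∸-assoc 1 k≤R)

      co-k⁺ : co (suc k) ≡ k'
      co-k⁺ = co-eq kr

      co-sw : ∀ {z} → z < r → co (sw k z) ≡ sw k' (co z)
      co-sw {z} h with swView k z
      ... | lo refl = trans (cong co (sw-k k)) (trans co-k⁺ (sym (trans (cong (sw k') co-k) (sw-suc k'))))
      ... | hi refl = trans (cong co (sw-suc k)) (trans co-k (sym (trans (cong (sw k') co-k⁺) (sw-k k'))))
      ... | off a b = trans (cong co (sw-off a b)) (sym (sw-off (λ e → b (co-inj h kr (trans e (sym co-k⁺)))) (λ e → a (co-inj h (Step.k<r kr) (trans e (sym co-k))))))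

      co-sL : ∀ {w} → IsPerm r w → map co (sL (suc k) w) ≡ sL (suc k') (map co w)
      co-sL {w} p = trans (sym (map-∘ w)) (trans (map-cong-local (All.map co-sw (perm-all p))) (map-∘ w))

      private
        i-lo : ∀ {w} → IsPerm r w → idx k' (map co w) ≡ idx (suc k) w
        i-lo {w} p = trans (cong (λ z → idx z (map co w)) (sym co-k⁺)) (co-idx (perm-all p) kr)
        i-hi : ∀ {w} → IsPerm r w → idx (suc k') (map co w) ≡ idx k w
        i-hi {w} p = trans (cong (λ z → idx z (map co w)) (sym co-k)) (co-idx (perm-all p) (Step.k<r kr))

      -- w₀ s_{k+1} = s_{R+1-k} w₀, and complementing reverses the order of values; so the index is
      -- mirrored and the operator changes direction.
      co-Tx : ∀ {w} → IsPerm r w → Td k' (map co w) ≡ map co (Tx k w)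
      co-Tx {w} p with asc-or-desc p kr
      ... | inj₁ a = trans (Step.Td-desc kr' (desc (subst₂ _<_ (sym (i-hi p)) (sym (i-lo p)) (lt↑ a)))) (trans (sym (co-sL p)) (cong (map co) (sym (Step.Tx-asc kr a))))
      ... | inj₂ d = trans (Step.Td-asc kr' (asc (subst₂ _<_ (sym (i-lo p)) (sym (i-hi p)) (lt↓ d)))) (cong (map co) (sym (Step.Tx-desc kr d)))

  module Inverse (r : ℕ) where

    sA : ℕ → Perm → Perm
    sA k = swapPos k (suc k)

    sA-perm : ∀ {k u} → suc k < r → IsPerm r u → IsPerm r (sA k u)
    sA-perm {k} {u} kr p with splitAt² u (n<1+n k) (subst (suc k <_) (sym (perm-length p)) kr)
    ... | split {A} {B} {C} {x} {y} e ea eb = ↭-trans (↭-reflexive (trans (cong (sA k) e) (trans (cong₂ (λ i j → swapPos i j (A ++ x ∷ B ++ y ∷ C)) ea eb) (swapPos-split A x B y C))))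
          (↭-trans (↭-sym (swap-↭ A x B y C)) (↭-trans (↭-reflexive (sym e)) p))

    nth-sA : ∀ {u} k i → IsPerm r u → i < r → nth (sA k u) i ≡ nth u (sw k i)
    nth-sA {u} k i p h = nth-tab (length u) (λ j → nth u (sw k j)) i (subst (i <_) (sym (perm-length p)) h)

    sw-< : ∀ {k x} → suc k < r → x < r → sw k x < r
    sw-< {k} {x} kr h with swView k x
    ... | lo refl = subst (_< r) (sym (sw-k k)) kr
    ... | hi refl = subst (_< r) (sym (sw-suc k)) (<-trans (n<1+n k) kr)
    ... | off a b = subst (_< r) (sym (sw-off a b)) h

    idx-sA : ∀ {u x k} → suc k < r → IsPerm r u → x < r → idx x (sA k u) ≡ sw k (idx x u)
    idx-sA {u} {x} {k} kr p h = trans (cong (λ z → idx z (sA k u)) (sym e)) (idx-nth-perm _ (sA-perm kr p) lt)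
      where
      lt = sw-< kr (idx-perm p h)
      e : nth (sA k u) (sw k (idx x u)) ≡ x
      e = trans (nth-sA k _ p lt) (trans (cong (nth u) (sw-inv k (idx x u))) (nth-idx (perm-∈ p h)))

    -- S_{k+1} acting from the right.
    Rx : ℕ → Perm → Perm
    Rx k u = if nth u k <ᵇ nth u (suc k) then sA k u else u

    Rx-yes : ∀ {k u a b} → nth u k ≡ a → nth u (suc k) ≡ b → a < b → Rx k u ≡ sA k u
    Rx-yes refl refl h rewrite <ᵇ-yes h = refl

    Rx-no : ∀ {k u a b} → nth u k ≡ a → nth u (suc k) ≡ b → ¬ a < b → Rx k u ≡ u
    Rx-no refl refl h rewrite <ᵇ-no h = refl

    module _ {i k : ℕ} (ir : suc i < r) (kr : suc k < r) {u : Perm} (p : IsPerm r u) where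
      private
        i<r = Step.k<r ir
        k<r = Step.k<r kr
        len-sA : ∀ {v} → IsPerm r v → length (sA k v) ≡ r
        len-sA q = perm-length (sA-perm kr q)

      sL-sA : sL (suc i) (sA k u) ≡ sA k (sL (suc i) u)
      sL-sA = ext _ _ (perm-length (Step.sL-perm ir (sA-perm kr p))) (len-sA (Step.sL-perm ir p)) λ j h →
        trans (nth-map (sw i) (sA k u) j (subst (j <_) (sym (len-sA p)) h)) (trans (cong (sw i) (nth-sA k j p h))
          (sym (trans (nth-sA k j (Step.sL-perm ir p) h) (nth-map (sw i) u (sw k j) (subst (sw k j <_) (sym (perm-length p)) (sw-< kr h))))))

      sL≡sA : nth u k ≡ i → nth u (suc k) ≡ suc i → sL (suc i) u ≡ sA k u
      sL≡sA e e' = ext _ _ (perm-length (Step.sL-perm ir p)) (len-sA p) entry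
        where
        entry : ∀ j → j < r → nth (sL (suc i) u) j ≡ nth (sA k u) j
        entry j h = trans (nth-map (sw i) u j (subst (j <_) (sym (perm-length p)) h)) (trans (go (swView k j)) (sym (nth-sA k j p h)))
          where
          inj : ∀ {l} → l < r → nth u j ≡ nth u l → j ≡ l
          inj l q = trans (sym (idx-nth-perm j p h)) (trans (cong (λ z → idx z u) q) (idx-nth-perm _ p l))
          go : SwView k j → sw i (nth u j) ≡ nth u (sw k j)
          go (lo refl) = trans (cong (sw i) e) (trans (sw-k i) (sym (trans (cong (nth u) (sw-k k)) e')))
          go (hi refl) = trans (cong (sw i) e') (trans (sw-suc i) (sym (trans (cong (nth u) (sw-suc k)) e)))
          go (off a b) = trans (sw-off (λ q → a (inj k<r (trans q (sym e)))) (λ q → b (inj kr (trans q (sym e'))))) (cong (nth u) (sym (sw-off a b)))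

      private
        a = idx i u
        b = idx (suc i) u
        c = nth u k
        d = nth u (suc k)
        ca : c ≡ i → a ≡ k
        ca e = trans (cong (λ z → idx z u) (sym e)) (idx-nth-perm k p k<r)
        da : d ≡ i → a ≡ suc k
        da e = trans (cong (λ z → idx z u) (sym e)) (idx-nth-perm (suc k) p kr)
        cb : c ≡ suc i → b ≡ k
        cb e = trans (cong (λ z → idx z u) (sym e)) (idx-nth-perm k p k<r)
        db : d ≡ suc i → b ≡ suc k
        db e = trans (cong (λ z → idx z u) (sym e)) (idx-nth-perm (suc k) p kr)
        ac : a ≡ k → c ≡ i
        ac e = trans (cong (nth u) (sym e)) (nth-idx (perm-∈ p i<r))
        ad : a ≡ suc k → d ≡ i
        ad e = trans (cong (nth u) (sym e)) (nth-idx (perm-∈ p i<r))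
        bc : b ≡ k → c ≡ suc i
        bc e = trans (cong (nth u) (sym e)) (nth-idx (perm-∈ p ir))
        bd : b ≡ suc k → d ≡ suc i
        bd e = trans (cong (nth u) (sym e)) (nth-idx (perm-∈ p ir))

        i₁ : idx i (sA k u) ≡ sw k a
        i₁ = idx-sA kr p i<r
        i₂ : idx (suc i) (sA k u) ≡ sw k b
        i₂ = idx-sA kr p ir
        n₁ : nth (sL (suc i) u) k ≡ sw i c
        n₁ = nth-map (sw i) u k (subst (k <_) (sym (perm-length p)) k<r)
        n₂ : nth (sL (suc i) u) (suc k) ≡ sw i d
        n₂ = nth-map (sw i) u (suc k) (subst (suc k <_) (sym (perm-length p)) kr)

        module Up (up : c ≡ i) (up' : d ≡ suc i) where
          a<b : a < b
          a<b = subst₂ _<_ (sym (ca up)) (sym (db up')) (n<1+n k)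
          c<d : c < d
          c<d = subst₂ _<_ (sym up) (sym up') (n<1+n i)
          tx = Tx-yes {i} {u} refl refl a<b
          rx = Rx-yes {k} {u} refl refl c<d
          e = sL≡sA up up'
          goal : Tx i (Rx k u) ≡ Rx k (Tx i u)
          goal = trans (cong (Tx i) (trans rx (sym e))) (trans (Tx-no {i} {sL (suc i) u} (idx-lo i u) (idx-hi i u) (<-asym a<b))
            (sym (trans (cong (Rx k) tx) (Rx-no {k} {sL (suc i) u} (trans n₁ (trans (cong (sw i) up) (sw-k i))) (trans n₂ (trans (cong (sw i) up') (sw-suc i))) (<-asym (n<1+n i))))))

        module Down (dn : c ≡ suc i) (dn' : d ≡ i) where
          goal : Tx i (Rx k u) ≡ Rx k (Tx i u)
          goal = trans (cong (Tx i) rx) (trans tx (sym (trans (cong (Rx k) tx) rx)))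
            where
            tx = Tx-no {i} {u} refl refl (<-asym (subst₂ _<_ (sym (cb dn)) (sym (da dn')) (n<1+n k)))
            rx = Rx-no {k} {u} refl refl (<-asym (subst₂ _<_ (sym dn') (sym dn) (n<1+n i)))

        module Free (f₁ : ¬ (c ≡ i × d ≡ suc i)) (f₂ : ¬ (c ≡ suc i × d ≡ i)) where
          ab< : a < b → sw k a < sw k b
          ab< h with Step.sw-mono kr h
          ... | inj₁ q = q
          ... | inj₂ (x , y) = ⊥-elim (f₁ (ac x , bd y))
          ba< : b < a → sw k b < sw k a
          ba< h with Step.sw-mono kr h
          ... | inj₁ q = q
          ... | inj₂ (x , y) = ⊥-elim (f₂ (bc x , ad y))
          cd< : c < d → sw i c < sw i d
          cd< h with Step.sw-mono ir h
          ... | inj₁ q = q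
          ... | inj₂ q = ⊥-elim (f₁ q)
          dc< : d < c → sw i d < sw i c
          dc< h with Step.sw-mono ir h
          ... | inj₁ q = q
          ... | inj₂ (x , y) = ⊥-elim (f₂ (y , x))
          c≢d : c ≢ d
          c≢d e = 1+n≢n (sym (trans (sym (idx-nth-perm k p k<r)) (trans (cong (λ z → idx z u) e) (idx-nth-perm (suc k) p kr))))
          goal : Tx i (Rx k u) ≡ Rx k (Tx i u)
          goal with asc-or-desc p ir | <-cmp c d
          ... | _ | tri≈ _ e _ = ⊥-elim (c≢d e)
          ... | inj₁ (asc h) | tri< q _ _ = trans (cong (Tx i) (Rx-yes {k} {u} refl refl q)) (trans (Tx-yes {i} {sA k u} i₁ i₂ (ab< h))
                (trans sL-sA (sym (trans (cong (Rx k) (Tx-yes {i} {u} refl refl h)) (Rx-yes {k} {sL (suc i) u} n₁ n₂ (cd< q))))))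
          ... | inj₁ (asc h) | tri> _ _ q = trans (cong (Tx i) (Rx-no {k} {u} refl refl (<-asym q))) (trans (Tx-yes {i} {u} refl refl h)
                (sym (trans (cong (Rx k) (Tx-yes {i} {u} refl refl h)) (Rx-no {k} {sL (suc i) u} n₁ n₂ (<-asym (dc< q))))))
          ... | inj₂ (desc h) | tri< q _ _ = trans (cong (Tx i) (Rx-yes {k} {u} refl refl q)) (trans (Tx-no {i} {sA k u} i₁ i₂ (<-asym (ba< h)))
                (sym (trans (cong (Rx k) (Tx-no {i} {u} refl refl (<-asym h))) (Rx-yes {k} {u} refl refl q))))
          ... | inj₂ (desc h) | tri> _ _ q = trans (cong (Tx i) (Rx-no {k} {u} refl refl (<-asym q))) (trans (Tx-no {i} {u} refl refl (<-asym h))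
                (sym (trans (cong (Rx k) (Tx-no {i} {u} refl refl (<-asym h))) (Rx-no {k} {u} refl refl (<-asym q)))))

      -- The left and right actions interfere only if positions k, k + 1 hold the values i, i + 1.
      -- Then s_{i+1} u = u s_{k+1}, so either operator performs the same swap and the other one
      -- finds it done. Otherwise neither swap disturbs the comparison made by the other.
      Tx-Rx : Tx i (Rx k u) ≡ Rx k (Tx i u)
      Tx-Rx with c ≟ i | d ≟ suc i | c ≟ suc i | d ≟ i
      ... | yes e | yes e' | _ | _ = Up.goal e e'
      ... | _ | _ | yes e | yes e' = Down.goal e e'
      ... | no f | _ | no f' | _ = Free.goal (f ∘ proj₁) (f' ∘ proj₁)
      ... | no f | _ | _ | no f' = Free.goal (f ∘ proj₁) (f' ∘ proj₂)
      ... | _ | no f | no f' | _ = Free.goal (f ∘ proj₂) (f' ∘ proj₁)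
      ... | _ | no f | _ | no f' = Free.goal (f ∘ proj₂) (f' ∘ proj₂)

    id-perm : IsPerm r (idP r)
    id-perm = ↭-refl

    nth-id : ∀ {x} → x < r → nth (idP r) x ≡ x
    nth-id {x} h = nth-upTo r x h

    Tx-id : ∀ {k} → suc k < r → Tx k (idP r) ≡ Rx k (idP r)
    Tx-id {k} kr = trans (Tx-yes {k} {idP r} (ii k<r) (ii kr) (n<1+n k)) (trans (sL≡sA kr kr id-perm (nth-id k<r) (nth-id kr)) (sym (Rx-yes {k} {idP r} (nth-id k<r) (nth-id kr) (n<1+n k))))
      where
      k<r = Step.k<r kr
      ii : ∀ {x} → x < r → idx x (idP r) ≡ x
      ii {x} h = trans (cong (λ z → idx z (idP r)) (sym (nth-id h))) (idx-nth-perm x id-perm h)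

    act-snoc : ∀ W {k} → All (Between 1 r) W → suc k < r → act W (Rx k (idP r)) ≡ Rx k (act W (idP r))
    act-snoc [] [] kr = refl
    act-snoc (suc j ∷ W) {k} ((_ , b) ∷ hs) kr = trans (cong (Tx j) (act-snoc W hs kr)) (Tx-Rx b kr (proj₁ (letters-act hs)))

    record Inv (u w : Perm) : Set where
      constructor inverse
      field at : ∀ x → x < r → nth u x ≡ idx x w

    inv-dot : ∀ {u w} → IsPerm r w → Inv u w → u · w ≡ idP r
    inv-dot {u} {w} p (inverse h) = ext _ _ (trans (length-map (nth u) w) (perm-length p)) (length-upTo r) λ j l →
      trans (nth-map (nth u) w j (subst (j <_) (sym (perm-length p)) l)) (trans (h (nth w j) (nth-perm p l)) (trans (idx-nth-perm j p l) (sym (nth-id l))))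

    inv-step : ∀ {u w k} → suc k < r → IsPerm r u → IsPerm r w → Inv u w → Inv (Rx k u) (Tx k w)
    inv-step {u} {w} {k} kr pu pw (inverse h) with asc-or-desc pw kr
    ... | inj₂ (desc d) = subst₂ Inv (sym (Rx-no {k} {u} (h k (Step.k<r kr)) (h (suc k) kr) (<-asym d))) (sym (Tx-no {k} {w} refl refl (<-asym d))) (inverse h)
    ... | inj₁ (asc a) = subst₂ Inv (sym (Rx-yes {k} {u} (h k (Step.k<r kr)) (h (suc k) kr) a)) (sym (Tx-yes {k} {w} refl refl a))
          (inverse λ x l → trans (nth-sA k x pu l) (trans (h (sw k x) (sw-< kr l)) (sym (idx-sL k x w))))

    -- Removing the first letter of `W` removes the last letter of the reversed word, and `act-snoc`
    -- makes that letter act from the right, as inversion requires.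
    reverse-inverse : ∀ W → All (Between 1 r) W → Inv (act (reverse W) (idP r)) (act W (idP r))
    reverse-inverse [] [] = inverse λ x l → trans (nth-id l) (sym (trans (cong (λ z → idx z (idP r)) (sym (nth-id l))) (idx-nth-perm x id-perm l)))
    reverse-inverse (suc k ∷ W) ((_ , b) ∷ hs) = subst (λ u → Inv u (Tx k (act W (idP r)))) (sym e)
        (inv-step b (proj₁ (letters-act hr)) (proj₁ (letters-act hs)) (reverse-inverse W hs))
      where
      hr = All-reverse W hs
      e : act (reverse (suc k ∷ W)) (idP r) ≡ Rx k (act (reverse W) (idP r))
      e = trans (cong (λ z → act z (idP r)) (reverse-++ (suc k ∷ []) W)) (trans (act-++ (reverse W) (suc k ∷ []) (idP r))
            (trans (cong (act (reverse W)) (Tx-id b)) (act-snoc (reverse W) hr b)))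

-- Ballot inequalities and the construction of the involution τ

module StarInvolution where
  open import Defs
  open import Data.Nat
  open import Data.Nat.Properties
  import Data.Integer as ℤ
  open ℤ using (ℤ; 0ℤ; -1ℤ)
  open import Data.List using (map)
  open import Data.List.Properties using (map-∘)
  open import Data.Maybe using (just)
  open import Data.Maybe.Properties using (just-injective)
  open Brackets
  open BracketCorners
  open Triangles
  open Weights
  open DoubleCrystal
  open TensorProducts
  open StringEmbedding
  open PatternEncoding
  open WordSymmetry

  -- A ballot condition: at most s of the - survive, and in any prefix each other - is matched by an
  -- earlier +.
  prefix-bound : ∀ L {q p} s → eps L q p ≤ s → ∀ X → X ≤ L → Σ< (suc X) q ≤ s + Σ< X p
  prefix-bound zero    s h zero    k = ≤-trans h (m≤m+n s 0)
  prefix-bound (suc L) {q} {p} s h zero k = ≤-trans (≤-trans (m≤m+n (q 0) _) h) (m≤m+n s 0)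
  prefix-bound (suc L) {q} {p} s h (suc X) k = subst₂ _≤_ (sym (Σ<-cons (suc X) q)) rhs
      (+-monoʳ-≤ (q 0) (prefix-bound L (p 0 + (s ∸ q 0)) tail X (s≤s⁻¹ k)))
    where
    q≤s : q 0 ≤ s
    q≤s = ≤-trans (m≤m+n (q 0) _) h
    tail : eps L (sh q) (sh p) ≤ p 0 + (s ∸ q 0)
    tail = ≤-trans (m≤n+m∸n (eps L (sh q) (sh p)) (p 0)) (+-monoʳ-≤ (p 0) (m+n≤o⇒m≤o∸n _ (subst (_≤ s) (+-comm (q 0) _) h)))
    rhs : q 0 + (p 0 + (s ∸ q 0) + Σ< X (sh p)) ≡ s + Σ< (suc X) p
    rhs = begin
      q 0 + (p 0 + (s ∸ q 0) + Σ< X (sh p))   ≡⟨ cong (λ z → q 0 + (z + Σ< X (sh p))) (+-comm (p 0) (s ∸ q 0)) ⟩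
      q 0 + ((s ∸ q 0) + p 0 + Σ< X (sh p))   ≡⟨ cong (q 0 +_) (+-assoc (s ∸ q 0) (p 0) _) ⟩
      q 0 + ((s ∸ q 0) + (p 0 + Σ< X (sh p))) ≡⟨ sym (+-assoc (q 0) _ _) ⟩
      q 0 + (s ∸ q 0) + (p 0 + Σ< X (sh p))   ≡⟨ cong₂ _+_ (m+[n∸m]≡n q≤s) (sym (Σ<-cons X p)) ⟩
      s + Σ< (suc X) p ∎
      where open ≡-Reasoning

  Σ<-mono : ∀ k {g h} → (∀ x → x < k → g x ≤ h x) → Σ< k g ≤ Σ< k h
  Σ<-mono zero    e = z≤n
  Σ<-mono (suc k) e = +-mono-≤ (Σ<-mono k λ x u → e x (m<n⇒m<1+n u)) (e k ≤-refl)

  Σ<-swap : ∀ a b (n : Mat) → cnt a b n ≡ Σ< b (λ y → Σ< a (λ x → n x y))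
  Σ<-swap zero    b n = sym (z b)
    where
    z : ∀ b → Σ< b (λ _ → 0) ≡ 0
    z zero    = refl
    z (suc b) = trans (+-identityʳ _) (z b)
  Σ<-swap (suc a) b n = trans (cong (_+ Σ< b (n a)) (Σ<-swap a b n)) (sym (Σ<-+ b (λ y → Σ< a (λ x → n x y)) (n a)))

  Σ<-drop : ∀ k g → Σ< k (sh g) ≤ Σ< (suc k) g
  Σ<-drop k g = subst (Σ< k (sh g) ≤_) (sym (Σ<-cons k g)) (m≤n+m _ (g 0))

  -- From g 0 = 0 ≤ g 1, convexity makes the sequence weakly increasing, and it ends at 0.
  convex-zero : ∀ r (g : ℕ → ℕ) → g 0 ≡ 0 → g (suc r) ≡ 0 → (∀ k → k < r → g (suc k) + g (suc k) ≤ g k + g (suc (suc k))) →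
                ∀ k → k ≤ suc r → g k ≡ 0
  convex-zero r g z z' h k le = n≤0⇒n≡0 (subst (g k ≤_) z' (climb (suc r ∸ k) k (m∸n+n≡m le)))
    where
    up' : ∀ k → k ≤ r → g k ≤ g (suc k)
    up' zero    _ = subst (_≤ g 1) (sym z) z≤n
    up' (suc k) u = +-cancelˡ-≤ (g (suc k)) _ _ (≤-trans (h k u) (+-monoˡ-≤ (g (suc (suc k))) (up' k (<⇒≤ u))))
    climb : ∀ d k → d + k ≡ suc r → g k ≤ g (suc r)
    climb zero    k e = ≤-reflexive (cong g e)
    climb (suc d) k e = ≤-trans (up' k (s≤s⁻¹ (subst (suc k ≤_) e (s≤s (m≤n+m k d))))) (climb d (suc k) (trans (+-suc d k) e))

  module Involution (R : ℕ) where
    open Words R public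
    module E = Crystal ends
    module S = Crystal starts
    module K = Compatible compatible

    r : ℕ
    r = suc (suc R)

    enc-inj : ∀ {n m} → enc n ≡ enc m → n ≈ m
    enc-inj {n} {m} e = StartStrings.St-inj J-≤ (trans (enc-St n) (trans e (sym (enc-St m)))) (≈-trans (enc-Res n) (≈-sym (enc-Res m)))

    enc-𝟎 : u0 r ≡ enc 𝟎
    enc-𝟎 = trans (cong (map (λ j → (j , 0ℤ))) (Jword-Js R)) (trans (sym (map-∘ Jr)) (trans (sym (proj₁ (StartStrings.St-𝟎 J-≤ ≈-refl))) (enc-St 𝟎)))

    fT-E : ∀ {i} n → i ≤ R → fT (suc i) (enc n) ≡ just (enc (E.f i n))
    fT-E n h = view-f (fT-enc n h)

    InB-enc : ∀ {v} → InB r v → ∃ λ n → v ≡ enc n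
    InB-enc base = 𝟎 , enc-𝟎
    InB-enc (step (suc i) _ h b q) with InB-enc b
    ... | n , refl = E.f i n , just-injective (trans (sym q) (fT-E n (s≤s⁻¹ h)))

    enc-InB : ∀ n → InB r (enc n)
    enc-InB = EP.generated (λ n → InB r (enc n)) (λ e b → subst (InB r) (enc-cong e) b) (subst (InB r) enc-𝟎 base)
      λ {i} {n} h b → step (suc i) (s≤s z≤n) (s≤s h) b (fT-E n h)

    private
      -- The f-string along `J` is the coordinate vector of some array, which will serve as `τ n`.
      -- The claim about the residue is carried along because `embed` needs it in the induction.
      Good : Mat → Set
      Good n = (∃ λ m → EndStrings.St Jr n ≡ enc m) × EndStrings.Res Jr n ≈ 𝟎

      next : ∀ {i} n → i ≤ R → (g : Good n) → EndStrings.St Jr (S.f i n) ≡ enc (E.f i (proj₁ (proj₁ g))) × EndStrings.Res Jr (S.f i n) ≈ 𝟎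
      next {i} n h ((m , q) , rs) with enc-nonneg m h
      ... | nn e is le with EndStrings.embed h J-≤ rs (trans (cong (epsT (suc i)) q) is) le
      ... | V , rs' = just-injective (trans (sym (view-f V)) (trans (cong (fT (suc i)) q) (fT-E m h))) , rs'

      St-zero : EndStrings.St Jr 𝟎 ≡ enc 𝟎
      St-zero = trans (proj₁ (EndStrings.St-𝟎 J-≤ ≈-refl)) (trans (sym (proj₁ (StartStrings.St-𝟎 J-≤ ≈-refl))) (enc-St 𝟎))

    opaque
      good : ∀ n → Good n
      good = SP.generated Good
        (λ { e ((m , q) , r) → (m , trans (EndStrings.St-cong J-≤ (≈-sym e)) q) , ≈-trans (EndStrings.Res-cong J-≤ (≈-sym e)) r })
        ((𝟎 , St-zero) , proj₂ (EndStrings.St-𝟎 J-≤ ≈-refl))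
        λ {i} {n} h g → (E.f i (proj₁ (proj₁ g)) , proj₁ (next n h g)) , proj₂ (next n h g)

    τ : Mat → Mat
    τ n = proj₁ (proj₁ (good n))

    τ-St : ∀ n → EndStrings.St Jr n ≡ enc (τ n)
    τ-St n = proj₂ (proj₁ (good n))

    τ-Res : ∀ n → EndStrings.Res Jr n ≈ 𝟎
    τ-Res n = proj₂ (good n)

    τ-cong : ∀ {n m} → n ≈ m → τ n ≈ τ m
    τ-cong {n} {m} e = enc-inj (trans (sym (τ-St n)) (trans (EndStrings.St-cong J-≤ e) (τ-St m)))

    τ-𝟎 : τ 𝟎 ≈ 𝟎
    τ-𝟎 = enc-inj (trans (sym (τ-St 𝟎)) St-zero)

    τ-S : ∀ {i} n → i ≤ R → τ (S.f i n) ≈ E.f i (τ n)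
    τ-S {i} n h = enc-inj (trans (sym (τ-St (S.f i n))) (proj₁ (next n h (good n))))

-- The axioms of ⋆ leave τ as the only choice

module StarUniqueness where
  open import Defs
  open import Data.Bool using (true; false; if_then_else_)
  open import Data.Nat
  open import Data.Nat.Properties
  import Data.Integer as ℤ
  open ℤ using (ℤ; 0ℤ; -1ℤ)
  import Data.Integer.Properties as ℤP
  open import Data.List using ([]; _∷_; map)
  open import Data.List.Relation.Unary.All using (All; []; _∷_)
  open import Data.Maybe using (just)
  open import Data.Maybe.Properties using (just-injective)
  open Brackets
  open BracketCorners
  open Triangles
  open Weights
  open DoubleCrystal
  open TensorProducts
  open StringEmbedding
  open PatternEncoding
  open WordSymmetry
  open StarInvolution

  module Uniqueness (R : ℕ) where
    open Involution R public

    τ-pow : ∀ m {i n} → i ≤ R → τ (SP.pow m i n) ≈ EP.pow m i (τ n)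
    τ-pow zero    h = ≈-refl
    τ-pow (suc m) {i} {n} h = ≈-trans (τ-S (SP.pow m i n) h) (E.f-cong h (τ-pow m h))

    τ-rebuild : ∀ {js} s → All (_≤ R) js → τ (StartStrings.rebuild js s) ≈ EndStrings.rebuild js s
    τ-rebuild s             []       = τ-𝟎
    τ-rebuild []            (h ∷ hs) = τ-𝟎
    τ-rebuild ((_ , a) ∷ s) (h ∷ hs) = ≈-trans (τ-pow (ℤ.∣ a ∣) h) (EP.pow-cong (ℤ.∣ a ∣) h (τ-rebuild s hs))

    -- Read as exponents of f', the coordinates of `n` rebuild `n` from `𝟎`, and τ turns each f'
    -- into f. Applied to `τ n`, whose coordinates are the f-string of `n`, the same procedure
    -- returns `n`; hence τ is an involution.
    τ-build : ∀ n → τ n ≈ EndStrings.rebuild Jr (enc n)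
    τ-build n = ≈-trans (τ-cong (≈-trans (StartStrings.rebuild-St J-≤ (enc-Res n)) (subst (λ s → StartStrings.rebuild Jr (StartStrings.St Jr n) ≈ StartStrings.rebuild Jr s) (enc-St n) ≈-refl)))
                  (τ-rebuild (enc n) J-≤)

    ττ : ∀ n → τ (τ n) ≈ n
    ττ n = ≈-trans (τ-build (τ n)) (≈-sym (subst (λ s → n ≈ EndStrings.rebuild Jr s) (τ-St n) (EndStrings.rebuild-St J-≤ (τ-Res n))))

    τ-E : ∀ {i} n → i ≤ R → τ (E.f i n) ≈ S.f i (τ n)
    τ-E {i} n h = ≈-trans (τ-cong (≈-trans (E.f-cong h (≈-sym (ττ n))) (≈-sym (τ-S (τ n) h)))) (ττ (S.f i (τ n)))

    τ-inj : ∀ {n m} → τ n ≈ τ m → n ≈ m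
    τ-inj {n} {m} e = ≈-trans (≈-sym (ττ n)) (≈-trans (τ-cong e) (ττ m))

    τ-pow' : ∀ m {i n} → i ≤ R → τ (EP.pow m i n) ≈ SP.pow m i (τ n)
    τ-pow' zero    h = ≈-refl
    τ-pow' (suc m) {i} {n} h = ≈-trans (τ-E (EP.pow m i n) h) (S.f-cong h (τ-pow' m h))

    τ-string : ∀ {i} n → i ≤ R → S.ε i (τ n) ≡ E.ε i n × SP.top i (τ n) ≈ τ (EP.top i n)
    τ-string {i} n h = SP.top-unique (E.ε i n) h (≈-trans (τ-cong (≈-sym (EP.pow-top h))) (τ-pow' (E.ε i n) h)) (zero-top (S.ε i (τ t)) refl)
      where
      t = EP.top i n
      zero-top : ∀ k → S.ε i (τ t) ≡ k → S.ε i (τ t) ≡ 0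
      zero-top zero    e = e
      zero-top (suc k) e = ⊥-elim (1+n≢0 (trans (sym (E.ε-f h)) (trans (sym (E.ε-cong h back)) (EP.ε-top h))))
        where
        back : t ≈ E.f i (τ (S.e i (τ t)))
        back = ≈-trans (≈-sym (ττ t)) (≈-trans (τ-cong (≈-sym (S.f-e h (subst (0 <_) (sym e) z<s)))) (τ-S (S.e i (τ t)) h))

    τ-string' : ∀ {i} n → i ≤ R → E.ε i (τ n) ≡ S.ε i n
    τ-string' {i} n h = trans (sym (proj₁ (τ-string (τ n) h))) (S.ε-cong h (ττ n))

    W-τ : ∀ k n → W k (τ n) ≡ W k n
    W-τ k = SP.generated (λ n → W k (τ n) ≡ W k n) (λ e q → trans (W-cong k (τ-cong (≈-sym e))) (trans q (W-cong k e)))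
      (W-cong k τ-𝟎) λ {i} {n} h q → trans (W-cong k (τ-S n h)) (trans (E.W-f k h) (trans (cong (_+ ind (suc i) k) q) (sym (S.W-f k h))))

    SameW : Mat → Mat → Set
    SameW n d = ∀ k → W k n ≡ W k d

    same-size : ∀ {n d} → SameW n d → EP.size n ≡ EP.size d
    same-size e = Σ<-cong (suc (suc R)) λ k _ → e k

    -- These are the elements on which ⋆ is not determined by commutation.
    Extremal : ℕ → Mat → Set
    Extremal l n = ∀ k → k ≤ R → k ≢ l → E.ε k n ≡ 0 × S.ε k n ≡ 0

    -- No - survives in the words of any index but l, so the ballot inequalities hold in all rows
    -- except l and all columns except R - l. They confine `n` to segments through α_{l+1}.
    module Shape {l n} (l≤R : l ≤ R) (ex : Extremal l n) where
      c = R ∸ l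

      col-bound : ∀ {y X} → y ≤ R → y ≢ c → X + y ≤ R → Σ< (suc X) (Q n y) ≤ Σ< X (P n y)
      col-bound {y} {X} h ne k = prefix-bound (R ∸ y) 0 (≤-reflexive (trans (sym (epsC-def y n)) z)) X (m+n≤o⇒m≤o∸n X k)
        where
        z : epsC y n ≡ 0
        z = subst (λ t → epsC t n ≡ 0) (m∸[m∸n]≡n h) (proj₁ (ex (R ∸ y) (m∸n≤m R y) λ e → ne (trans (sym (m∸[m∸n]≡n h)) (cong (R ∸_) e))))

      row-bound : ∀ {x Y} → x ≤ R → x ≢ l → x + Y ≤ R → Σ< (suc Y) (n x) ≤ Σ< Y (n (suc x))
      row-bound {x} {Y} h ne k = prefix-bound (R ∸ x) 0 (≤-reflexive (trans (sym (epsC-def x (T n))) (proj₂ (ex x h ne)))) Y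
        (m+n≤o⇒m≤o∸n Y (subst (_≤ R) (+-comm x Y) k))

      -- The columns empty one after another starting from y = R, because the bound for column y is
      -- taken from column y + 1.
      col-zero : ∀ d y → d + y ≡ R → c < y → ∀ x → x + y ≤ R → n x y ≡ 0
      col-zero d y e h x k = n≤0⇒n≡0 (≤-trans (≤-trans (m≤n+m (n x y) (Σ< x (Q n y))) (col-bound (subst (y ≤_) e (m≤n+m y d)) (λ q → <-irrefl (sym q) h) k)) (≤-reflexive (zr d e x k)))
        where
        zr : ∀ d → d + y ≡ R → ∀ X → X + y ≤ R → Σ< X (P n y) ≡ 0
        zr d       e zero    k = refl
        zr zero    e (suc X) k = ⊥-elim (<⇒≱ (subst (_< suc X + y) e (s≤s (m≤n+m y X))) k)
        zr (suc d) e (suc X) k = cong₂ _+_ (zr (suc d) e X (≤-trans (n≤1+n _) k))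
          (col-zero d (suc y) (trans (+-suc d y) e) (m<n⇒m<1+n h) X (subst (_≤ R) (sym (+-suc X y)) k))

      row-zero : ∀ d x → d + x ≡ R → l < x → ∀ y → x + y ≤ R → n x y ≡ 0
      row-zero d x e h y k = n≤0⇒n≡0 (≤-trans (≤-trans (m≤n+m (n x y) (Σ< y (n x))) (row-bound (subst (x ≤_) e (m≤n+m x d)) (λ q → <-irrefl (sym q) h) k)) (≤-reflexive (zr d e y k)))
        where
        zr : ∀ d → d + x ≡ R → ∀ Y → x + Y ≤ R → Σ< Y (n (suc x)) ≡ 0
        zr d       e zero    k = refl
        zr zero    e (suc Y) k = ⊥-elim (<⇒≱ (subst (_< x + suc Y) e (subst (x <_) (sym (+-suc x Y)) (s≤s (m≤m+n x Y)))) k)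
        zr (suc d) e (suc Y) k = cong₂ _+_ (zr (suc d) e Y (≤-trans (+-monoʳ-≤ x (n≤1+n Y)) k))
          (row-zero d (suc x) (trans (+-suc d x) e) (m<n⇒m<1+n h) Y (subst (_≤ R) (+-suc x Y) k))

      outside : ∀ x y → x + y ≤ R → l < x ⊎ c < y → n x y ≡ 0
      outside x y k (inj₁ h) = row-zero (R ∸ x) x (m∸n+n≡m (≤-trans (m≤m+n x y) k)) h y k
      outside x y k (inj₂ h) = col-zero (R ∸ y) y (m∸n+n≡m (≤-trans (m≤n+m y x) k)) h x k

      lc : l + c ≡ R
      lc = m+[n∸m]≡n l≤R

      inside : ∀ {x y} → x ≤ l → y ≤ c → x + y ≤ R
      inside h k = subst (_ ≤_) lc (+-mono-≤ h k)

      -- The column inequalities give one direction and the row inequalities the other.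
      diagonal : ∀ {a b} → a ≤ l → b ≤ c → cnt (suc a) b n ≡ cnt a (suc b) n
      diagonal {a} {b} ha hb = ≤-antisym left right
        where
        left : cnt (suc a) b n ≤ cnt a (suc b) n
        left = subst₂ _≤_ (sym (Σ<-swap (suc a) b n)) (sym (Σ<-swap a (suc b) n))
          (≤-trans (Σ<-mono b λ y u → col-bound (≤-trans (<⇒≤ (<-≤-trans u hb)) (m∸n≤m R l)) (<⇒≢ (<-≤-trans u hb)) (inside ha (<⇒≤ (<-≤-trans u hb))))
                   (Σ<-drop b (λ y → Σ< a (λ x → n x y))))
        right : cnt a (suc b) n ≤ cnt (suc a) b n
        right = ≤-trans (Σ<-mono a λ x u → row-bound (≤-trans (<⇒≤ (<-≤-trans u ha)) l≤R) (<⇒≢ (<-≤-trans u ha)) (inside (<⇒≤ (<-≤-trans u ha)) hb))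
                   (Σ<-drop a (λ x → Σ< b (n x)))

      cnt-tall : ∀ t b → t + (suc l + b) ≤ suc (suc R) → cnt (t + suc l) b n ≡ cnt (suc l) b n
      cnt-tall zero    b h = refl
      cnt-tall (suc t) b h = trans (cong (cnt (t + suc l) b n +_) (zr b ≤-refl)) (trans (+-identityʳ _) (cnt-tall t b (<⇒≤ h)))
        where
        zr : ∀ Y → Y ≤ b → Σ< Y (n (t + suc l)) ≡ 0
        zr zero    _ = refl
        zr (suc Y) u = cong₂ _+_ (zr Y (<⇒≤ u)) (outside (t + suc l) Y
          (s≤s⁻¹ (s≤s⁻¹ (≤-trans (subst (_≤ suc (t + (suc l + b))) (cong suc (trans (sym (+-assoc t (suc l) (suc Y))) (+-suc (t + suc l) Y))) (s≤s (+-monoʳ-≤ t (+-monoʳ-≤ (suc l) u)))) h)))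
          (inj₁ (m≤n+m (suc l) t)))

      -- Rows beyond l are empty, so a rectangle of height l + 1 may be stretched to the one that
      -- defines a weight.
      cnt-W : ∀ b → b ≤ c → cnt (suc l) (suc b) n ≡ W (suc R ∸ b) n
      cnt-W b h = trans (sym (cnt-tall (c ∸ b) (suc b) (≤-reflexive size-eq))) (cong₂ (λ s t → cnt s t n) e₁ e₂)
        where
        b≤R : b ≤ R
        b≤R = ≤-trans h (m∸n≤m R l)
        e₁ : (c ∸ b) + suc l ≡ suc R ∸ b
        e₁ = trans (+-suc (c ∸ b) l) (trans (cong suc (trans (+-comm (c ∸ b) l) (trans (sym (+-∸-assoc l h)) (cong (_∸ b) lc)))) (sym (+-∸-assoc 1 b≤R)))
        e₂ : suc b ≡ suc (suc R) ∸ (suc R ∸ b)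
        e₂ = sym (trans (+-∸-assoc 1 (m∸n≤m (suc R) b)) (cong suc (m∸[m∸n]≡n (≤-trans b≤R (n≤1+n R)))))
        size-eq : (c ∸ b) + (suc l + suc b) ≡ suc (suc R)
        size-eq = trans (sym (+-assoc (c ∸ b) (suc l) (suc b))) (trans (cong (_+ suc b) e₁) (trans (+-suc (suc R ∸ b) b) (cong suc (m∸n+n≡m (≤-trans b≤R (n≤1+n R))))))

    -- By `diagonal` a rectangle at the origin may slide, gaining a row and losing a column, until
    -- it has height l + 1 and its sum is a weight. The multiplicities are differences of such sums.
    extremal-unique : ∀ {l n d} → l ≤ R → Extremal l n → Extremal l d → SameW n d → n ≈ d
    extremal-unique {l} {n} {d} l≤R en ed w = pw entry
      where
      module N = Shape l≤R en
      module D = Shape l≤R ed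
      c = R ∸ l
      empty : ∀ a (m : Mat) → cnt a 0 m ≡ 0
      empty zero    m = refl
      empty (suc a) m = trans (+-identityʳ _) (empty a m)
      cnts : ∀ j a b → j + a ≡ suc l → b ≤ suc c → cnt a b n ≡ cnt a b d
      cnts j       a zero    e h = trans (empty a n) (sym (empty a d))
      cnts zero    a (suc b) refl h = trans (N.cnt-W b (s≤s⁻¹ h)) (trans (w (suc R ∸ b)) (sym (D.cnt-W b (s≤s⁻¹ h))))
      cnts (suc j) a (suc b) e h = trans (sym (N.diagonal a≤l (s≤s⁻¹ h))) (trans (cnts j (suc a) b (trans (+-suc j a) e) (≤-trans (n≤1+n b) h)) (D.diagonal a≤l (s≤s⁻¹ h)))
        where a≤l = s≤s⁻¹ (subst (suc a ≤_) e (s≤s (m≤n+m a j)))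
      rows : ∀ x b → x ≤ l → b ≤ suc c → Σ< b (n x) ≡ Σ< b (d x)
      rows x b h k = +-cancelˡ-≡ (cnt x b n) _ _ (trans (cnts (l ∸ x) (suc x) b (trans (+-suc (l ∸ x) x) (cong suc (m∸n+n≡m h))) k)
        (cong (_+ Σ< b (d x)) (sym (cnts (suc l ∸ x) x b (m∸n+n≡m (≤-trans h (n≤1+n l))) k))))
      entry : ∀ x y → x + y ≤ R → n x y ≡ d x y
      entry x y k with x ≤? l | y ≤? c
      ... | yes h | yes h' = +-cancelˡ-≡ (Σ< y (n x)) _ _ (trans (rows x (suc y) h (s≤s h')) (cong (_+ d x y) (sym (rows x y h (≤-trans h' (n≤1+n c))))))
      ... | no h  | _      = trans (N.outside x y k (inj₁ (≰⇒> h))) (sym (D.outside x y k (inj₁ (≰⇒> h))))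
      ... | yes _ | no h   = trans (N.outside x y k (inj₂ (≰⇒> h))) (sym (D.outside x y k (inj₂ (≰⇒> h))))

    -- For l ≢ l' the common weight would be dominant, hence zero.
    extremal-index : ∀ {l l' n d} → Extremal l n → Extremal l' d → SameW n d → l ≢ l' → n ≈ 𝟎
    extremal-index {l} {l'} {n} {d} en ed w ne = E.extremal λ i h → zero-eps i h (W-zero (suc i) (s≤s (≤-trans h (n≤1+n R))))
      where
      flat : ∀ {k m j} → k ≤ R → Extremal j m → k ≢ j → W (suc k) m + W (suc k) m ≤ W k m + W (suc (suc k)) m
      flat {k} {m} h e q = subst (W (suc k) m + W (suc k) m ≤_) (trans (K.κ-eq h) (cong (_+ (W k m + W (suc (suc k)) m)) (cong₂ _+_ (proj₁ (e k h q)) (proj₂ (e k h q)))))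
                            (m≤n+m _ (K.κ k m))
      conv : ∀ k → k < suc R → W (suc k) n + W (suc k) n ≤ W k n + W (suc (suc k)) n
      conv k u with k ≟ l
      ... | no q = flat (s≤s⁻¹ u) en q
      ... | yes refl = subst₂ _≤_ (sym (cong₂ _+_ (w (suc k)) (w (suc k)))) (sym (cong₂ _+_ (w k) (w (suc (suc k))))) (flat (s≤s⁻¹ u) ed ne)
      last-zero : W (suc (suc R)) n ≡ 0
      last-zero = trans (cong (λ z → cnt (suc (suc R)) z n) (n∸n≡0 R)) (em (suc (suc R)))
        where
        em : ∀ a → cnt a 0 n ≡ 0
        em zero    = refl
        em (suc a) = trans (+-identityʳ _) (em a)
      W-zero : ∀ k → k ≤ suc (suc R) → W k n ≡ 0
      W-zero = convex-zero (suc R) (λ k → W k n) refl last-zero conv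
      zero-eps : ∀ i → i ≤ R → W (suc i) n ≡ 0 → E.ε i n ≡ 0
      zero-eps i h z = go (E.ε i n) refl
        where
        go : ∀ m → E.ε i n ≡ m → E.ε i n ≡ 0
        go zero    q = q
        go (suc m) q = ⊥-elim (1+n≢0 (trans (+-comm 1 (W (suc i) (E.e i n))) (trans (cong (W (suc i) (E.e i n) +_) (sym (ind-refl i)))
          (trans (sym (E.W-f (suc i) h)) (trans (W-cong (suc i) (E.f-e h (subst (0 <_) (sym q) z<s))) z)))))

    wtc-enc : ∀ k n → wtc (suc k) (enc n) ≡ ℤ.- (ℤ.+ W (suc k) n)
    wtc-enc k = EP.generated (λ n → wtc (suc k) (enc n) ≡ ℤ.- (ℤ.+ W (suc k) n))
        (λ e q → trans (cong (wtc (suc k)) (sym (enc-cong e))) (trans q (cong (λ z → ℤ.- (ℤ.+ z)) (W-cong (suc k) e))))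
        (trans (cong (wtc (suc k)) (trans (sym (enc-St 𝟎)) (proj₁ (StartStrings.St-𝟎 J-≤ ≈-refl)))) (trans (zeros Jr) (cong (λ z → ℤ.- (ℤ.+ z)) (sym (EndStrings.W-𝟎 (suc k))))))
        λ {i} {n} h q → trans (wtc-view (suc k) (fT-enc n h)) (trans (cong₂ ℤ._+_ q (bit i)) (trans (l (W (suc k) n) (ind i k)) (cong (λ z → ℤ.- (ℤ.+ z)) (sym (E.W-f (suc k) h)))))
      where
      zeros : ∀ js → wtc (suc k) (map (λ j → (suc j , 0ℤ)) js) ≡ 0ℤ
      zeros []       = refl
      zeros (j ∷ js) with k ≡ᵇ j
      ... | true  = trans (ℤP.+-identityˡ _) (zeros js)
      ... | false = trans (ℤP.+-identityˡ _) (zeros js)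
      bit : ∀ i → (if k ≡ᵇ i then -1ℤ else 0ℤ) ≡ ℤ.- (ℤ.+ ind i k)
      bit i with k ≟ i
      ... | yes refl rewrite ≡ᵇ-yes k | ind-refl k = refl
      ... | no ne rewrite ≡ᵇ-no ne | ind-≢ (ne ∘ sym) = refl
      l : ∀ a b → ℤ.- (ℤ.+ a) ℤ.+ ℤ.- (ℤ.+ b) ≡ ℤ.- (ℤ.+ (a + b))
      l a b = trans (sym (ℤP.neg-distrib-+ (ℤ.+ a) (ℤ.+ b))) (cong ℤ.-_ (sym (ℤP.pos-+ a b)))

    another : ∀ l (p : ℕ → ℕ) → (∃ λ k → k ≤ R × k ≢ l × 0 < p k) ⊎ (∀ k → k ≤ R → k ≢ l → p k ≡ 0)
    another l p with search (suc R)
      where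
      search : ∀ N → (∃ λ k → k < N × k ≢ l × 0 < p k) ⊎ (∀ k → k < N → k ≢ l → p k ≡ 0)
      search zero = inj₂ λ _ ()
      search (suc N) with search N | N ≟ l | 0 <? p N
      ... | inj₁ (k , a , b) | _ | _ = inj₁ (k , m<n⇒m<1+n a , b)
      ... | inj₂ g | no a | yes b = inj₁ (N , ≤-refl , a , b)
      ... | inj₂ g | yes refl | _ = inj₂ λ k u q → g k (≤∧≢⇒< (s≤s⁻¹ u) q) q
      ... | inj₂ g | no a | no b = inj₂ λ k u q → ext' k u q
        where
        ext' : ∀ k → k < suc N → k ≢ l → p k ≡ 0
        ext' k u q with k ≟ N
        ... | yes refl = n≤0⇒n≡0 (≮⇒≥ b)
        ... | no v     = g k (≤∧≢⇒< (s≤s⁻¹ u) v) q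
    ... | inj₁ (k , a , b) = inj₁ (k , s≤s⁻¹ a , b)
    ... | inj₂ g = inj₂ λ k u q → g k (s≤s u) q

    record Resolved (n : Mat) : Set where
      constructor resolved
      field
        {l k} : ℕ
        l≤R   : l ≤ R
        k≤R   : k ≤ R
        k≢l   : k ≢ l
        {h g} : Mat
        n-is  : n ≈ E.f l h
        h-is  : τ h ≈ E.f k g

    resolve : ∀ {n l k} → l ≤ R → k ≤ R → k ≢ l → 0 < E.ε l n → 0 < E.ε k (τ (E.e l n)) → Resolved n
    resolve h k ne p q = resolved h k ne (≈-sym (E.f-e h p)) (≈-sym (E.f-e k q))

    -- Let ε_l n > 0. If only ε_l^⋆ can be positive on e_l n, then ε_k^⋆ n = 0 for k ≠ l, and ε_l^⋆
    -- n > 0 as n is not `𝟎`. Any other positive ε_k n then gives a resolution with k and l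
    -- exchanged; if there is none, n is extremal.
    trichotomy : ∀ n → n ≈ 𝟎 ⊎ Resolved n ⊎ (∃ λ l → l ≤ R × Extremal l n)
    trichotomy n with EP.find n
    ... | inj₂ z = inj₁ z
    ... | inj₁ (l , h , p) with another l (λ k → E.ε k (τ (E.e l n)))
    ...   | inj₁ (k , u , ne , q) = inj₂ (inj₁ (resolve h u ne p q))
    ...   | inj₂ z = second (another l (λ k → E.ε k n))
      where
      starts-zero : ∀ k → k ≤ R → k ≢ l → S.ε k n ≡ 0
      starts-zero k u ne = trans (S.ε-cong u (≈-sym (E.f-e h p))) (trans (K.ε'-comm u h ne) (trans (sym (τ-string' (E.e l n) u)) (z k u ne)))
      starts-l : 0 < S.ε l n
      starts-l = go (S.ε l n) refl
        where
        go : ∀ m → S.ε l n ≡ m → 0 < S.ε l n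
        go (suc m) q = subst (0 <_) (sym q) z<s
        go zero    q = ⊥-elim (<-irrefl (sym (trans (E.ε-cong h (S.extremal all)) (E.ε-𝟎 h))) p)
          where
          all : ∀ i → i ≤ R → S.ε i n ≡ 0
          all i u with i ≟ l
          ... | yes refl = q
          ... | no ne    = starts-zero i u ne
      second : (∃ λ k → k ≤ R × k ≢ l × 0 < E.ε k n) ⊎ (∀ k → k ≤ R → k ≢ l → E.ε k n ≡ 0) → n ≈ 𝟎 ⊎ Resolved n ⊎ (∃ λ l → l ≤ R × Extremal l n)
      second (inj₁ (k , u , ne , q)) = inj₂ (inj₁ (resolve u h (ne ∘ sym) q
        (subst (0 <_) (trans (S.ε-cong h (≈-sym (E.f-e u q))) (trans (K.ε'-comm h u (ne ∘ sym)) (sym (τ-string' (E.e k n) h)))) starts-l)))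
      second (inj₂ y) = inj₂ (inj₂ (l , h , λ k u ne → y k u ne , starts-zero k u ne))

    module _ (star : State → State) (isStar : IsStar r star) where
      open IsStar isStar

      private
        star-just : ∀ {l} n m → l ≤ R → star (enc n) ≡ enc m → fStar star (suc l) (enc n) ≡ just (star (enc (E.f l m)))
        star-just {l} n m h e = cong (mapM star) (trans (cong (fT (suc l)) e) (fT-E m h))

        -- ⋆ f_l h = f_l^⋆ (f_k g) = f_k (f_l^⋆ g), and ⋆ is known on h and g.
        by-commuting : ∀ n → Resolved n → (∀ m → EP.size m < EP.size n → star (enc m) ≡ enc (τ m)) → star (enc n) ≡ enc (τ n)
        by-commuting n (resolved {l} {k} hl hk ne {h} {g} n-is h-is) ih = trans (cong star (enc-cong n-is)) (trans (just-injective key) (enc-cong final))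
          where
          size-n : EP.size n ≡ suc (suc (EP.size g))
          size-n = trans (same-size λ z → W-cong z n-is) (trans (EP.size-f hl) (cong suc (trans (sym (same-size λ z → W-τ z h)) (trans (same-size λ z → W-cong z h-is) (EP.size-f hk)))))
          lt₂ : EP.size g < EP.size n
          lt₂ = subst (EP.size g <_) (sym size-n) (s≤s (n≤1+n _))
          lt₁ : ∀ m → EP.size m ≡ suc (EP.size g) → EP.size m < EP.size n
          lt₁ m e = subst₂ _<_ (sym e) (sym size-n) ≤-refl
          s₁ : star (enc (E.f k g)) ≡ enc h
          s₁ = trans (ih (E.f k g) (lt₁ (E.f k g) (EP.size-f hk))) (enc-cong (≈-trans (τ-cong (≈-sym h-is)) (ττ h)))
          s₂ : star (enc (E.f l (τ g))) ≡ enc (S.f l g)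
          s₂ = trans (ih (E.f l (τ g)) (lt₁ (E.f l (τ g)) (trans (EP.size-f hl) (cong suc (same-size λ z → W-τ z g)))))
                 (enc-cong (≈-trans (τ-E (τ g) hl) (S.f-cong hl (ττ g))))
          open ≡-Reasoning
          key : just (star (enc (E.f l h))) ≡ just (enc (E.f k (S.f l g)))
          key = begin
            just (star (enc (E.f l h)))                          ≡⟨ sym (star-just (E.f k g) h hl s₁) ⟩
            fStar star (suc l) (enc (E.f k g))                   ≡⟨ cong (λ z → bindM z (fStar star (suc l))) (sym (fT-E g hk)) ⟩
            bindM (fT (suc k) (enc g)) (fStar star (suc l))      ≡⟨ ks-comm (suc l) (suc k) (s≤s z≤n) (s≤s hl) (s≤s z≤n) (s≤s hk) (ne ∘ sym ∘ suc-injective) (enc g) (enc-InB g) ⟩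
            bindM (fStar star (suc l) (enc g)) (fT (suc k))      ≡⟨ cong (λ z → bindM z (fT (suc k))) (star-just g (τ g) hl (ih g lt₂)) ⟩
            fT (suc k) (star (enc (E.f l (τ g))))                ≡⟨ cong (fT (suc k)) s₂ ⟩
            fT (suc k) (enc (S.f l g))                           ≡⟨ fT-E (S.f l g) hk ⟩
            just (enc (E.f k (S.f l g))) ∎
          final : E.f k (S.f l g) ≈ τ n
          final = ≈-trans (K.comm hk hl ne) (≈-trans (S.f-cong hl (≈-sym h-is)) (≈-trans (≈-sym (τ-E h hl)) (τ-cong (≈-sym n-is))))

      star-τ-below : ∀ N n → EP.size n < N → star (enc n) ≡ enc (τ n)
      star-τ-below (suc N) n lt with trichotomy n
      ... | inj₁ z = trans (cong star (trans (enc-cong z) (sym enc-𝟎))) (trans star-u0 (trans enc-𝟎 (enc-cong (≈-sym (≈-trans (τ-cong z) τ-𝟎)))))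
      ... | inj₂ (inj₁ rs) = by-commuting n rs λ m u → star-τ-below N m (<-≤-trans u (s≤s⁻¹ lt))
      ... | inj₂ (inj₂ (l , h , ex)) with InB-enc (star-B (enc n) (enc-InB n))
      -- Commutation does not reach an extremal n. Its image d = ⋆ n has the same weight, and ⋆
      -- sends it back, so knowledge about d can be used instead.
      ... | d , eq = third (trichotomy d)
        where
        back : star (enc d) ≡ enc n
        back = trans (cong star (sym eq)) (star-invol (enc n) (enc-InB n))
        same : SameW n d
        same zero    = refl
        same (suc k) = ℤP.+-injective (ℤP.neg-injective (trans (sym (wtc-enc k n)) (trans (sym (star-wt (enc n) (enc-InB n) (suc k))) (trans (cong (wtc (suc k)) eq) (wtc-enc k d)))))
        ex-τ : Extremal l (τ n)
        ex-τ k u ne = trans (τ-string' n u) (proj₂ (ex k u ne)) , trans (proj₁ (τ-string n u)) (proj₁ (ex k u ne))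
        third : d ≈ 𝟎 ⊎ Resolved d ⊎ (∃ λ l → l ≤ R × Extremal l d) → star (enc n) ≡ enc (τ n)
        third (inj₁ z) = trans eq (enc-cong (≈-trans z (≈-sym (≈-trans (τ-cong n0) τ-𝟎))))
          where
          n0 : n ≈ 𝟎
          n0 = enc-inj (trans (sym back) (trans (cong star (trans (enc-cong z) (sym enc-𝟎))) (trans star-u0 enc-𝟎)))
        -- Commutation gives ⋆ d = τ d, and ⋆ d = n; hence d = τ n.
        third (inj₂ (inj₁ rs)) = trans eq (enc-cong (≈-trans (≈-sym (ττ d)) (τ-cong (enc-inj (trans (sym
          (by-commuting d rs λ m u → star-τ-below N m (<-≤-trans u (subst (_≤ N) (same-size same) (s≤s⁻¹ lt))))) back)))))
        third (inj₂ (inj₂ (l' , h' , ex'))) with l ≟ l'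
        ... | yes refl = trans eq (enc-cong (≈-trans (≈-sym (extremal-unique h ex ex' same)) (extremal-unique h ex ex-τ (λ k → sym (W-τ k n)))))
        ... | no ne = trans (cong star (trans (enc-cong n0) (sym enc-𝟎))) (trans star-u0 (trans enc-𝟎 (enc-cong (≈-sym (≈-trans (τ-cong n0) τ-𝟎)))))
          where n0 = extremal-index ex ex' same ne

      star-τ : ∀ n → star (enc n) ≡ enc (τ n)
      star-τ n = star-τ-below (suc (EP.size n)) n ≤-refl

-- Demazure crystals and the two descriptions of their least elements

module DemazureCrystals where
  open import Defs
  open import Data.Nat using (ℕ; zero; suc; _+_; _∸_; _≤_; _<_; z≤n; s≤s; z<s; s≤s⁻¹; _≟_)
  open import Data.Nat.Properties
  import Data.Integer as ℤ
  open ℤ using (ℤ; 0ℤ; -1ℤ)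
  import Data.Integer.Properties as ℤP
  open import Data.List using (List; []; _∷_; map; reverse; length; upTo)
  open import Data.List.Properties using (reverse-involutive)
  open import Data.List.Relation.Unary.All as All using (All; []; _∷_)
  open import Data.List.Relation.Binary.Permutation.Propositional using (↭-refl; ↭-trans; ↭-reflexive)
  open import Data.Maybe using (just)
  open import Data.Maybe.Properties using (just-injective)
  open import Function.Bundles using (_⇔_; mk⇔; Equivalence)
  open Triangles
  open DoubleCrystal
  open TensorProducts
  open StringEmbedding
  open PatternEncoding
  open HeckeAction
  open BlockWords
  open WordSymmetry
  open Inversions
  open BruhatOrder
  open LongestElement
  open StarInvolution
  open StarUniqueness

  module Demazure (R : ℕ) where
    open Uniqueness R public
    open Complement R
    open Inverse r using (reverse-inverse; inv-dot)

    eT-E : ∀ {i} n → i ≤ R → 0 < E.ε i n → eT (suc i) (enc n) ≡ just (enc (E.e i n))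
    eT-E {i} n h p = fT⇒eT (suc i) (enc (E.e i n)) (trans (fT-E (E.e i n) h) (cong just (enc-cong (E.f-e h p))))

    eIter-E : ∀ {i} m n → i ≤ R → m ≤ E.ε i n → eIter (suc i) m (enc n) ≡ just (enc (EP.lower m i n))
    eIter-E zero    n h k = refl
    eIter-E {i} (suc m) n h k with eT (suc i) (enc n) | eT-E n h (≤-trans z<s k)
    ... | just _ | refl = eIter-E m (E.e i n) h (s≤s⁻¹ (subst (suc m ≤_) (EP.ε-e h (≤-trans z<s k)) k))

    eIter-back : ∀ {i} k v {m} → i ≤ R → eIter (suc i) k v ≡ just (enc m) → v ≡ enc (EP.pow k i m)
    eIter-back zero    v h refl = refl
    eIter-back {i} (suc k) v h q with eT (suc i) v in e
    ... | just v₁ with eIter-back k v₁ h q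
    ...   | refl = just-injective (trans (sym (eT⇒fT (suc i) v e)) (fT-E _ h))

    Eps-enc : ∀ {i n b} → i ≤ R → Eps r (suc i) (enc n) b → b ≡ E.ε i n
    Eps-enc {i} {n} {b} h ((u , q , inB) , notMore) with InB-enc inB
    ... | m , refl = ≤-antisym upper (≮⇒≥ λ lt → notMore (enc (EP.lower (suc b) i n) , eIter-E (suc b) n h lt , enc-InB _))
      where
      upper : b ≤ E.ε i n
      upper = subst (b ≤_) (sym (trans (E.ε-cong h (enc-inj (eIter-back b (enc n) h q))) (EP.ε-pow b h))) (m≤m+n b _)

    enc-Eps : ∀ {i} n → i ≤ R → Eps r (suc i) (enc n) (E.ε i n)
    enc-Eps {i} n h = (enc (EP.top i n) , eIter-E (E.ε i n) n h ≤-refl , enc-InB _) , maximal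
      where
      maximal : ¬ NzE r (suc i) (suc (E.ε i n)) (enc n)
      maximal (u , q , inB) with InB-enc inB
      ... | m , refl = <-irrefl refl (subst (suc (E.ε i n) ≤_) (sym (trans (E.ε-cong h (enc-inj (eIter-back (suc (E.ε i n)) (enc n) h q))) (EP.ε-pow (suc (E.ε i n)) h))) (m≤m+n _ _))

    string-of : ∀ {js n bs} → All (_≤ R) js → Str r (map suc js) (enc n) bs → map posℤ bs ≡ map neg (EndStrings.St js n)
    string-of []       [] = refl
    string-of {j ∷ js} {n} (h ∷ hs) (cons {b = b} ep q s) with Eps-enc h ep
    ... | refl with just-injective (trans (sym q) (eIter-E (E.ε j n) n h ≤-refl))
    ...   | refl = cong₂ _∷_ (sym (ℤP.neg-involutive (ℤ.+ E.ε j n))) (string-of hs s)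

    a-string : ∀ {js} n → All (_≤ R) js → ∃ λ bs → Str r (map suc js) (enc n) bs
    a-string n [] = [] , []
    a-string {j ∷ js} n (h ∷ hs) with a-string (EP.top j n) hs
    ... | bs , s = E.ε j n ∷ bs , cons (enc-Eps n h) (eIter-E (E.ε j n) n h ≤-refl) s

    StringJ-enc : ∀ {n bs} → StringJ r (enc n) bs → map posℤ bs ≡ map neg (enc (τ n))
    StringJ-enc {n} {bs} s = trans (string-of J-≤ (subst (λ W → Str r W (enc n) bs) (Jword-Js R) s)) (cong (map neg) (τ-St n))

    -- A claim about all strings of v says something about ω(v) only because a string exists.
    a-StringJ : ∀ n → ∃ λ bs → StringJ r (enc n) bs
    a-StringJ n with a-string n J-≤
    ... | bs , s = bs , subst (λ W → Str r W (enc n) bs) (sym (Jword-Js R)) s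

    D : Mat → Perm
    D n = wd n (idP r)

    letters : ∀ n → All (Between 1 r) (Wd (suc R) n)
    letters n = Wd-between (suc R) n

    D-perm : ∀ n → IsPerm r (D n)
    D-perm n = proj₁ (letters-act (letters n))

    dag-D : ∀ n → omegaDag r (enc n) ≡ D n
    dag-D n = trans (dag-word R n) (proj₁ (proj₂ (letters-act (letters n))))

    omega-rev : ∀ {n bs} → map posℤ bs ≡ map neg (enc n) → omegaOfString r bs ≡ act (reverse (Wd (suc R) n)) (idP r)
    omega-rev {n} {bs} e = trans (string-word R n bs e) (proj₁ (proj₂ (letters-act (All-reverse _ (letters n)))))

    omega-D : ∀ {n bs} → StringJ r (enc n) bs → omegaOfString r bs ≡ D (T (τ n))
    omega-D {n} s = trans (omega-rev (StringJ-enc s)) (reverse-word (suc R) (τ n) (idP r))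

    -- Each letter adds at most one to the length, so reaching w₀ takes as many letters as the
    -- triangle has cells, and every multiplicity is zero.
    D-w0 : ∀ {n} → D n ≡ w0 r → n ≈ 𝟎
    D-w0 {n} e = pw λ x y h → Wd-full (suc R) n full x y (s≤s h)
      where
      full : tri (suc R) ≤ length (Wd (suc R) n)
      full = begin
        tri (suc R)                            ≡⟨ sym (len-w0 {r} (suc R)) ⟩
        len (w0 r)                             ≡⟨ cong len (sym e) ⟩
        len (D n)                              ≤⟨ proj₂ (proj₂ (letters-act (letters n))) ⟩
        length (Wd (suc R) n) + len (idP r)    ≡⟨ cong (length (Wd (suc R) n) +_) (len-id {r} r) ⟩
        length (Wd (suc R) n) + 0              ≡⟨ +-identityʳ _ ⟩
        length (Wd (suc R) n) ∎
        where open ≤-Reasoning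

    -- All ε vanish on `𝟎`, so every generator fixes the product and no ascent is left.
    D-𝟎 : D 𝟎 ≡ w0 r
    D-𝟎 = desc-w0 (D-perm 𝟎) λ k kr → fixed-desc kr (D-perm 𝟎) (wd-fix 𝟎 (idP r) (s≤s⁻¹ (s≤s⁻¹ kr)) (E.ε-𝟎 (s≤s⁻¹ (s≤s⁻¹ kr))))
      where
      fixed-desc : ∀ {k w} → suc k < r → IsPerm r w → Tx k w ≡ w → Desc k w
      fixed-desc {k} {w} kr p e with asc-or-desc p kr
      ... | inj₂ d = d
      ... | inj₁ a = ⊥-elim (1+n≢n (trans (sym (Step.asc-len kr p a)) (cong len (trans (sym (Step.Tx-asc kr a)) e))))

    D-top : ∀ {i} n → i ≤ R → D (EP.top i n) ≡ Tx i (D n)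
    D-top n h = sym (wd-top n (idP r) h)

    -- What makes μ(v) the least w with v in the Demazure crystal of w.
    record Key (μ : Mat → Perm) : Set where
      field
        perm  : ∀ n → IsPerm r (μ n)
        respects  : ∀ {n m} → n ≈ m → μ n ≡ μ m
        tops  : ∀ {i} n → i ≤ R → μ (EP.top i n) ≡ Td i (μ n)
        at-𝟎  : μ 𝟎 ≡ idP r
        only-𝟎 : ∀ {n} → μ n ≡ idP r → n ≈ 𝟎

    inR : ∀ {i} → i ≤ R → suc i < r
    inR h = s≤s (s≤s h)

    Tx-Td-≥ : ∀ {i w} → i ≤ R → IsPerm r w → w ≤B Tx i (Td i w)
    Tx-Td-≥ {i} {w} h p with asc-or-desc p (inR h)
    ... | inj₁ a = subst (λ z → w ≤B Tx i z) (sym (Step.Td-asc (inR h) a)) (Step.≤B-Tx (inR h) p)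
    ... | inj₂ d = subst (w ≤B_) (sym (trans (cong (Tx i) (Step.Td-desc (inR h) d)) (trans (Step.Tx-asc (inR h) (desc-asc d)) (sL-inv i w)))) ≤B-refl

    ≤B-id : ∀ {u w} → u ≤B w → len w ≡ 0 → u ≡ w
    ≤B-id ≤B-refl e = refl
    ≤B-id (≤B-step a b h k q l) e = ⊥-elim (<⇒≱ l (subst (_≤ _) (sym e) z≤n))

    module KeyTheorem {μ : Mat → Perm} (key : Key μ) where
      open Key key

      Dem-InB : ∀ {w v} → Dem r w v → InB r v
      Dem-InB dem1 = base
      Dem-InB (demS i k _ _ _ _ b _) = b

      -- v and e_i^k v lie on one i-string, so `Td` gives their values of μ the same image. It is at
      -- most w, and `Tx` lifts it above μ(v) and w to s_i w.
      bounded : ∀ {w v} → Dem r w v → IsPerm r w × (∀ n → v ≡ enc n → μ n ≤B w)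
      bounded dem1 = ↭-refl , λ n e → subst (_≤B idP r) (sym (trans (respects (enc-inj (trans (sym e) enc-𝟎))) at-𝟎)) ≤B-refl
      bounded (demS {w} {u} (suc i) k _ (s≤s h) l d b q) with bounded d | InB-enc (Dem-InB d)
      ... | p , rec | m , refl = Step.sL-perm (inR h) p , up'
        where
        up' : ∀ n → _ ≡ enc n → μ n ≤B sL (suc i) w
        up' n refl = ≤B-trans (Tx-Td-≥ h (perm n)) (subst (Tx i (Td i (μ n)) ≤B_) (Step.Tx-asc (inR h) (Step.len-asc (inR h) p l))
            (Step.Tx-mono (inR h) p (subst (_≤B w) same (≤B-trans (Step.Td-≤B (inR h) (perm m)) (rec m refl)))))
          where
          tops≈ : EP.top i m ≈ EP.top i n
          tops≈ = ≈-sym (proj₂ (EP.top-unique (k + E.ε i m) h (≈-trans (enc-inj (eIter-back k (enc n) h q)) (≈-trans (EP.pow-cong k h (≈-sym (EP.pow-top h))) (pow-pow k (E.ε i m)))) (EP.ε-top h)))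
            where
            pow-pow : ∀ k j {x} → EP.pow k i (EP.pow j i x) ≈ EP.pow (k + j) i x
            pow-pow zero    j = ≈-refl
            pow-pow (suc k) j = E.f-cong h (pow-pow k j)
          same : Td i (μ m) ≡ Td i (μ n)
          same = trans (sym (tops m h)) (trans (respects tops≈) (tops n h))

      descent : ∀ {w} → IsPerm r w → (∃ λ k → k ≤ R × Desc k w) ⊎ w ≡ idP r
      descent {w} p with search (suc R) ≤-refl
        where
        search : ∀ N → N ≤ suc R → (∃ λ k → k ≤ R × Desc k w) ⊎ (∀ k → k < N → Asc k w)
        search zero    u = inj₂ λ _ ()
        search (suc N) u with search N (<⇒≤ u) | asc-or-desc p (s≤s u)
        ... | inj₁ x | _ = inj₁ x
        ... | inj₂ g | inj₂ d = inj₁ (N , s≤s⁻¹ u , d)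
        ... | inj₂ g | inj₁ a = inj₂ λ k v → last k v
          where
          last : ∀ k → k < suc N → Asc k w
          last k v with k ≟ N
          ... | yes refl = a
          ... | no ne    = g k (≤∧≢⇒< (s≤s⁻¹ v) ne)
      ... | inj₁ x = inj₁ x
      ... | inj₂ g = inj₂ (asc-id p λ k kr → g k (s≤s⁻¹ kr))

      -- Strip a descent from w and the whole i-string from v: monotonicity of `Td` turns μ(v) ≤ w
      -- into the same inequality for the stripped pair. `N` bounds the length.
      attained : ∀ N {w} → len w < N → IsPerm r w → ∀ n → μ n ≤B w → Dem r w (enc n)
      attained (suc N) {w} lt p n le with descent p
      ... | inj₂ refl = subst (Dem r (idP r)) (trans enc-𝟎 (enc-cong (≈-sym (only-𝟎 (≤B-id le (len-id {r} r)))))) dem1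
      ... | inj₁ (i , h , d) = subst (λ z → Dem r z (enc n)) (sL-inv i w)
          (demS (suc i) (E.ε i n) (s≤s z≤n) (s≤s h) (subst₂ _<_ refl (trans (sym down-len) (cong len (sym (sL-inv i w)))) ≤-refl)
            (attained N (s≤s⁻¹ (subst (_< suc N) down-len lt)) (Step.sL-perm (inR h) p) (EP.top i n)
              (subst₂ _≤B_ (sym (tops n h)) (Step.Td-desc (inR h) d) (Step.Td-mono (inR h) p le)))
            (enc-InB n) (eIter-E (E.ε i n) n h ≤-refl))
        where
        down-len : len w ≡ suc (len (sL (suc i) w))
        down-len = Step.desc-len (inR h) p d

      Dem⇔ : ∀ {w} → IsPerm r w → ∀ n → Dem r w (enc n) ⇔ (μ n ≤B w)
      Dem⇔ {w} p n = mk⇔ (λ d → proj₂ (bounded d) n refl) (attained (suc (len w)) ≤-refl p n)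

    -- These are ω†(v) w₀ and w₀ ω(v): reversing the list is multiplication by w₀ on the right,
    -- complementing the values is multiplication on the left.
    μ₁ μ₂ : Mat → Perm
    μ₁ n = reverse (D n)
    μ₂ n = map co (D (T (τ n)))

    key₁ : Key μ₁
    key₁ = record
      { perm = λ n → reverse-perm (D-perm n)
      ; respects = λ e → cong reverse (wd-cong e (idP r))
      ; tops = λ {i} n h → trans (cong reverse (D-top n h)) (sym (rev-Tx (inR h) (D-perm n)))
      ; at-𝟎 = trans (cong reverse D-𝟎) (reverse-involutive (upTo r))
      ; only-𝟎 = λ {n} e → D-w0 (trans (sym (reverse-involutive (D n))) (cong reverse e)) }

    co-perm : ∀ {w} → IsPerm r w → IsPerm r (map co w)
    co-perm p = ↭-trans (map⁺ co p) (↭-trans (↭-reflexive (sym co-w0)) (w0-perm {r}))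
      where open import Data.List.Relation.Binary.Permutation.Propositional.Properties using (map⁺)

    -- The mirror image exchanges the two families and sends α_{i+1} to α_{R+1-i}.
    T-top : ∀ {i} m → i ≤ R → T (SP.top i m) ≈ EP.top (R ∸ i) (T m)
    T-top {i} m h = ≈-sym (proj₂ (EP.top-unique {R ∸ i} (S.ε i m) (m∸n≤m R i)
        (≈-trans (T-cong (≈-sym (SP.pow-top {i} {m} h))) (pow-T (S.ε i m) (SP.top i m)))
        (trans (cong (λ c → epsC c (T (SP.top i m))) (m∸[m∸n]≡n h)) (SP.ε-top {i} {m} h))))
      where
      pow-T : ∀ k x → T (SP.pow k i x) ≈ EP.pow k (R ∸ i) (T x)
      pow-T zero    x = ≈-refl
      pow-T (suc k) x = subst (λ c → F i (T (SP.pow k i x)) ≈ F c (EP.pow k (R ∸ i) (T x))) (sym (m∸[m∸n]≡n h)) (F-cong h (pow-T k x))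

    -- τ turns an f-string into an f'-string, the mirror image turns that into an f-string of index
    -- R - i, and multiplication by w₀ restores the index i.
    key₂ : Key μ₂
    key₂ = record
      { perm = λ n → co-perm (D-perm (T (τ n)))
      ; respects = λ e → cong (map co) (wd-cong (T-cong (τ-cong e)) (idP r))
      ; tops = λ {i} n h → trans (cong (map co) (trans (wd-cong (≈-trans (T-cong (≈-sym (proj₂ (τ-string n h)))) (T-top (τ n) h)) (idP r)) (D-top (T (τ n)) (m∸n≤m R i))))
                 (trans (sym (co-Tx (m∸n≤m R i) (D-perm (T (τ n))))) (cong (λ k → Td k (μ₂ n)) (m∸[m∸n]≡n h)))
      ; at-𝟎 = trans (cong (map co) (trans (wd-cong (T-cong τ-𝟎) (idP r)) (trans D-𝟎 co-w0))) (co-co ↭-refl)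
      ; only-𝟎 = λ {n} e → τ-inj (≈-trans (T-inv (D-w0 (trans (sym (co-co (D-perm (T (τ n))))) (trans (cong (map co) e) (sym co-w0))))) (≈-sym τ-𝟎)) }

    module K₁ = KeyTheorem key₁
    module K₂ = KeyTheorem key₂

    μ-agree : ∀ n → μ₁ n ≡ μ₂ n
    μ-agree n = ≤B-antisym
      (to (K₁.Dem⇔ (Key.perm key₂ n) n) (from (K₂.Dem⇔ (Key.perm key₂ n) n) ≤B-refl))
      (to (K₂.Dem⇔ (Key.perm key₁ n) n) (from (K₁.Dem⇔ (Key.perm key₁ n) n) ≤B-refl))
      where open Equivalence

    μ₁-dag : ∀ n → omegaDag r (enc n) · w0 r ≡ μ₁ n
    μ₁-dag n = trans (cong (_· w0 r) (dag-D n)) (dot-w0 (D-perm n))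

    μ₂-omega : ∀ {n bs} → StringJ r (enc n) bs → w0 r · omegaOfString r bs ≡ μ₂ n
    μ₂-omega s = cong (w0 r ·_) (omega-D s)

    by-dagger : ∀ {w} → IsPerm r w → ∀ v → Dem r w v ⇔ (InB r v × ((omegaDag r v · w0 r) ≤B w))
    by-dagger {w} p v = mk⇔ there' back
      where
      open Equivalence
      there' : Dem r w v → InB r v × ((omegaDag r v · w0 r) ≤B w)
      there' d with InB-enc (K₁.Dem-InB d)
      ... | n , refl = K₁.Dem-InB d , subst (_≤B w) (sym (μ₁-dag n)) (to (K₁.Dem⇔ p n) d)
      back : InB r v × ((omegaDag r v · w0 r) ≤B w) → Dem r w v
      back (b , le) with InB-enc b
      ... | n , refl = from (K₁.Dem⇔ p n) (subst (_≤B w) (μ₁-dag n) le)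

    by-omega : ∀ {w} → IsPerm r w → ∀ v → Dem r w v ⇔ (InB r v × (∀ bs → StringJ r v bs → (w0 r · omegaOfString r bs) ≤B w))
    by-omega {w} p v = mk⇔ there' back
      where
      open Equivalence
      there' : Dem r w v → InB r v × (∀ bs → StringJ r v bs → (w0 r · omegaOfString r bs) ≤B w)
      there' d with InB-enc (K₁.Dem-InB d)
      ... | n , refl = K₁.Dem-InB d , λ bs s → subst (_≤B w) (sym (μ₂-omega s)) (to (K₂.Dem⇔ p n) d)
      back : InB r v × (∀ bs → StringJ r v bs → (w0 r · omegaOfString r bs) ≤B w) → Dem r w v
      back (b , le) with InB-enc b
      ... | n , refl with a-StringJ n
      ...   | bs , s = from (K₂.Dem⇔ p n) (subst (_≤B w) (μ₂-omega s) (le bs s))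

    conjugate : ∀ n {bs} → StringJ r (enc n) bs → (w0 r · omegaOfString r bs) · w0 r ≡ omegaDag r (enc n)
    conjugate n s = trans (cong (_· w0 r) (trans (μ₂-omega s) (sym (μ-agree n))))
      (trans (dot-w0 (Key.perm key₁ n)) (trans (reverse-involutive (D n)) (sym (dag-D n))))

    -- The string of v^⋆ is the coordinate vector of τ τ v = v. So ω(v^⋆) is the product of the word
    -- of ω†(v) in reverse order, which is the inverse permutation.
    star-inverse : ∀ star → IsStar r star → ∀ n {bs} → StringJ r (star (enc n)) bs → omegaOfString r bs · omegaDag r (enc n) ≡ idP r
    star-inverse star is n {bs} s = trans (cong₂ _·_ (omega-rev e) (dag-D n)) (inv-dot (D-perm n) (reverse-inverse (Wd (suc R) n) (letters n)))
      where
      e : map posℤ bs ≡ map neg (enc n)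
      e = trans (StringJ-enc (subst (λ v → StringJ r v bs) (star-τ star is n) s)) (cong (map neg) (enc-cong (ττ n)))

open import Defs
open import Data.Nat using (ℕ; _≤_; suc; zero; s≤s)
open import Data.List using (List)
open import Function.Bundles using (_⇔_)

theorem8p1 : (r : ℕ) → 2 ≤ r → (star : State → State) → IsStar r star →
    ((w : Perm) → IsPerm r w → (v : State) →
    (Dem r w v ⇔ (InB r v × ((omegaDag r v · w0 r) ≤B w))) ×
    (Dem r w v ⇔ (InB r v × ((bs : List ℕ) → StringJ r v bs →
    ((w0 r · omegaOfString r bs) ≤B w)))))
    ×
    ((v : State) → InB r v → (bs bs⋆ : List ℕ) → StringJ r v bs → StringJ r (star v) bs⋆ →
    (((w0 r · omegaOfString r bs) · w0 r) ≡ omegaDag r v) ×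
    ((omegaOfString r bs⋆ · omegaDag r v) ≡ idP r))
theorem8p1 (suc (suc R)) _ star is = (λ w p v → by-dagger p v , by-omega p v) , equalities
  where
  open DemazureCrystals.Demazure R
  equalities : (v : State) → InB r v → (bs bs⋆ : List ℕ) → StringJ r v bs → StringJ r (star v) bs⋆ →
    (((w0 r · omegaOfString r bs) · w0 r) ≡ omegaDag r v) × ((omegaOfString r bs⋆ · omegaDag r v) ≡ idP r)
  equalities v b bs bs⋆ s s⋆ with InB-enc b
  ... | n , refl = conjugate n s , star-inverse star is n s⋆
theorem8p1 (suc zero) (s≤s ())
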